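{- The labelled transition system of processes of HO$\pi$LL enjoys erasure with respect to the labelled transition system of typing derivations of HO$\pi$LL. That is, for every derivation $D$ and every derivation-label $l$ (a label whose higher-order payloads are derivations), writing $\mathrm{proc}(l)$ for the label obtained from $l$ by replacing each payload $E$ with $\mathrm{proc}(E)$: (i) if $D\xrightarrow{l}D'$ then $\mathrm{proc}(D)\xrightarrow{\mathrm{proc}(l)}\mathrm{proc}(D')$; and (ii) if $\mathrm{proc}(D)\xrightarrow{\mathrm{proc}(l)}P'$ then there is $D'$ with $D\xrightarrow{l}D'$ and $\mathrm{proc}(D')=P'$.
   Context: **Syntax.** Names $x,y,z,\ldots$ come from an infinite set with decidable equality; $p,q,\ldots$ are process variables; $f,g,\ldots$ are parameter names (constants); $X$ ranges over type variables. Types: $A,B::=A\otimes B\mid A\wp B\mid 1\mid\bot\mid A\oplus B\mid A\&B\mid X\mid X^\perp\mid\exists X.A\mid\forall X.A\mid{?}A\mid{!}A\mid[\mathcal G]\mid\langle\mathcal G\rangle$, where $[\mathcal G]$ (provide) and $\langle\mathcal G\rangle$ (assume) contain a hyperenvironment over parameter names. A record $\rho=\{f_i=x_i\}_{i\in I}$ ($I$ finite) maps parameter names to names; $\mathcal G\rho$ replaces each $f_i$ by $x_i$. An abstraction $(\rho)P$ binds in $P$ all names in the image of $\rho$, and this image must be exactly $\mathrm{fn}(P)$. Processes: $P,Q::=x[y].P\mid x(y).P\mid x[].P\mid x().P\mid x[\mathsf{inl}].P\mid x[\mathsf{inr}].P\mid x\triangleright(P,Q)\mid x[A].P\mid x(X).P\mid{!}x(y).P\mid{?}x[y].P\mid{?}x[x_1,x_2].P\mid{?}x[].P\mid(\nu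 xy)P\mid P\parallel Q\mid\mathbf 0\mid x\leftrightarrow y\mid x[(\rho)P].Q\mid x(p).P\mid p^{\mathcal G}\langle\rho\rangle\mid Q[p:=(\rho)P]$ (the last is an explicit substitution, binding $p$ in $Q$). Names, type variables and process variables in brackets of a prefix (other than in an output type or abstraction) bind in the continuation, $(\nu xy)$ binds $x,y$; $\mathrm{fn}$, $\mathrm{fpv}$ (free process variables) and $=_\alpha$ are as usual; $(\nu xy)P$ and $(\nu yx)P$ are identified. **Typing.** Duality is the involution with $(A\otimes B)^\perp=A^\perp\wp B^\perp$, $1^\perp=\bot$, $(A\oplus B)^\perp=A^\perp\&B^\perp$, $({?}A)^\perp={!}A^\perp$, $(\exists X.A)^\perp=\forall X.A^\perp$, $(X)^\perp=X^\perp$, $[\mathcal G]^\perp=\langle\mathcal G\rangle$, and symmetrically. Environments $\Gamma$: finite unordered lists of distinct names with types. Hyperenvironments $\mathcal G=\Gamma_1\parallel\cdots\parallel\Gamma_n$: finite multisets of environments with all names distinct; $\emptyset$ has no environments. Process environments $\Theta,\Pi$: finite unordered lists $p_1:\mathcal G_1,\ldots,p_k:\mathcal G_k$ of distinct process variables ($\cdot$ is empty). ${?}\Gamma$: all types have the form ${?}A$. Typing rules (premises $\Rightarrow$ conclusion): (Ax) $\cdot\vdash x\leftrightarrow y::x:A^\perp,y:A$. (Mix$_0$) $\cdot\vdash\mathbf 0::\emptyset$. (Id) $p:\mathcal G\vdash p^{\mathcal G}\langle\rho\rangle::\mathcal G\rho$. (Mix) $\Theta\vdash P::\mathcal G$,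 $\Pi\vdash Q::\mathcal H\Rightarrow\Theta,\Pi\vdash P\parallel Q::\mathcal G\parallel\mathcal H$. (Cut) $\Theta\vdash P::\mathcal G\parallel\Gamma,x:A\parallel\Delta,y:A^\perp\Rightarrow\Theta\vdash(\nu xy)P::\mathcal G\parallel\Gamma,\Delta$. (Chop) $\Pi\vdash P::\mathcal H\rho$, $\Theta,p:\mathcal H\vdash Q::\mathcal G\Rightarrow\Theta,\Pi\vdash Q[p:=(\rho)P]::\mathcal G$. ($\otimes$) $\Theta\vdash P::\Gamma,y:A\parallel\Delta,x:B\Rightarrow\Theta\vdash x[y].P::\Gamma,\Delta,x:A\otimes B$. (1) $\Theta\vdash P::\emptyset\Rightarrow\Theta\vdash x[].P::x:1$. ($\wp$) $\Theta\vdash P::\Gamma,y:A,x:B\Rightarrow\Theta\vdash x(y).P::\Gamma,x:A\wp B$. ($\bot$) $\Theta\vdash P::\Gamma\Rightarrow\Theta\vdash x().P::\Gamma,x:\bot$. ($\oplus_1$) $\Theta\vdash P::\Gamma,x:A\Rightarrow\Theta\vdash x[\mathsf{inl}].P::\Gamma,x:A\oplus B$. ($\oplus_2$) $\Theta\vdash P::\Gamma,x:B\Rightarrow\Theta\vdash x[\mathsf{inr}].P::\Gamma,x:A\oplus B$. ($\&$) $\Theta\vdash P::\Gamma,x:A$, $\Theta\vdash Q::\Gamma,x:B\Rightarrow\Theta\vdash x\triangleright(P,Q)::\Gamma,x:A\&B$. (!) $\cdot\vdash P::{?}\Gamma,y:A\Rightarrow\cdot\vdash{!}x(y).P::{?}\Gamma,x:{!}A$.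 (?) $\Theta\vdash P::\Gamma,y:A\Rightarrow\Theta\vdash{?}x[y].P::\Gamma,x:{?}A$. (W) $\Theta\vdash P::\Gamma\Rightarrow\Theta\vdash{?}x[].P::\Gamma,x:{?}A$. (C) $\Theta\vdash P::\Gamma,x_1:{?}A,x_2:{?}A\Rightarrow\Theta\vdash{?}x[x_1,x_2].P::\Gamma,x:{?}A$. ($\exists$) $\Theta\vdash P::\Gamma,x:B\{A/X\}\Rightarrow\Theta\vdash x[A].P::\Gamma,x:\exists X.B$. ($\forall$) $\Theta\vdash P::\Gamma,x:B$, $X$ not free in $\Gamma$ $\Rightarrow\Theta\vdash x(X).P::\Gamma,x:\forall X.B$. (Provide) $\Theta\vdash P::\mathcal G\rho$, $\cdot\vdash Q::\emptyset\Rightarrow\Theta\vdash x[(\rho)P].Q::x:[\mathcal G]$. (Assume) $\Theta,p:\mathcal G\vdash P::\Gamma\Rightarrow\Theta\vdash x(p).P::\Gamma,x:\langle\mathcal G\rangle$. A derivation $D$ is a finite tree built with these rules; $\mathrm{proc}(D)$ is the process in its conclusion. **Labels** (parametric in a set $S$ of payloads: processes for process labels, derivations for derivation labels). Act$(S)$: $x[]$, $x()$, $x[y]$, $x(y)$, $x[\mathsf{inl}]$, $x(\mathsf{inl})$, $x[\mathsf{inr}]$, $x(\mathsf{inr})$, ${?}x[y]$, ${!}x(y)$, ${?}x[x_1,x_2]$, ${!}x(x_1,x_2)$, ${?}x[]$, ${!}x()$, $x[A]$, $x(A)$, $x[(\sigma)s]$, $x(p)$, with $s\in S$. Labels: $\tau$,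 $x\leftrightarrow y$, $l$, unordered pairs $l\parallel l'$ ($l,l'\in$ Act$(S)$), and $p^{\mathcal G}\mapsto(\sigma)s$. In an action $x$ is free and names in brackets are bound; both names of a link label are free; $\mathrm{cn}=\mathrm{fn}\cup\mathrm{bn}$; $\mathrm{fpv}(l)$ are the free process variables of $l$ ($p$ is free in $p^{\mathcal G}\mapsto(\sigma)s$ and bound in $x(p)$; payload process variables are free). **Process transitions** (least relation closed under): $\pi.P\xrightarrow{\pi}P$ for $\pi$ of the form $x[y],x(y),x[],x(),x[\mathsf{inl}],x[\mathsf{inr}],x[A],{?}x[y],{!}x(y),x[(\rho)R],x(p)$; $x\triangleright(P,Q)\xrightarrow{x(\mathsf{inl})}P$; $x\triangleright(P,Q)\xrightarrow{x(\mathsf{inr})}Q$; $x(X).P\xrightarrow{x(A)}P\{A/X\}$; ${?}x[].P\xrightarrow{{?}x[]}x().P$; ${?}x[x_1,x_2].P\xrightarrow{{?}x[x_1,x_2]}x_1(x_2).P$; ${!}x(x').P\xrightarrow{{!}x()}{?}z_1[].\cdots{?}z_n[].x[].\mathbf 0$ and ${!}x(x').P\xrightarrow{{!}x(x_1,x_2)}{?}z_1[z_1\sigma_1,z_1\sigma_2].\cdots{?}z_n[z_n\sigma_1,z_n\sigma_2].x_1[x_2].({!}x_1(x'\sigma_1).P\sigma_1\parallel{!}x_2(x'\sigma_2).P\sigma_2)$, where $\mathrm{fn}(P)\setminus\{x'\}=\{z_1,\ldots,z_n\}$ and $\sigma_1,\sigma_2$ are name substitutions with $\mathrm{fn}(P\sigma_1)\cap\mathrm{fn}(P\sigma_2)=\emptyset$;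 $x\leftrightarrow y\xrightarrow{x\leftrightarrow y}\mathbf 0$; $x\leftrightarrow y\xrightarrow{y\leftrightarrow x}\mathbf 0$; $p^{\mathcal G}\langle\sigma\rangle\xrightarrow{p^{\mathcal G}\mapsto(\rho)P}P\{\sigma\circ\rho^{ -1}\}$. ($\alpha$) $P=_\alpha Q\xrightarrow{l}R$ implies $P\xrightarrow{l}R$. (Par) $P\xrightarrow{l}P'$, $\mathrm{bn}(l)\cap\mathrm{fn}(Q)=\emptyset$ imply $P\parallel Q\xrightarrow{l}P'\parallel Q$; symmetrically. (Syn) $P\xrightarrow{l}P'$, $Q\xrightarrow{l'}Q'$, $l,l'$ actions, $\mathrm{bn}(l)\cap\mathrm{bn}(l')=\emptyset$ imply $P\parallel Q\xrightarrow{l\parallel l'}P'\parallel Q'$. (Res) $P\xrightarrow{l}P'$, $x,y\notin\mathrm{cn}(l)$ imply $(\nu xy)P\xrightarrow{l}(\nu xy)P'$. (Run) $P\xrightarrow{q^{\mathcal G}\mapsto(\rho)Q}P'$ implies $P[q:=(\rho)Q]\xrightarrow{\tau}P'$. (Ext) $P\xrightarrow{x[(\sigma)R]}P'$, $q\in\mathrm{fpv}(R)$ imply $P[q:=(\rho)Q]\xrightarrow{x[(\sigma)(R[q:=(\rho)Q])]}P'$. (Lift) $P\xrightarrow{l}P'$, $q\notin\mathrm{fpv}(l)$ imply $P[q:=(\rho)Q]\xrightarrow{l}P'[q:=(\rho)Q]$. (Communication) $(\nu xy)P\xrightarrow{\tau}R$ whenever $P\xrightarrow{m}P'$ and: $m=x[]\parallel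 y()$, $R=P'$; $m=x[x']\parallel y(y')$, $R=(\nu xy)(\nu x'y')P'$; $m=x[\mathsf{inl}]\parallel y(\mathsf{inl})$, $x[\mathsf{inr}]\parallel y(\mathsf{inr})$, $x[A]\parallel y(A)$ or ${?}x[]\parallel{!}y()$, $R=(\nu xy)P'$; $m={?}x[x']\parallel{!}y(y')$, $R=(\nu x'y')P'$; $m={?}x[x_1,x_2]\parallel{!}y(y_1,y_2)$, $R=(\nu x_1y_1)P'$; $m=x[(\rho)Q]\parallel y(q)$, $R=P'[q:=(\rho)Q]$; $m=z\leftrightarrow y$, $z\notin\{x,y\}$, $R=P'\{z/x\}$. **Derivation transitions.** Each typing rule introduces one process constructor, so derivations are written with the same constructors. The transition relation on derivations is the least one closed under all the rules above read on derivations (process metavariables, including payloads, replaced by derivations; constructors denoting typing rule applications; all displayed derivations valid; substitution applied throughout; $\mathrm{fn},\mathrm{fpv}$ of a derivation are those of its process); ($\alpha$) reads: a derivation of $\Theta\vdash P::\mathcal G$ has every transition of any derivation of $\Theta\vdash Q::\mathcal G$ with $P=_\alpha Q$; in the rule for $p^{\mathcal G}\langle\sigma\rangle$ the payload is any derivation of $\Pi\vdash P::\mathcal G\rho$. In (Res) the premise goes from hyperenvironment $\mathcal G\parallel\Gamma,x:A\parallel\Delta,y:A^\perp$ to $\mathcal G'\parallel\Gamma',x:A\parallel\Delta',y:A^\perp$. In (Communication) the premise goes from $\mathcal G\parallel\Gamma,x:C\parallel\Delta,y:C^\perp$ to: $\mathcal G\parallel\Delta$ for $C=1$ ($\Gamma$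 empty); $\mathcal G\parallel\Gamma_1,x:B\parallel\Gamma_2,x':A\parallel\Delta,y:B^\perp,y':A^\perp$ for $C=A\otimes B$, $\Gamma=\Gamma_1,\Gamma_2$; $\mathcal G\parallel\Gamma,x:A_i\parallel\Delta,y:A_i^\perp$ for $C=A_1\oplus A_2$ ($i=1$ for $\mathsf{inl}$, $2$ for $\mathsf{inr}$); $\mathcal G\parallel\Gamma,x:B\{A/X\}\parallel\Delta,y:B^\perp\{A/X\}$ for $C=\exists X.B$; for $C={?}A$: $\mathcal G\parallel\Gamma,x':A\parallel\Delta,y':A^\perp$ (use), $\mathcal G\parallel\Gamma,x_1:{?}A\wp{?}A\parallel\Delta,y_1:{!}A^\perp\otimes{!}A^\perp$ (duplication, $\Delta={?}\Delta'$), $\mathcal G\parallel\Gamma,x:\bot\parallel\Delta,y:1$ (disposal, $\Delta={?}\Delta'$); and $\mathcal G\parallel\Delta$ for $C=[\mathcal H]$ ($\Gamma$ empty), where the process environment goes from $\Theta,\Pi$ to $\Theta,q:\mathcal H$ with payload a derivation of $\Pi\vdash Q::\mathcal H\rho$. In all other communication cases the process environment is unchanged. For a link, the premise goes from $\mathcal G\parallel z:A^\perp,y:A\parallel\Gamma,x:A^\perp$ to $\mathcal G\parallel\Gamma,x:A^\perp$.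
   Formalization: In (ii) label payloads must have the type the transition prescribes; process transitions whose result would capture or share names or process variables are excluded; disposal and duplication drop Δ=?Δ′; in (∀), X is also not free in Θ. Without these (ii) fails. -}

module Defs where

open import Data.Fin using (Fin; zero; suc)
open import Data.List using (List; []; _∷_; _++_; map; concat; foldr; filter)
open import Data.List.Membership.Propositional using (_∈_; _∉_)
open import Data.List.Relation.Binary.Disjoint.Propositional using (Disjoint)
open import Data.List.Relation.Binary.Permutation.Homogeneous using (Permutation)
open import Data.List.Relation.Binary.Permutation.Propositional using (_↭_)
open import Data.List.Relation.Binary.Pointwise using (Pointwise)
open import Data.List.Relation.Unary.All using (All)
open import Data.List.Relation.Unary.AllPairs using (AllPairs)
open import Data.List.Relation.Unary.Unique.Propositional using (Unique)
open import Data.Maybe using (Maybe; just; nothing; fromMaybe)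
open import Data.Nat using (ℕ; suc)
open import Data.Product using (_×_; _,_; proj₁; proj₂; ∃; ∃-syntax; map₂)
open import Data.Product.Relation.Binary.Pointwise.NonDependent using () renaming (Pointwise to ×-Pointwise)
open import Data.Unit using (⊤)
open import Function using (_∘_; _⇔_)
open import Relation.Binary.Definitions using (DecidableEquality)
open import Relation.Binary.PropositionalEquality using (_≡_; _≢_)
open import Relation.Nullary using (¬?; yes; no)

-- An infinite set with decidable equality: every finite list misses an element.
record Atoms : Set₁ where
  field
    Carrier : Set
    _≟_     : DecidableEquality Carrier
    fresh   : List Carrier → Carrier
    fresh∉  : ∀ xs → fresh xs ∉ xs

module HOπLL (𝒩 𝒫 : Atoms) (Param : Set) (_≟ᶠ_ : DecidableEquality Param) where

  open Atoms 𝒩 public using () renaming (Carrier to Name; _≟_ to _≟ⁿ_; fresh to freshⁿ)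
  open Atoms 𝒫 public using () renaming (Carrier to PVar; _≟_ to _≟ᵖ_)

  pattern _∶_ k a = k , a
  infix 5 _∶_

  infixr 6 _⊗_ _⅋_ _⊕_ _&_

  -- Type variables are well-scoped de Bruijn indices, so types are identified up to
  -- renaming of bound type variables.  The lists below are read up to reordering
  -- (see _≈_) and with distinct parameter names (see Wfᵗ).
  data Ty (n : ℕ) : Set where
    _⊗_ _⅋_ _⊕_ _&_ : Ty n → Ty n → Ty n
    𝟙 ⊥             : Ty n
    var var⊥        : Fin n → Ty n
    ∃ᵗ ∀ᵗ           : Ty (suc n) → Ty n
    ⁇ ‼             : Ty n → Ty n
    prov asm        : List (List (Param × Ty n)) → Ty n   -- [𝒢] and ⟨𝒢⟩

  Env : Set → ℕ → Set
  Env K n = List (K × Ty n)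

  HEnv : Set → ℕ → Set
  HEnv K n = List (Env K n)

  PEnv : ℕ → Set
  PEnv n = List (PVar × HEnv Param n)

  private
    variable
      n m : ℕ
      K   : Set

  infix 8 _ᗮ
  _ᗮ : Ty n → Ty n
  (A ⊗ B) ᗮ = A ᗮ ⅋ B ᗮ
  (A ⅋ B) ᗮ = A ᗮ ⊗ B ᗮ
  (A ⊕ B) ᗮ = A ᗮ & B ᗮ
  (A & B) ᗮ = A ᗮ ⊕ B ᗮ
  𝟙 ᗮ       = ⊥
  ⊥ ᗮ       = 𝟙
  var X ᗮ   = var⊥ X
  var⊥ X ᗮ  = var X
  ∃ᵗ A ᗮ    = ∀ᵗ (A ᗮ)
  ∀ᵗ A ᗮ    = ∃ᵗ (A ᗮ)
  ⁇ A ᗮ     = ‼ (A ᗮ)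
  ‼ A ᗮ     = ⁇ (A ᗮ)
  prov 𝒢 ᗮ  = asm 𝒢
  asm 𝒢 ᗮ   = prov 𝒢

  liftʳ : (Fin n → Fin m) → Fin (suc n) → Fin (suc m)
  liftʳ r zero    = zero
  liftʳ r (suc X) = suc (r X)

  mutual
    ren : (Fin n → Fin m) → Ty n → Ty m
    ren r (A ⊗ B)  = ren r A ⊗ ren r B
    ren r (A ⅋ B)  = ren r A ⅋ ren r B
    ren r (A ⊕ B)  = ren r A ⊕ ren r B
    ren r (A & B)  = ren r A & ren r B
    ren r 𝟙        = 𝟙
    ren r ⊥        = ⊥
    ren r (var X)  = var (r X)
    ren r (var⊥ X) = var⊥ (r X)
    ren r (∃ᵗ A)   = ∃ᵗ (ren (liftʳ r) A)
    ren r (∀ᵗ A)   = ∀ᵗ (ren (liftʳ r) A)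
    ren r (⁇ A)    = ⁇ (ren r A)
    ren r (‼ A)    = ‼ (ren r A)
    ren r (prov 𝒢) = prov (renᴴ r 𝒢)
    ren r (asm 𝒢)  = asm (renᴴ r 𝒢)

    renᴱ : (Fin n → Fin m) → Env K n → Env K m
    renᴱ r []            = []
    renᴱ r ((k ∶ A) ∷ Γ) = (k ∶ ren r A) ∷ renᴱ r Γ

    renᴴ : (Fin n → Fin m) → HEnv K n → HEnv K m
    renᴴ r []      = []
    renᴴ r (Γ ∷ 𝒢) = renᴱ r Γ ∷ renᴴ r 𝒢

  renᴾ : (Fin n → Fin m) → PEnv n → PEnv m
  renᴾ r = map (map₂ (renᴴ r))

  liftˢ : (Fin n → Ty m) → Fin (suc n) → Ty (suc m)
  liftˢ τ zero    = var zero
  liftˢ τ (suc X) = ren suc (τ X)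

  mutual
    sub : (Fin n → Ty m) → Ty n → Ty m
    sub τ (A ⊗ B)  = sub τ A ⊗ sub τ B
    sub τ (A ⅋ B)  = sub τ A ⅋ sub τ B
    sub τ (A ⊕ B)  = sub τ A ⊕ sub τ B
    sub τ (A & B)  = sub τ A & sub τ B
    sub τ 𝟙        = 𝟙
    sub τ ⊥        = ⊥
    sub τ (var X)  = τ X
    sub τ (var⊥ X) = τ X ᗮ
    sub τ (∃ᵗ A)   = ∃ᵗ (sub (liftˢ τ) A)
    sub τ (∀ᵗ A)   = ∀ᵗ (sub (liftˢ τ) A)
    sub τ (⁇ A)    = ⁇ (sub τ A)
    sub τ (‼ A)    = ‼ (sub τ A)
    sub τ (prov 𝒢) = prov (subᴴ τ 𝒢)
    sub τ (asm 𝒢)  = asm (subᴴ τ 𝒢)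

    subᴱ : (Fin n → Ty m) → Env K n → Env K m
    subᴱ τ []            = []
    subᴱ τ ((k ∶ A) ∷ Γ) = (k ∶ sub τ A) ∷ subᴱ τ Γ

    subᴴ : (Fin n → Ty m) → HEnv K n → HEnv K m
    subᴴ τ []      = []
    subᴴ τ (Γ ∷ 𝒢) = subᴱ τ Γ ∷ subᴴ τ 𝒢

  single : Ty n → Fin (suc n) → Ty n
  single A zero    = A
  single A (suc X) = var X

  infix 9 _[_]ᵗ
  _[_]ᵗ : Ty (suc n) → Ty n → Ty n
  B [ A ]ᵗ = sub (single A) B

  -- Environments, hyperenvironments and process environments are unordered; since
  -- hyperenvironments occur inside types, so does this identification.
  infix 4 _≈_ _≋_ _≋ᴾ_
  data _≈_ {n : ℕ} : Ty n → Ty n → Set where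
    _⊗_  : ∀ {A A′ B B′} → A ≈ A′ → B ≈ B′ → A ⊗ B ≈ A′ ⊗ B′
    _⅋_  : ∀ {A A′ B B′} → A ≈ A′ → B ≈ B′ → A ⅋ B ≈ A′ ⅋ B′
    _⊕_  : ∀ {A A′ B B′} → A ≈ A′ → B ≈ B′ → A ⊕ B ≈ A′ ⊕ B′
    _&_  : ∀ {A A′ B B′} → A ≈ A′ → B ≈ B′ → A & B ≈ A′ & B′
    𝟙    : 𝟙 ≈ 𝟙
    ⊥    : ⊥ ≈ ⊥
    var  : ∀ X → var X ≈ var X
    var⊥ : ∀ X → var⊥ X ≈ var⊥ X
    ∃ᵗ   : ∀ {A A′} → A ≈ A′ → ∃ᵗ A ≈ ∃ᵗ A′
    ∀ᵗ   : ∀ {A A′} → A ≈ A′ → ∀ᵗ A ≈ ∀ᵗ A′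
    ⁇    : ∀ {A A′} → A ≈ A′ → ⁇ A ≈ ⁇ A′
    ‼    : ∀ {A A′} → A ≈ A′ → ‼ A ≈ ‼ A′
    prov : ∀ {𝒢 ℋ} → Permutation (Permutation (×-Pointwise _≡_ _≈_)) 𝒢 ℋ → prov 𝒢 ≈ prov ℋ
    asm  : ∀ {𝒢 ℋ} → Permutation (Permutation (×-Pointwise _≡_ _≈_)) 𝒢 ℋ → asm 𝒢 ≈ asm ℋ

  _≋_ : HEnv K n → HEnv K n → Set
  _≋_ = Permutation (Permutation (×-Pointwise _≡_ _≈_))

  _≋ᴾ_ : PEnv n → PEnv n → Set
  _≋ᴾ_ = Permutation (×-Pointwise _≡_ _≋_)

  dom : HEnv K n → List K
  dom 𝒢 = map proj₁ (concat 𝒢)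

  mutual
    Wfᵗ : Ty n → Set
    Wfᵗ (A ⊗ B)  = Wfᵗ A × Wfᵗ B
    Wfᵗ (A ⅋ B)  = Wfᵗ A × Wfᵗ B
    Wfᵗ (A ⊕ B)  = Wfᵗ A × Wfᵗ B
    Wfᵗ (A & B)  = Wfᵗ A × Wfᵗ B
    Wfᵗ 𝟙        = ⊤
    Wfᵗ ⊥        = ⊤
    Wfᵗ (var X)  = ⊤
    Wfᵗ (var⊥ X) = ⊤
    Wfᵗ (∃ᵗ A)   = Wfᵗ A
    Wfᵗ (∀ᵗ A)   = Wfᵗ A
    Wfᵗ (⁇ A)    = Wfᵗ A
    Wfᵗ (‼ A)    = Wfᵗ A
    Wfᵗ (prov 𝒢) = Unique (dom 𝒢) × Wfᵗˢ 𝒢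
    Wfᵗ (asm 𝒢)  = Unique (dom 𝒢) × Wfᵗˢ 𝒢

    Wfᴱ : Env K n → Set
    Wfᴱ []            = ⊤
    Wfᴱ ((k ∶ A) ∷ Γ) = Wfᵗ A × Wfᴱ Γ

    Wfᵗˢ : HEnv K n → Set
    Wfᵗˢ []      = ⊤
    Wfᵗˢ (Γ ∷ 𝒢) = Wfᴱ Γ × Wfᵗˢ 𝒢

  Wf : HEnv K n → Set
  Wf 𝒢 = Unique (dom 𝒢) × Wfᵗˢ 𝒢

  Rec : Set
  Rec = List (Param × Name)

  keys : Rec → List Param
  keys = map proj₁

  image : Rec → List Name
  image = map proj₂

  -- 𝒢 ⟦ ρ ⟧≔ ℋ means that ℋ is 𝒢ρ.
  infix 4 _⟦_⟧≔_
  _⟦_⟧≔_ : HEnv Param n → Rec → HEnv Name n → Set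
  𝒢 ⟦ ρ ⟧≔ ℋ = keys ρ ↭ dom 𝒢
             × Pointwise (Pointwise (λ b c → (proj₁ b , proj₁ c) ∈ ρ × proj₂ b ≡ proj₂ c)) 𝒢 ℋ

  lookupᴿ : Rec → Param → Maybe Name
  lookupᴿ []            f = nothing
  lookupᴿ ((g , x) ∷ ρ) f with f ≟ᶠ g
  ... | yes _ = just x
  ... | no  _ = lookupᴿ ρ f

  -- σ ∘ ρ⁻¹, extended by the identity outside the image of ρ
  infix 9 _∘⁻¹_
  _∘⁻¹_ : Rec → Rec → Name → Name
  (σ ∘⁻¹ []) x = x
  (σ ∘⁻¹ ((f , y) ∷ ρ)) x with x ≟ⁿ y
  ... | yes _ = fromMaybe x (lookupᴿ σ f)
  ... | no  _ = (σ ∘⁻¹ ρ) x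

  data Proc (n : ℕ) : Set where
    send    : Name → Name → Proc n → Proc n                  -- x[y].P
    recv    : Name → Name → Proc n → Proc n                  -- x(y).P
    close   : Name → Proc n → Proc n                         -- x[].P
    wait    : Name → Proc n → Proc n                         -- x().P
    inl     : Name → Proc n → Proc n                         -- x[inl].P
    inr     : Name → Proc n → Proc n                         -- x[inr].P
    case    : Name → Proc n → Proc n → Proc n                -- x▷(P,Q)
    sendT   : Name → Ty n → Proc n → Proc n                  -- x[A].P
    recvT   : Name → Proc (suc n) → Proc n                   -- x(X).P
    serve   : Name → Name → Proc n → Proc n                  -- !x(y).P
    use     : Name → Name → Proc n → Proc n                  -- ?x[y].P
    dup     : Name → Name → Name → Proc n → Proc n           -- ?x[x₁,x₂].P
    disp    : Name → Proc n → Proc n                         -- ?x[].P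
    ν       : Name → Name → Proc n → Proc n
    _∥_     : Proc n → Proc n → Proc n
    𝟎       : Proc n
    link    : Name → Name → Proc n
    provide : Name → Rec → Proc n → Proc n → Proc n          -- x[(ρ)P].Q
    assume  : Name → PVar → Proc n → Proc n                  -- x(p).P
    call    : PVar → HEnv Param n → Rec → Proc n             -- p^𝒢⟨ρ⟩
    chop    : Proc n → PVar → Rec → Proc n → Proc n          -- Q[p:=(ρ)P]

  infixr 5 _∥_

  infixl 7 _∖_ _∖ᵖ_
  _∖_ : List Name → Name → List Name
  xs ∖ y = filter (λ x → ¬? (x ≟ⁿ y)) xs

  _∖ᵖ_ : List PVar → PVar → List PVar
  ps ∖ᵖ q = filter (λ p → ¬? (p ≟ᵖ q)) ps

  -- An abstraction (ρ)P must satisfy image ρ = fn(P), hence is closed for names: here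
  -- and in substitution and α-equivalence its body contributes and receives no names.
  -- Typing enforces the condition.
  fn : Proc n → List Name
  fn (send x y P)      = x ∷ fn P ∖ y
  fn (recv x y P)      = x ∷ fn P ∖ y
  fn (close x P)       = x ∷ fn P
  fn (wait x P)        = x ∷ fn P
  fn (inl x P)         = x ∷ fn P
  fn (inr x P)         = x ∷ fn P
  fn (case x P Q)      = x ∷ fn P ++ fn Q
  fn (sendT x A P)     = x ∷ fn P
  fn (recvT x P)       = x ∷ fn P
  fn (serve x y P)     = x ∷ fn P ∖ y
  fn (use x y P)       = x ∷ fn P ∖ y
  fn (dup x y z P)     = x ∷ fn P ∖ y ∖ z
  fn (disp x P)        = x ∷ fn P
  fn (ν x y P)         = fn P ∖ x ∖ y
  fn (P ∥ Q)           = fn P ++ fn Q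
  fn 𝟎                 = []
  fn (link x y)        = x ∷ y ∷ []
  fn (provide x ρ P Q) = x ∷ fn Q
  fn (assume x p P)    = x ∷ fn P
  fn (call p 𝒢 ρ)      = image ρ
  fn (chop Q p ρ P)    = fn Q

  fpv : Proc n → List PVar
  fpv (send x y P)      = fpv P
  fpv (recv x y P)      = fpv P
  fpv (close x P)       = fpv P
  fpv (wait x P)        = fpv P
  fpv (inl x P)         = fpv P
  fpv (inr x P)         = fpv P
  fpv (case x P Q)      = fpv P ++ fpv Q
  fpv (sendT x A P)     = fpv P
  fpv (recvT x P)       = fpv P
  fpv (serve x y P)     = fpv P
  fpv (use x y P)       = fpv P
  fpv (dup x y z P)     = fpv P
  fpv (disp x P)        = fpv P
  fpv (ν x y P)         = fpv P
  fpv (P ∥ Q)           = fpv P ++ fpv Q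
  fpv 𝟎                 = []
  fpv (link x y)        = []
  fpv (provide x ρ P Q) = fpv P ++ fpv Q
  fpv (assume x p P)    = fpv P ∖ᵖ p
  fpv (call p 𝒢 ρ)      = p ∷ []
  fpv (chop Q p ρ P)    = fpv Q ∖ᵖ p ++ fpv P

  Abstraction : Rec → Proc n → Set
  Abstraction ρ P = Unique (keys ρ) × Unique (image ρ) × (∀ x → x ∈ image ρ ⇔ x ∈ fn P)

  infixl 9 _[_↦_]
  _[_↦_] : (Name → Name) → Name → Name → Name → Name
  (σ [ y ↦ z ]) x with x ≟ⁿ y
  ... | yes _ = z
  ... | no  _ = σ x

  -- Simultaneous capture-avoiding renaming P{σ}: every binder is replaced by a name
  -- outside the σ-image of the free names in its scope.
  infixl 10 _⟪_⟫
  _⟪_⟫ : Proc n → (Name → Name) → Proc n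
  send x y P      ⟪ σ ⟫ = let y′ = freshⁿ (map σ (fn P ∖ y)) in send (σ x) y′ (P ⟪ σ [ y ↦ y′ ] ⟫)
  recv x y P      ⟪ σ ⟫ = let y′ = freshⁿ (map σ (fn P ∖ y)) in recv (σ x) y′ (P ⟪ σ [ y ↦ y′ ] ⟫)
  close x P       ⟪ σ ⟫ = close (σ x) (P ⟪ σ ⟫)
  wait x P        ⟪ σ ⟫ = wait (σ x) (P ⟪ σ ⟫)
  inl x P         ⟪ σ ⟫ = inl (σ x) (P ⟪ σ ⟫)
  inr x P         ⟪ σ ⟫ = inr (σ x) (P ⟪ σ ⟫)
  case x P Q      ⟪ σ ⟫ = case (σ x) (P ⟪ σ ⟫) (Q ⟪ σ ⟫)
  sendT x A P     ⟪ σ ⟫ = sendT (σ x) A (P ⟪ σ ⟫)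
  recvT x P       ⟪ σ ⟫ = recvT (σ x) (P ⟪ σ ⟫)
  serve x y P     ⟪ σ ⟫ = let y′ = freshⁿ (map σ (fn P ∖ y)) in serve (σ x) y′ (P ⟪ σ [ y ↦ y′ ] ⟫)
  use x y P       ⟪ σ ⟫ = let y′ = freshⁿ (map σ (fn P ∖ y)) in use (σ x) y′ (P ⟪ σ [ y ↦ y′ ] ⟫)
  dup x y z P     ⟪ σ ⟫ = let zs = map σ (fn P ∖ y ∖ z)
                              y′ = freshⁿ zs
                              z′ = freshⁿ (y′ ∷ zs)
                          in dup (σ x) y′ z′ (P ⟪ σ [ y ↦ y′ ] [ z ↦ z′ ] ⟫)
  disp x P        ⟪ σ ⟫ = disp (σ x) (P ⟪ σ ⟫)
  ν x y P         ⟪ σ ⟫ = let zs = map σ (fn P ∖ x ∖ y)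
                              x′ = freshⁿ zs
                              y′ = freshⁿ (x′ ∷ zs)
                          in ν x′ y′ (P ⟪ σ [ x ↦ x′ ] [ y ↦ y′ ] ⟫)
  (P ∥ Q)         ⟪ σ ⟫ = P ⟪ σ ⟫ ∥ Q ⟪ σ ⟫
  𝟎               ⟪ σ ⟫ = 𝟎
  link x y        ⟪ σ ⟫ = link (σ x) (σ y)
  provide x ρ P Q ⟪ σ ⟫ = provide (σ x) ρ P (Q ⟪ σ ⟫)
  assume x p P    ⟪ σ ⟫ = assume (σ x) p (P ⟪ σ ⟫)
  call p 𝒢 ρ      ⟪ σ ⟫ = call p 𝒢 (map (map₂ σ) ρ)
  chop Q p ρ P    ⟪ σ ⟫ = chop (Q ⟪ σ ⟫) p ρ P

  -- z for x
  infix 11 _/_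
  _/_ : Name → Name → Name → Name
  z / x = (λ y → y) [ x ↦ z ]

  subProc : (Fin n → Ty m) → Proc n → Proc m
  subProc τ (send x y P)      = send x y (subProc τ P)
  subProc τ (recv x y P)      = recv x y (subProc τ P)
  subProc τ (close x P)       = close x (subProc τ P)
  subProc τ (wait x P)        = wait x (subProc τ P)
  subProc τ (inl x P)         = inl x (subProc τ P)
  subProc τ (inr x P)         = inr x (subProc τ P)
  subProc τ (case x P Q)      = case x (subProc τ P) (subProc τ Q)
  subProc τ (sendT x A P)     = sendT x (sub τ A) (subProc τ P)
  subProc τ (recvT x P)       = recvT x (subProc (liftˢ τ) P)
  subProc τ (serve x y P)     = serve x y (subProc τ P)
  subProc τ (use x y P)       = use x y (subProc τ P)
  subProc τ (dup x y z P)     = dup x y z (subProc τ P)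
  subProc τ (disp x P)        = disp x (subProc τ P)
  subProc τ (ν x y P)         = ν x y (subProc τ P)
  subProc τ (P ∥ Q)           = subProc τ P ∥ subProc τ Q
  subProc τ 𝟎                 = 𝟎
  subProc τ (link x y)        = link x y
  subProc τ (provide x ρ P Q) = provide x ρ (subProc τ P) (subProc τ Q)
  subProc τ (assume x p P)    = assume x p (subProc τ P)
  subProc τ (call p 𝒢 ρ)      = call p (subᴴ τ 𝒢) ρ
  subProc τ (chop Q p ρ P)    = chop (subProc τ Q) p ρ (subProc τ P)

  -- Two atoms agree under a list of paired binders (innermost first) if they are
  -- bound by the same pair, or both unbound and equal.
  data _⊢_~_ {A : Set} : List (A × A) → A → A → Set where
    free  : ∀ {x} → [] ⊢ x ~ x
    here  : ∀ {x y β} → ((x , y) ∷ β) ⊢ x ~ y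
    there : ∀ {x y a b β} → x ≢ a → y ≢ b → β ⊢ x ~ y → ((a , b) ∷ β) ⊢ x ~ y

  infix 4 _⊢_~_ _∣_⊢_~ᴾ_ _⊢_≐_ _=α_

  -- Records are unordered; ρ ≐ ρ′ pairs the names that two records assign to each key.
  data _⊢_≐_ : List (Name × Name) → Rec → Rec → Set where
    []   : [] ⊢ [] ≐ []
    cons : ∀ {f x y β ρ ρ′ ρ″} → ρ″ ↭ (f , y) ∷ ρ′ → β ⊢ ρ ≐ ρ′ → ((x , y) ∷ β) ⊢ (f , x) ∷ ρ ≐ ρ″

  -- β and π pair the bound names and the bound process variables.  Besides α-conversion
  -- this identifies (νxy)P with (νyx)P, and annotations that differ by reordering.
  data _∣_⊢_~ᴾ_ {n : ℕ} (β : List (Name × Name)) (π : List (PVar × PVar)) : Proc n → Proc n → Set where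
    send    : ∀ {x x′ y y′ P P′} → β ⊢ x ~ x′ → ((y , y′) ∷ β) ∣ π ⊢ P ~ᴾ P′ → β ∣ π ⊢ send x y P ~ᴾ send x′ y′ P′
    recv    : ∀ {x x′ y y′ P P′} → β ⊢ x ~ x′ → ((y , y′) ∷ β) ∣ π ⊢ P ~ᴾ P′ → β ∣ π ⊢ recv x y P ~ᴾ recv x′ y′ P′
    close   : ∀ {x x′ P P′} → β ⊢ x ~ x′ → β ∣ π ⊢ P ~ᴾ P′ → β ∣ π ⊢ close x P ~ᴾ close x′ P′
    wait    : ∀ {x x′ P P′} → β ⊢ x ~ x′ → β ∣ π ⊢ P ~ᴾ P′ → β ∣ π ⊢ wait x P ~ᴾ wait x′ P′
    inl     : ∀ {x x′ P P′} → β ⊢ x ~ x′ → β ∣ π ⊢ P ~ᴾ P′ → β ∣ π ⊢ inl x P ~ᴾ inl x′ P′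
    inr     : ∀ {x x′ P P′} → β ⊢ x ~ x′ → β ∣ π ⊢ P ~ᴾ P′ → β ∣ π ⊢ inr x P ~ᴾ inr x′ P′
    case    : ∀ {x x′ P P′ Q Q′} → β ⊢ x ~ x′ → β ∣ π ⊢ P ~ᴾ P′ → β ∣ π ⊢ Q ~ᴾ Q′ →
              β ∣ π ⊢ case x P Q ~ᴾ case x′ P′ Q′
    sendT   : ∀ {x x′ A A′ P P′} → β ⊢ x ~ x′ → A ≈ A′ → β ∣ π ⊢ P ~ᴾ P′ → β ∣ π ⊢ sendT x A P ~ᴾ sendT x′ A′ P′
    recvT   : ∀ {x x′ P P′} → β ⊢ x ~ x′ → β ∣ π ⊢ P ~ᴾ P′ → β ∣ π ⊢ recvT x P ~ᴾ recvT x′ P′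
    serve   : ∀ {x x′ y y′ P P′} → β ⊢ x ~ x′ → ((y , y′) ∷ β) ∣ π ⊢ P ~ᴾ P′ → β ∣ π ⊢ serve x y P ~ᴾ serve x′ y′ P′
    use     : ∀ {x x′ y y′ P P′} → β ⊢ x ~ x′ → ((y , y′) ∷ β) ∣ π ⊢ P ~ᴾ P′ → β ∣ π ⊢ use x y P ~ᴾ use x′ y′ P′
    dup     : ∀ {x x′ y y′ z z′ P P′} → β ⊢ x ~ x′ → ((z , z′) ∷ (y , y′) ∷ β) ∣ π ⊢ P ~ᴾ P′ →
              β ∣ π ⊢ dup x y z P ~ᴾ dup x′ y′ z′ P′
    disp    : ∀ {x x′ P P′} → β ⊢ x ~ x′ → β ∣ π ⊢ P ~ᴾ P′ → β ∣ π ⊢ disp x P ~ᴾ disp x′ P′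
    ν       : ∀ {x x′ y y′ P P′} → ((y , y′) ∷ (x , x′) ∷ β) ∣ π ⊢ P ~ᴾ P′ → β ∣ π ⊢ ν x y P ~ᴾ ν x′ y′ P′
    ν-comm  : ∀ {x x′ y y′ P P′} → ((y , y′) ∷ (x , x′) ∷ β) ∣ π ⊢ P ~ᴾ P′ → β ∣ π ⊢ ν x y P ~ᴾ ν y′ x′ P′
    _∥_     : ∀ {P P′ Q Q′} → β ∣ π ⊢ P ~ᴾ P′ → β ∣ π ⊢ Q ~ᴾ Q′ → β ∣ π ⊢ P ∥ Q ~ᴾ P′ ∥ Q′
    𝟎       : β ∣ π ⊢ 𝟎 ~ᴾ 𝟎
    link    : ∀ {x x′ y y′} → β ⊢ x ~ x′ → β ⊢ y ~ y′ → β ∣ π ⊢ link x y ~ᴾ link x′ y′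
    provide : ∀ {x x′ γ ρ ρ′ P P′ Q Q′} → β ⊢ x ~ x′ → γ ⊢ ρ ≐ ρ′ → γ ∣ π ⊢ P ~ᴾ P′ → β ∣ π ⊢ Q ~ᴾ Q′ →
              β ∣ π ⊢ provide x ρ P Q ~ᴾ provide x′ ρ′ P′ Q′
    assume  : ∀ {x x′ p p′ P P′} → β ⊢ x ~ x′ → β ∣ (p , p′) ∷ π ⊢ P ~ᴾ P′ → β ∣ π ⊢ assume x p P ~ᴾ assume x′ p′ P′
    call    : ∀ {p p′ 𝒢 𝒢′ γ ρ ρ′} → π ⊢ p ~ p′ → 𝒢 ≋ 𝒢′ → γ ⊢ ρ ≐ ρ′ → All (λ (x , x′) → β ⊢ x ~ x′) γ →
              β ∣ π ⊢ call p 𝒢 ρ ~ᴾ call p′ 𝒢′ ρ′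
    chop    : ∀ {p p′ γ ρ ρ′ P P′ Q Q′} → β ∣ (p , p′) ∷ π ⊢ Q ~ᴾ Q′ → γ ⊢ ρ ≐ ρ′ → γ ∣ π ⊢ P ~ᴾ P′ →
              β ∣ π ⊢ chop Q p ρ P ~ᴾ chop Q′ p′ ρ′ P′

  _=α_ : Proc n → Proc n → Set
  P =α Q = [] ∣ [] ⊢ P ~ᴾ Q

  record Valid (Θ : PEnv n) (𝒢 : HEnv Name n) : Set where
    field
      distinct : Unique (map proj₁ Θ)
      wfΘ      : All (Wf ∘ proj₂) Θ
      wf𝒢      : Wf 𝒢

  data Is⁇ {n : ℕ} : Name × Ty n → Set where
    is⁇ : ∀ {x A} → Is⁇ (x ∶ ⁇ A)

  infix 3 _⊢_▹_ _⊩_▹_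

  mutual
    -- A node is a rule instance (of Θ ⊩ P ▹ 𝒢) whose conclusion is read up to reordering.
    data _⊢_▹_ {n : ℕ} : PEnv n → Proc n → HEnv Name n → Set where
      node : ∀ {Θ Θ′ P 𝒢 𝒢′} → Θ ⊩ P ▹ 𝒢 → Θ ≋ᴾ Θ′ → 𝒢 ≋ 𝒢′ → Valid Θ′ 𝒢′ → Θ′ ⊢ P ▹ 𝒢′

    data _⊩_▹_ {n : ℕ} : PEnv n → Proc n → HEnv Name n → Set where
      ax   : ∀ {x y A} → [] ⊩ link x y ▹ ((x ∶ A ᗮ) ∷ (y ∶ A) ∷ []) ∷ []
      mix₀ : [] ⊩ 𝟎 ▹ []
      call : ∀ {p 𝒢 ρ ℋ} → 𝒢 ⟦ ρ ⟧≔ ℋ → (p ∶ 𝒢) ∷ [] ⊩ call p 𝒢 ρ ▹ ℋ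
      mix  : ∀ {Θ Π P Q 𝒢 ℋ} → Θ ⊢ P ▹ 𝒢 → Π ⊢ Q ▹ ℋ → Θ ++ Π ⊩ P ∥ Q ▹ 𝒢 ++ ℋ
      cut  : ∀ {Θ x y A P Γ Δ 𝒢} → Θ ⊢ P ▹ ((x ∶ A) ∷ Γ) ∷ ((y ∶ A ᗮ) ∷ Δ) ∷ 𝒢 → Θ ⊩ ν x y P ▹ (Γ ++ Δ) ∷ 𝒢
      chop : ∀ {Θ Π p ρ P Q ℋ ℋρ 𝒢} → Π ⊢ P ▹ ℋρ → ℋ ⟦ ρ ⟧≔ ℋρ → (p ∶ ℋ) ∷ Θ ⊢ Q ▹ 𝒢 →
             Θ ++ Π ⊩ chop Q p ρ P ▹ 𝒢
      ten  : ∀ {Θ x y A B P Γ Δ} → Θ ⊢ P ▹ ((y ∶ A) ∷ Γ) ∷ ((x ∶ B) ∷ Δ) ∷ [] →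
             Θ ⊩ send x y P ▹ ((x ∶ A ⊗ B) ∷ Γ ++ Δ) ∷ []
      one  : ∀ {Θ x P} → Θ ⊢ P ▹ [] → Θ ⊩ close x P ▹ ((x ∶ 𝟙) ∷ []) ∷ []
      par  : ∀ {Θ x y A B P Γ} → Θ ⊢ P ▹ ((y ∶ A) ∷ (x ∶ B) ∷ Γ) ∷ [] → Θ ⊩ recv x y P ▹ ((x ∶ A ⅋ B) ∷ Γ) ∷ []
      bot  : ∀ {Θ x P Γ} → Θ ⊢ P ▹ Γ ∷ [] → Θ ⊩ wait x P ▹ ((x ∶ ⊥) ∷ Γ) ∷ []
      plus₁ : ∀ {Θ x A B P Γ} → Θ ⊢ P ▹ ((x ∶ A) ∷ Γ) ∷ [] → Θ ⊩ inl x P ▹ ((x ∶ A ⊕ B) ∷ Γ) ∷ []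
      plus₂ : ∀ {Θ x A B P Γ} → Θ ⊢ P ▹ ((x ∶ B) ∷ Γ) ∷ [] → Θ ⊩ inr x P ▹ ((x ∶ A ⊕ B) ∷ Γ) ∷ []
      with′ : ∀ {Θ x A B P Q Γ} → Θ ⊢ P ▹ ((x ∶ A) ∷ Γ) ∷ [] → Θ ⊢ Q ▹ ((x ∶ B) ∷ Γ) ∷ [] →
              Θ ⊩ case x P Q ▹ ((x ∶ A & B) ∷ Γ) ∷ []
      bang : ∀ {x y A P Γ} → All Is⁇ Γ → [] ⊢ P ▹ ((y ∶ A) ∷ Γ) ∷ [] → [] ⊩ serve x y P ▹ ((x ∶ ‼ A) ∷ Γ) ∷ []
      que  : ∀ {Θ x y A P Γ} → Θ ⊢ P ▹ ((y ∶ A) ∷ Γ) ∷ [] → Θ ⊩ use x y P ▹ ((x ∶ ⁇ A) ∷ Γ) ∷ []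
      weak : ∀ {Θ x A P Γ} → Θ ⊢ P ▹ Γ ∷ [] → Θ ⊩ disp x P ▹ ((x ∶ ⁇ A) ∷ Γ) ∷ []
      contr : ∀ {Θ x x₁ x₂ A P Γ} → Θ ⊢ P ▹ ((x₂ ∶ ⁇ A) ∷ (x₁ ∶ ⁇ A) ∷ Γ) ∷ [] →
              Θ ⊩ dup x x₁ x₂ P ▹ ((x ∶ ⁇ A) ∷ Γ) ∷ []
      ex   : ∀ {Θ x A B P Γ} → Wfᵗ A → Θ ⊢ P ▹ ((x ∶ B [ A ]ᵗ) ∷ Γ) ∷ [] → Θ ⊩ sendT x A P ▹ ((x ∶ ∃ᵗ B) ∷ Γ) ∷ []
      -- Weakening Γ expresses that X is not free in it; x(X).P binds X in P, so X is
      -- likewise not among the type variables of Θ.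
      all  : ∀ {Θ x B P Γ} → renᴾ suc Θ ⊢ P ▹ ((x ∶ B) ∷ renᴱ suc Γ) ∷ [] → Θ ⊩ recvT x P ▹ ((x ∶ ∀ᵗ B) ∷ Γ) ∷ []
      prov : ∀ {Θ x ρ P Q 𝒢 𝒢ρ} → Θ ⊢ P ▹ 𝒢ρ → 𝒢 ⟦ ρ ⟧≔ 𝒢ρ → [] ⊢ Q ▹ [] →
             Θ ⊩ provide x ρ P Q ▹ ((x ∶ prov 𝒢) ∷ []) ∷ []
      asm  : ∀ {Θ x p P 𝒢 Γ} → (p ∶ 𝒢) ∷ Θ ⊢ P ▹ Γ ∷ [] → Θ ⊩ assume x p P ▹ ((x ∶ asm 𝒢) ∷ Γ) ∷ []

  record Deriv (n : ℕ) : Set where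
    constructor ⌊_⌋
    field
      {penv} : PEnv n
      {proc} : Proc n
      {henv} : HEnv Name n
      tree   : penv ⊢ proc ▹ henv

  open Deriv public

  data Act (n : ℕ) (S : Set) : Set where
    close wait inl coinl inr coinr disp codisp : Name → Act n S   -- co- marks x(inl), x(inr), !x()
    send recv use couse : Name → Name → Act n S                   -- couse is !x(y)
    dup codup           : Name → Name → Name → Act n S
    sendT recvT         : Name → Ty n → Act n S
    provide             : Name → Rec → S → Act n S
    assume              : Name → PVar → Act n S

  data Label (n : ℕ) (S : Set) : Set where
    τ       : Label n S
    link    : Name → Name → Label n S
    act     : Act n S → Label n S
    _∣_     : Act n S → Act n S → Label n S                       -- unordered, see swap below
    _^_↦_∙_ : PVar → HEnv Param n → Rec → S → Label n S

  infix 6 _∣_ _^_↦_∙_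

  mapAct : {S T : Set} → (S → T) → Act n S → Act n T
  mapAct h (close x)       = close x
  mapAct h (wait x)        = wait x
  mapAct h (inl x)         = inl x
  mapAct h (coinl x)       = coinl x
  mapAct h (inr x)         = inr x
  mapAct h (coinr x)       = coinr x
  mapAct h (disp x)        = disp x
  mapAct h (codisp x)      = codisp x
  mapAct h (send x y)      = send x y
  mapAct h (recv x y)      = recv x y
  mapAct h (use x y)       = use x y
  mapAct h (couse x y)     = couse x y
  mapAct h (dup x y z)     = dup x y z
  mapAct h (codup x y z)   = codup x y z
  mapAct h (sendT x A)     = sendT x A
  mapAct h (recvT x A)     = recvT x A
  mapAct h (provide x ρ s) = provide x ρ (h s)
  mapAct h (assume x p)    = assume x p

  mapLabel : {S T : Set} → (S → T) → Label n S → Label n T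
  mapLabel h τ               = τ
  mapLabel h (link x y)      = link x y
  mapLabel h (act a)         = act (mapAct h a)
  mapLabel h (a ∣ b)         = mapAct h a ∣ mapAct h b
  mapLabel h (p ^ 𝒢 ↦ ρ ∙ s) = p ^ 𝒢 ↦ ρ ∙ h s

  private
    variable
      S : Set

  subject : Act n S → Name
  subject (close x)       = x
  subject (wait x)        = x
  subject (inl x)         = x
  subject (coinl x)       = x
  subject (inr x)         = x
  subject (coinr x)       = x
  subject (disp x)        = x
  subject (codisp x)      = x
  subject (send x y)      = x
  subject (recv x y)      = x
  subject (use x y)       = x
  subject (couse x y)     = x
  subject (dup x y z)     = x
  subject (codup x y z)   = x
  subject (sendT x A)     = x
  subject (recvT x A)     = x
  subject (provide x ρ s) = x
  subject (assume x p)    = x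

  bnᴬ : Act n S → List Name
  bnᴬ (send x y)      = y ∷ []
  bnᴬ (recv x y)      = y ∷ []
  bnᴬ (use x y)       = y ∷ []
  bnᴬ (couse x y)     = y ∷ []
  bnᴬ (dup x y z)     = y ∷ z ∷ []
  bnᴬ (codup x y z)   = y ∷ z ∷ []
  bnᴬ (provide x ρ s) = image ρ
  bnᴬ _               = []

  fnᴸ bn cn : Label n S → List Name
  fnᴸ τ               = []
  fnᴸ (link x y)      = x ∷ y ∷ []
  fnᴸ (act a)         = subject a ∷ []
  fnᴸ (a ∣ b)         = subject a ∷ subject b ∷ []
  fnᴸ (p ^ 𝒢 ↦ ρ ∙ s) = []

  bn τ               = []
  bn (link x y)      = []
  bn (act a)         = bnᴬ a
  bn (a ∣ b)         = bnᴬ a ++ bnᴬ b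
  bn (p ^ 𝒢 ↦ ρ ∙ s) = image ρ

  cn l = fnᴸ l ++ bn l

  fpvᴬ : (S → List PVar) → Act n S → List PVar
  fpvᴬ fpvˢ (provide x ρ s) = fpvˢ s
  fpvᴬ fpvˢ _               = []

  fpvᴸ : (S → List PVar) → Label n S → List PVar
  fpvᴸ fpvˢ τ               = []
  fpvᴸ fpvˢ (link x y)      = []
  fpvᴸ fpvˢ (act a)         = fpvᴬ fpvˢ a
  fpvᴸ fpvˢ (a ∣ b)         = fpvᴬ fpvˢ a ++ fpvᴬ fpvˢ b
  fpvᴸ fpvˢ (p ^ 𝒢 ↦ ρ ∙ s) = p ∷ fpvˢ s

  -- P and Q may be composed in parallel only if they share no free names or process
  -- variables, as validity demands of derivations.  The conditions on bound names alone
  -- do not ensure this: x[y].P ∥ z().Q with y ∈ fn(Q) would otherwise move by x[y] ∥ z()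
  -- to P ∥ Q, capturing y; and they say nothing of process variables bound by x(p).
  infix 4 _#_
  _#_ : Proc n → Proc n → Set
  P # Q = Disjoint (fn P) (fn Q) × Disjoint (fpv P) (fpv Q)

  _Enumerates_∖_ : List Name → Proc n → Name → Set
  zs Enumerates P ∖ x = Unique zs × (∀ z → z ∈ zs ⇔ (z ∈ fn P × z ≢ x))

  -- ?z₁[].⋯?zₙ[].P
  disps : List Name → Proc n → Proc n
  disps zs P = foldr disp P zs

  -- ?z₁[z₁σ₁,z₁σ₂].⋯?zₙ[zₙσ₁,zₙσ₂].P
  dups : (σ₁ σ₂ : Name → Name) → List Name → Proc n → Proc n
  dups σ₁ σ₂ zs P = foldr (λ z → dup z (σ₁ z) (σ₂ z)) P zs

  -- The conditions on !x(x′).P —!x(x₁,x₂)→ …: the substitutions rename apart, and none of the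
  -- names introduced by the prefixes ?zᵢ[zᵢσ₁,zᵢσ₂] and x₁[x₂] is captured.
  record Splits (P : Proc n) (x′ x₁ x₂ : Name) (σ₁ σ₂ : Name → Name) (zs : List Name) : Set where
    field
      enumerates : zs Enumerates P ∖ x′
      apart      : Disjoint (fn (P ⟪ σ₁ ⟫)) (fn (P ⟪ σ₂ ⟫))
      injective₁ : ∀ {y z} → y ∈ fn P → z ∈ fn P → σ₁ y ≡ σ₁ z → y ≡ z
      injective₂ : ∀ {y z} → y ∈ fn P → z ∈ fn P → σ₂ y ≡ σ₂ z → y ≡ z
      distinct   : Unique (x₁ ∷ x₂ ∷ map σ₁ zs ++ map σ₂ zs)
      x₁∉zs      : x₁ ∉ zs
      no-capture : AllPairs (λ z w → σ₁ z ≢ w × σ₂ z ≢ w) zs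

  infix 3 _—[_]→_
  data _—[_]→_ {n : ℕ} : Proc n → Label n (Proc n) → Proc n → Set where
    send    : ∀ {x y P} → send x y P —[ act (send x y) ]→ P
    recv    : ∀ {x y P} → recv x y P —[ act (recv x y) ]→ P
    close   : ∀ {x P} → close x P —[ act (close x) ]→ P
    wait    : ∀ {x P} → wait x P —[ act (wait x) ]→ P
    inl     : ∀ {x P} → inl x P —[ act (inl x) ]→ P
    inr     : ∀ {x P} → inr x P —[ act (inr x) ]→ P
    coinl   : ∀ {x P Q} → case x P Q —[ act (coinl x) ]→ P
    coinr   : ∀ {x P Q} → case x P Q —[ act (coinr x) ]→ Q
    sendT   : ∀ {x A P} → sendT x A P —[ act (sendT x A) ]→ P
    recvT   : ∀ {x A P} → Wfᵗ A → recvT x P —[ act (recvT x A) ]→ subProc (single A) P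
    use     : ∀ {x y P} → use x y P —[ act (use x y) ]→ P
    couse   : ∀ {x y P} → serve x y P —[ act (couse x y) ]→ P
    disp    : ∀ {x P} → disp x P —[ act (disp x) ]→ wait x P
    dup     : ∀ {x x₁ x₂ P} → dup x x₁ x₂ P —[ act (dup x x₁ x₂) ]→ recv x₁ x₂ P
    codisp  : ∀ {x x′ P zs} → zs Enumerates P ∖ x′ →
              serve x x′ P —[ act (codisp x) ]→ disps zs (close x 𝟎)
    codup   : ∀ {x x′ x₁ x₂ P σ₁ σ₂ zs} → Splits P x′ x₁ x₂ σ₁ σ₂ zs →
              serve x x′ P —[ act (codup x x₁ x₂) ]→
              dups σ₁ σ₂ zs (send x₁ x₂ (serve x₁ (σ₁ x′) (P ⟪ σ₁ ⟫) ∥ serve x₂ (σ₂ x′) (P ⟪ σ₂ ⟫)))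
    provide : ∀ {x ρ P Q} → provide x ρ P Q —[ act (provide x ρ P) ]→ Q
    assume  : ∀ {x p P} → assume x p P —[ act (assume x p) ]→ P
    linkˡ   : ∀ {x y} → link x y —[ link x y ]→ 𝟎
    linkʳ   : ∀ {x y} → link x y —[ link y x ]→ 𝟎
    call    : ∀ {p 𝒢 ρ σ P} → keys ρ ↭ keys σ → Abstraction ρ P →
              call p 𝒢 σ —[ p ^ 𝒢 ↦ ρ ∙ P ]→ P ⟪ σ ∘⁻¹ ρ ⟫

    alpha   : ∀ {P Q R l} → P =α Q → Q —[ l ]→ R → P —[ l ]→ R
    swap    : ∀ {P P′ a b} → P —[ a ∣ b ]→ P′ → P —[ b ∣ a ]→ P′

    parˡ    : ∀ {P P′ Q l} → P —[ l ]→ P′ → Disjoint (bn l) (fn Q) → P′ # Q → P ∥ Q —[ l ]→ P′ ∥ Q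
    parʳ    : ∀ {P Q Q′ l} → Q —[ l ]→ Q′ → Disjoint (bn l) (fn P) → P # Q′ → P ∥ Q —[ l ]→ P ∥ Q′
    syn     : ∀ {P P′ Q Q′ a b} → P —[ act a ]→ P′ → Q —[ act b ]→ Q′ → Disjoint (bnᴬ a) (bnᴬ b) → P′ # Q′ →
              P ∥ Q —[ a ∣ b ]→ P′ ∥ Q′
    res     : ∀ {x y P P′ l} → P —[ l ]→ P′ → x ∉ cn l → y ∉ cn l → ν x y P —[ l ]→ ν x y P′

    run     : ∀ {q 𝒢 ρ P P′ Q} → P —[ q ^ 𝒢 ↦ ρ ∙ Q ]→ P′ → chop P q ρ Q —[ τ ]→ P′
    ext     : ∀ {x q σ ρ P P′ Q R} → P —[ act (provide x σ R) ]→ P′ → q ∈ fpv R →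
              chop P q ρ Q —[ act (provide x σ (chop R q ρ Q)) ]→ P′
    lift    : ∀ {q ρ P P′ Q l} → P —[ l ]→ P′ → q ∉ fpvᴸ fpv l → Disjoint (fpv P′ ∖ᵖ q) (fpv Q) →
              chop P q ρ Q —[ l ]→ chop P′ q ρ Q

    com-unit : ∀ {x y P P′} → P —[ close x ∣ wait y ]→ P′ → ν x y P —[ τ ]→ P′
    com-name : ∀ {x y x′ y′ P P′} → P —[ send x x′ ∣ recv y y′ ]→ P′ → ν x y P —[ τ ]→ ν x y (ν x′ y′ P′)
    com-inl  : ∀ {x y P P′} → P —[ inl x ∣ coinl y ]→ P′ → ν x y P —[ τ ]→ ν x y P′
    com-inr  : ∀ {x y P P′} → P —[ inr x ∣ coinr y ]→ P′ → ν x y P —[ τ ]→ ν x y P′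
    com-type : ∀ {x y A P P′} → P —[ sendT x A ∣ recvT y A ]→ P′ → ν x y P —[ τ ]→ ν x y P′
    com-disp : ∀ {x y P P′} → P —[ disp x ∣ codisp y ]→ P′ → ν x y P —[ τ ]→ ν x y P′
    com-use  : ∀ {x y x′ y′ P P′} → P —[ use x x′ ∣ couse y y′ ]→ P′ → ν x y P —[ τ ]→ ν x′ y′ P′
    com-dup  : ∀ {x y x₁ x₂ y₁ y₂ P P′} → P —[ dup x x₁ x₂ ∣ codup y y₁ y₂ ]→ P′ → ν x y P —[ τ ]→ ν x₁ y₁ P′
    com-proc : ∀ {x y q ρ P P′ Q} → P —[ provide x ρ Q ∣ assume y q ]→ P′ → ν x y P —[ τ ]→ chop P′ q ρ Q
    com-link : ∀ {x y z P P′} → P —[ link z y ]→ P′ → z ≢ x → z ≢ y → ν x y P —[ τ ]→ P′ ⟪ z / x ⟫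

  -- D ⟨ σ ⟩⇝ E : E is D{σ}, that is the same tree with the same types, names renamed
  -- by σ.  The choice of bound names is left to the process that E derives.
  infix 3 _⟨_⟩⇝_ _⟨_⟩⇝ʳ_
  mutual
    data _⟨_⟩⇝_ {n : ℕ} : {Θ Θ′ : PEnv n} {P P′ : Proc n} {𝒢 𝒢′ : HEnv Name n} →
                Θ ⊢ P ▹ 𝒢 → (Name → Name) → Θ′ ⊢ P′ ▹ 𝒢′ → Set where
      node : ∀ {σ Θ₀ Θ₀′ Θ Θ′ P P′ 𝒢₀ 𝒢₀′ 𝒢 𝒢′} {r : Θ₀ ⊩ P ▹ 𝒢₀} {r′ : Θ₀′ ⊩ P′ ▹ 𝒢₀′}
               {e : Θ₀ ≋ᴾ Θ} {f : 𝒢₀ ≋ 𝒢} {v} {e′ : Θ₀′ ≋ᴾ Θ′} {f′ : 𝒢₀′ ≋ 𝒢′} {v′} →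
             r ⟨ σ ⟩⇝ʳ r′ → node r e f v ⟨ σ ⟩⇝ node r′ e′ f′ v′

    data _⟨_⟩⇝ʳ_ {n : ℕ} : {Θ Θ′ : PEnv n} {P P′ : Proc n} {𝒢 𝒢′ : HEnv Name n} →
                 Θ ⊩ P ▹ 𝒢 → (Name → Name) → Θ′ ⊩ P′ ▹ 𝒢′ → Set where
      ax    : ∀ {σ x y A} → ax {x = x} {y} {A} ⟨ σ ⟩⇝ʳ ax {x = σ x} {σ y} {A}
      mix₀  : ∀ {σ} → mix₀ ⟨ σ ⟩⇝ʳ mix₀
      call  : ∀ {σ p 𝒢 ρ ℋ ℋ′} {i : 𝒢 ⟦ ρ ⟧≔ ℋ} {i′ : 𝒢 ⟦ map (map₂ σ) ρ ⟧≔ ℋ′} →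
              call {p = p} i ⟨ σ ⟩⇝ʳ call {p = p} i′
      mix   : ∀ {σ Θ Π Θ′ Π′ P P′ Q Q′ 𝒢 𝒢′ ℋ ℋ′} {D : Θ ⊢ P ▹ 𝒢} {D′ : Θ′ ⊢ P′ ▹ 𝒢′} {E : Π ⊢ Q ▹ ℋ} {E′ : Π′ ⊢ Q′ ▹ ℋ′} →
              D ⟨ σ ⟩⇝ D′ → E ⟨ σ ⟩⇝ E′ → mix D E ⟨ σ ⟩⇝ʳ mix D′ E′
      cut   : ∀ {σ Θ Θ′ x x′ y y′ A P P′ Γ Γ′ Δ Δ′ 𝒢 𝒢′}
                {D : Θ ⊢ P ▹ ((x ∶ A) ∷ Γ) ∷ ((y ∶ A ᗮ) ∷ Δ) ∷ 𝒢} {D′ : Θ′ ⊢ P′ ▹ ((x′ ∶ A) ∷ Γ′) ∷ ((y′ ∶ A ᗮ) ∷ Δ′) ∷ 𝒢′} →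
              D ⟨ σ [ x ↦ x′ ] [ y ↦ y′ ] ⟩⇝ D′ → cut D ⟨ σ ⟩⇝ʳ cut D′
      chop  : ∀ {σ Θ Θ′ Π p ρ P Q Q′ ℋ ℋρ 𝒢 𝒢′} {E : Π ⊢ P ▹ ℋρ} {i : ℋ ⟦ ρ ⟧≔ ℋρ}
                {D : (p ∶ ℋ) ∷ Θ ⊢ Q ▹ 𝒢} {D′ : (p ∶ ℋ) ∷ Θ′ ⊢ Q′ ▹ 𝒢′} →
              D ⟨ σ ⟩⇝ D′ → chop E i D ⟨ σ ⟩⇝ʳ chop E i D′
      ten   : ∀ {σ Θ Θ′ x y y′ A B P P′ Γ Γ′ Δ Δ′}
                {D : Θ ⊢ P ▹ ((y ∶ A) ∷ Γ) ∷ ((x ∶ B) ∷ Δ) ∷ []} {D′ : Θ′ ⊢ P′ ▹ ((y′ ∶ A) ∷ Γ′) ∷ ((σ x ∶ B) ∷ Δ′) ∷ []} →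
              D ⟨ σ [ y ↦ y′ ] ⟩⇝ D′ → ten D ⟨ σ ⟩⇝ʳ ten D′
      one   : ∀ {σ Θ Θ′ x P P′} {D : Θ ⊢ P ▹ []} {D′ : Θ′ ⊢ P′ ▹ []} →
              D ⟨ σ ⟩⇝ D′ → one {x = x} D ⟨ σ ⟩⇝ʳ one {x = σ x} D′
      par   : ∀ {σ Θ Θ′ x y y′ A B P P′ Γ Γ′}
                {D : Θ ⊢ P ▹ ((y ∶ A) ∷ (x ∶ B) ∷ Γ) ∷ []} {D′ : Θ′ ⊢ P′ ▹ ((y′ ∶ A) ∷ (σ x ∶ B) ∷ Γ′) ∷ []} →
              D ⟨ σ [ y ↦ y′ ] ⟩⇝ D′ → par D ⟨ σ ⟩⇝ʳ par D′
      bot   : ∀ {σ Θ Θ′ x P P′ Γ Γ′} {D : Θ ⊢ P ▹ Γ ∷ []} {D′ : Θ′ ⊢ P′ ▹ Γ′ ∷ []} →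
              D ⟨ σ ⟩⇝ D′ → bot {x = x} D ⟨ σ ⟩⇝ʳ bot {x = σ x} D′
      plus₁ : ∀ {σ Θ Θ′ x A B P P′ Γ Γ′} {D : Θ ⊢ P ▹ ((x ∶ A) ∷ Γ) ∷ []} {D′ : Θ′ ⊢ P′ ▹ ((σ x ∶ A) ∷ Γ′) ∷ []} →
              D ⟨ σ ⟩⇝ D′ → plus₁ {B = B} D ⟨ σ ⟩⇝ʳ plus₁ {B = B} D′
      plus₂ : ∀ {σ Θ Θ′ x A B P P′ Γ Γ′} {D : Θ ⊢ P ▹ ((x ∶ B) ∷ Γ) ∷ []} {D′ : Θ′ ⊢ P′ ▹ ((σ x ∶ B) ∷ Γ′) ∷ []} →
              D ⟨ σ ⟩⇝ D′ → plus₂ {A = A} D ⟨ σ ⟩⇝ʳ plus₂ {A = A} D′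
      with′ : ∀ {σ Θ Θ′ x A B P P′ Q Q′ Γ Γ′}
                {D : Θ ⊢ P ▹ ((x ∶ A) ∷ Γ) ∷ []} {D′ : Θ′ ⊢ P′ ▹ ((σ x ∶ A) ∷ Γ′) ∷ []}
                {E : Θ ⊢ Q ▹ ((x ∶ B) ∷ Γ) ∷ []} {E′ : Θ′ ⊢ Q′ ▹ ((σ x ∶ B) ∷ Γ′) ∷ []} →
              D ⟨ σ ⟩⇝ D′ → E ⟨ σ ⟩⇝ E′ → with′ D E ⟨ σ ⟩⇝ʳ with′ D′ E′
      bang  : ∀ {σ x y y′ A P P′ Γ Γ′} {w : All Is⁇ Γ} {w′ : All Is⁇ Γ′}
                {D : [] ⊢ P ▹ ((y ∶ A) ∷ Γ) ∷ []} {D′ : [] ⊢ P′ ▹ ((y′ ∶ A) ∷ Γ′) ∷ []} →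
              D ⟨ σ [ y ↦ y′ ] ⟩⇝ D′ → bang {x = x} w D ⟨ σ ⟩⇝ʳ bang {x = σ x} w′ D′
      que   : ∀ {σ Θ Θ′ x y y′ A P P′ Γ Γ′} {D : Θ ⊢ P ▹ ((y ∶ A) ∷ Γ) ∷ []} {D′ : Θ′ ⊢ P′ ▹ ((y′ ∶ A) ∷ Γ′) ∷ []} →
              D ⟨ σ [ y ↦ y′ ] ⟩⇝ D′ → que {x = x} D ⟨ σ ⟩⇝ʳ que {x = σ x} D′
      weak  : ∀ {σ Θ Θ′ x A P P′ Γ Γ′} {D : Θ ⊢ P ▹ Γ ∷ []} {D′ : Θ′ ⊢ P′ ▹ Γ′ ∷ []} →
              D ⟨ σ ⟩⇝ D′ → weak {x = x} {A} D ⟨ σ ⟩⇝ʳ weak {x = σ x} {A} D′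
      contr : ∀ {σ Θ Θ′ x x₁ x₂ x₁′ x₂′ A P P′ Γ Γ′}
                {D : Θ ⊢ P ▹ ((x₂ ∶ ⁇ A) ∷ (x₁ ∶ ⁇ A) ∷ Γ) ∷ []} {D′ : Θ′ ⊢ P′ ▹ ((x₂′ ∶ ⁇ A) ∷ (x₁′ ∶ ⁇ A) ∷ Γ′) ∷ []} →
              D ⟨ σ [ x₁ ↦ x₁′ ] [ x₂ ↦ x₂′ ] ⟩⇝ D′ → contr {x = x} D ⟨ σ ⟩⇝ʳ contr {x = σ x} D′
      ex    : ∀ {σ Θ Θ′ x A B P P′ Γ Γ′} {w w′ : Wfᵗ A}
                {D : Θ ⊢ P ▹ ((x ∶ B [ A ]ᵗ) ∷ Γ) ∷ []} {D′ : Θ′ ⊢ P′ ▹ ((σ x ∶ B [ A ]ᵗ) ∷ Γ′) ∷ []} →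
              D ⟨ σ ⟩⇝ D′ → ex {A = A} {B} w D ⟨ σ ⟩⇝ʳ ex {A = A} {B} w′ D′
      all   : ∀ {σ Θ Θ′ x B P P′ Γ Γ′}
                {D : renᴾ suc Θ ⊢ P ▹ ((x ∶ B) ∷ renᴱ suc Γ) ∷ []} {D′ : renᴾ suc Θ′ ⊢ P′ ▹ ((σ x ∶ B) ∷ renᴱ suc Γ′) ∷ []} →
              D ⟨ σ ⟩⇝ D′ → all {Θ = Θ} {Γ = Γ} D ⟨ σ ⟩⇝ʳ all {Θ = Θ′} {Γ = Γ′} D′
      prov  : ∀ {σ Θ x ρ P Q Q′ 𝒢 𝒢ρ} {E : Θ ⊢ P ▹ 𝒢ρ} {i : 𝒢 ⟦ ρ ⟧≔ 𝒢ρ} {D : [] ⊢ Q ▹ []} {D′ : [] ⊢ Q′ ▹ []} →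
              D ⟨ σ ⟩⇝ D′ → prov {x = x} E i D ⟨ σ ⟩⇝ʳ prov {x = σ x} E i D′
      asm   : ∀ {σ Θ Θ′ x p P P′ 𝒢 Γ Γ′} {D : (p ∶ 𝒢) ∷ Θ ⊢ P ▹ Γ ∷ []} {D′ : (p ∶ 𝒢) ∷ Θ′ ⊢ P′ ▹ Γ′ ∷ []} →
              D ⟨ σ ⟩⇝ D′ → asm {x = x} D ⟨ σ ⟩⇝ʳ asm {x = σ x} D′

  -- D ⟨ τ ⟩⇝ᵗ E : E is D{τ} for a substitution τ of types for type variables.
  infix 3 _⟨_⟩⇝ᵗ_ _⟨_⟩⇝ᵗʳ_
  mutual
    data _⟨_⟩⇝ᵗ_ {n m : ℕ} : {Θ : PEnv n} {Θ′ : PEnv m} {P : Proc n} {P′ : Proc m} {𝒢 : HEnv Name n} {𝒢′ : HEnv Name m} →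
                 Θ ⊢ P ▹ 𝒢 → (Fin n → Ty m) → Θ′ ⊢ P′ ▹ 𝒢′ → Set where
      node : ∀ {τ Θ₀ Θ₀′ Θ Θ′ P P′ 𝒢₀ 𝒢₀′ 𝒢 𝒢′} {r : Θ₀ ⊩ P ▹ 𝒢₀} {r′ : Θ₀′ ⊩ P′ ▹ 𝒢₀′}
               {e : Θ₀ ≋ᴾ Θ} {f : 𝒢₀ ≋ 𝒢} {v} {e′ : Θ₀′ ≋ᴾ Θ′} {f′ : 𝒢₀′ ≋ 𝒢′} {v′} →
             r ⟨ τ ⟩⇝ᵗʳ r′ → node r e f v ⟨ τ ⟩⇝ᵗ node r′ e′ f′ v′

    data _⟨_⟩⇝ᵗʳ_ {n m : ℕ} : {Θ : PEnv n} {Θ′ : PEnv m} {P : Proc n} {P′ : Proc m} {𝒢 : HEnv Name n} {𝒢′ : HEnv Name m} →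
                  Θ ⊩ P ▹ 𝒢 → (Fin n → Ty m) → Θ′ ⊩ P′ ▹ 𝒢′ → Set where
      ax    : ∀ {τ x y A} → ax {x = x} {y} {A} ⟨ τ ⟩⇝ᵗʳ ax {x = x} {y} {sub τ A}
      mix₀  : ∀ {τ} → mix₀ ⟨ τ ⟩⇝ᵗʳ mix₀
      call  : ∀ {τ p 𝒢 ρ ℋ ℋ′} {i : 𝒢 ⟦ ρ ⟧≔ ℋ} {i′ : subᴴ τ 𝒢 ⟦ ρ ⟧≔ ℋ′} →
              call {p = p} i ⟨ τ ⟩⇝ᵗʳ call {p = p} i′
      mix   : ∀ {τ Θ Π Θ′ Π′ P P′ Q Q′ 𝒢 𝒢′ ℋ ℋ′} {D : Θ ⊢ P ▹ 𝒢} {D′ : Θ′ ⊢ P′ ▹ 𝒢′} {E : Π ⊢ Q ▹ ℋ} {E′ : Π′ ⊢ Q′ ▹ ℋ′} →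
              D ⟨ τ ⟩⇝ᵗ D′ → E ⟨ τ ⟩⇝ᵗ E′ → mix D E ⟨ τ ⟩⇝ᵗʳ mix D′ E′
      cut   : ∀ {τ Θ Θ′ x y A P P′ Γ Γ′ Δ Δ′ 𝒢 𝒢′} {D : Θ ⊢ P ▹ ((x ∶ A) ∷ Γ) ∷ ((y ∶ A ᗮ) ∷ Δ) ∷ 𝒢}
                {D′ : Θ′ ⊢ P′ ▹ ((x ∶ sub τ A) ∷ Γ′) ∷ ((y ∶ sub τ A ᗮ) ∷ Δ′) ∷ 𝒢′} →
              D ⟨ τ ⟩⇝ᵗ D′ → cut D ⟨ τ ⟩⇝ᵗʳ cut D′
      chop  : ∀ {τ Θ Θ′ Π Π′ p ρ P P′ Q Q′ ℋ ℋρ ℋρ′ 𝒢 𝒢′}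
                {E : Π ⊢ P ▹ ℋρ} {i : ℋ ⟦ ρ ⟧≔ ℋρ} {E′ : Π′ ⊢ P′ ▹ ℋρ′} {i′ : subᴴ τ ℋ ⟦ ρ ⟧≔ ℋρ′}
                {D : (p ∶ ℋ) ∷ Θ ⊢ Q ▹ 𝒢} {D′ : (p ∶ subᴴ τ ℋ) ∷ Θ′ ⊢ Q′ ▹ 𝒢′} →
              E ⟨ τ ⟩⇝ᵗ E′ → D ⟨ τ ⟩⇝ᵗ D′ → chop E i D ⟨ τ ⟩⇝ᵗʳ chop E′ i′ D′
      ten   : ∀ {τ Θ Θ′ x y A B P P′ Γ Γ′ Δ Δ′} {D : Θ ⊢ P ▹ ((y ∶ A) ∷ Γ) ∷ ((x ∶ B) ∷ Δ) ∷ []}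
                {D′ : Θ′ ⊢ P′ ▹ ((y ∶ sub τ A) ∷ Γ′) ∷ ((x ∶ sub τ B) ∷ Δ′) ∷ []} →
              D ⟨ τ ⟩⇝ᵗ D′ → ten D ⟨ τ ⟩⇝ᵗʳ ten D′
      one   : ∀ {τ Θ Θ′ x P P′} {D : Θ ⊢ P ▹ []} {D′ : Θ′ ⊢ P′ ▹ []} →
              D ⟨ τ ⟩⇝ᵗ D′ → one {x = x} D ⟨ τ ⟩⇝ᵗʳ one {x = x} D′
      par   : ∀ {τ Θ Θ′ x y A B P P′ Γ Γ′} {D : Θ ⊢ P ▹ ((y ∶ A) ∷ (x ∶ B) ∷ Γ) ∷ []}
                {D′ : Θ′ ⊢ P′ ▹ ((y ∶ sub τ A) ∷ (x ∶ sub τ B) ∷ Γ′) ∷ []} →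
              D ⟨ τ ⟩⇝ᵗ D′ → par D ⟨ τ ⟩⇝ᵗʳ par D′
      bot   : ∀ {τ Θ Θ′ x P P′ Γ Γ′} {D : Θ ⊢ P ▹ Γ ∷ []} {D′ : Θ′ ⊢ P′ ▹ Γ′ ∷ []} →
              D ⟨ τ ⟩⇝ᵗ D′ → bot {x = x} D ⟨ τ ⟩⇝ᵗʳ bot {x = x} D′
      plus₁ : ∀ {τ Θ Θ′ x A B P P′ Γ Γ′} {D : Θ ⊢ P ▹ ((x ∶ A) ∷ Γ) ∷ []} {D′ : Θ′ ⊢ P′ ▹ ((x ∶ sub τ A) ∷ Γ′) ∷ []} →
              D ⟨ τ ⟩⇝ᵗ D′ → plus₁ {B = B} D ⟨ τ ⟩⇝ᵗʳ plus₁ {B = sub τ B} D′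
      plus₂ : ∀ {τ Θ Θ′ x A B P P′ Γ Γ′} {D : Θ ⊢ P ▹ ((x ∶ B) ∷ Γ) ∷ []} {D′ : Θ′ ⊢ P′ ▹ ((x ∶ sub τ B) ∷ Γ′) ∷ []} →
              D ⟨ τ ⟩⇝ᵗ D′ → plus₂ {A = A} D ⟨ τ ⟩⇝ᵗʳ plus₂ {A = sub τ A} D′
      with′ : ∀ {τ Θ Θ′ x A B P P′ Q Q′ Γ Γ′}
                {D : Θ ⊢ P ▹ ((x ∶ A) ∷ Γ) ∷ []} {D′ : Θ′ ⊢ P′ ▹ ((x ∶ sub τ A) ∷ Γ′) ∷ []}
                {E : Θ ⊢ Q ▹ ((x ∶ B) ∷ Γ) ∷ []} {E′ : Θ′ ⊢ Q′ ▹ ((x ∶ sub τ B) ∷ Γ′) ∷ []} →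
              D ⟨ τ ⟩⇝ᵗ D′ → E ⟨ τ ⟩⇝ᵗ E′ → with′ D E ⟨ τ ⟩⇝ᵗʳ with′ D′ E′
      bang  : ∀ {τ x y A P P′ Γ Γ′} {w : All Is⁇ Γ} {w′ : All Is⁇ Γ′}
                {D : [] ⊢ P ▹ ((y ∶ A) ∷ Γ) ∷ []} {D′ : [] ⊢ P′ ▹ ((y ∶ sub τ A) ∷ Γ′) ∷ []} →
              D ⟨ τ ⟩⇝ᵗ D′ → bang {x = x} w D ⟨ τ ⟩⇝ᵗʳ bang {x = x} w′ D′
      que   : ∀ {τ Θ Θ′ x y A P P′ Γ Γ′} {D : Θ ⊢ P ▹ ((y ∶ A) ∷ Γ) ∷ []} {D′ : Θ′ ⊢ P′ ▹ ((y ∶ sub τ A) ∷ Γ′) ∷ []} →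
              D ⟨ τ ⟩⇝ᵗ D′ → que {x = x} D ⟨ τ ⟩⇝ᵗʳ que {x = x} D′
      weak  : ∀ {τ Θ Θ′ x A P P′ Γ Γ′} {D : Θ ⊢ P ▹ Γ ∷ []} {D′ : Θ′ ⊢ P′ ▹ Γ′ ∷ []} →
              D ⟨ τ ⟩⇝ᵗ D′ → weak {x = x} {A} D ⟨ τ ⟩⇝ᵗʳ weak {x = x} {sub τ A} D′
      contr : ∀ {τ Θ Θ′ x x₁ x₂ A P P′ Γ Γ′} {D : Θ ⊢ P ▹ ((x₂ ∶ ⁇ A) ∷ (x₁ ∶ ⁇ A) ∷ Γ) ∷ []}
                {D′ : Θ′ ⊢ P′ ▹ ((x₂ ∶ ⁇ (sub τ A)) ∷ (x₁ ∶ ⁇ (sub τ A)) ∷ Γ′) ∷ []} →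
              D ⟨ τ ⟩⇝ᵗ D′ → contr {x = x} D ⟨ τ ⟩⇝ᵗʳ contr {x = x} D′
      ex    : ∀ {τ Θ Θ′ x A B P P′ Γ Γ′} {w : Wfᵗ A} {w′ : Wfᵗ (sub τ A)} {D : Θ ⊢ P ▹ ((x ∶ B [ A ]ᵗ) ∷ Γ) ∷ []}
                {D′ : Θ′ ⊢ P′ ▹ ((x ∶ sub (liftˢ τ) B [ sub τ A ]ᵗ) ∷ Γ′) ∷ []} →
              D ⟨ τ ⟩⇝ᵗ D′ → ex {A = A} {B} w D ⟨ τ ⟩⇝ᵗʳ ex {A = sub τ A} {sub (liftˢ τ) B} w′ D′
      all   : ∀ {τ Θ Θ′ x B P P′ Γ Γ′} {D : renᴾ suc Θ ⊢ P ▹ ((x ∶ B) ∷ renᴱ suc Γ) ∷ []}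
                {D′ : renᴾ suc Θ′ ⊢ P′ ▹ ((x ∶ sub (liftˢ τ) B) ∷ renᴱ suc Γ′) ∷ []} →
              D ⟨ liftˢ τ ⟩⇝ᵗ D′ → all {Θ = Θ} {Γ = Γ} D ⟨ τ ⟩⇝ᵗʳ all {Θ = Θ′} {Γ = Γ′} D′
      prov  : ∀ {τ Θ Θ′ x ρ P P′ Q Q′ 𝒢 𝒢ρ 𝒢ρ′} {E : Θ ⊢ P ▹ 𝒢ρ} {i : 𝒢 ⟦ ρ ⟧≔ 𝒢ρ}
                {E′ : Θ′ ⊢ P′ ▹ 𝒢ρ′} {i′ : subᴴ τ 𝒢 ⟦ ρ ⟧≔ 𝒢ρ′} {D : [] ⊢ Q ▹ []} {D′ : [] ⊢ Q′ ▹ []} →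
              E ⟨ τ ⟩⇝ᵗ E′ → D ⟨ τ ⟩⇝ᵗ D′ → prov {x = x} E i D ⟨ τ ⟩⇝ᵗʳ prov {x = x} E′ i′ D′
      asm   : ∀ {τ Θ Θ′ x p P P′ 𝒢 Γ Γ′} {D : (p ∶ 𝒢) ∷ Θ ⊢ P ▹ Γ ∷ []} {D′ : (p ∶ subᴴ τ 𝒢) ∷ Θ′ ⊢ P′ ▹ Γ′ ∷ []} →
              D ⟨ τ ⟩⇝ᵗ D′ → asm {x = x} D ⟨ τ ⟩⇝ᵗʳ asm {x = x} D′

  -- Contracts σ₁ σ₂ E zs F : F extends E with the applications of (C) for dups σ₁ σ₂ zs.
  data Contracts {n : ℕ} (σ₁ σ₂ : Name → Name) {Π : PEnv n} {Q : Proc n} {ℋ : HEnv Name n} (E : Π ⊢ Q ▹ ℋ) :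
                 (zs : List Name) {Θ : PEnv n} {𝒢 : HEnv Name n} → Θ ⊢ dups σ₁ σ₂ zs Q ▹ 𝒢 → Set where
    []  : Contracts σ₁ σ₂ E [] E
    _∷_ : ∀ z {zs Θ Θ′ A Γ 𝒢 e f v} {F : Θ ⊢ dups σ₁ σ₂ zs Q ▹ ((σ₂ z ∶ ⁇ A) ∷ (σ₁ z ∶ ⁇ A) ∷ Γ) ∷ []} →
          Contracts σ₁ σ₂ E zs F → Contracts σ₁ σ₂ E (z ∷ zs) {Θ′} {𝒢} (node (contr F) e f v)

  -- The process rules read on derivations; an index Θ ⊢ P ▹ 𝒢 carries validity.  Conclusions
  -- are read up to reordering, hence the arbitrary arguments e, f, v of node.
  infix 3 _—⟨_⟩→_
  data _—⟨_⟩→_ {n : ℕ} : {Θ Θ′ : PEnv n} {P P′ : Proc n} {𝒢 𝒢′ : HEnv Name n} →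
               Θ ⊢ P ▹ 𝒢 → Label n (Deriv n) → Θ′ ⊢ P′ ▹ 𝒢′ → Set where
    send    : ∀ {Θ Θ′ x y A B P Γ Δ 𝒢 e f v} {D : Θ ⊢ P ▹ ((y ∶ A) ∷ Γ) ∷ ((x ∶ B) ∷ Δ) ∷ []} →
              node {Θ′ = Θ′} {𝒢′ = 𝒢} (ten D) e f v —⟨ act (send x y) ⟩→ D
    recv    : ∀ {Θ Θ′ x y A B P Γ 𝒢 e f v} {D : Θ ⊢ P ▹ ((y ∶ A) ∷ (x ∶ B) ∷ Γ) ∷ []} →
              node {Θ′ = Θ′} {𝒢′ = 𝒢} (par D) e f v —⟨ act (recv x y) ⟩→ D
    close   : ∀ {Θ Θ′ x P 𝒢 e f v} {D : Θ ⊢ P ▹ []} →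
              node {Θ′ = Θ′} {𝒢′ = 𝒢} (one {x = x} D) e f v —⟨ act (close x) ⟩→ D
    wait    : ∀ {Θ Θ′ x P Γ 𝒢 e f v} {D : Θ ⊢ P ▹ Γ ∷ []} →
              node {Θ′ = Θ′} {𝒢′ = 𝒢} (bot {x = x} D) e f v —⟨ act (wait x) ⟩→ D
    inl     : ∀ {Θ Θ′ x A B P Γ 𝒢 e f v} {D : Θ ⊢ P ▹ ((x ∶ A) ∷ Γ) ∷ []} →
              node {Θ′ = Θ′} {𝒢′ = 𝒢} (plus₁ {B = B} D) e f v —⟨ act (inl x) ⟩→ D
    inr     : ∀ {Θ Θ′ x A B P Γ 𝒢 e f v} {D : Θ ⊢ P ▹ ((x ∶ B) ∷ Γ) ∷ []} →
              node {Θ′ = Θ′} {𝒢′ = 𝒢} (plus₂ {A = A} D) e f v —⟨ act (inr x) ⟩→ D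
    coinl   : ∀ {Θ Θ′ x A B P Q Γ 𝒢 e f v} {D : Θ ⊢ P ▹ ((x ∶ A) ∷ Γ) ∷ []} {E : Θ ⊢ Q ▹ ((x ∶ B) ∷ Γ) ∷ []} →
              node {Θ′ = Θ′} {𝒢′ = 𝒢} (with′ D E) e f v —⟨ act (coinl x) ⟩→ D
    coinr   : ∀ {Θ Θ′ x A B P Q Γ 𝒢 e f v} {D : Θ ⊢ P ▹ ((x ∶ A) ∷ Γ) ∷ []} {E : Θ ⊢ Q ▹ ((x ∶ B) ∷ Γ) ∷ []} →
              node {Θ′ = Θ′} {𝒢′ = 𝒢} (with′ D E) e f v —⟨ act (coinr x) ⟩→ E
    sendT   : ∀ {Θ Θ′ x A B P Γ 𝒢 e f v w} {D : Θ ⊢ P ▹ ((x ∶ B [ A ]ᵗ) ∷ Γ) ∷ []} →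
              node {Θ′ = Θ′} {𝒢′ = 𝒢} (ex {A = A} {B} w D) e f v —⟨ act (sendT x A) ⟩→ D
    recvT   : ∀ {Θ Θ′ x A B P Γ 𝒢 e f v} {D : renᴾ suc Θ ⊢ P ▹ ((x ∶ B) ∷ renᴱ suc Γ) ∷ []}
                {E : Θ ⊢ subProc (single A) P ▹ ((x ∶ B [ A ]ᵗ) ∷ Γ) ∷ []} →
              Wfᵗ A → D ⟨ single A ⟩⇝ᵗ E →
              node {Θ′ = Θ′} {𝒢′ = 𝒢} (all {Θ = Θ} {Γ = Γ} D) e f v —⟨ act (recvT x A) ⟩→ E
    use     : ∀ {Θ Θ′ x y A P Γ 𝒢 e f v} {D : Θ ⊢ P ▹ ((y ∶ A) ∷ Γ) ∷ []} →
              node {Θ′ = Θ′} {𝒢′ = 𝒢} (que {x = x} D) e f v —⟨ act (use x y) ⟩→ D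
    couse   : ∀ {Θ x y A P Γ 𝒢 e f v w} {D : [] ⊢ P ▹ ((y ∶ A) ∷ Γ) ∷ []} →
              node {Θ′ = Θ} {𝒢′ = 𝒢} (bang {x = x} w D) e f v —⟨ act (couse x y) ⟩→ D
    disp    : ∀ {Θ Θ′ Θ″ x A P Γ 𝒢 ℋ e f v e′ f′ v′} {D : Θ ⊢ P ▹ Γ ∷ []} →
              node {Θ′ = Θ′} {𝒢′ = 𝒢} (weak {x = x} {A} D) e f v —⟨ act (disp x) ⟩→
              node {Θ′ = Θ″} {𝒢′ = ℋ} (bot {x = x} D) e′ f′ v′
    dup     : ∀ {Θ Θ′ Θ″ x x₁ x₂ A P Γ 𝒢 ℋ e f v e′ f′ v′} {D : Θ ⊢ P ▹ ((x₂ ∶ ⁇ A) ∷ (x₁ ∶ ⁇ A) ∷ Γ) ∷ []} →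
              node {Θ′ = Θ′} {𝒢′ = 𝒢} (contr {x = x} D) e f v —⟨ act (dup x x₁ x₂) ⟩→
              node {Θ′ = Θ″} {𝒢′ = ℋ} (par D) e′ f′ v′
    -- The judgement of E fixes every type in it.
    codisp  : ∀ {Θ x x′ A P Γ zs 𝒢 e f v w} {D : [] ⊢ P ▹ ((x′ ∶ A) ∷ Γ) ∷ []}
                {E : [] ⊢ disps zs (close x 𝟎) ▹ ((x ∶ 𝟙) ∷ Γ) ∷ []} →
              zs Enumerates P ∖ x′ →
              node {Θ′ = Θ} {𝒢′ = 𝒢} (bang {x = x} w D) e f v —⟨ act (codisp x) ⟩→ E
    codup   : ∀ {Θ Π₁ Π₂ Π₃ Π₄ Θ′ x x′ x₁ x₂ A P Γ Γ₁ Γ₂ σ₁ σ₂ zs 𝒢 ℋ₁ ℋ₂ ℋ₄ 𝒢′ w w₁ w₂ e f v e₁ f₁ v₁ e₂ f₂ v₂ e₃ f₃ v₃ e₄ f₄ v₄}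
                {D  : [] ⊢ P ▹ ((x′ ∶ A) ∷ Γ) ∷ []}
                {D₁ : [] ⊢ P ⟪ σ₁ ⟫ ▹ ((σ₁ x′ ∶ A) ∷ Γ₁) ∷ []}
                {D₂ : [] ⊢ P ⟪ σ₂ ⟫ ▹ ((σ₂ x′ ∶ A) ∷ Γ₂) ∷ []}
                {F  : Θ′ ⊢ dups σ₁ σ₂ zs (send x₁ x₂ (serve x₁ (σ₁ x′) (P ⟪ σ₁ ⟫) ∥ serve x₂ (σ₂ x′) (P ⟪ σ₂ ⟫))) ▹ 𝒢′} →
              Splits P x′ x₁ x₂ σ₁ σ₂ zs → D ⟨ σ₁ ⟩⇝ D₁ → D ⟨ σ₂ ⟩⇝ D₂ →
              (let E₁ = node {Θ′ = Π₁} {𝒢′ = ℋ₁} (bang {x = x₁} w₁ D₁) e₁ f₁ v₁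
                   E₂ = node {Θ′ = Π₂} {𝒢′ = ℋ₂} (bang {x = x₂} w₂ D₂) e₂ f₂ v₂
                   E₃ = node {Θ′ = Π₃} {𝒢′ = ((x₂ ∶ ‼ A) ∷ Γ₂) ∷ ((x₁ ∶ ‼ A) ∷ Γ₁) ∷ []} (mix E₁ E₂) e₃ f₃ v₃
                   E₄ = node {Θ′ = Π₄} {𝒢′ = ℋ₄} (ten E₃) e₄ f₄ v₄) →
              Contracts σ₁ σ₂ E₄ zs F →
              node {Θ′ = Θ} {𝒢′ = 𝒢} (bang {x = x} w D) e f v —⟨ act (codup x x₁ x₂) ⟩→ F
    provide : ∀ {Θ Θ′ x ρ P Q 𝒢 𝒢ρ ℋ e f v} {E : Θ ⊢ P ▹ 𝒢ρ} {i : 𝒢 ⟦ ρ ⟧≔ 𝒢ρ} {D : [] ⊢ Q ▹ []} →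
              node {Θ′ = Θ′} {𝒢′ = ℋ} (prov {x = x} E i D) e f v —⟨ act (provide x ρ ⌊ E ⌋) ⟩→ D
    assume  : ∀ {Θ Θ′ x p P 𝒢 Γ ℋ e f v} {D : (p ∶ 𝒢) ∷ Θ ⊢ P ▹ Γ ∷ []} →
              node {Θ′ = Θ′} {𝒢′ = ℋ} (asm {x = x} D) e f v —⟨ act (assume x p) ⟩→ D
    linkˡ   : ∀ {Θ Θ′ x y A 𝒢 𝒢′ e f v e′ f′ v′} →
              node {Θ′ = Θ} {𝒢′ = 𝒢} (ax {x = x} {y} {A}) e f v —⟨ link x y ⟩→ node {Θ′ = Θ′} {𝒢′ = 𝒢′} mix₀ e′ f′ v′
    linkʳ   : ∀ {Θ Θ′ x y A 𝒢 𝒢′ e f v e′ f′ v′} →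
              node {Θ′ = Θ} {𝒢′ = 𝒢} (ax {x = x} {y} {A}) e f v —⟨ link y x ⟩→ node {Θ′ = Θ′} {𝒢′ = 𝒢′} mix₀ e′ f′ v′
    call    : ∀ {Θ Π p 𝒢 ρ σ P 𝒢σ 𝒢ρ ℋ 𝒦 e f v} {i : 𝒢 ⟦ σ ⟧≔ 𝒢σ} {E : Π ⊢ P ▹ ℋ} {F : Π ⊢ P ⟪ σ ∘⁻¹ ρ ⟫ ▹ 𝒢σ} →
              𝒢 ⟦ ρ ⟧≔ 𝒢ρ → 𝒢ρ ≋ ℋ → E ⟨ σ ∘⁻¹ ρ ⟩⇝ F →
              node {Θ′ = Θ} {𝒢′ = 𝒦} (call {p = p} i) e f v —⟨ p ^ 𝒢 ↦ ρ ∙ ⌊ E ⌋ ⟩→ F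

    alpha   : ∀ {Θ Θ₀ Θ′ P Q R 𝒢 𝒢₀ 𝒢′ l} {D : Θ ⊢ P ▹ 𝒢} {D₀ : Θ₀ ⊢ Q ▹ 𝒢₀} {E : Θ′ ⊢ R ▹ 𝒢′} →
              P =α Q → Θ ≋ᴾ Θ₀ → 𝒢 ≋ 𝒢₀ → D₀ —⟨ l ⟩→ E → D —⟨ l ⟩→ E
    reorder : ∀ {Θ Θ₀ Θ′ Θ″ P Q 𝒢 𝒢₀ 𝒢′ 𝒢″ l e f v e′ f′ v′} {D : Θ ⊢ P ▹ 𝒢} {r : Θ₀ ⊩ Q ▹ 𝒢₀} →
              D —⟨ l ⟩→ node {Θ′ = Θ′} {𝒢′ = 𝒢′} r e f v → D —⟨ l ⟩→ node {Θ′ = Θ″} {𝒢′ = 𝒢″} r e′ f′ v′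
    swap    : ∀ {Θ Θ′ P P′ 𝒢 𝒢′ a b} {D : Θ ⊢ P ▹ 𝒢} {D′ : Θ′ ⊢ P′ ▹ 𝒢′} → D —⟨ a ∣ b ⟩→ D′ → D —⟨ b ∣ a ⟩→ D′

    parˡ    : ∀ {Θ Θ′ Π Ξ Ξ′ P P′ Q 𝒢 𝒢′ ℋ 𝒦 𝒦′ l e f v e′ f′ v′} {D : Θ ⊢ P ▹ 𝒢} {D′ : Θ′ ⊢ P′ ▹ 𝒢′} {E : Π ⊢ Q ▹ ℋ} →
              D —⟨ l ⟩→ D′ → Disjoint (bn l) (fn Q) →
              node {Θ′ = Ξ} {𝒢′ = 𝒦} (mix D E) e f v —⟨ l ⟩→ node {Θ′ = Ξ′} {𝒢′ = 𝒦′} (mix D′ E) e′ f′ v′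
    parʳ    : ∀ {Θ Π Π′ Ξ Ξ′ P Q Q′ 𝒢 ℋ ℋ′ 𝒦 𝒦′ l e f v e′ f′ v′} {D : Θ ⊢ P ▹ 𝒢} {E : Π ⊢ Q ▹ ℋ} {E′ : Π′ ⊢ Q′ ▹ ℋ′} →
              E —⟨ l ⟩→ E′ → Disjoint (bn l) (fn P) →
              node {Θ′ = Ξ} {𝒢′ = 𝒦} (mix D E) e f v —⟨ l ⟩→ node {Θ′ = Ξ′} {𝒢′ = 𝒦′} (mix D E′) e′ f′ v′
    syn     : ∀ {Θ Θ′ Π Π′ Ξ Ξ′ P P′ Q Q′ 𝒢 𝒢′ ℋ ℋ′ 𝒦 𝒦′ a b e f v e′ f′ v′}
                {D : Θ ⊢ P ▹ 𝒢} {D′ : Θ′ ⊢ P′ ▹ 𝒢′} {E : Π ⊢ Q ▹ ℋ} {E′ : Π′ ⊢ Q′ ▹ ℋ′} →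
              D —⟨ act a ⟩→ D′ → E —⟨ act b ⟩→ E′ → Disjoint (bnᴬ a) (bnᴬ b) →
              node {Θ′ = Ξ} {𝒢′ = 𝒦} (mix D E) e f v —⟨ a ∣ b ⟩→ node {Θ′ = Ξ′} {𝒢′ = 𝒦′} (mix D′ E′) e′ f′ v′
    res     : ∀ {Θ Θ′ Ξ Ξ′ x y A P P′ Γ Γ′ Δ Δ′ 𝒢 𝒢′ 𝒦 𝒦′ l e f v e′ f′ v′}
                {D : Θ ⊢ P ▹ ((x ∶ A) ∷ Γ) ∷ ((y ∶ A ᗮ) ∷ Δ) ∷ 𝒢}
                {D′ : Θ′ ⊢ P′ ▹ ((x ∶ A) ∷ Γ′) ∷ ((y ∶ A ᗮ) ∷ Δ′) ∷ 𝒢′} →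
              D —⟨ l ⟩→ D′ → x ∉ cn l → y ∉ cn l →
              node {Θ′ = Ξ} {𝒢′ = 𝒦} (cut D) e f v —⟨ l ⟩→ node {Θ′ = Ξ′} {𝒢′ = 𝒦′} (cut D′) e′ f′ v′

    run     : ∀ {Θ Θ′ Π Ξ q 𝒢 ρ P P′ Q ℋ ℋρ 𝒦 𝒦′ 𝒥 e f v} {E : Π ⊢ Q ▹ ℋρ} {i : ℋ ⟦ ρ ⟧≔ ℋρ}
                {D : (q ∶ ℋ) ∷ Θ ⊢ P ▹ 𝒦} {D′ : Θ′ ⊢ P′ ▹ 𝒦′} →
              D —⟨ q ^ 𝒢 ↦ ρ ∙ ⌊ E ⌋ ⟩→ D′ →
              node {Θ′ = Ξ} {𝒢′ = 𝒥} (chop E i D) e f v —⟨ τ ⟩→ D′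
    ext     : ∀ {Θ Θ₁ Θ′ Π Ξ Ξ₁ x q σ ρ P P′ Q R ℋ ℋρ 𝒦 𝒦₁ 𝒦′ 𝒥 𝒥₁ e f v e₁ f₁ v₁} {E : Π ⊢ Q ▹ ℋρ} {i : ℋ ⟦ ρ ⟧≔ ℋρ}
                {D : (q ∶ ℋ) ∷ Θ ⊢ P ▹ 𝒦} {D₁ : (q ∶ ℋ) ∷ Θ₁ ⊢ R ▹ 𝒦₁} {D′ : Θ′ ⊢ P′ ▹ 𝒦′} →
              D —⟨ act (provide x σ ⌊ D₁ ⌋) ⟩→ D′ → q ∈ fpv R →
              node {Θ′ = Ξ} {𝒢′ = 𝒥} (chop E i D) e f v
                —⟨ act (provide x σ ⌊ node {Θ′ = Ξ₁} {𝒢′ = 𝒥₁} (chop E i D₁) e₁ f₁ v₁ ⌋) ⟩→ D′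
    lift    : ∀ {Θ Θ′ Π Ξ Ξ′ q ρ P P′ Q ℋ ℋρ 𝒦 𝒦′ 𝒥 𝒥′ l e f v e′ f′ v′} {E : Π ⊢ Q ▹ ℋρ} {i : ℋ ⟦ ρ ⟧≔ ℋρ}
                {D : (q ∶ ℋ) ∷ Θ ⊢ P ▹ 𝒦} {D′ : (q ∶ ℋ) ∷ Θ′ ⊢ P′ ▹ 𝒦′} →
              D —⟨ l ⟩→ D′ → q ∉ fpvᴸ (fpv ∘ proc) l →
              node {Θ′ = Ξ} {𝒢′ = 𝒥} (chop E i D) e f v —⟨ l ⟩→ node {Θ′ = Ξ′} {𝒢′ = 𝒥′} (chop E i D′) e′ f′ v′

    com-unit : ∀ {Θ Ξ x y P P′ Δ 𝒢 𝒥 e f v}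
                 {D : Θ ⊢ P ▹ ((x ∶ 𝟙) ∷ []) ∷ ((y ∶ ⊥) ∷ Δ) ∷ 𝒢} {D′ : Θ ⊢ P′ ▹ Δ ∷ 𝒢} →
               D —⟨ close x ∣ wait y ⟩→ D′ →
               node {Θ′ = Ξ} {𝒢′ = 𝒥} (cut D) e f v —⟨ τ ⟩→ D′
    com-name : ∀ {Θ Ξ Ξ₁ Ξ₂ x y x′ y′ A B P P′ Γ Γ₁ Γ₂ Δ 𝒢 𝒥 𝒥₂ e f v e₁ f₁ v₁ e₂ f₂ v₂}
                 {D : Θ ⊢ P ▹ ((x ∶ A ⊗ B) ∷ Γ) ∷ ((y ∶ A ᗮ ⅋ B ᗮ) ∷ Δ) ∷ 𝒢}
                 {D′ : Θ ⊢ P′ ▹ ((x′ ∶ A) ∷ Γ₂) ∷ ((y′ ∶ A ᗮ) ∷ (y ∶ B ᗮ) ∷ Δ) ∷ ((x ∶ B) ∷ Γ₁) ∷ 𝒢} →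
               Γ ↭ Γ₁ ++ Γ₂ → D —⟨ send x x′ ∣ recv y y′ ⟩→ D′ →
               (let E = node {Θ′ = Ξ₁} {𝒢′ = ((x ∶ B) ∷ Γ₁) ∷ ((y ∶ B ᗮ) ∷ Γ₂ ++ Δ) ∷ 𝒢} (cut D′) e₁ f₁ v₁) →
               node {Θ′ = Ξ} {𝒢′ = 𝒥} (cut D) e f v —⟨ τ ⟩→ node {Θ′ = Ξ₂} {𝒢′ = 𝒥₂} (cut E) e₂ f₂ v₂
    com-inl  : ∀ {Θ Ξ Ξ₁ x y A B P P′ Γ Δ 𝒢 𝒥 𝒥₁ e f v e₁ f₁ v₁}
                 {D : Θ ⊢ P ▹ ((x ∶ A ⊕ B) ∷ Γ) ∷ ((y ∶ A ᗮ & B ᗮ) ∷ Δ) ∷ 𝒢}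
                 {D′ : Θ ⊢ P′ ▹ ((x ∶ A) ∷ Γ) ∷ ((y ∶ A ᗮ) ∷ Δ) ∷ 𝒢} →
               D —⟨ inl x ∣ coinl y ⟩→ D′ →
               node {Θ′ = Ξ} {𝒢′ = 𝒥} (cut D) e f v —⟨ τ ⟩→ node {Θ′ = Ξ₁} {𝒢′ = 𝒥₁} (cut D′) e₁ f₁ v₁
    com-inr  : ∀ {Θ Ξ Ξ₁ x y A B P P′ Γ Δ 𝒢 𝒥 𝒥₁ e f v e₁ f₁ v₁}
                 {D : Θ ⊢ P ▹ ((x ∶ A ⊕ B) ∷ Γ) ∷ ((y ∶ A ᗮ & B ᗮ) ∷ Δ) ∷ 𝒢}
                 {D′ : Θ ⊢ P′ ▹ ((x ∶ B) ∷ Γ) ∷ ((y ∶ B ᗮ) ∷ Δ) ∷ 𝒢} →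
               D —⟨ inr x ∣ coinr y ⟩→ D′ →
               node {Θ′ = Ξ} {𝒢′ = 𝒥} (cut D) e f v —⟨ τ ⟩→ node {Θ′ = Ξ₁} {𝒢′ = 𝒥₁} (cut D′) e₁ f₁ v₁
    com-type : ∀ {Θ Ξ Ξ₁ x y A B P P′ Γ Δ 𝒢 𝒥 𝒥₁ e f v e₁ f₁ v₁}
                 {D : Θ ⊢ P ▹ ((x ∶ ∃ᵗ B) ∷ Γ) ∷ ((y ∶ ∀ᵗ (B ᗮ)) ∷ Δ) ∷ 𝒢}
                 {D′ : Θ ⊢ P′ ▹ ((x ∶ B [ A ]ᵗ) ∷ Γ) ∷ ((y ∶ (B [ A ]ᵗ) ᗮ) ∷ Δ) ∷ 𝒢} →
               D —⟨ sendT x A ∣ recvT y A ⟩→ D′ →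
               node {Θ′ = Ξ} {𝒢′ = 𝒥} (cut D) e f v —⟨ τ ⟩→ node {Θ′ = Ξ₁} {𝒢′ = 𝒥₁} (cut D′) e₁ f₁ v₁
    -- In com-disp and com-dup Δ need not consist of ⁇-types: cuts around the promotion at y
    -- may have merged its environment with others.
    com-disp : ∀ {Θ Ξ Ξ₁ x y A P P′ Γ Δ 𝒢 𝒥 𝒥₁ e f v e₁ f₁ v₁}
                 {D : Θ ⊢ P ▹ ((x ∶ ⁇ A) ∷ Γ) ∷ ((y ∶ ‼ (A ᗮ)) ∷ Δ) ∷ 𝒢}
                 {D′ : Θ ⊢ P′ ▹ ((x ∶ ⊥) ∷ Γ) ∷ ((y ∶ 𝟙) ∷ Δ) ∷ 𝒢} →
               D —⟨ disp x ∣ codisp y ⟩→ D′ →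
               node {Θ′ = Ξ} {𝒢′ = 𝒥} (cut D) e f v —⟨ τ ⟩→ node {Θ′ = Ξ₁} {𝒢′ = 𝒥₁} (cut D′) e₁ f₁ v₁
    com-use  : ∀ {Θ Ξ Ξ₁ x y x′ y′ A P P′ Γ Δ 𝒢 𝒥 𝒥₁ e f v e₁ f₁ v₁}
                 {D : Θ ⊢ P ▹ ((x ∶ ⁇ A) ∷ Γ) ∷ ((y ∶ ‼ (A ᗮ)) ∷ Δ) ∷ 𝒢}
                 {D′ : Θ ⊢ P′ ▹ ((x′ ∶ A) ∷ Γ) ∷ ((y′ ∶ A ᗮ) ∷ Δ) ∷ 𝒢} →
               D —⟨ use x x′ ∣ couse y y′ ⟩→ D′ →
               node {Θ′ = Ξ} {𝒢′ = 𝒥} (cut D) e f v —⟨ τ ⟩→ node {Θ′ = Ξ₁} {𝒢′ = 𝒥₁} (cut D′) e₁ f₁ v₁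
    com-dup  : ∀ {Θ Ξ Ξ₁ x y x₁ x₂ y₁ y₂ A P P′ Γ Δ 𝒢 𝒥 𝒥₁ e f v e₁ f₁ v₁}
                 {D : Θ ⊢ P ▹ ((x ∶ ⁇ A) ∷ Γ) ∷ ((y ∶ ‼ (A ᗮ)) ∷ Δ) ∷ 𝒢}
                 {D′ : Θ ⊢ P′ ▹ ((x₁ ∶ ⁇ A ⅋ ⁇ A) ∷ Γ) ∷ ((y₁ ∶ ‼ (A ᗮ) ⊗ ‼ (A ᗮ)) ∷ Δ) ∷ 𝒢} →
               D —⟨ dup x x₁ x₂ ∣ codup y y₁ y₂ ⟩→ D′ →
               node {Θ′ = Ξ} {𝒢′ = 𝒥} (cut D) e f v —⟨ τ ⟩→ node {Θ′ = Ξ₁} {𝒢′ = 𝒥₁} (cut D′) e₁ f₁ v₁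
    com-proc : ∀ {Θ Π Ξ Ξ₁ x y q ρ P P′ Q Δ 𝒢 ℋ ℋρ 𝒥 𝒥₁ e f v e₁ f₁ v₁}
                 {D : Θ ++ Π ⊢ P ▹ ((x ∶ prov ℋ) ∷ []) ∷ ((y ∶ asm ℋ) ∷ Δ) ∷ 𝒢}
                 {E : Π ⊢ Q ▹ ℋρ} {i : ℋ ⟦ ρ ⟧≔ ℋρ} {D′ : (q ∶ ℋ) ∷ Θ ⊢ P′ ▹ Δ ∷ 𝒢} →
               D —⟨ provide x ρ ⌊ E ⌋ ∣ assume y q ⟩→ D′ →
               node {Θ′ = Ξ} {𝒢′ = 𝒥} (cut D) e f v —⟨ τ ⟩→ node {Θ′ = Ξ₁} {𝒢′ = 𝒥₁} (chop E i D′) e₁ f₁ v₁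
    com-link : ∀ {Θ Ξ x y z A P P′ Γ 𝒢 𝒥 e f v}
                 {D : Θ ⊢ P ▹ ((x ∶ A) ∷ Γ) ∷ ((y ∶ A ᗮ) ∷ (z ∶ A) ∷ []) ∷ 𝒢}
                 {D′ : Θ ⊢ P′ ▹ ((x ∶ A) ∷ Γ) ∷ 𝒢} {D″ : Θ ⊢ P′ ⟪ z / x ⟫ ▹ ((z ∶ A) ∷ Γ) ∷ 𝒢} →
               D —⟨ link z y ⟩→ D′ → z ≢ x → z ≢ y → D′ ⟨ z / x ⟩⇝ D″ →
               node {Θ′ = Ξ} {𝒢′ = 𝒥} (cut D) e f v —⟨ τ ⟩→ D″

  infix 3 _⟶⟨_⟩_
  _⟶⟨_⟩_ : Deriv n → Label n (Deriv n) → Deriv n → Set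
  D ⟶⟨ l ⟩ D′ = tree D —⟨ l ⟩→ tree D′

  procᴸ : Label n (Deriv n) → Label n (Proc n)
  procᴸ = mapLabel proc

  -- Fits 𝒢 l : the payloads of l have the types that the transition prescribes, namely in
  -- x[(ρ)E] the type provided at x by the source, whose hyperenvironment is 𝒢, and in
  -- p^ℋ ↦ (ρ)E the annotation ℋ.  Erasing a payload forgets its type, e.g. u↔v has derivations
  -- of u:A⊥, v:A for every A, of which a given derivation of x[(ρ)u↔v].𝟎 emits only one type.
  FitsAct : HEnv Name n → Act n (Deriv n) → Set
  FitsAct 𝒢 (provide x ρ E) = ∃[ ℋ ] ∃[ ℋρ ] (x , prov ℋ) ∈ concat 𝒢 × ℋ ⟦ ρ ⟧≔ ℋρ × ℋρ ≋ henv E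
  FitsAct 𝒢 _               = ⊤

  Fits : HEnv Name n → Label n (Deriv n) → Set
  Fits 𝒢 (act a)         = FitsAct 𝒢 a
  Fits 𝒢 (a ∣ b)         = FitsAct 𝒢 a × FitsAct 𝒢 b
  Fits 𝒢 (p ^ ℋ ↦ ρ ∙ E) = ∃[ ℋρ ] ℋ ⟦ ρ ⟧≔ ℋρ × ℋρ ≋ henv E
  Fits 𝒢 _               = ⊤

-- Erasing a transition of derivations is immediate once fn P and fpv P are known to be the names
-- and process variables of every judgement of P: the side conditions on processes are then the
-- disjointness that validity demands.
--
-- Conversely, a transition of processes is lifted to a given derivation.  By the rule alpha a
-- transition depends only on the judgement of its source, so that derivation may be rearranged
-- freely: along α-equivalence, reorderings, and replacement of the payload by another derivation of
-- the same process.  To rebuild the cut at ν x y, the induction also records the effect of the label: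
-- each action consumes one entry of an environment and splits the rest of it.  Hence x and y keep
-- their types and stay apart as long as they do not act, and a communication between them consumes
-- dual entries.

module Submission where

open import Defs
open import Data.Fin using (Fin; zero; suc)
open import Data.List using (List; []; _∷_; _++_; map; concat)
open import Data.List.Membership.Propositional using (_∈_; _∉_)
open import Data.List.Membership.Propositional.Properties.WithK using (unique∧set⇒bag)
open import Data.List.Relation.Binary.BagAndSetEquality using (∼bag⇒↭)
open import Data.List.Membership.Propositional.Properties
  using (∈-++⁺ˡ; ∈-++⁺ʳ; ∈-++⁻; ∈-map⁺; ∈-map⁻; ∈-filter⁺; ∈-filter⁻; ∈-∃++)
import Data.List.Properties as List
open import Data.List.Relation.Binary.Disjoint.Propositional using (Disjoint)
open import Data.List.Relation.Binary.Permutation.Homogeneous using (Permutation)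
  renaming (refl to reflᵖ; prep to prepᵖ; swap to swapᵖ; trans to transᵖ)
open import Data.List.Relation.Binary.Permutation.Propositional using (_↭_; ↭-sym; ↭-trans; ↭-refl; prep)
import Data.List.Relation.Binary.Permutation.Propositional as ↭
import Data.List.Relation.Binary.Permutation.Propositional.Properties as ↭
import Data.List.Relation.Binary.Permutation.Setoid as PermS
import Data.List.Relation.Binary.Permutation.Setoid.Properties as Perm
import Algebra.Solver.CommutativeMonoid as CMSolver
open import Data.List.Relation.Binary.Pointwise using (Pointwise; []; _∷_)
import Data.List.Relation.Binary.Pointwise as Pointwise
open import Data.List.Relation.Unary.All using (All; []; _∷_)
import Data.List.Relation.Unary.All as All
import Data.List.Relation.Unary.All.Properties as All
open import Data.List.Relation.Unary.AllPairs using (AllPairs; []; _∷_)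
import Data.List.Relation.Unary.AllPairs as AllPairs
open import Data.List.Relation.Unary.Any using (Any; here; there)
import Data.List.Relation.Unary.Any as Any
import Data.List.Relation.Unary.Any.Properties as Any
open import Data.List.Relation.Unary.Unique.Propositional using (Unique)
import Data.List.Relation.Unary.Unique.Propositional.Properties as Unique
open import Data.Maybe using (just; fromMaybe)
open import Data.Nat using (ℕ; suc)
open import Data.Product using (_×_; _,_; proj₁; proj₂; ∃; ∃-syntax; map₁; map₂)
open import Data.Product.Relation.Binary.Pointwise.NonDependent using (×-setoid) renaming (Pointwise to ×-Pointwise)
open import Data.Sum using (_⊎_; inj₁; inj₂; [_,_]′)
open import Data.Unit using (tt)
open import Function using (_∘_; id; case_of_; mk⇔; Equivalence)
open import Relation.Binary.Bundles using (Setoid)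
open import Relation.Binary.Definitions using (DecidableEquality)
open import Relation.Binary.PropositionalEquality
  using (_≡_; _≢_; refl; sym; trans; cong; cong₂; subst; subst₂)
import Relation.Binary.PropositionalEquality as ≡
open import Relation.Nullary using (yes; no; ¬?; contradiction)

-- The obstacle is that erasure forgets typing choices. The process environment can be recovered:
-- every call carries its annotation, so `penv-unique` reads it off the process. The
-- hyperenvironment cannot, as an axiom may be typed at any `A`. A payload of the label may thus
-- replace the one in the source only if its hyperenvironment fits, and inside the induction this
-- condition must reach premises whose types agree only up to `_≈_`; hence the universally
-- quantified `Fits∀`. A silent conclusion supplies no payload at all. For a process communication,
-- `offer` extracts one from the source derivation; for `run`, the body bound by `chop` serves once
-- `annotation` has identified the annotation of the call with the hyperenvironment of the variable.
-- Effects record process variables besides names because a `chop`, like a cut, must be rebuilt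
-- around transitions that do not involve what it binds. Since reordering reaches inside types, the
-- cut formula of a communication is known only up to `_≈_`, and the source is retyped before a rule
-- applies.

module Erasure (𝒩 𝒫 : Atoms) (Param : Set) (_≟ᶠ_ : DecidableEquality Param) where

  open HOπLL 𝒩 𝒫 Param _≟ᶠ_

  private
    variable
      n m k : ℕ
      K L   : Set

  -- Types up to reordering of the environments in them

  liftʳ-∘ : {r : Fin m → Fin k} {s : Fin n → Fin m} {t : Fin n → Fin k} → (∀ X → r (s X) ≡ t X) →
            ∀ X → liftʳ r (liftʳ s X) ≡ liftʳ t X
  liftʳ-∘ h zero    = refl
  liftʳ-∘ h (suc X) = cong suc (h X)

  mutual
    -- The composite enters as a third map with a pointwise hypothesis, not as a literal
    -- composition, so that under a binder `liftʳ-∘` restores the hypothesis for the lifted maps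
    -- without function extensionality. The substitution laws below have the same form.
    ren-ren : {r : Fin m → Fin k} {s : Fin n → Fin m} {t : Fin n → Fin k} → (∀ X → r (s X) ≡ t X) → ∀ (A : Ty n) → ren r (ren s A) ≡ ren t A
    ren-ren h (A ⊗ B) = cong₂ _⊗_ (ren-ren h A) (ren-ren h B)
    ren-ren h (A ⅋ B) = cong₂ _⅋_ (ren-ren h A) (ren-ren h B)
    ren-ren h (A ⊕ B) = cong₂ _⊕_ (ren-ren h A) (ren-ren h B)
    ren-ren h (A & B) = cong₂ _&_ (ren-ren h A) (ren-ren h B)
    ren-ren h 𝟙 = refl
    ren-ren h ⊥ = refl
    ren-ren h (var X) = cong var (h X)
    ren-ren h (var⊥ X) = cong var⊥ (h X)
    ren-ren h (∃ᵗ A) = cong ∃ᵗ (ren-ren (liftʳ-∘ h) A)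
    ren-ren h (∀ᵗ A) = cong ∀ᵗ (ren-ren (liftʳ-∘ h) A)
    ren-ren h (⁇ A) = cong ⁇ (ren-ren h A)
    ren-ren h (‼ A) = cong ‼ (ren-ren h A)
    ren-ren h (prov 𝒢) = cong prov (ren-renᴴ h 𝒢)
    ren-ren h (asm 𝒢) = cong asm (ren-renᴴ h 𝒢)

    ren-renᴱ : {r : Fin m → Fin k} {s : Fin n → Fin m} {t : Fin n → Fin k} → (∀ X → r (s X) ≡ t X) →
               ∀ {K : Set} (Γ : Env K n) → renᴱ r (renᴱ s Γ) ≡ renᴱ t Γ
    ren-renᴱ h [] = refl
    ren-renᴱ h ((k ∶ A) ∷ Γ) = cong₂ (λ B Δ → (k ∶ B) ∷ Δ) (ren-ren h A) (ren-renᴱ h Γ)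

    ren-renᴴ : {r : Fin m → Fin k} {s : Fin n → Fin m} {t : Fin n → Fin k} → (∀ X → r (s X) ≡ t X) →
               ∀ {K : Set} (𝒢 : HEnv K n) → renᴴ r (renᴴ s 𝒢) ≡ renᴴ t 𝒢
    ren-renᴴ h [] = refl
    ren-renᴴ h (Γ ∷ 𝒢) = cong₂ _∷_ (ren-renᴱ h Γ) (ren-renᴴ h 𝒢)

  sub-lift-ren : {ξ : Fin m → Ty k} {s : Fin n → Fin m} {υ : Fin n → Ty k} → (∀ X → ξ (s X) ≡ υ X) →
                 ∀ X → liftˢ ξ (liftʳ s X) ≡ liftˢ υ X
  sub-lift-ren h zero    = refl
  sub-lift-ren h (suc X) = cong (ren suc) (h X)

  mutual
    sub-ren : {ξ : Fin m → Ty k} {s : Fin n → Fin m} {υ : Fin n → Ty k} → (∀ X → ξ (s X) ≡ υ X) → ∀ (A : Ty n) → sub ξ (ren s A) ≡ sub υ A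
    sub-ren h (A ⊗ B) = cong₂ _⊗_ (sub-ren h A) (sub-ren h B)
    sub-ren h (A ⅋ B) = cong₂ _⅋_ (sub-ren h A) (sub-ren h B)
    sub-ren h (A ⊕ B) = cong₂ _⊕_ (sub-ren h A) (sub-ren h B)
    sub-ren h (A & B) = cong₂ _&_ (sub-ren h A) (sub-ren h B)
    sub-ren h 𝟙 = refl
    sub-ren h ⊥ = refl
    sub-ren h (var X) = h X
    sub-ren h (var⊥ X) = cong _ᗮ (h X)
    sub-ren h (∃ᵗ A) = cong ∃ᵗ (sub-ren (sub-lift-ren h) A)
    sub-ren h (∀ᵗ A) = cong ∀ᵗ (sub-ren (sub-lift-ren h) A)
    sub-ren h (⁇ A) = cong ⁇ (sub-ren h A)
    sub-ren h (‼ A) = cong ‼ (sub-ren h A)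
    sub-ren h (prov 𝒢) = cong prov (sub-renᴴ h 𝒢)
    sub-ren h (asm 𝒢) = cong asm (sub-renᴴ h 𝒢)

    sub-renᴱ : {ξ : Fin m → Ty k} {s : Fin n → Fin m} {υ : Fin n → Ty k} → (∀ X → ξ (s X) ≡ υ X) →
               ∀ {K : Set} (Γ : Env K n) → subᴱ ξ (renᴱ s Γ) ≡ subᴱ υ Γ
    sub-renᴱ h [] = refl
    sub-renᴱ h ((k ∶ A) ∷ Γ) = cong₂ (λ B Δ → (k ∶ B) ∷ Δ) (sub-ren h A) (sub-renᴱ h Γ)

    sub-renᴴ : {ξ : Fin m → Ty k} {s : Fin n → Fin m} {υ : Fin n → Ty k} → (∀ X → ξ (s X) ≡ υ X) →
               ∀ {K : Set} (𝒢 : HEnv K n) → subᴴ ξ (renᴴ s 𝒢) ≡ subᴴ υ 𝒢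
    sub-renᴴ h [] = refl
    sub-renᴴ h (Γ ∷ 𝒢) = cong₂ _∷_ (sub-renᴱ h Γ) (sub-renᴴ h 𝒢)

  ᗮ-involutive : (A : Ty n) → (A ᗮ) ᗮ ≡ A
  ᗮ-involutive (A ⊗ B) = cong₂ _⊗_ (ᗮ-involutive A) (ᗮ-involutive B)
  ᗮ-involutive (A ⅋ B) = cong₂ _⅋_ (ᗮ-involutive A) (ᗮ-involutive B)
  ᗮ-involutive (A ⊕ B) = cong₂ _⊕_ (ᗮ-involutive A) (ᗮ-involutive B)
  ᗮ-involutive (A & B) = cong₂ _&_ (ᗮ-involutive A) (ᗮ-involutive B)
  ᗮ-involutive 𝟙 = refl
  ᗮ-involutive ⊥ = refl
  ᗮ-involutive (var X) = refl
  ᗮ-involutive (var⊥ X) = refl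
  ᗮ-involutive (prov 𝒢) = refl
  ᗮ-involutive (asm 𝒢) = refl
  ᗮ-involutive (∃ᵗ A) = cong ∃ᵗ (ᗮ-involutive A)
  ᗮ-involutive (∀ᵗ A) = cong ∀ᵗ (ᗮ-involutive A)
  ᗮ-involutive (⁇ A) = cong ⁇ (ᗮ-involutive A)
  ᗮ-involutive (‼ A) = cong ‼ (ᗮ-involutive A)

  ren-ᗮ : (r : Fin n → Fin m) (A : Ty n) → ren r (A ᗮ) ≡ ren r A ᗮ
  ren-ᗮ r (A ⊗ B) = cong₂ _⅋_ (ren-ᗮ r A) (ren-ᗮ r B)
  ren-ᗮ r (A ⅋ B) = cong₂ _⊗_ (ren-ᗮ r A) (ren-ᗮ r B)
  ren-ᗮ r (A ⊕ B) = cong₂ _&_ (ren-ᗮ r A) (ren-ᗮ r B)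
  ren-ᗮ r (A & B) = cong₂ _⊕_ (ren-ᗮ r A) (ren-ᗮ r B)
  ren-ᗮ r 𝟙 = refl
  ren-ᗮ r ⊥ = refl
  ren-ᗮ r (var X) = refl
  ren-ᗮ r (var⊥ X) = refl
  ren-ᗮ r (prov 𝒢) = refl
  ren-ᗮ r (asm 𝒢) = refl
  ren-ᗮ r (∃ᵗ A) = cong ∀ᵗ (ren-ᗮ (liftʳ r) A)
  ren-ᗮ r (∀ᵗ A) = cong ∃ᵗ (ren-ᗮ (liftʳ r) A)
  ren-ᗮ r (⁇ A) = cong ‼ (ren-ᗮ r A)
  ren-ᗮ r (‼ A) = cong ⁇ (ren-ᗮ r A)

  sub-ᗮ : (ξ : Fin n → Ty m) (A : Ty n) → sub ξ (A ᗮ) ≡ sub ξ A ᗮ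
  sub-ᗮ ξ (A ⊗ B) = cong₂ _⅋_ (sub-ᗮ ξ A) (sub-ᗮ ξ B)
  sub-ᗮ ξ (A ⅋ B) = cong₂ _⊗_ (sub-ᗮ ξ A) (sub-ᗮ ξ B)
  sub-ᗮ ξ (A ⊕ B) = cong₂ _&_ (sub-ᗮ ξ A) (sub-ᗮ ξ B)
  sub-ᗮ ξ (A & B) = cong₂ _⊕_ (sub-ᗮ ξ A) (sub-ᗮ ξ B)
  sub-ᗮ ξ 𝟙 = refl
  sub-ᗮ ξ ⊥ = refl
  sub-ᗮ ξ (var X) = refl
  sub-ᗮ ξ (prov 𝒢) = refl
  sub-ᗮ ξ (asm 𝒢) = refl
  -- `sub` already dualizes `ξ X` at a dual variable, so the two sides differ by a double dual.
  sub-ᗮ ξ (var⊥ X) = sym (ᗮ-involutive (ξ X))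
  sub-ᗮ ξ (∃ᵗ A) = cong ∀ᵗ (sub-ᗮ (liftˢ ξ) A)
  sub-ᗮ ξ (∀ᵗ A) = cong ∃ᵗ (sub-ᗮ (liftˢ ξ) A)
  sub-ᗮ ξ (⁇ A) = cong ‼ (sub-ᗮ ξ A)
  sub-ᗮ ξ (‼ A) = cong ⁇ (sub-ᗮ ξ A)

  ren-lift-sub : {r : Fin m → Fin k} {ξ : Fin n → Ty m} {υ : Fin n → Ty k} → (∀ X → ren r (ξ X) ≡ υ X) →
                 ∀ X → ren (liftʳ r) (liftˢ ξ X) ≡ liftˢ υ X
  ren-lift-sub         h zero    = refl
  ren-lift-sub {ξ = ξ} h (suc X) =
    -- Weakening before the lifted renaming and weakening after the plain one are both the renaming
    -- by `suc ∘ r`.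
    trans (ren-ren (λ _ → refl) (ξ X)) (trans (sym (ren-ren (λ _ → refl) (ξ X))) (cong (ren suc) (h X)))

  mutual
    ren-sub : {r : Fin m → Fin k} {ξ : Fin n → Ty m} {υ : Fin n → Ty k} → (∀ X → ren r (ξ X) ≡ υ X) → ∀ (A : Ty n) → ren r (sub ξ A) ≡ sub υ A
    ren-sub h (A ⊗ B) = cong₂ _⊗_ (ren-sub h A) (ren-sub h B)
    ren-sub h (A ⅋ B) = cong₂ _⅋_ (ren-sub h A) (ren-sub h B)
    ren-sub h (A ⊕ B) = cong₂ _⊕_ (ren-sub h A) (ren-sub h B)
    ren-sub h (A & B) = cong₂ _&_ (ren-sub h A) (ren-sub h B)
    ren-sub h 𝟙 = refl
    ren-sub h ⊥ = refl
    ren-sub h (var X) = h X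
    ren-sub h (var⊥ X) = trans (ren-ᗮ _ _) (cong _ᗮ (h X))
    ren-sub h (∃ᵗ A) = cong ∃ᵗ (ren-sub (ren-lift-sub h) A)
    ren-sub h (∀ᵗ A) = cong ∀ᵗ (ren-sub (ren-lift-sub h) A)
    ren-sub h (⁇ A) = cong ⁇ (ren-sub h A)
    ren-sub h (‼ A) = cong ‼ (ren-sub h A)
    ren-sub h (prov 𝒢) = cong prov (ren-subᴴ h 𝒢)
    ren-sub h (asm 𝒢) = cong asm (ren-subᴴ h 𝒢)

    ren-subᴱ : {r : Fin m → Fin k} {ξ : Fin n → Ty m} {υ : Fin n → Ty k} → (∀ X → ren r (ξ X) ≡ υ X) →
               ∀ {K : Set} (Γ : Env K n) → renᴱ r (subᴱ ξ Γ) ≡ subᴱ υ Γ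
    ren-subᴱ h [] = refl
    ren-subᴱ h ((k ∶ A) ∷ Γ) = cong₂ (λ B Δ → (k ∶ B) ∷ Δ) (ren-sub h A) (ren-subᴱ h Γ)

    ren-subᴴ : {r : Fin m → Fin k} {ξ : Fin n → Ty m} {υ : Fin n → Ty k} → (∀ X → ren r (ξ X) ≡ υ X) →
               ∀ {K : Set} (𝒢 : HEnv K n) → renᴴ r (subᴴ ξ 𝒢) ≡ subᴴ υ 𝒢
    ren-subᴴ h [] = refl
    ren-subᴴ h (Γ ∷ 𝒢) = cong₂ _∷_ (ren-subᴱ h Γ) (ren-subᴴ h 𝒢)

  sub-lift-sub : {ξ : Fin m → Ty k} {υ : Fin n → Ty m} {ω : Fin n → Ty k} → (∀ X → sub ξ (υ X) ≡ ω X) →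
                 ∀ X → sub (liftˢ ξ) (liftˢ υ X) ≡ liftˢ ω X
  sub-lift-sub         h zero    = refl
  sub-lift-sub {υ = υ} h (suc X) =
    trans (sub-ren (λ _ → refl) (υ X)) (trans (sym (ren-sub (λ _ → refl) (υ X))) (cong (ren suc) (h X)))

  mutual
    sub-sub : {ξ : Fin m → Ty k} {υ : Fin n → Ty m} {ω : Fin n → Ty k} → (∀ X → sub ξ (υ X) ≡ ω X) → ∀ (A : Ty n) → sub ξ (sub υ A) ≡ sub ω A
    sub-sub h (A ⊗ B) = cong₂ _⊗_ (sub-sub h A) (sub-sub h B)
    sub-sub h (A ⅋ B) = cong₂ _⅋_ (sub-sub h A) (sub-sub h B)
    sub-sub h (A ⊕ B) = cong₂ _⊕_ (sub-sub h A) (sub-sub h B)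
    sub-sub h (A & B) = cong₂ _&_ (sub-sub h A) (sub-sub h B)
    sub-sub h 𝟙 = refl
    sub-sub h ⊥ = refl
    sub-sub h (var X) = h X
    sub-sub {ξ = ξ} {υ} h (var⊥ X) = trans (sub-ᗮ ξ (υ X)) (cong _ᗮ (h X))
    sub-sub h (∃ᵗ A) = cong ∃ᵗ (sub-sub (sub-lift-sub h) A)
    sub-sub h (∀ᵗ A) = cong ∀ᵗ (sub-sub (sub-lift-sub h) A)
    sub-sub h (⁇ A) = cong ⁇ (sub-sub h A)
    sub-sub h (‼ A) = cong ‼ (sub-sub h A)
    sub-sub h (prov 𝒢) = cong prov (sub-subᴴ h 𝒢)
    sub-sub h (asm 𝒢) = cong asm (sub-subᴴ h 𝒢)

    sub-subᴱ : {ξ : Fin m → Ty k} {υ : Fin n → Ty m} {ω : Fin n → Ty k} → (∀ X → sub ξ (υ X) ≡ ω X) →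
               ∀ {K : Set} (Γ : Env K n) → subᴱ ξ (subᴱ υ Γ) ≡ subᴱ ω Γ
    sub-subᴱ h [] = refl
    sub-subᴱ h ((k ∶ A) ∷ Γ) = cong₂ (λ B Δ → (k ∶ B) ∷ Δ) (sub-sub h A) (sub-subᴱ h Γ)

    sub-subᴴ : {ξ : Fin m → Ty k} {υ : Fin n → Ty m} {ω : Fin n → Ty k} → (∀ X → sub ξ (υ X) ≡ ω X) →
               ∀ {K : Set} (𝒢 : HEnv K n) → subᴴ ξ (subᴴ υ 𝒢) ≡ subᴴ ω 𝒢
    sub-subᴴ h [] = refl
    sub-subᴴ h (Γ ∷ 𝒢) = cong₂ _∷_ (sub-subᴱ h Γ) (sub-subᴴ h 𝒢)

  liftˢ-var : {ξ : Fin n → Ty n} → (∀ X → ξ X ≡ var X) → ∀ X → liftˢ ξ X ≡ var X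
  liftˢ-var h zero    = refl
  liftˢ-var h (suc X) = cong (ren suc) (h X)

  mutual
    sub-id : {ξ : Fin n → Ty n} → (∀ X → ξ X ≡ var X) → ∀ (A : Ty n) → sub ξ A ≡ A
    sub-id h (A ⊗ B) = cong₂ _⊗_ (sub-id h A) (sub-id h B)
    sub-id h (A ⅋ B) = cong₂ _⅋_ (sub-id h A) (sub-id h B)
    sub-id h (A ⊕ B) = cong₂ _⊕_ (sub-id h A) (sub-id h B)
    sub-id h (A & B) = cong₂ _&_ (sub-id h A) (sub-id h B)
    sub-id h 𝟙 = refl
    sub-id h ⊥ = refl
    sub-id h (var X) = h X
    sub-id h (var⊥ X) = cong _ᗮ (h X)
    sub-id h (∃ᵗ A) = cong ∃ᵗ (sub-id (liftˢ-var h) A)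
    sub-id h (∀ᵗ A) = cong ∀ᵗ (sub-id (liftˢ-var h) A)
    sub-id h (⁇ A) = cong ⁇ (sub-id h A)
    sub-id h (‼ A) = cong ‼ (sub-id h A)
    sub-id h (prov 𝒢) = cong prov (sub-idᴴ h 𝒢)
    sub-id h (asm 𝒢) = cong asm (sub-idᴴ h 𝒢)

    sub-idᴱ : {ξ : Fin n → Ty n} → (∀ X → ξ X ≡ var X) → ∀ {K : Set} (Γ : Env K n) → subᴱ ξ Γ ≡ Γ
    sub-idᴱ h [] = refl
    sub-idᴱ h ((k ∶ A) ∷ Γ) = cong₂ (λ B Δ → (k ∶ B) ∷ Δ) (sub-id h A) (sub-idᴱ h Γ)

    sub-idᴴ : {ξ : Fin n → Ty n} → (∀ X → ξ X ≡ var X) → ∀ {K : Set} (𝒢 : HEnv K n) → subᴴ ξ 𝒢 ≡ 𝒢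
    sub-idᴴ h [] = refl
    sub-idᴴ h (Γ ∷ 𝒢) = cong₂ _∷_ (sub-idᴱ h Γ) (sub-idᴴ h 𝒢)

  single-ren : (A B : Ty n) → sub (single A) (ren suc B) ≡ B
  single-ren A B = trans (sub-ren (λ _ → refl) B) (sub-id (λ _ → refl) B)

  single-renᴱ : (A : Ty n) (Γ : Env K n) → subᴱ (single A) (renᴱ suc Γ) ≡ Γ
  single-renᴱ A Γ = trans (sub-renᴱ (λ _ → refl) Γ) (sub-idᴱ (λ _ → refl) Γ)

  single-renᴴ : (A : Ty n) (𝒢 : HEnv K n) → subᴴ (single A) (renᴴ suc 𝒢) ≡ 𝒢
  single-renᴴ A 𝒢 = trans (sub-renᴴ (λ _ → refl) 𝒢) (sub-idᴴ (λ _ → refl) 𝒢)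

  -- For the rule (∃): its premise is typed at an instance, and must again be typed at an instance
  -- after a substitution for the outer variables.
  sub-[]ᵗ : (ξ : Fin n → Ty m) (B : Ty (suc n)) (A : Ty n) → sub ξ (B [ A ]ᵗ) ≡ sub (liftˢ ξ) B [ sub ξ A ]ᵗ
  sub-[]ᵗ {n} {m} ξ B A = trans (sub-sub (λ _ → refl) B) (sym (sub-sub single-lift B))
    where
    single-lift : ∀ X → sub (single (sub ξ A)) (liftˢ ξ X) ≡ sub ξ (single A X)
    single-lift zero    = refl
    single-lift (suc X) = single-ren (sub ξ A) (ξ X)

  sub-lift-ren-sucᴱ : (ξ : Fin n → Ty m) (Γ : Env K n) → subᴱ (liftˢ ξ) (renᴱ suc Γ) ≡ renᴱ suc (subᴱ ξ Γ)
  sub-lift-ren-sucᴱ ξ Γ = trans (sub-renᴱ (λ _ → refl) Γ) (sym (ren-subᴱ (λ _ → refl) Γ))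

  sub-lift-ren-sucᴴ : (ξ : Fin n → Ty m) (𝒢 : HEnv K n) → subᴴ (liftˢ ξ) (renᴴ suc 𝒢) ≡ renᴴ suc (subᴴ ξ 𝒢)
  sub-lift-ren-sucᴴ ξ 𝒢 = trans (sub-renᴴ (λ _ → refl) 𝒢) (sym (ren-subᴴ (λ _ → refl) 𝒢))

  -- Reordering as an equivalence and a congruence.

  infix 4 _≋ᴱ_
  _≋ᴱ_ : Env K n → Env K n → Set
  _≋ᴱ_ = Permutation (×-Pointwise _≡_ _≈_)

  mutual
    ≈-refl : (A : Ty n) → A ≈ A
    ≈-refl (A ⊗ B) = ≈-refl A ⊗ ≈-refl B
    ≈-refl (A ⅋ B) = ≈-refl A ⅋ ≈-refl B
    ≈-refl (A ⊕ B) = ≈-refl A ⊕ ≈-refl B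
    ≈-refl (A & B) = ≈-refl A & ≈-refl B
    ≈-refl 𝟙 = 𝟙
    ≈-refl ⊥ = ⊥
    ≈-refl (var X) = var X
    ≈-refl (var⊥ X) = var⊥ X
    ≈-refl (∃ᵗ A) = ∃ᵗ (≈-refl A)
    ≈-refl (∀ᵗ A) = ∀ᵗ (≈-refl A)
    ≈-refl (⁇ A) = ⁇ (≈-refl A)
    ≈-refl (‼ A) = ‼ (≈-refl A)
    ≈-refl (prov 𝒢) = prov (reflᵖ (≈-reflᴴ 𝒢))
    ≈-refl (asm 𝒢) = asm (reflᵖ (≈-reflᴴ 𝒢))

    ≈-reflᴱ : (Γ : Env K n) → Pointwise (×-Pointwise _≡_ _≈_) Γ Γ
    ≈-reflᴱ []            = []
    ≈-reflᴱ ((k ∶ A) ∷ Γ) = (refl , ≈-refl A) ∷ ≈-reflᴱ Γ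

    ≈-reflᴴ : (𝒢 : HEnv K n) → Pointwise _≋ᴱ_ 𝒢 𝒢
    ≈-reflᴴ []      = []
    ≈-reflᴴ (Γ ∷ 𝒢) = reflᵖ (≈-reflᴱ Γ) ∷ ≈-reflᴴ 𝒢

  mutual
    -- Types recur inside two layers of permutations. The constructors of both layers are matched
    -- explicitly, so that every recursive call is on a visible subproof.
    ≈-sym : ∀ {A B : Ty n} → A ≈ B → B ≈ A
    ≈-sym (p ⊗ q) = ≈-sym p ⊗ ≈-sym q
    ≈-sym (p ⅋ q) = ≈-sym p ⅋ ≈-sym q
    ≈-sym (p ⊕ q) = ≈-sym p ⊕ ≈-sym q
    ≈-sym (p & q) = ≈-sym p & ≈-sym q
    ≈-sym 𝟙 = 𝟙
    ≈-sym ⊥ = ⊥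
    ≈-sym (var X) = var X
    ≈-sym (var⊥ X) = var⊥ X
    ≈-sym (∃ᵗ p) = ∃ᵗ (≈-sym p)
    ≈-sym (∀ᵗ p) = ∀ᵗ (≈-sym p)
    ≈-sym (⁇ p) = ⁇ (≈-sym p)
    ≈-sym (‼ p) = ‼ (≈-sym p)
    ≈-sym (prov p) = prov (≈-symᴴ p)
    ≈-sym (asm p) = asm (≈-symᴴ p)

    ≈-symᴱ : ∀ {K : Set} {Γ Δ : Env K n} → Γ ≋ᴱ Δ → Δ ≋ᴱ Γ
    ≈-symᴱ (reflᵖ ps) = reflᵖ (≈-symᴱʷ ps)
    ≈-symᴱ (prepᵖ (refl , p1) ps) = prepᵖ (refl , ≈-sym p1) (≈-symᴱ ps)
    ≈-symᴱ (swapᵖ (refl , p1) (refl , p2) ps) = swapᵖ (refl , ≈-sym p2) (refl , ≈-sym p1) (≈-symᴱ ps)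
    ≈-symᴱ (transᵖ ps qs) = transᵖ (≈-symᴱ qs) (≈-symᴱ ps)

    ≈-symᴱʷ : ∀ {K : Set} {Γ Δ : Env K n} → Pointwise (×-Pointwise _≡_ _≈_) Γ Δ → Pointwise (×-Pointwise _≡_ _≈_) Δ Γ
    ≈-symᴱʷ [] = []
    ≈-symᴱʷ ((refl , p1) ∷ ps) = (refl , ≈-sym p1) ∷ ≈-symᴱʷ ps

    ≈-symᴴ : ∀ {K : Set} {𝒢 ℋ : HEnv K n} → 𝒢 ≋ ℋ → ℋ ≋ 𝒢
    ≈-symᴴ (reflᵖ ps) = reflᵖ (≈-symᴴʷ ps)
    ≈-symᴴ (prepᵖ p1 ps) = prepᵖ (≈-symᴱ p1) (≈-symᴴ ps)
    ≈-symᴴ (swapᵖ p1 p2 ps) = swapᵖ (≈-symᴱ p2) (≈-symᴱ p1) (≈-symᴴ ps)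
    ≈-symᴴ (transᵖ ps qs) = transᵖ (≈-symᴴ qs) (≈-symᴴ ps)

    ≈-symᴴʷ : ∀ {K : Set} {𝒢 ℋ : HEnv K n} → Pointwise _≋ᴱ_ 𝒢 ℋ → Pointwise _≋ᴱ_ ℋ 𝒢
    ≈-symᴴʷ [] = []
    ≈-symᴴʷ (p1 ∷ ps) = (≈-symᴱ p1) ∷ ≈-symᴴʷ ps

  ≈-trans : {A B C : Ty n} → A ≈ B → B ≈ C → A ≈ C
  ≈-trans (p ⊗ q) (p′ ⊗ q′) = ≈-trans p p′ ⊗ ≈-trans q q′
  ≈-trans (p ⅋ q) (p′ ⅋ q′) = ≈-trans p p′ ⅋ ≈-trans q q′
  ≈-trans (p ⊕ q) (p′ ⊕ q′) = ≈-trans p p′ ⊕ ≈-trans q q′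
  ≈-trans (p & q) (p′ & q′) = ≈-trans p p′ & ≈-trans q q′
  ≈-trans 𝟙 𝟙 = 𝟙
  ≈-trans ⊥ ⊥ = ⊥
  ≈-trans (var X) (var X) = var X
  ≈-trans (var⊥ X) (var⊥ X) = var⊥ X
  ≈-trans (∃ᵗ p) (∃ᵗ q) = ∃ᵗ (≈-trans p q)
  ≈-trans (∀ᵗ p) (∀ᵗ q) = ∀ᵗ (≈-trans p q)
  ≈-trans (⁇ p) (⁇ q) = ⁇ (≈-trans p q)
  ≈-trans (‼ p) (‼ q) = ‼ (≈-trans p q)
  -- Transitivity is a constructor of `Permutation`, so the recursion may stop here.
  ≈-trans (prov p) (prov q) = prov (transᵖ p q)
  ≈-trans (asm p) (asm q) = asm (transᵖ p q)

  ᗮ-cong : {A B : Ty n} → A ≈ B → A ᗮ ≈ B ᗮ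
  ᗮ-cong (p ⊗ q) = ᗮ-cong p ⅋ ᗮ-cong q
  ᗮ-cong (p ⅋ q) = ᗮ-cong p ⊗ ᗮ-cong q
  ᗮ-cong (p ⊕ q) = ᗮ-cong p & ᗮ-cong q
  ᗮ-cong (p & q) = ᗮ-cong p ⊕ ᗮ-cong q
  ᗮ-cong 𝟙 = ⊥
  ᗮ-cong ⊥ = 𝟙
  ᗮ-cong (var X) = var⊥ X
  ᗮ-cong (var⊥ X) = var X
  ᗮ-cong (∃ᵗ p) = ∀ᵗ (ᗮ-cong p)
  ᗮ-cong (∀ᵗ p) = ∃ᵗ (ᗮ-cong p)
  ᗮ-cong (⁇ p) = ‼ (ᗮ-cong p)
  ᗮ-cong (‼ p) = ⁇ (ᗮ-cong p)
  ᗮ-cong (prov p) = asm p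
  ᗮ-cong (asm p) = prov p

  mutual
    ren-cong : (r : Fin n → Fin m) → ∀ {A B} → A ≈ B → ren r A ≈ ren r B
    ren-cong r (p ⊗ q) = ren-cong r p ⊗ ren-cong r q
    ren-cong r (p ⅋ q) = ren-cong r p ⅋ ren-cong r q
    ren-cong r (p ⊕ q) = ren-cong r p ⊕ ren-cong r q
    ren-cong r (p & q) = ren-cong r p & ren-cong r q
    ren-cong r 𝟙 = 𝟙
    ren-cong r ⊥ = ⊥
    ren-cong r (var X) = var (r X)
    ren-cong r (var⊥ X) = var⊥ (r X)
    ren-cong r (∃ᵗ p) = ∃ᵗ (ren-cong (liftʳ r) p)
    ren-cong r (∀ᵗ p) = ∀ᵗ (ren-cong (liftʳ r) p)
    ren-cong r (⁇ p) = ⁇ (ren-cong r p)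
    ren-cong r (‼ p) = ‼ (ren-cong r p)
    ren-cong r (prov p) = prov (ren-congᴴ r p)
    ren-cong r (asm p) = asm (ren-congᴴ r p)

    ren-congᴱ : (r : Fin n → Fin m) → ∀ {K : Set} {Γ Δ : Env K _} → Γ ≋ᴱ Δ → renᴱ r Γ ≋ᴱ renᴱ r Δ
    ren-congᴱ r (reflᵖ ps) = reflᵖ (ren-congᴱʷ r ps)
    ren-congᴱ r (prepᵖ (refl , p1) ps) = prepᵖ (refl , ren-cong r p1) (ren-congᴱ r ps)
    ren-congᴱ r (swapᵖ (refl , p1) (refl , p2) ps) = swapᵖ (refl , ren-cong r p1) (refl , ren-cong r p2) (ren-congᴱ r ps)
    ren-congᴱ r (transᵖ ps qs) = transᵖ (ren-congᴱ r ps) (ren-congᴱ r qs)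

    ren-congᴱʷ : (r : Fin n → Fin m) →
                 ∀ {K : Set} {Γ Δ : Env K _} → Pointwise (×-Pointwise _≡_ _≈_) Γ Δ → Pointwise (×-Pointwise _≡_ _≈_) (renᴱ r Γ) (renᴱ r Δ)
    ren-congᴱʷ r [] = []
    ren-congᴱʷ r ((refl , p1) ∷ ps) = (refl , ren-cong r p1) ∷ ren-congᴱʷ r ps

    ren-congᴴ : (r : Fin n → Fin m) → ∀ {K : Set} {𝒢 ℋ : HEnv K _} → 𝒢 ≋ ℋ → renᴴ r 𝒢 ≋ renᴴ r ℋ
    ren-congᴴ r (reflᵖ ps) = reflᵖ (ren-congᴴʷ r ps)
    ren-congᴴ r (prepᵖ p1 ps) = prepᵖ (ren-congᴱ r p1) (ren-congᴴ r ps)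
    ren-congᴴ r (swapᵖ p1 p2 ps) = swapᵖ (ren-congᴱ r p1) (ren-congᴱ r p2) (ren-congᴴ r ps)
    ren-congᴴ r (transᵖ ps qs) = transᵖ (ren-congᴴ r ps) (ren-congᴴ r qs)

    ren-congᴴʷ : (r : Fin n → Fin m) → ∀ {K : Set} {𝒢 ℋ : HEnv K _} → Pointwise _≋ᴱ_ 𝒢 ℋ → Pointwise _≋ᴱ_ (renᴴ r 𝒢) (renᴴ r ℋ)
    ren-congᴴʷ r [] = []
    ren-congᴴʷ r (p1 ∷ ps) = (ren-congᴱ r p1) ∷ ren-congᴴʷ r ps

  liftˢ-cong : {ξ υ : Fin n → Ty m} → (∀ X → ξ X ≈ υ X) → ∀ X → liftˢ ξ X ≈ liftˢ υ X
  liftˢ-cong h zero    = var zero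
  liftˢ-cong h (suc X) = ren-cong suc (h X)

  mutual
    sub-cong : {ξ υ : Fin n → Ty m} → (∀ X → ξ X ≈ υ X) → ∀ {A B} → A ≈ B → sub ξ A ≈ sub υ B
    sub-cong h (p ⊗ q) = sub-cong h p ⊗ sub-cong h q
    sub-cong h (p ⅋ q) = sub-cong h p ⅋ sub-cong h q
    sub-cong h (p ⊕ q) = sub-cong h p ⊕ sub-cong h q
    sub-cong h (p & q) = sub-cong h p & sub-cong h q
    sub-cong h 𝟙 = 𝟙
    sub-cong h ⊥ = ⊥
    sub-cong h (var X) = h X
    sub-cong h (var⊥ X) = ᗮ-cong (h X)
    sub-cong h (∃ᵗ p) = ∃ᵗ (sub-cong (liftˢ-cong h) p)
    sub-cong h (∀ᵗ p) = ∀ᵗ (sub-cong (liftˢ-cong h) p)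
    sub-cong h (⁇ p) = ⁇ (sub-cong h p)
    sub-cong h (‼ p) = ‼ (sub-cong h p)
    sub-cong h (prov p) = prov (sub-congᴴ h p)
    sub-cong h (asm p) = asm (sub-congᴴ h p)

    sub-congᴱ : {ξ υ : Fin n → Ty m} → (∀ X → ξ X ≈ υ X) → ∀ {K : Set} {Γ Δ : Env K _} → Γ ≋ᴱ Δ → subᴱ ξ Γ ≋ᴱ subᴱ υ Δ
    sub-congᴱ h (reflᵖ ps) = reflᵖ (sub-congᴱʷ h ps)
    sub-congᴱ h (prepᵖ (refl , p1) ps) = prepᵖ (refl , sub-cong h p1) (sub-congᴱ h ps)
    sub-congᴱ h (swapᵖ (refl , p1) (refl , p2) ps) = swapᵖ (refl , sub-cong h p1) (refl , sub-cong h p2) (sub-congᴱ h ps)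
    -- The passage from `ξ` to `υ` is made in the first half; the second half stays at `υ`.
    sub-congᴱ h (transᵖ ps qs) = transᵖ (sub-congᴱ h ps) (sub-congᴱ (λ X → ≈-refl _) qs)

    sub-congᴱʷ : {ξ υ : Fin n → Ty m} → (∀ X → ξ X ≈ υ X) →
                 ∀ {K : Set} {Γ Δ : Env K _} → Pointwise (×-Pointwise _≡_ _≈_) Γ Δ → Pointwise (×-Pointwise _≡_ _≈_) (subᴱ ξ Γ) (subᴱ υ Δ)
    sub-congᴱʷ h [] = []
    sub-congᴱʷ h ((refl , p1) ∷ ps) = (refl , sub-cong h p1) ∷ sub-congᴱʷ h ps

    sub-congᴴ : {ξ υ : Fin n → Ty m} → (∀ X → ξ X ≈ υ X) → ∀ {K : Set} {𝒢 ℋ : HEnv K _} → 𝒢 ≋ ℋ → subᴴ ξ 𝒢 ≋ subᴴ υ ℋ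
    sub-congᴴ h (reflᵖ ps) = reflᵖ (sub-congᴴʷ h ps)
    sub-congᴴ h (prepᵖ p1 ps) = prepᵖ (sub-congᴱ h p1) (sub-congᴴ h ps)
    sub-congᴴ h (swapᵖ p1 p2 ps) = swapᵖ (sub-congᴱ h p1) (sub-congᴱ h p2) (sub-congᴴ h ps)
    sub-congᴴ h (transᵖ ps qs) = transᵖ (sub-congᴴ h ps) (sub-congᴴ (λ X → ≈-refl _) qs)

    sub-congᴴʷ : {ξ υ : Fin n → Ty m} → (∀ X → ξ X ≈ υ X) →
                 ∀ {K : Set} {𝒢 ℋ : HEnv K _} → Pointwise _≋ᴱ_ 𝒢 ℋ → Pointwise _≋ᴱ_ (subᴴ ξ 𝒢) (subᴴ υ ℋ)
    sub-congᴴʷ h [] = []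
    sub-congᴴʷ h (p1 ∷ ps) = (sub-congᴱ h p1) ∷ sub-congᴴʷ h ps

  -- Domains and well-formedness under reordering, renaming and substitution.

  dom-++ : (𝒢 ℋ : HEnv K n) → dom (𝒢 ++ ℋ) ≡ dom 𝒢 ++ dom ℋ
  dom-++ 𝒢 ℋ = trans (cong (map proj₁) (sym (List.concat-++ 𝒢 ℋ))) (List.map-++ proj₁ (concat 𝒢) (concat ℋ))

  dom-∷ : (Γ : Env K n) (𝒢 : HEnv K n) → dom (Γ ∷ 𝒢) ≡ map proj₁ Γ ++ dom 𝒢
  dom-∷ Γ 𝒢 = List.map-++ proj₁ Γ (concat 𝒢)

  keys-↭ : {V : Set} {R : V → V → Set} {xs ys : List (K × V)} →
           Permutation (×-Pointwise _≡_ R) xs ys → map proj₁ xs ↭ map proj₁ ys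
  keys-↭ {R = R} (reflᵖ ps) = ↭.↭-reflexive (keys-≡ ps)
    where
    keys-≡ : ∀ {xs ys} → Pointwise (×-Pointwise _≡_ R) xs ys → map proj₁ xs ≡ map proj₁ ys
    keys-≡ []                = refl
    keys-≡ ((refl , _) ∷ ps) = cong (_ ∷_) (keys-≡ ps)
  keys-↭ (prepᵖ (refl , _) ps)            = prep _ (keys-↭ ps)
  keys-↭ (swapᵖ (refl , _) (refl , _) ps) = ↭.swap _ _ (keys-↭ ps)
  keys-↭ (transᵖ ps qs)                   = ↭-trans (keys-↭ ps) (keys-↭ qs)

  dom-↭ : {𝒢 ℋ : HEnv K n} → 𝒢 ≋ ℋ → dom 𝒢 ↭ dom ℋ
  dom-↭ (reflᵖ ps) = go ps
    where
    go : ∀ {𝒢 ℋ : HEnv K n} → Pointwise _≋ᴱ_ 𝒢 ℋ → dom 𝒢 ↭ dom ℋ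
    go []       = ↭-refl
    go {𝒢 = Γ ∷ 𝒢} {Δ ∷ ℋ} (p ∷ ps) =
      subst₂ _↭_ (sym (dom-∷ Γ 𝒢)) (sym (dom-∷ Δ ℋ)) (↭.++⁺ (keys-↭ p) (go ps))
  dom-↭ {𝒢 = Γ ∷ 𝒢} {Δ ∷ ℋ} (prepᵖ p ps) =
    subst₂ _↭_ (sym (dom-∷ Γ 𝒢)) (sym (dom-∷ Δ ℋ)) (↭.++⁺ (keys-↭ p) (dom-↭ ps))
  dom-↭ {𝒢 = Γ ∷ Γ′ ∷ 𝒢} {Δ′ ∷ Δ ∷ ℋ} (swapᵖ p q ps) =
    subst₂ _↭_ (sym (trans (dom-∷ Γ (Γ′ ∷ 𝒢)) (cong (map proj₁ Γ ++_) (dom-∷ Γ′ 𝒢))))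
               (sym (trans (dom-∷ Δ′ (Δ ∷ ℋ)) (cong (map proj₁ Δ′ ++_) (dom-∷ Δ ℋ))))
      (↭-trans (↭.++⁺ (keys-↭ p) (↭.++⁺ (keys-↭ q) (dom-↭ ps))) (↭.shifts (map proj₁ Δ) (map proj₁ Δ′)))
  dom-↭ (transᵖ ps qs) = ↭-trans (dom-↭ ps) (dom-↭ qs)

  Unique-↭ : {A : Set} {xs ys : List A} → xs ↭ ys → Unique xs → Unique ys
  Unique-↭ {A} p = Perm.Unique-resp-↭ (≡.setoid A) (↭.↭⇒↭ₛ p)

  mutual
    Wfᵗ-≈ : {A B : Ty n} → A ≈ B → Wfᵗ A → Wfᵗ B
    Wfᵗ-≈ (p ⊗ q) (v , w) = Wfᵗ-≈ p v , Wfᵗ-≈ q w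
    Wfᵗ-≈ (p ⅋ q) (v , w) = Wfᵗ-≈ p v , Wfᵗ-≈ q w
    Wfᵗ-≈ (p ⊕ q) (v , w) = Wfᵗ-≈ p v , Wfᵗ-≈ q w
    Wfᵗ-≈ (p & q) (v , w) = Wfᵗ-≈ p v , Wfᵗ-≈ q w
    Wfᵗ-≈ 𝟙 w = tt
    Wfᵗ-≈ ⊥ w = tt
    Wfᵗ-≈ (var X) w = tt
    Wfᵗ-≈ (var⊥ X) w = tt
    Wfᵗ-≈ (∃ᵗ p) w = Wfᵗ-≈ p w
    Wfᵗ-≈ (∀ᵗ p) w = Wfᵗ-≈ p w
    Wfᵗ-≈ (⁇ p) w = Wfᵗ-≈ p w
    Wfᵗ-≈ (‼ p) w = Wfᵗ-≈ p w
    Wfᵗ-≈ (prov p) (u , w) = Unique-↭ (dom-↭ p) u , Wfᵗˢ-≋ p w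
    Wfᵗ-≈ (asm p) (u , w) = Unique-↭ (dom-↭ p) u , Wfᵗˢ-≋ p w

    Wfᴱ-≋ : {Γ Δ : Env K n} → Γ ≋ᴱ Δ → Wfᴱ Γ → Wfᴱ Δ
    Wfᴱ-≋ (reflᵖ ps)                   w            = Wfᴱ-≋ʷ ps w
    Wfᴱ-≋ (prepᵖ (refl , p) ps)        (v , w)      = Wfᵗ-≈ p v , Wfᴱ-≋ ps w
    Wfᴱ-≋ (swapᵖ (refl , p) (refl , q) ps) (u , v , w) = Wfᵗ-≈ q v , Wfᵗ-≈ p u , Wfᴱ-≋ ps w
    Wfᴱ-≋ (transᵖ ps qs)               w            = Wfᴱ-≋ qs (Wfᴱ-≋ ps w)

    Wfᴱ-≋ʷ : {Γ Δ : Env K n} → Pointwise (×-Pointwise _≡_ _≈_) Γ Δ → Wfᴱ Γ → Wfᴱ Δ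
    Wfᴱ-≋ʷ []                w       = tt
    Wfᴱ-≋ʷ ((refl , p) ∷ ps) (v , w) = Wfᵗ-≈ p v , Wfᴱ-≋ʷ ps w

    Wfᵗˢ-≋ : {𝒢 ℋ : HEnv K n} → 𝒢 ≋ ℋ → Wfᵗˢ 𝒢 → Wfᵗˢ ℋ
    Wfᵗˢ-≋ (reflᵖ ps)     w           = Wfᵗˢ-≋ʷ ps w
    Wfᵗˢ-≋ (prepᵖ p ps)   (v , w)     = Wfᴱ-≋ p v , Wfᵗˢ-≋ ps w
    Wfᵗˢ-≋ (swapᵖ p q ps) (u , v , w) = Wfᴱ-≋ q v , Wfᴱ-≋ p u , Wfᵗˢ-≋ ps w
    Wfᵗˢ-≋ (transᵖ ps qs) w           = Wfᵗˢ-≋ qs (Wfᵗˢ-≋ ps w)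

    Wfᵗˢ-≋ʷ : {𝒢 ℋ : HEnv K n} → Pointwise _≋ᴱ_ 𝒢 ℋ → Wfᵗˢ 𝒢 → Wfᵗˢ ℋ
    Wfᵗˢ-≋ʷ []       w       = tt
    Wfᵗˢ-≋ʷ (p ∷ ps) (v , w) = Wfᴱ-≋ p v , Wfᵗˢ-≋ʷ ps w

  Wf-≋ : {𝒢 ℋ : HEnv K n} → 𝒢 ≋ ℋ → Wf 𝒢 → Wf ℋ
  Wf-≋ p (u , w) = Unique-↭ (dom-↭ p) u , Wfᵗˢ-≋ p w

  names-ren : (r : Fin n → Fin m) (Γ : Env K n) → map proj₁ (renᴱ r Γ) ≡ map proj₁ Γ
  names-ren r []            = refl
  names-ren r ((k ∶ A) ∷ Γ) = cong (k ∷_) (names-ren r Γ)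

  dom-ren : (r : Fin n → Fin m) (𝒢 : HEnv K n) → dom (renᴴ r 𝒢) ≡ dom 𝒢
  dom-ren r []      = refl
  dom-ren r (Γ ∷ 𝒢) = trans (dom-∷ (renᴱ r Γ) (renᴴ r 𝒢))
                        (trans (cong₂ _++_ (names-ren r Γ) (dom-ren r 𝒢)) (sym (dom-∷ Γ 𝒢)))

  names-sub : (ξ : Fin n → Ty m) (Γ : Env K n) → map proj₁ (subᴱ ξ Γ) ≡ map proj₁ Γ
  names-sub ξ []            = refl
  names-sub ξ ((k ∶ A) ∷ Γ) = cong (k ∷_) (names-sub ξ Γ)

  dom-sub : (ξ : Fin n → Ty m) (𝒢 : HEnv K n) → dom (subᴴ ξ 𝒢) ≡ dom 𝒢
  dom-sub ξ []      = refl
  dom-sub ξ (Γ ∷ 𝒢) = trans (dom-∷ (subᴱ ξ Γ) (subᴴ ξ 𝒢))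
                        (trans (cong₂ _++_ (names-sub ξ Γ) (dom-sub ξ 𝒢)) (sym (dom-∷ Γ 𝒢)))

  Wfᵗ-ᗮ : (A : Ty n) → Wfᵗ A → Wfᵗ (A ᗮ)
  Wfᵗ-ᗮ (A ⊗ B) (v , w) = Wfᵗ-ᗮ A v , Wfᵗ-ᗮ B w
  Wfᵗ-ᗮ (A ⅋ B) (v , w) = Wfᵗ-ᗮ A v , Wfᵗ-ᗮ B w
  Wfᵗ-ᗮ (A ⊕ B) (v , w) = Wfᵗ-ᗮ A v , Wfᵗ-ᗮ B w
  Wfᵗ-ᗮ (A & B) (v , w) = Wfᵗ-ᗮ A v , Wfᵗ-ᗮ B w
  Wfᵗ-ᗮ 𝟙 w = tt
  Wfᵗ-ᗮ ⊥ w = tt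
  Wfᵗ-ᗮ (var X) w = tt
  Wfᵗ-ᗮ (var⊥ X) w = tt
  Wfᵗ-ᗮ (∃ᵗ A) w = Wfᵗ-ᗮ A w
  Wfᵗ-ᗮ (∀ᵗ A) w = Wfᵗ-ᗮ A w
  Wfᵗ-ᗮ (⁇ A) w = Wfᵗ-ᗮ A w
  Wfᵗ-ᗮ (‼ A) w = Wfᵗ-ᗮ A w
  Wfᵗ-ᗮ (prov 𝒢) w = w
  Wfᵗ-ᗮ (asm 𝒢) w = w

  mutual
    Wfᵗ-ren : (r : Fin n → Fin m) (A : Ty n) → Wfᵗ A → Wfᵗ (ren r A)
    Wfᵗ-ren r (A ⊗ B) (v , w) = Wfᵗ-ren r A v , Wfᵗ-ren r B w
    Wfᵗ-ren r (A ⅋ B) (v , w) = Wfᵗ-ren r A v , Wfᵗ-ren r B w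
    Wfᵗ-ren r (A ⊕ B) (v , w) = Wfᵗ-ren r A v , Wfᵗ-ren r B w
    Wfᵗ-ren r (A & B) (v , w) = Wfᵗ-ren r A v , Wfᵗ-ren r B w
    Wfᵗ-ren r 𝟙 w = tt
    Wfᵗ-ren r ⊥ w = tt
    Wfᵗ-ren r (var X) w = tt
    Wfᵗ-ren r (var⊥ X) w = tt
    Wfᵗ-ren r (∃ᵗ A) w = Wfᵗ-ren (liftʳ r) A w
    Wfᵗ-ren r (∀ᵗ A) w = Wfᵗ-ren (liftʳ r) A w
    Wfᵗ-ren r (⁇ A) w = Wfᵗ-ren r A w
    Wfᵗ-ren r (‼ A) w = Wfᵗ-ren r A w
    Wfᵗ-ren r (prov 𝒢) w = Wfᵗ-renᴴ r 𝒢 w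
    Wfᵗ-ren r (asm 𝒢) w = Wfᵗ-renᴴ r 𝒢 w

    Wfᵗ-renᴱ : (r : Fin n → Fin m) {K : Set} (Γ : Env K n) → Wfᴱ Γ → Wfᴱ (renᴱ r Γ)
    Wfᵗ-renᴱ r []            w       = tt
    Wfᵗ-renᴱ r ((k ∶ A) ∷ Γ) (v , w) = Wfᵗ-ren r A v , Wfᵗ-renᴱ r Γ w

    Wfᵗ-renˢ : (r : Fin n → Fin m) {K : Set} (𝒢 : HEnv K n) → Wfᵗˢ 𝒢 → Wfᵗˢ (renᴴ r 𝒢)
    Wfᵗ-renˢ r []      w       = tt
    Wfᵗ-renˢ r (Γ ∷ 𝒢) (v , w) = Wfᵗ-renᴱ r Γ v , Wfᵗ-renˢ r 𝒢 w

    Wfᵗ-renᴴ : (r : Fin n → Fin m) {K : Set} (𝒢 : HEnv K n) → Wf 𝒢 → Wf (renᴴ r 𝒢)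
    Wfᵗ-renᴴ r 𝒢 (u , w) = subst Unique (sym (dom-ren _ 𝒢)) u , Wfᵗ-renˢ r 𝒢 w

  Wfᵗ-lift : {ξ : Fin n → Ty m} → (∀ X → Wfᵗ (ξ X)) → ∀ X → Wfᵗ (liftˢ ξ X)
  Wfᵗ-lift h zero    = tt
  Wfᵗ-lift {ξ = ξ} h (suc X) = Wfᵗ-ren suc (ξ X) (h X)

  mutual
    Wfᵗ-sub : {ξ : Fin n → Ty m} → (∀ X → Wfᵗ (ξ X)) → (A : Ty n) → Wfᵗ A → Wfᵗ (sub ξ A)
    Wfᵗ-sub h (A ⊗ B) (v , w) = Wfᵗ-sub h A v , Wfᵗ-sub h B w
    Wfᵗ-sub h (A ⅋ B) (v , w) = Wfᵗ-sub h A v , Wfᵗ-sub h B w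
    Wfᵗ-sub h (A ⊕ B) (v , w) = Wfᵗ-sub h A v , Wfᵗ-sub h B w
    Wfᵗ-sub h (A & B) (v , w) = Wfᵗ-sub h A v , Wfᵗ-sub h B w
    Wfᵗ-sub h 𝟙 w = tt
    Wfᵗ-sub h ⊥ w = tt
    Wfᵗ-sub h (var X) w = h X
    Wfᵗ-sub {ξ = ξ} h (var⊥ X) w = Wfᵗ-ᗮ (ξ X) (h X)
    Wfᵗ-sub h (∃ᵗ A) w = Wfᵗ-sub (Wfᵗ-lift h) A w
    Wfᵗ-sub h (∀ᵗ A) w = Wfᵗ-sub (Wfᵗ-lift h) A w
    Wfᵗ-sub h (⁇ A) w = Wfᵗ-sub h A w
    Wfᵗ-sub h (‼ A) w = Wfᵗ-sub h A w
    Wfᵗ-sub h (prov 𝒢) w = Wfᵗ-subᴴ h 𝒢 w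
    Wfᵗ-sub h (asm 𝒢) w = Wfᵗ-subᴴ h 𝒢 w

    Wfᵗ-subᴱ : {ξ : Fin n → Ty m} → (∀ X → Wfᵗ (ξ X)) → {K : Set} (Γ : Env K n) → Wfᴱ Γ → Wfᴱ (subᴱ ξ Γ)
    Wfᵗ-subᴱ h []            w       = tt
    Wfᵗ-subᴱ h ((k ∶ A) ∷ Γ) (v , w) = Wfᵗ-sub h A v , Wfᵗ-subᴱ h Γ w

    Wfᵗ-subˢ : {ξ : Fin n → Ty m} → (∀ X → Wfᵗ (ξ X)) → {K : Set} (𝒢 : HEnv K n) → Wfᵗˢ 𝒢 → Wfᵗˢ (subᴴ ξ 𝒢)
    Wfᵗ-subˢ h []      w       = tt
    Wfᵗ-subˢ h (Γ ∷ 𝒢) (v , w) = Wfᵗ-subᴱ h Γ v , Wfᵗ-subˢ h 𝒢 w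

    Wfᵗ-subᴴ : {ξ : Fin n → Ty m} → (∀ X → Wfᵗ (ξ X)) → {K : Set} (𝒢 : HEnv K n) → Wf 𝒢 → Wf (subᴴ ξ 𝒢)
    Wfᵗ-subᴴ h 𝒢 (u , w) = subst Unique (sym (dom-sub _ 𝒢)) u , Wfᵗ-subˢ h 𝒢 w

  -- Permutations, and steps of hyperenvironments

  module Inversion {c} (S : Setoid c c) where
    open Setoid S using () renaming (_≈_ to _∼_; sym to ∼-sym)
    open PermS S using (↭-prep) renaming (_↭_ to _⇄_; ↭-refl to ⇄-refl; ↭-sym to ⇄-sym; ↭-trans to ⇄-trans)
    open Perm S using (↭-split; ↭-shift; shift)

    -- The partner `y` is only related to `x`, but the decomposition of `ys` is a propositional
    -- equality. Matching on it with `refl` then reveals where in a concrete list the partner lies.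
    ∷-inv : ∀ {x xs ys} → x ∷ xs ⇄ ys →
            ∃[ pre ] ∃[ y ] ∃[ post ] ys ≡ pre ++ y ∷ post × x ∼ y × xs ⇄ pre ++ post
    ∷-inv {x} {xs} p with ↭-split x [] xs (⇄-sym p)
    ... | ps , qs , e , q = go ps e (⇄-sym q)
      where
      go : ∀ ps {ys zs} → Pointwise _∼_ ys (ps ++ x ∷ qs) → zs ⇄ ps ++ qs →
           ∃[ pre ] ∃[ y ] ∃[ post ] ys ≡ pre ++ y ∷ post × x ∼ y × zs ⇄ pre ++ post
      go ps e r with splitʷ ps e
        where
        splitʷ : ∀ ps {ys} → Pointwise _∼_ ys (ps ++ x ∷ qs) →
                 ∃[ pre ] ∃[ y ] ∃[ post ] ys ≡ pre ++ y ∷ post × x ∼ y × Pointwise _∼_ (ps ++ qs) (pre ++ post)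
        splitʷ [] (y∼x ∷ e) = [] , _ , _ , refl , ∼-sym y∼x , Pointwise.symmetric ∼-sym e
        splitʷ (_ ∷ ps) (y∼p ∷ e) with splitʷ ps e
        ... | pre , y , post , refl , x∼y , w = _ ∷ pre , y , post , refl , x∼y , ∼-sym y∼p ∷ w
      ... | pre , y , post , ys≡ , x∼y , w = pre , y , post , ys≡ , x∼y , ⇄-trans r (reflᵖ w)

    ∷-++-inv : ∀ {x xs} ys {zs} → x ∷ xs ⇄ ys ++ zs →
               (∃[ ys′ ] ys ⇄ x ∷ ys′ × xs ⇄ ys′ ++ zs) ⊎ (∃[ zs′ ] zs ⇄ x ∷ zs′ × xs ⇄ ys ++ zs′)
    ∷-++-inv {x} {xs} ys {zs} p with ∷-inv p
    ... | pre , y , post , eq , x∼y , q = go ys pre eq q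
      where
      go : ∀ {ws} ys pre → ys ++ zs ≡ pre ++ y ∷ post → ws ⇄ pre ++ post →
           (∃[ ys′ ] ys ⇄ x ∷ ys′ × ws ⇄ ys′ ++ zs) ⊎ (∃[ zs′ ] zs ⇄ x ∷ zs′ × ws ⇄ ys ++ zs′)
      go []       pre       refl q = inj₂ (pre ++ post , shift (∼-sym x∼y) pre post , q)
      go (_ ∷ ys) []        refl q = inj₁ (ys , PermS.prep (∼-sym x∼y) ⇄-refl , q)
      go (a ∷ ys) (_ ∷ pre) eq   q with List.∷-injective eq
      ... | refl , eq′ with go ys pre eq′ ⇄-refl
      ... | inj₁ (ys′ , r , s) = inj₁ (a ∷ ys′ , ⇄-trans (↭-prep a r) (PermS.↭-swap S a x ⇄-refl) , ⇄-trans q (↭-prep a s))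
      ... | inj₂ (zs′ , r , s) = inj₂ (zs′ , r , ⇄-trans q (↭-prep a s))

  tyS : ℕ → Setoid _ _
  tyS n = record
    { Carrier = Ty n ; _≈_ = _≈_
    ; isEquivalence = record { refl = ≈-refl _ ; sym = ≈-sym ; trans = ≈-trans } }

  entryS : Set → ℕ → Setoid _ _
  entryS K n = ×-setoid (≡.setoid K) (tyS n)

  envS henvS : Set → ℕ → Setoid _ _
  envS K n = PermS.↭-setoid (entryS K n)
  henvS K n = PermS.↭-setoid (envS K n)

  pentryS : ℕ → Setoid _ _
  pentryS n = ×-setoid (≡.setoid PVar) (henvS Param n)

  module ℰ {K : Set} {n : ℕ} where
    open PermS (entryS K n) public using (↭-prep; ↭-swap; ↭-refl; ↭-sym; ↭-trans; ↭-reflexive)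
    open Perm (entryS K n) public
    open Inversion (entryS K n) public

  module ℋ {K : Set} {n : ℕ} where
    open PermS (envS K n) public using (↭-prep; ↭-swap; ↭-refl; ↭-sym; ↭-trans; ↭-reflexive)
    open Perm (envS K n) public
    open Inversion (envS K n) public

  module 𝒫 {n : ℕ} where
    open PermS (pentryS n) public using (↭-prep; ↭-swap; ↭-refl; ↭-sym; ↭-trans; ↭-reflexive)
    open Perm (pentryS n) public
    open Inversion (pentryS n) public

  module Rearrange {c} (S : Setoid c c) where
    open CMSolver (Perm.++-commutativeMonoid S) public using (solve; _⊜_) renaming (_⊕_ to infixr 5 _⊹_)

  module ℰS {K : Set} {n : ℕ} = Rearrange (entryS K n)
  module ℋS {K : Set} {n : ℕ} = Rearrange (envS K n)
  module 𝒫S {n : ℕ} = Rearrange (pentryS n)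

  module Keyed {K : Set} {c} (V : Setoid c c) where
    open Setoid V using () renaming (Carrier to A; _≈_ to _∼_; sym to ∼-sym)
    open Inversion (×-setoid (≡.setoid K) V) using (∷-inv)

    -- Inverting the permutation from the right locates the partner of the right-hand head on the
    -- left. If it were not the left-hand head, `x` would be a key of `xs`.
    align : ∀ {x a b} {xs ys : List (K × A)} → x ∉ map proj₁ xs →
            Permutation (×-Pointwise _≡_ _∼_) ((x , a) ∷ xs) ((x , b) ∷ ys) →
            a ∼ b × Permutation (×-Pointwise _≡_ _∼_) xs ys
    align x∉ p with ∷-inv (PermS.↭-sym (×-setoid (≡.setoid K) V) p)
    ... | []      , _ , _    , refl , (refl , b∼a) , q = ∼-sym b∼a , PermS.↭-sym (×-setoid (≡.setoid K) V) q
    ... | _ ∷ pre , _ , post , refl , (refl , b∼a) , q = contradiction (∈-map⁺ proj₁ (∈-++⁺ʳ pre (here refl))) x∉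

  -- The argument of `align`, one level up: a name that occurs once determines its environment, and
  -- then its entry in that environment.
  focus : ∀ {x A B} {Γ Δ : Env K n} {𝒦 ℒ} → x ∉ map proj₁ Γ → x ∉ dom 𝒦 →
          ((x ∶ A) ∷ Γ) ∷ 𝒦 ≋ ((x ∶ B) ∷ Δ) ∷ ℒ → A ≈ B × Γ ≋ᴱ Δ × 𝒦 ≋ ℒ
  focus {n = n} x∉Γ x∉𝒦 p with ℋ.∷-inv (ℋ.↭-sym p)
  ... | []      , _ , _    , refl , q , r =
    let A≈B , Γ≋Δ = Keyed.align (tyS n) x∉Γ (ℰ.↭-sym q) in A≈B , Γ≋Δ , ℋ.↭-sym r
  ... | _ ∷ pre , Ξ , post , refl , q , r = contradiction x∈𝒦 x∉𝒦
    where
    x∈𝒦 : _ ∈ dom (pre ++ Ξ ∷ post)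
    x∈𝒦 = subst (_ ∈_) (sym (dom-++ pre (Ξ ∷ post))) (∈-++⁺ʳ (dom pre)
            (subst (_ ∈_) (sym (dom-∷ Ξ post)) (∈-++⁺ˡ (↭.∈-resp-↭ (keys-↭ q) (here refl)))))

  -- The key type may change: the same operation applies a record to a hyperenvironment over
  -- parameters, renames names, and tags names by their origin.
  relabelᴱ : (K → L) → Env K n → Env L n
  relabelᴱ f = map (map₁ f)

  relabel : (K → L) → HEnv K n → HEnv L n
  relabel f = map (relabelᴱ f)

  relabelᴱ-≋ : (f : K → L) {Γ Δ : Env K n} → Γ ≋ᴱ Δ → relabelᴱ f Γ ≋ᴱ relabelᴱ f Δ
  relabelᴱ-≋ f = Perm.map⁺ (entryS _ _) (entryS _ _) λ { (refl , p) → refl , p }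

  relabel-≋ : (f : K → L) {𝒢 ℋ : HEnv K n} → 𝒢 ≋ ℋ → relabel f 𝒢 ≋ relabel f ℋ
  relabel-≋ f = Perm.map⁺ (envS _ _) (envS _ _) (relabelᴱ-≋ f)

  names-relabel : (f : K → L) (Γ : Env K n) → map proj₁ (relabelᴱ f Γ) ≡ map f (map proj₁ Γ)
  names-relabel f []      = refl
  names-relabel f (_ ∷ Γ) = cong (_ ∷_) (names-relabel f Γ)

  dom-relabel : (f : K → L) (𝒢 : HEnv K n) → dom (relabel f 𝒢) ≡ map f (dom 𝒢)
  dom-relabel f []      = refl
  dom-relabel f (Γ ∷ 𝒢) = trans (dom-∷ (relabelᴱ f Γ) (relabel f 𝒢))
    (trans (cong₂ _++_ (names-relabel f Γ) (dom-relabel f 𝒢))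
    (trans (sym (List.map-++ f (map proj₁ Γ) (dom 𝒢))) (cong (map f) (sym (dom-∷ Γ 𝒢)))))

  -- A step consumes entries c of one environment and distributes the other entries of this
  -- environment over the produced environments ps.
  Block : Set → ℕ → Set
  Block K n = Env K n × Env K n

  remainder : List (Block K n) → Env K n
  remainder bs = concat (map proj₂ bs)

  merge : List (Block K n) → HEnv K n
  merge = map λ (p , Γ) → p ++ Γ

  remainder-++ : (bs cs : List (Block K n)) → remainder (bs ++ cs) ≡ remainder bs ++ remainder cs
  remainder-++ bs cs = trans (cong concat (List.map-++ proj₂ bs cs)) (sym (List.concat-++ (map proj₂ bs) (map proj₂ cs)))

  record Step (c : Env K n) (ps : HEnv K n) (𝒢 𝒢′ : HEnv K n) : Set where
    constructor step
    field
      {blocks} : List (Block K n)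
      {rest}   : HEnv K n
      shape    : map proj₁ blocks ≡ ps
      source   : 𝒢 ≋ (c ++ remainder blocks) ∷ rest
      target   : merge blocks ++ rest ≋ 𝒢′

  -- A chain, because a parallel pair of actions takes two steps, of which the second may act in an
  -- environment left by the first. Silent labels and calls take none.
  data Steps {K : Set} {n : ℕ} : List (Env K n × HEnv K n) → HEnv K n → HEnv K n → Set where
    []  : ∀ {𝒢 𝒢′} → 𝒢 ≋ 𝒢′ → Steps [] 𝒢 𝒢′
    _∷_ : ∀ {c ps rs 𝒢 𝒢₁ 𝒢′} → Step c ps 𝒢 𝒢₁ → Steps rs 𝒢₁ 𝒢′ → Steps ((c , ps) ∷ rs) 𝒢 𝒢′

  module _ where

    private
      variable
        c           : Env K n
        ps          : HEnv K n
        𝒢 𝒢₁ 𝒢′ ℋ ℋ′ : HEnv K n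
        rs ss       : List (Env K n × HEnv K n)

    Step-≋ : 𝒢 ≋ 𝒢₁ → 𝒢′ ≋ ℋ′ → Step c ps 𝒢₁ 𝒢′ → Step c ps 𝒢 ℋ′
    Step-≋ p q (step e s t) = step e (transᵖ p s) (transᵖ t q)

    Steps-≋ˡ : 𝒢 ≋ 𝒢₁ → Steps rs 𝒢₁ 𝒢′ → Steps rs 𝒢 𝒢′
    Steps-≋ˡ p ([] q)   = [] (transᵖ p q)
    Steps-≋ˡ p (s ∷ ss) = Step-≋ p ℋ.↭-refl s ∷ ss

    Steps-≋ʳ : 𝒢′ ≋ ℋ′ → Steps rs 𝒢 𝒢′ → Steps rs 𝒢 ℋ′
    Steps-≋ʳ p ([] q)   = [] (transᵖ q p)
    Steps-≋ʳ p (s ∷ ss) = s ∷ Steps-≋ʳ p ss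

    Step-frame : (ℋ : HEnv K n) → Step c ps 𝒢 𝒢′ → Step c ps (𝒢 ++ ℋ) (𝒢′ ++ ℋ)
    Step-frame ℋ (step {bs} {rest} e s t) =
      step {rest = rest ++ ℋ} e (ℋ.++⁺ʳ ℋ s) (transᵖ (ℋ.↭-sym (ℋ.++-assoc (merge bs) rest ℋ)) (ℋ.++⁺ʳ ℋ t))

    Steps-frame : (ℋ : HEnv K n) → Steps rs 𝒢 𝒢′ → Steps rs (𝒢 ++ ℋ) (𝒢′ ++ ℋ)
    Steps-frame ℋ ([] p)   = [] (ℋ.++⁺ʳ ℋ p)
    Steps-frame ℋ (s ∷ ss) = Step-frame ℋ s ∷ Steps-frame ℋ ss

    Steps-frameˡ : (ℋ : HEnv K n) → Steps rs 𝒢 𝒢′ → Steps rs (ℋ ++ 𝒢) (ℋ ++ 𝒢′)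
    Steps-frameˡ {𝒢 = 𝒢} {𝒢′} ℋ ss =
      Steps-≋ˡ (ℋ.++-comm ℋ 𝒢) (Steps-≋ʳ (ℋ.++-comm 𝒢′ ℋ) (Steps-frame ℋ ss))

    Steps-++ : Steps rs 𝒢 𝒢₁ → Steps ss 𝒢₁ 𝒢′ → Steps (rs ++ ss) 𝒢 𝒢′
    Steps-++ ([] p)   ts = Steps-≋ˡ p ts
    Steps-++ (s ∷ ss) ts = s ∷ Steps-++ ss ts

    pull : ∀ {x} {Γ : Env K n} bs → x ∷ Γ ≋ᴱ remainder bs →
           ∃[ bs₁ ] ∃[ p ] ∃[ Δx ] ∃[ Δ ] ∃[ bs₂ ]
             bs ≡ bs₁ ++ (p , Δx) ∷ bs₂ × Δx ≋ᴱ x ∷ Δ × Γ ≋ᴱ remainder bs₁ ++ Δ ++ remainder bs₂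
    pull []             q = contradiction q ℰ.¬x∷xs↭[]
    pull ((p , Δ) ∷ bs) q with ℰ.∷-++-inv Δ q
    ... | inj₁ (Δ′ , r , s) = [] , p , Δ , Δ′ , bs , refl , r , s
    ... | inj₂ (Ξ , r , s) with pull bs (ℰ.↭-sym r)
    ... | bs₁ , p′ , Δx , Δ′ , bs₂ , refl , t , u =
      (p , Δ) ∷ bs₁ , p′ , Δx , Δ′ , bs₂ , refl , t ,
      transᵖ s (transᵖ (ℰ.++⁺ˡ Δ u) (ℰ.↭-sym (ℰ.++-assoc Δ (remainder bs₁) _)))

    private
      -- The case of a step in the environment of `x`. As `x` is not consumed, it ends up in one
      -- particular block; adding `Δ` to the remainder of that block gives the same step after the
      -- cut.
      Step-cutˡ : ∀ {x} {Γ Δ Y : Env K n} {𝒢₀ rest} bs → map proj₁ bs ≡ ps → proj₁ x ∉ map proj₁ c →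
                  x ∷ Γ ≋ᴱ c ++ remainder bs → rest ≋ Y ∷ 𝒢₀ → merge bs ++ rest ≋ 𝒢′ →
                  ∃[ Γ′ ] ∃[ 𝒢₀′ ] 𝒢′ ≋ (x ∷ Γ′) ∷ Y ∷ 𝒢₀′ × Step c ps ((Γ ++ Δ) ∷ 𝒢₀) ((Γ′ ++ Δ) ∷ 𝒢₀′)
      Step-cutˡ {c = c} {x = x} {Γ} {Δ} {Y} {𝒢₀} {rest} bs e x∉c s r t with ℰ.∷-++-inv c s
      ... | inj₁ (c′ , q , _) = contradiction (↭.∈-resp-↭ (keys-↭ (ℰ.↭-sym q)) (here refl)) x∉c
      ... | inj₂ (Ξ , q , s′) with pull bs (ℰ.↭-sym q)
      ... | bs₁ , p , Θx , Θ , bs₂ , refl , u , v =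
        p ++ Θ , 𝒢₀ ++ merge bs₁ ++ merge bs₂ ,
        transᵖ (ℋ.↭-sym t) (subst (λ ms → ms ++ rest ≋ _) (sym (List.map-++ _ bs₁ _))
          (transᵖ (solve 4 (λ m₁ w m₂ r → (m₁ ⊹ w ⊹ m₂) ⊹ r ⊜ w ⊹ r ⊹ m₁ ⊹ m₂) ℋ.↭-refl
                    (merge bs₁) ((p ++ Θx) ∷ []) (merge bs₂) rest)
            (prepᵖ (transᵖ (ℰ.++⁺ˡ p u) (ℰ.↭-shift p Θ)) (ℋ.++⁺ʳ (merge bs₁ ++ merge bs₂) r)))) ,
        step {blocks = bs₁ ++ (p , Θ ++ Δ) ∷ bs₂}
          (trans (List.map-++ proj₁ bs₁ _) (trans (sym (List.map-++ proj₁ bs₁ _)) e))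
          (prepᵖ (transᵖ (ℰ.++⁺ʳ Δ (transᵖ s′ (ℰ.++⁺ˡ c v)))
            (transᵖ (solveᴱ 5 (λ c r₁ t r₂ d → (c ⊹ᴱ r₁ ⊹ᴱ t ⊹ᴱ r₂) ⊹ᴱ d ⊜ᴱ c ⊹ᴱ r₁ ⊹ᴱ (t ⊹ᴱ d) ⊹ᴱ r₂) ℰ.↭-refl
                      c (remainder bs₁) Θ (remainder bs₂) Δ)
              (ℰ.++⁺ˡ c (ℰ.↭-reflexive (sym (remainder-++ bs₁ _)))))) ℋ.↭-refl)
          (subst (λ ms → ms ++ 𝒢₀ ≋ ((p ++ Θ) ++ Δ) ∷ 𝒢₀ ++ merge bs₁ ++ merge bs₂) (sym (List.map-++ _ bs₁ _))
            (transᵖ (solve 4 (λ m₁ w m₂ g → (m₁ ⊹ w ⊹ m₂) ⊹ g ⊜ w ⊹ g ⊹ m₁ ⊹ m₂) ℋ.↭-refl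
                      (merge bs₁) ((p ++ Θ ++ Δ) ∷ []) (merge bs₂) 𝒢₀)
              (prepᵖ (ℰ.↭-sym (ℰ.++-assoc p Θ Δ)) ℋ.↭-refl)))
        where
        open ℋS
        open ℰS renaming (solve to solveᴱ; _⊹_ to infixr 5 _⊹ᴱ_; _⊜_ to _⊜ᴱ_)

    private
      -- The case of a step in an environment of neither cut name: `X` and `Y` are part of the
      -- frame, and may be exchanged for the merged environment `Z`.
      Step-cutʳ : ∀ {X Y Ξ : Env K n} {Z 𝒦 rest} bs → map proj₁ bs ≡ ps → c ++ remainder bs ≋ᴱ Ξ → rest ≋ X ∷ Y ∷ 𝒦 → merge bs ++ rest ≋ 𝒢′ →
                  𝒢′ ≋ X ∷ Y ∷ merge bs ++ 𝒦 × Step c ps (Z ∷ Ξ ∷ 𝒦) (Z ∷ merge bs ++ 𝒦)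
      Step-cutʳ {X = X} {Y} {Ξ} {Z} {𝒦} bs e q r t =
        transᵖ (ℋ.↭-sym t) (transᵖ (ℋ.++⁺ˡ (merge bs) r) (ℋ.shifts (merge bs) (X ∷ Y ∷ []))) ,
        step {blocks = bs} {Z ∷ 𝒦} e (swapᵖ ℰ.↭-refl (ℰ.↭-sym q) ℋ.↭-refl) (ℋ.↭-shift (merge bs) 𝒦)

    -- A step splits one environment and never joins two, so entries that lie apart and are not
    -- consumed still lie apart afterwards. This is why a cut can be rebuilt around a step that
    -- ignores its names.
    Step-cut : ∀ {x y} {Γ Δ : Env K n} {𝒢₀} → proj₁ x ∉ map proj₁ c → proj₁ y ∉ map proj₁ c →
               𝒢 ≋ (x ∷ Γ) ∷ (y ∷ Δ) ∷ 𝒢₀ → Step c ps 𝒢 𝒢′ →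
               ∃[ Γ′ ] ∃[ Δ′ ] ∃[ 𝒢₀′ ] 𝒢′ ≋ (x ∷ Γ′) ∷ (y ∷ Δ′) ∷ 𝒢₀′ × Step c ps ((Γ ++ Δ) ∷ 𝒢₀) ((Γ′ ++ Δ′) ∷ 𝒢₀′)
    Step-cut {c = c} {ps = ps} {𝒢′ = 𝒢′} {x = x} {y} {Γ} {Δ} {𝒢₀} x∉c y∉c p (step {bs} {rest} e s t) = go (ℋ.∷-inv (transᵖ (ℋ.↭-sym s) p))
      where
      go : (∃[ pre ] ∃[ Ξ ] ∃[ post ] (x ∷ Γ) ∷ (y ∷ Δ) ∷ 𝒢₀ ≡ pre ++ Ξ ∷ post × c ++ remainder bs ≋ᴱ Ξ × rest ≋ pre ++ post) →
           ∃[ Γ′ ] ∃[ Δ′ ] ∃[ 𝒢₀′ ] 𝒢′ ≋ (x ∷ Γ′) ∷ (y ∷ Δ′) ∷ 𝒢₀′ × Step c ps ((Γ ++ Δ) ∷ 𝒢₀) ((Γ′ ++ Δ′) ∷ 𝒢₀′)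
      go ([] , _ , _ , refl , q , r) =
        let Γ′ , 𝒢₀′ , u , v = Step-cutˡ {Δ = Δ} bs e x∉c (ℰ.↭-sym q) r t in Γ′ , Δ , 𝒢₀′ , u , v
      -- The environment of `y` is hit: the same argument with the two sides exchanged, undone by
      -- commutativity of the merged environment.
      go (_ ∷ [] , _ , _ , refl , q , r) =
        let Δ′ , 𝒢₀′ , u , v = Step-cutˡ {Δ = Γ} bs e y∉c (ℰ.↭-sym q) r t
        in Γ , Δ′ , 𝒢₀′ , transᵖ u (ℋ.↭-swap (y ∷ Δ′) (x ∷ Γ) ℋ.↭-refl) ,
           Step-≋ (prepᵖ (ℰ.++-comm Γ Δ) ℋ.↭-refl) (prepᵖ (ℰ.++-comm Δ′ Γ) ℋ.↭-refl) v
      go (_ ∷ _ ∷ pre , Ξ , post , refl , q , r) =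
        let u , v = Step-cutʳ {Z = Γ ++ Δ} bs e q r t
        in Γ , Δ , merge bs ++ pre ++ post , u ,
           Step-≋ (prepᵖ ℰ.↭-refl (ℋ.↭-shift pre post)) ℋ.↭-refl v

    Steps-cut : ∀ {x y} {Γ Δ : Env K n} {𝒢₀} → All (λ r → proj₁ x ∉ map proj₁ (proj₁ r) × proj₁ y ∉ map proj₁ (proj₁ r)) rs →
                𝒢 ≋ (x ∷ Γ) ∷ (y ∷ Δ) ∷ 𝒢₀ → Steps rs 𝒢 𝒢′ →
                ∃[ Γ′ ] ∃[ Δ′ ] ∃[ 𝒢₀′ ] 𝒢′ ≋ (x ∷ Γ′) ∷ (y ∷ Δ′) ∷ 𝒢₀′ × Steps rs ((Γ ++ Δ) ∷ 𝒢₀) ((Γ′ ++ Δ′) ∷ 𝒢₀′)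
    Steps-cut []               p ([] q)   = _ , _ , _ , transᵖ (ℋ.↭-sym q) p , [] ℋ.↭-refl
    Steps-cut ((x∉ , y∉) ∷ ns) p (s ∷ ss) =
      let _ , _ , _ , q , s′ = Step-cut x∉ y∉ p s
          _ , _ , _ , r , ss′ = Steps-cut ns q ss
      in _ , _ , _ , r , s′ ∷ ss′

  -- The names and process variables of a derivation

  ∈-∖⁺ : ∀ {x y xs} → x ∈ xs → x ≢ y → x ∈ xs ∖ y
  ∈-∖⁺ = ∈-filter⁺ (λ x → ¬? (x ≟ⁿ _))

  ∈-∖⁻ : ∀ {x y} xs → x ∈ xs ∖ y → x ∈ xs × x ≢ y
  ∈-∖⁻ xs = ∈-filter⁻ (λ x → ¬? (x ≟ⁿ _)) {xs = xs}

  ∈-∖ᵖ⁺ : ∀ {x y xs} → x ∈ xs → x ≢ y → x ∈ xs ∖ᵖ y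
  ∈-∖ᵖ⁺ = ∈-filter⁺ (λ x → ¬? (x ≟ᵖ _))

  ∈-∖ᵖ⁻ : ∀ {x y} xs → x ∈ xs ∖ᵖ y → x ∈ xs × x ≢ y
  ∈-∖ᵖ⁻ xs = ∈-filter⁻ (λ x → ¬? (x ≟ᵖ _)) {xs = xs}

  ∈-names-++⁻ : ∀ {V : Set} {x : K} (xs : List (K × V)) {ys} → x ∈ map proj₁ (xs ++ ys) → x ∈ map proj₁ xs ⊎ x ∈ map proj₁ ys
  ∈-names-++⁻ xs p = ∈-++⁻ (map proj₁ xs) (subst (_ ∈_) (List.map-++ proj₁ xs _) p)

  ∈-names-++⁺ˡ : ∀ {V : Set} {x : K} (xs : List (K × V)) {ys} → x ∈ map proj₁ xs → x ∈ map proj₁ (xs ++ ys)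
  ∈-names-++⁺ˡ xs p = subst (_ ∈_) (sym (List.map-++ proj₁ xs _)) (∈-++⁺ˡ p)

  ∈-names-++⁺ʳ : ∀ {V : Set} {x : K} (xs : List (K × V)) {ys} → x ∈ map proj₁ ys → x ∈ map proj₁ (xs ++ ys)
  ∈-names-++⁺ʳ xs p = subst (_ ∈_) (sym (List.map-++ proj₁ xs _)) (∈-++⁺ʳ (map proj₁ xs) p)

  ∈-dom-++⁻ : ∀ {x : K} (𝒢 : HEnv K n) {ℋ} → x ∈ dom (𝒢 ++ ℋ) → x ∈ dom 𝒢 ⊎ x ∈ dom ℋ
  ∈-dom-++⁻ 𝒢 p = ∈-++⁻ (dom 𝒢) (subst (_ ∈_) (dom-++ 𝒢 _) p)

  ∈-dom-++⁺ˡ : ∀ {x : K} (𝒢 : HEnv K n) {ℋ} → x ∈ dom 𝒢 → x ∈ dom (𝒢 ++ ℋ)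
  ∈-dom-++⁺ˡ 𝒢 p = subst (_ ∈_) (sym (dom-++ 𝒢 _)) (∈-++⁺ˡ p)

  ∈-dom-++⁺ʳ : ∀ {x : K} (𝒢 : HEnv K n) {ℋ} → x ∈ dom ℋ → x ∈ dom (𝒢 ++ ℋ)
  ∈-dom-++⁺ʳ 𝒢 p = subst (_ ∈_) (sym (dom-++ 𝒢 _)) (∈-++⁺ʳ (dom 𝒢) p)

  ∈-dom-[]⁻ : ∀ {x : K} (Γ : Env K n) → x ∈ dom (Γ ∷ []) → x ∈ map proj₁ Γ
  ∈-dom-[]⁻ Γ p = [ id , (λ ()) ]′ (∈-names-++⁻ Γ p)

  module _ {A : Set} where

    Unique-++⁻ : (xs : List A) {ys : List A} → Unique (xs ++ ys) → Unique xs × Unique ys × Disjoint xs ys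
    Unique-++⁻ []       u = [] , u , λ ()
    Unique-++⁻ (x ∷ xs) (x≢ ∷ u) =
      let v , w , d = Unique-++⁻ xs u
      in All.++⁻ˡ xs x≢ ∷ v , w , λ { (here refl , q) → All.lookup (All.++⁻ʳ xs x≢) q refl ; (there p , q) → d (p , q) }

    ∉-head : ∀ {x : A} {xs} → Unique (x ∷ xs) → x ∉ xs
    ∉-head (x≢ ∷ _) p = All.lookup x≢ p refl

    ∈⇒≢head : ∀ {x z : A} {xs} → Unique (x ∷ xs) → z ∈ xs → z ≢ x
    ∈⇒≢head u p refl = ∉-head u p

  Unique-keys-++⁻ : ∀ {V : Set} (xs : List (K × V)) {ys} → Unique (map proj₁ (xs ++ ys)) →
                    Unique (map proj₁ xs) × Unique (map proj₁ ys) × Disjoint (map proj₁ xs) (map proj₁ ys)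
  Unique-keys-++⁻ xs u = Unique-++⁻ (map proj₁ xs) (subst Unique (List.map-++ proj₁ xs _) u)

  Unique-keys-++⁺ : ∀ {V : Set} (xs : List (K × V)) {ys} → Unique (map proj₁ xs) → Unique (map proj₁ ys) →
                    Disjoint (map proj₁ xs) (map proj₁ ys) → Unique (map proj₁ (xs ++ ys))
  Unique-keys-++⁺ xs u v d = subst Unique (sym (List.map-++ proj₁ xs _)) (Unique.++⁺ u v d)

  Unique-dom-++⁻ : (𝒢 : HEnv K n) {ℋ : HEnv K n} → Unique (dom (𝒢 ++ ℋ)) → Unique (dom 𝒢) × Unique (dom ℋ) × Disjoint (dom 𝒢) (dom ℋ)
  Unique-dom-++⁻ 𝒢 u = Unique-++⁻ (dom 𝒢) (subst Unique (dom-++ 𝒢 _) u)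

  Unique-dom-++⁺ : (𝒢 : HEnv K n) {ℋ : HEnv K n} → Unique (dom 𝒢) → Unique (dom ℋ) → Disjoint (dom 𝒢) (dom ℋ) → Unique (dom (𝒢 ++ ℋ))
  Unique-dom-++⁺ 𝒢 u v d = subst Unique (sym (dom-++ 𝒢 _)) (Unique.++⁺ u v d)

  valid : ∀ {Θ : PEnv n} {P 𝒢} → Θ ⊢ P ▹ 𝒢 → Valid Θ 𝒢
  valid (node _ _ _ v) = v

  unique : ∀ {Θ : PEnv n} {P 𝒢} → Θ ⊢ P ▹ 𝒢 → Unique (dom 𝒢)
  unique D = proj₁ (Valid.wf𝒢 (valid D))

  uniqueᴾ : ∀ {Θ : PEnv n} {P 𝒢} → Θ ⊢ P ▹ 𝒢 → Unique (map proj₁ Θ)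
  uniqueᴾ D = Valid.distinct (valid D)

  keys-renᴾ : (r : Fin n → Fin m) (Θ : PEnv n) → map proj₁ (renᴾ r Θ) ≡ map proj₁ Θ
  keys-renᴾ r []      = refl
  keys-renᴾ r (_ ∷ Θ) = cong (_ ∷_) (keys-renᴾ r Θ)

  -- An arbitrary name if f is not a key of ρ.
  _!_ : Rec → Param → Name
  ρ ! f = fromMaybe (freshⁿ []) (lookupᴿ ρ f)

  !-∈ : ∀ {ρ f x} → Unique (keys ρ) → (f , x) ∈ ρ → ρ ! f ≡ x
  !-∈ {(g , y) ∷ ρ} {f} u p with f ≟ᶠ g
  !-∈ {(g , y) ∷ ρ} {f} u (here refl) | yes _ = refl
  !-∈ {(g , y) ∷ ρ} {f} u (there p) | yes refl = contradiction (∈-map⁺ proj₁ p) (∉-head u)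
  !-∈ {(g , y) ∷ ρ} {f} u (here refl) | no f≢g = contradiction refl f≢g
  !-∈ {(g , y) ∷ ρ} {f} (_ ∷ u) (there p) | no _ = !-∈ u p

  ∈-! : ∀ {ρ f} → f ∈ keys ρ → (f , ρ ! f) ∈ ρ
  ∈-! {(g , y) ∷ ρ} {f} p with f ≟ᶠ g
  ∈-! {(g , y) ∷ ρ} {f} p | yes refl = here refl
  ∈-! {(g , y) ∷ ρ} {f} (here refl) | no f≢g = contradiction refl f≢g
  ∈-! {(g , y) ∷ ρ} {f} (there p) | no _ = there (∈-! p)

  image-! : (ρ : Rec) → Unique (keys ρ) → image ρ ≡ map (ρ !_) (keys ρ)
  image-! ρ u = trans (List.map-cong-local (All.tabulate λ p → sym (!-∈ u p))) (List.map-∘ ρ)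

  module _ {𝒢 : HEnv Param n} {ρ : Rec} where

    keys-unique : ∀ {ℋ} → 𝒢 ⟦ ρ ⟧≔ ℋ → Unique (dom 𝒢) → Unique (keys ρ)
    keys-unique (ks , _) = Unique-↭ (↭-sym ks)

    -- A record pairs a parameter with at most one name when its keys are distinct, so the relation
    -- is the graph of lookup. With `relabel-≔` for the converse, facts on `𝒢ρ` become facts on
    -- relabelling.
    ≔⇒relabel : ∀ {ℋ} → 𝒢 ⟦ ρ ⟧≔ ℋ → Unique (keys ρ) → relabel (ρ !_) 𝒢 ≡ ℋ
    ≔⇒relabel (_ , ps) u = go ps
      where
      goᴱ : ∀ {Γ : Env Param n} {Δ} → Pointwise (λ b c → (proj₁ b , proj₁ c) ∈ ρ × proj₂ b ≡ proj₂ c) Γ Δ → relabelᴱ (ρ !_) Γ ≡ Δ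
      goᴱ []                = refl
      goᴱ ((p , refl) ∷ ps) = cong₂ _∷_ (cong (_, _) (!-∈ u p)) (goᴱ ps)

      go : ∀ {𝒢 : HEnv Param n} {ℋ} →
           Pointwise (Pointwise (λ b c → (proj₁ b , proj₁ c) ∈ ρ × proj₂ b ≡ proj₂ c)) 𝒢 ℋ → relabel (ρ !_) 𝒢 ≡ ℋ
      go []       = refl
      go (p ∷ ps) = cong₂ _∷_ (goᴱ p) (go ps)

    ≔-dom : ∀ {ℋ} → 𝒢 ⟦ ρ ⟧≔ ℋ → Unique (dom 𝒢) → image ρ ↭ dom ℋ
    ≔-dom {ℋ} i u = subst₂ _↭_ (sym (image-! ρ uρ)) (trans (sym (dom-relabel (ρ !_) 𝒢)) (cong dom (≔⇒relabel i uρ)))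
                      (↭.map⁺ (ρ !_) (proj₁ i))
      where uρ = keys-unique i u

  relabel-≔ : (𝒢 : HEnv Param n) {ρ : Rec} → keys ρ ↭ dom 𝒢 → 𝒢 ⟦ ρ ⟧≔ relabel (ρ !_) 𝒢
  relabel-≔ {n = n} 𝒢 {ρ} ks = ks , go 𝒢 (λ p → ↭.∈-resp-↭ (↭-sym ks) p)
    where
    goᴱ : (Γ : Env Param n) → (∀ {f} → f ∈ map proj₁ Γ → f ∈ keys ρ) →
          Pointwise (λ b c → (proj₁ b , proj₁ c) ∈ ρ × proj₂ b ≡ proj₂ c) Γ (relabelᴱ (ρ !_) Γ)
    goᴱ []      s = []
    goᴱ (_ ∷ Γ) s = (∈-! (s (here refl)) , refl) ∷ goᴱ Γ (s ∘ there)

    go : (𝒢 : HEnv Param n) → (∀ {f} → f ∈ dom 𝒢 → f ∈ keys ρ) →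
         Pointwise (Pointwise (λ b c → (proj₁ b , proj₁ c) ∈ ρ × proj₂ b ≡ proj₂ c)) 𝒢 (relabel (ρ !_) 𝒢)
    go []      s = []
    go (Γ ∷ 𝒢) s = goᴱ Γ (s ∘ ∈-names-++⁺ˡ Γ) ∷ go 𝒢 (s ∘ ∈-names-++⁺ʳ Γ)

  ≔-≋ : ∀ {𝒢 𝒢′ : HEnv Param n} {ρ ℋ} → Unique (dom 𝒢) → 𝒢 ≋ 𝒢′ → 𝒢 ⟦ ρ ⟧≔ ℋ → ∃[ ℋ′ ] 𝒢′ ⟦ ρ ⟧≔ ℋ′ × ℋ ≋ ℋ′
  ≔-≋ {𝒢 = 𝒢} {𝒢′} {ρ} u p i@(ks , _) =
    relabel (ρ !_) 𝒢′ , relabel-≔ 𝒢′ (↭-trans ks (dom-↭ p)) ,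
    subst (_≋ relabel (ρ !_) 𝒢′) (≔⇒relabel i (keys-unique i u)) (relabel-≋ (ρ !_) p)

  image⊆dom : ∀ {𝒢 : HEnv Param n} {ρ ℋ x} → Unique (dom 𝒢) → 𝒢 ⟦ ρ ⟧≔ ℋ → x ∈ image ρ → x ∈ dom ℋ
  image⊆dom u i = ↭.∈-resp-↭ (≔-dom i u)

  wfᴾ-≋ : {Θ Θ′ : PEnv n} → Θ ≋ᴾ Θ′ → All (Wf ∘ proj₂) Θ → All (Wf ∘ proj₂) Θ′
  wfᴾ-≋ = 𝒫.All-resp-↭ λ { (_ , p) w → Wf-≋ p w }

  mutual
    fn⊆dom : ∀ {Θ : PEnv n} {P 𝒢 x} → Θ ⊢ P ▹ 𝒢 → x ∈ fn P → x ∈ dom 𝒢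
    fn⊆dom (node r e f v) p = ↭.∈-resp-↭ (dom-↭ f) (fn⊆domʳ (wfᴾ-≋ (𝒫.↭-sym e) (Valid.wfΘ v)) r p)

    -- Validity is attached to nodes, not to rule instances, so well-formedness of `Θ` is handed
    -- down from the node. At a call it makes the parameters of the annotation distinct, hence the
    -- image of the record the whole domain.
    fn⊆domʳ : ∀ {Θ : PEnv n} {P 𝒢 x} → All (Wf ∘ proj₂) Θ → Θ ⊩ P ▹ 𝒢 → x ∈ fn P → x ∈ dom 𝒢
    fn⊆domʳ wf ax p = p
    fn⊆domʳ wf (call i) p = image⊆dom (proj₁ (All.head wf)) i p
    fn⊆domʳ wf (mix {P = P} {𝒢 = 𝒢} D E) p =
      [ ∈-dom-++⁺ˡ 𝒢 ∘ fn⊆dom D , ∈-dom-++⁺ʳ 𝒢 ∘ fn⊆dom E ]′ (∈-++⁻ (fn P) p)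
    fn⊆domʳ wf (cut {x = x} {P = P} {Γ} {Δ} {𝒢} D) p with ∈-∖⁻ (fn P ∖ x) p
    ... | q , z≢y with ∈-∖⁻ (fn P) q
    ... | q , z≢x with fn⊆dom D q
    ... | here refl = contradiction refl z≢x
    ... | there q with ∈-names-++⁻ Γ q
    ... | inj₁ q = ∈-names-++⁺ˡ (Γ ++ Δ) (∈-names-++⁺ˡ Γ q)
    ... | inj₂ (here refl) = contradiction refl z≢y
    ... | inj₂ (there q) = subst (λ Ξ → _ ∈ map proj₁ Ξ) (sym (List.++-assoc Γ Δ (concat 𝒢))) (∈-names-++⁺ʳ Γ q)
    fn⊆domʳ wf (chop E i D) p = fn⊆dom D p
    fn⊆domʳ wf (ten D) (here refl) = here refl
    fn⊆domʳ wf (ten {P = P} {Γ} {Δ} D) (there p) with ∈-∖⁻ (fn P) p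
    ... | q , z≢y with fn⊆dom D q
    ... | here refl = contradiction refl z≢y
    ... | there q with ∈-names-++⁻ Γ q
    ... | inj₁ q = there (∈-names-++⁺ˡ (Γ ++ Δ) (∈-names-++⁺ˡ Γ q))
    ... | inj₂ (here refl) = here refl
    ... | inj₂ (there q) = there (∈-names-++⁺ˡ (Γ ++ Δ) (∈-names-++⁺ʳ Γ (∈-dom-[]⁻ Δ q)))
    fn⊆domʳ wf (one D) (here refl) = here refl
    fn⊆domʳ wf (one D) (there p) = contradiction (fn⊆dom D p) λ ()
    fn⊆domʳ wf (par D) (here refl) = here refl
    fn⊆domʳ wf (par {P = P} D) (there p) with ∈-∖⁻ (fn P) p
    ... | q , z≢y with fn⊆dom D q
    ... | here refl = contradiction refl z≢y
    ... | there q = q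
    fn⊆domʳ wf (bot D) (here refl) = here refl
    fn⊆domʳ wf (bot D) (there p) = there (fn⊆dom D p)
    fn⊆domʳ wf (plus₁ D) (here refl) = here refl
    fn⊆domʳ wf (plus₁ D) (there p) = fn⊆dom D p
    fn⊆domʳ wf (plus₂ D) (here refl) = here refl
    fn⊆domʳ wf (plus₂ D) (there p) = fn⊆dom D p
    fn⊆domʳ wf (with′ D E) (here refl) = here refl
    fn⊆domʳ wf (with′ {P = P} D E) (there p) = [ fn⊆dom D , fn⊆dom E ]′ (∈-++⁻ (fn P) p)
    fn⊆domʳ wf (bang w D) (here refl) = here refl
    fn⊆domʳ wf (bang {P = P} w D) (there p) with ∈-∖⁻ (fn P) p
    ... | q , z≢y with fn⊆dom D q
    ... | here refl = contradiction refl z≢y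
    ... | there q = there q
    fn⊆domʳ wf (que D) (here refl) = here refl
    fn⊆domʳ wf (que {P = P} D) (there p) with ∈-∖⁻ (fn P) p
    ... | q , z≢y with fn⊆dom D q
    ... | here refl = contradiction refl z≢y
    ... | there q = there q
    fn⊆domʳ wf (weak D) (here refl) = here refl
    fn⊆domʳ wf (weak D) (there p) = there (fn⊆dom D p)
    fn⊆domʳ wf (contr D) (here refl) = here refl
    fn⊆domʳ wf (contr {x₁ = x₁} {P = P} D) (there p) with ∈-∖⁻ (fn P ∖ x₁) p
    ... | q , z≢x₂ with ∈-∖⁻ (fn P) q
    ... | q , z≢x₁ with fn⊆dom D q
    ... | here refl = contradiction refl z≢x₂
    ... | there (here refl) = contradiction refl z≢x₁
    ... | there (there q) = there q
    fn⊆domʳ wf (ex w D) (here refl) = here refl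
    fn⊆domʳ wf (ex w D) (there p) = fn⊆dom D p
    fn⊆domʳ wf (all D) (here refl) = here refl
    fn⊆domʳ wf (all {Γ = Γ} D) (there p) with fn⊆dom D p
    ... | here refl = here refl
    ... | there q = there (∈-names-++⁺ˡ Γ (subst (_ ∈_) (names-ren suc Γ) (∈-dom-[]⁻ (renᴱ suc Γ) q)))
    fn⊆domʳ wf (prov E i D) (here refl) = here refl
    fn⊆domʳ wf (prov E i D) (there p) = contradiction (fn⊆dom D p) λ ()
    fn⊆domʳ wf (asm D) (here refl) = here refl
    fn⊆domʳ wf (asm D) (there p) = there (fn⊆dom D p)

  ∈-dom-[]⁺ : ∀ {x : K} (Γ : Env K n) → x ∈ map proj₁ Γ → x ∈ dom (Γ ∷ [])
  ∈-dom-[]⁺ Γ = ∈-names-++⁺ˡ Γ {[]}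

  mutual
    -- At a binder, distinctness of the names in the premise separates the bound name from those
    -- that reach the conclusion, so none of the latter is removed.
    dom⊆fn : ∀ {Θ : PEnv n} {P 𝒢 x} → Θ ⊢ P ▹ 𝒢 → x ∈ dom 𝒢 → x ∈ fn P
    dom⊆fn (node r e f v) p = dom⊆fnʳ (wfᴾ-≋ (𝒫.↭-sym e) (Valid.wfΘ v)) r (↭.∈-resp-↭ (↭-sym (dom-↭ f)) p)

    dom⊆fnʳ : ∀ {Θ : PEnv n} {P 𝒢 x} → All (Wf ∘ proj₂) Θ → Θ ⊩ P ▹ 𝒢 → x ∈ dom 𝒢 → x ∈ fn P
    dom⊆fnʳ wf ax p = p
    dom⊆fnʳ wf (call i) p = ↭.∈-resp-↭ (↭-sym (≔-dom i (proj₁ (All.head wf)))) p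
    dom⊆fnʳ wf (mix {P = P} {𝒢 = 𝒢} D E) p = [ ∈-++⁺ˡ ∘ dom⊆fn D , ∈-++⁺ʳ (fn P) ∘ dom⊆fn E ]′ (∈-dom-++⁻ 𝒢 p)
    dom⊆fnʳ {x = z} wf (cut {x = x} {y} {A} {P} {Γ} {Δ} {𝒢} D) p = ∈-∖⁺ (∈-∖⁺ (dom⊆fn D (proj₁ z∈)) (proj₁ (proj₂ z∈))) (proj₂ (proj₂ z∈))
      where
      u = unique D

      y-unique = proj₁ (proj₂ (Unique-keys-++⁻ Γ (AllPairs.tail u)))

      z∈ : z ∈ dom (((x ∶ A) ∷ Γ) ∷ ((y ∶ A ᗮ) ∷ Δ) ∷ 𝒢) × z ≢ x × z ≢ y
      z∈ with ∈-names-++⁻ Γ (subst (λ Ξ → z ∈ map proj₁ Ξ) (List.++-assoc Γ Δ (concat 𝒢)) p)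
      ... | inj₁ q = let q′ = ∈-names-++⁺ˡ Γ q in
        there q′ , ∈⇒≢head u q′ ,
        λ { refl → proj₂ (proj₂ (Unique-keys-++⁻ Γ (AllPairs.tail u))) (q , here refl) }
      ... | inj₂ q = let q′ = ∈-names-++⁺ʳ Γ (there q) in there q′ , ∈⇒≢head u q′ , ∈⇒≢head y-unique q
    dom⊆fnʳ wf (chop E i D) p = dom⊆fn D p
    dom⊆fnʳ wf (ten D) (here refl) = here refl
    dom⊆fnʳ {x = z} wf (ten {x = x} {y} {P = P} {Γ} {Δ} D) (there p) with ∈-names-++⁻ Γ (∈-dom-[]⁻ (Γ ++ Δ) p)
    ... | inj₁ q = let q′ = ∈-names-++⁺ˡ Γ q in there (∈-∖⁺ (dom⊆fn D (there q′)) (∈⇒≢head (unique D) q′))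
    ... | inj₂ q = let q′ = ∈-names-++⁺ʳ Γ (there (∈-dom-[]⁺ Δ q)) in there (∈-∖⁺ (dom⊆fn D (there q′)) (∈⇒≢head (unique D) q′))
    dom⊆fnʳ wf (one D) (here refl) = here refl
    dom⊆fnʳ wf (par D) (here refl) = here refl
    dom⊆fnʳ wf (par D) (there p) = there (∈-∖⁺ (dom⊆fn D (there (there p))) (∈⇒≢head (unique D) (there p)))
    dom⊆fnʳ wf (bot D) (here refl) = here refl
    dom⊆fnʳ wf (bot D) (there p) = there (dom⊆fn D p)
    dom⊆fnʳ wf (plus₁ D) (here refl) = here refl
    dom⊆fnʳ wf (plus₁ D) (there p) = there (dom⊆fn D (there p))
    dom⊆fnʳ wf (plus₂ D) (here refl) = here refl
    dom⊆fnʳ wf (plus₂ D) (there p) = there (dom⊆fn D (there p))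
    dom⊆fnʳ wf (with′ D E) (here refl) = here refl
    dom⊆fnʳ wf (with′ D E) (there p) = there (∈-++⁺ˡ (dom⊆fn D (there p)))
    dom⊆fnʳ wf (bang w D) (here refl) = here refl
    dom⊆fnʳ wf (bang w D) (there p) = there (∈-∖⁺ (dom⊆fn D (there p)) (∈⇒≢head (unique D) p))
    dom⊆fnʳ wf (que D) (here refl) = here refl
    dom⊆fnʳ wf (que D) (there p) = there (∈-∖⁺ (dom⊆fn D (there p)) (∈⇒≢head (unique D) p))
    dom⊆fnʳ wf (weak D) (here refl) = here refl
    dom⊆fnʳ wf (weak D) (there p) = there (dom⊆fn D p)
    dom⊆fnʳ wf (contr D) (here refl) = here refl
    dom⊆fnʳ wf (contr D) (there p) =
      there (∈-∖⁺ (∈-∖⁺ (dom⊆fn D (there (there p))) (∈⇒≢head (AllPairs.tail (unique D)) p)) (∈⇒≢head (unique D) (there p)))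
    dom⊆fnʳ wf (ex w D) (here refl) = here refl
    dom⊆fnʳ wf (ex w D) (there p) = there (dom⊆fn D (there p))
    dom⊆fnʳ wf (all D) (here refl) = here refl
    dom⊆fnʳ wf (all {Γ = Γ} D) (there p) =
      there (dom⊆fn D (there (∈-dom-[]⁺ (renᴱ suc Γ) (subst (_ ∈_) (sym (names-ren suc Γ)) (∈-dom-[]⁻ Γ p)))))
    dom⊆fnʳ wf (prov E i D) (here refl) = here refl
    dom⊆fnʳ wf (asm D) (here refl) = here refl
    dom⊆fnʳ wf (asm D) (there p) = there (dom⊆fn D p)

  mutual
    fpv⊆ : ∀ {Θ : PEnv n} {P 𝒢 p} → Θ ⊢ P ▹ 𝒢 → p ∈ fpv P → p ∈ map proj₁ Θ
    fpv⊆ (node r e _ _) q = ↭.∈-resp-↭ (keys-↭ e) (fpv⊆ʳ r q)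

    fpv⊆ʳ : ∀ {Θ : PEnv n} {P 𝒢 p} → Θ ⊩ P ▹ 𝒢 → p ∈ fpv P → p ∈ map proj₁ Θ
    fpv⊆ʳ (call i) q = q
    fpv⊆ʳ (mix {Θ = Θ} {P = P} D E) q = [ ∈-names-++⁺ˡ Θ ∘ fpv⊆ D , ∈-names-++⁺ʳ Θ ∘ fpv⊆ E ]′ (∈-++⁻ (fpv P) q)
    fpv⊆ʳ (cut D) q = fpv⊆ D q
    fpv⊆ʳ (chop {Θ = Θ} {p = p} {Q = Q} E i D) q with ∈-++⁻ (fpv Q ∖ᵖ p) q
    ... | inj₂ r = ∈-names-++⁺ʳ Θ (fpv⊆ E r)
    ... | inj₁ r with ∈-∖ᵖ⁻ (fpv Q) r
    ... | s , ≢p with fpv⊆ D s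
    ... | here refl = contradiction refl ≢p
    ... | there t = ∈-names-++⁺ˡ Θ t
    fpv⊆ʳ (ten D) q = fpv⊆ D q
    fpv⊆ʳ (one D) q = fpv⊆ D q
    fpv⊆ʳ (par D) q = fpv⊆ D q
    fpv⊆ʳ (bot D) q = fpv⊆ D q
    fpv⊆ʳ (plus₁ D) q = fpv⊆ D q
    fpv⊆ʳ (plus₂ D) q = fpv⊆ D q
    fpv⊆ʳ (with′ {P = P} D E) q = [ fpv⊆ D , fpv⊆ E ]′ (∈-++⁻ (fpv P) q)
    fpv⊆ʳ (bang w D) q = fpv⊆ D q
    fpv⊆ʳ (que D) q = fpv⊆ D q
    fpv⊆ʳ (weak D) q = fpv⊆ D q
    fpv⊆ʳ (contr D) q = fpv⊆ D q
    fpv⊆ʳ (ex w D) q = fpv⊆ D q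
    fpv⊆ʳ (all {Θ = Θ} D) q = subst (_ ∈_) (keys-renᴾ suc Θ) (fpv⊆ D q)
    fpv⊆ʳ (prov {P = P} E i D) q = [ fpv⊆ E , (λ r → contradiction (fpv⊆ D r) λ ()) ]′ (∈-++⁻ (fpv P) q)
    fpv⊆ʳ (asm {p = p} {P = P} D) q with ∈-∖ᵖ⁻ (fpv P) q
    ... | r , ≢p with fpv⊆ D r
    ... | here refl = contradiction refl ≢p
    ... | there s = s

  mutual
    ⊆fpv : ∀ {Θ : PEnv n} {P 𝒢 p} → Θ ⊢ P ▹ 𝒢 → p ∈ map proj₁ Θ → p ∈ fpv P
    ⊆fpv (node r e _ _) q = ⊆fpvʳ r (↭.∈-resp-↭ (↭-sym (keys-↭ e)) q)

    ⊆fpvʳ : ∀ {Θ : PEnv n} {P 𝒢 p} → Θ ⊩ P ▹ 𝒢 → p ∈ map proj₁ Θ → p ∈ fpv P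
    ⊆fpvʳ (call i) q = q
    ⊆fpvʳ (mix {Θ = Θ} {P = P} D E) q = [ ∈-++⁺ˡ ∘ ⊆fpv D , ∈-++⁺ʳ (fpv P) ∘ ⊆fpv E ]′ (∈-names-++⁻ Θ q)
    ⊆fpvʳ (cut D) q = ⊆fpv D q
    ⊆fpvʳ (chop {Θ = Θ} {p = p} {Q = Q} E i D) q =
      [ (λ r → ∈-++⁺ˡ (∈-∖ᵖ⁺ (⊆fpv D (there r)) (∈⇒≢head (uniqueᴾ D) r))) , ∈-++⁺ʳ (fpv Q ∖ᵖ p) ∘ ⊆fpv E ]′ (∈-names-++⁻ Θ q)
    ⊆fpvʳ (ten D) q = ⊆fpv D q
    ⊆fpvʳ (one D) q = ⊆fpv D q
    ⊆fpvʳ (par D) q = ⊆fpv D q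
    ⊆fpvʳ (bot D) q = ⊆fpv D q
    ⊆fpvʳ (plus₁ D) q = ⊆fpv D q
    ⊆fpvʳ (plus₂ D) q = ⊆fpv D q
    ⊆fpvʳ (with′ D E) q = ∈-++⁺ˡ (⊆fpv D q)
    ⊆fpvʳ (que D) q = ⊆fpv D q
    ⊆fpvʳ (weak D) q = ⊆fpv D q
    ⊆fpvʳ (contr D) q = ⊆fpv D q
    ⊆fpvʳ (ex w D) q = ⊆fpv D q
    ⊆fpvʳ (all {Θ = Θ} D) q = ⊆fpv D (subst (_ ∈_) (sym (keys-renᴾ suc Θ)) q)
    ⊆fpvʳ (prov E i D) q = ∈-++⁺ˡ (⊆fpv E q)
    ⊆fpvʳ (asm D) q = ∈-∖ᵖ⁺ (⊆fpv D (there q)) (∈⇒≢head (uniqueᴾ D) q)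

  -- Renaming and instantiation of type variables

  infix 4 _⊨_injective
  -- Relative to a list, since neither `z / x` nor a renaming extended at a binder need be injective
  -- on all names; only the names that occur matter.
  _⊨_injective : {A B : Set} → List A → (A → B) → Set
  xs ⊨ σ injective = ∀ {x y} → x ∈ xs → y ∈ xs → σ x ≡ σ y → x ≡ y

  module _ {A B : Set} {σ : A → B} where

    Unique-map : ∀ {xs} → xs ⊨ σ injective → Unique xs → Unique (map σ xs)
    Unique-map inj []       = []
    Unique-map inj (x≢ ∷ u) =
      All.map⁺ (All.tabulate λ q e → All.lookup x≢ q (inj (here refl) (there q) e)) ∷
      Unique-map (λ p q → inj (there p) (there q)) u

  ↦-≡ : ∀ (σ : Name → Name) y z → (σ [ y ↦ z ]) y ≡ z
  ↦-≡ σ y z with y ≟ⁿ y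
  ... | yes _  = refl
  ... | no y≢y = contradiction refl y≢y

  ↦-≢ : ∀ (σ : Name → Name) {x y z} → x ≢ y → (σ [ y ↦ z ]) x ≡ σ x
  ↦-≢ σ {x} {y} x≢y with x ≟ⁿ y
  ... | yes x≡y = contradiction x≡y x≢y
  ... | no _    = refl

  fresh-∉ : ∀ xs → freshⁿ xs ∉ xs
  fresh-∉ = Atoms.fresh∉ 𝒩

  ↦-injective : ∀ {σ : Name → Name} {y y′} xs → xs ∖ y ⊨ σ injective → y′ ∉ map σ (xs ∖ y) → xs ⊨ σ [ y ↦ y′ ] injective
  ↦-injective {σ} {y} {y′} xs inj y′∉ {a} {b} p q with a ≟ⁿ y | b ≟ⁿ y
  ... | yes refl | yes refl = λ _ → refl
  ... | yes refl | no b≢y   = λ e → contradiction (subst (_∈ map σ (xs ∖ y)) (sym e) (∈-map⁺ σ (∈-∖⁺ q b≢y))) y′∉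
  ... | no a≢y   | yes refl = λ e → contradiction (subst (_∈ map σ (xs ∖ y)) e (∈-map⁺ σ (∈-∖⁺ p a≢y))) y′∉
  ... | no a≢y   | no b≢y   = inj (∈-∖⁺ p a≢y) (∈-∖⁺ q b≢y)

  ↦-fresh-injective : ∀ {σ : Name → Name} {y} xs → xs ∖ y ⊨ σ injective → xs ⊨ σ [ y ↦ freshⁿ (map σ (xs ∖ y)) ] injective
  ↦-fresh-injective xs inj = ↦-injective xs inj (fresh-∉ _)

  -- The override at `z` is outermost, so injectivity is first obtained away from `z`.
  -- Capture-avoiding renaming removes the two binders in the opposite order, which `swap-∖`
  -- reconciles.
  ↦↦-fresh-injective : ∀ {σ : Name → Name} {y z} xs → xs ∖ y ∖ z ⊨ σ injective →
                       let zs = map σ (xs ∖ y ∖ z)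
                           y′ = freshⁿ zs
                       in xs ⊨ σ [ y ↦ y′ ] [ z ↦ freshⁿ (y′ ∷ zs) ] injective
  ↦↦-fresh-injective {σ} {y} {z} xs inj =
    ↦-injective xs (↦-injective (xs ∖ z) (λ p q → inj (swap-∖ p) (swap-∖ q)) y′∉) z′∉
    where
    swap-∖ : ∀ {a} → a ∈ xs ∖ z ∖ y → a ∈ xs ∖ y ∖ z
    swap-∖ p = let q , ≢y = ∈-∖⁻ (xs ∖ z) p ; r , ≢z = ∈-∖⁻ xs q in ∈-∖⁺ (∈-∖⁺ r ≢y) ≢z

    zs = map σ (xs ∖ y ∖ z)
    y′ = freshⁿ zs

    y′∉ : y′ ∉ map σ (xs ∖ z ∖ y)
    y′∉ p with ∈-map⁻ σ p
    ... | _ , q , e = fresh-∉ zs (subst (_∈ zs) (sym e) (∈-map⁺ σ (swap-∖ q)))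

    z′∉ : freshⁿ (y′ ∷ zs) ∉ map (σ [ y ↦ y′ ]) (xs ∖ z)
    z′∉ p with ∈-map⁻ (σ [ y ↦ y′ ]) p
    ... | a , q , e with ∈-∖⁻ xs q
    ... | r , a≢z with a ≟ⁿ y
    ... | yes refl = fresh-∉ (y′ ∷ zs) (here e)
    ... | no a≢y   = fresh-∉ (y′ ∷ zs) (there (subst (_∈ zs) (sym e) (∈-map⁺ σ (∈-∖⁺ (∈-∖⁺ r a≢y) a≢z))))

  relabelᴱ-∉ : ∀ {σ : Name → Name} {y z} (Γ : Env Name n) → y ∉ map proj₁ Γ → relabelᴱ (σ [ y ↦ z ]) Γ ≡ relabelᴱ σ Γ
  relabelᴱ-∉ []            y∉ = refl
  relabelᴱ-∉ {σ = σ} (_ ∷ Γ) y∉ =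
    cong₂ _∷_ (cong (_, _) (↦-≢ σ λ { refl → y∉ (here refl) })) (relabelᴱ-∉ Γ (y∉ ∘ there))

  relabel-∉ : ∀ {σ : Name → Name} {y z} (𝒢 : HEnv Name n) → y ∉ dom 𝒢 → relabel (σ [ y ↦ z ]) 𝒢 ≡ relabel σ 𝒢
  relabel-∉ []      y∉ = refl
  relabel-∉ (Γ ∷ 𝒢) y∉ = cong₂ _∷_ (relabelᴱ-∉ Γ (y∉ ∘ ∈-names-++⁺ˡ Γ)) (relabel-∉ 𝒢 (y∉ ∘ ∈-names-++⁺ʳ Γ))

  -- Distinctness in the premise confines the override to the bound entry; all other names are still
  -- renamed by `σ`.
  relabel-bind : ∀ {σ : Name → Name} {y z A} (Γ : Env Name n) 𝒢 → Unique (dom (((y ∶ A) ∷ Γ) ∷ 𝒢)) →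
                 relabel (σ [ y ↦ z ]) (((y ∶ A) ∷ Γ) ∷ 𝒢) ≡ ((z ∶ A) ∷ relabelᴱ σ Γ) ∷ relabel σ 𝒢
  relabel-bind {σ = σ} {y} {z} Γ 𝒢 u =
    cong₂ _∷_ (cong₂ _∷_ (cong (_, _) (↦-≡ σ y z)) (relabelᴱ-∉ Γ (∉-head u ∘ ∈-names-++⁺ˡ Γ)))
              (relabel-∉ 𝒢 (∉-head u ∘ ∈-names-++⁺ʳ Γ))

  relabel-bind₂ : ∀ {σ : Name → Name} {x y x′ y′ A B} (Γ Δ : Env Name n) 𝒢 → Unique (dom (((x ∶ A) ∷ Γ) ∷ ((y ∶ B) ∷ Δ) ∷ 𝒢)) →
                  relabel (σ [ x ↦ x′ ] [ y ↦ y′ ]) (((x ∶ A) ∷ Γ) ∷ ((y ∶ B) ∷ Δ) ∷ 𝒢) ≡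
                  ((x′ ∶ A) ∷ relabelᴱ σ Γ) ∷ ((y′ ∶ B) ∷ relabelᴱ σ Δ) ∷ relabel σ 𝒢
  relabel-bind₂ {σ = σ} {x} {y} {x′} {y′} Γ Δ 𝒢 u@(_ ∷ u′) =
    cong₂ _∷_
      (trans (relabelᴱ-∉ ((x ∶ _) ∷ Γ) λ { (here refl) → ∉-head u (∈-names-++⁺ʳ Γ (here refl))
                                         ; (there p) → proj₂ (proj₂ (Unique-keys-++⁻ Γ u′)) (p , here refl) })
             (cong₂ _∷_ (cong (_, _) (↦-≡ σ x x′)) (relabelᴱ-∉ Γ (∉-head u ∘ ∈-names-++⁺ˡ Γ))))
      (trans (relabel-bind Δ 𝒢 (proj₁ (proj₂ (Unique-keys-++⁻ Γ u′))))
             (cong₂ _∷_ (cong (_ ∷_) (relabelᴱ-∉ Δ (x∉ ∘ ∈-names-++⁺ˡ Δ))) (relabel-∉ 𝒢 (x∉ ∘ ∈-names-++⁺ʳ Δ))))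
    where
    x∉ : x ∉ map proj₁ (Δ ++ concat 𝒢)
    x∉ = ∉-head u ∘ ∈-names-++⁺ʳ Γ ∘ there

  relabel-bind₂′ : ∀ {σ : Name → Name} {x y x′ y′ A B} (Γ : Env Name n) → Unique (dom (((y ∶ B) ∷ (x ∶ A) ∷ Γ) ∷ [])) →
                   relabel (σ [ x ↦ x′ ] [ y ↦ y′ ]) (((y ∶ B) ∷ (x ∶ A) ∷ Γ) ∷ []) ≡ ((y′ ∶ B) ∷ (x′ ∶ A) ∷ relabelᴱ σ Γ) ∷ []
  relabel-bind₂′ {x = x} {y′ = y′} {A} {B} Γ u =
    trans (relabel-bind ((x ∶ A) ∷ Γ) [] u)
          (cong (map ((y′ ∶ B) ∷_)) (relabel-bind Γ [] (AllPairs.tail u)))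

  relabel-++ : (f : K → L) (𝒢 ℋ : HEnv K n) → relabel f (𝒢 ++ ℋ) ≡ relabel f 𝒢 ++ relabel f ℋ
  relabel-++ f = List.map-++ (relabelᴱ f)

  relabelᴱ-++ : (f : K → L) (Γ Δ : Env K n) → relabelᴱ f (Γ ++ Δ) ≡ relabelᴱ f Γ ++ relabelᴱ f Δ
  relabelᴱ-++ f = List.map-++ (map₁ f)

  relabelᴱ-ren : (f : K → L) (r : Fin n → Fin m) (Γ : Env K n) → relabelᴱ f (renᴱ r Γ) ≡ renᴱ r (relabelᴱ f Γ)
  relabelᴱ-ren f r []      = refl
  relabelᴱ-ren f r (_ ∷ Γ) = cong (_ ∷_) (relabelᴱ-ren f r Γ)

  Wfᴱ-relabel : (f : K → L) (Γ : Env K n) → Wfᴱ Γ → Wfᴱ (relabelᴱ f Γ)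
  Wfᴱ-relabel f []      w       = tt
  Wfᴱ-relabel f (_ ∷ Γ) (v , w) = v , Wfᴱ-relabel f Γ w

  Wfᵗˢ-relabel : (f : K → L) (𝒢 : HEnv K n) → Wfᵗˢ 𝒢 → Wfᵗˢ (relabel f 𝒢)
  Wfᵗˢ-relabel f []      w       = tt
  Wfᵗˢ-relabel f (Γ ∷ 𝒢) (v , w) = Wfᴱ-relabel f Γ v , Wfᵗˢ-relabel f 𝒢 w

  Wf-relabel : {f : K → L} (𝒢 : HEnv K n) → dom 𝒢 ⊨ f injective → Wf 𝒢 → Wf (relabel f 𝒢)
  Wf-relabel {f = f} 𝒢 inj (u , w) = subst Unique (sym (dom-relabel f 𝒢)) (Unique-map inj u) , Wfᵗˢ-relabel f 𝒢 w

  -- Stated for any record `ρ′` that contains the renamed pairs, to cover both renaming, where `ρ′`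
  -- is a map of `ρ`, and α-equivalence, where `ρ′` may also list its pairs in another order.
  ≔-map : ∀ {σ : Name → Name} {𝒢 : HEnv Param n} {ρ ρ′ ℋ} → keys ρ′ ↭ keys ρ → (∀ {f x} → (f , x) ∈ ρ → (f , σ x) ∈ ρ′) →
          𝒢 ⟦ ρ ⟧≔ ℋ → 𝒢 ⟦ ρ′ ⟧≔ relabel σ ℋ
  ≔-map {n = n} {σ} {ρ = ρ} {ρ′} k h (ks , ps) = ↭-trans k ks , go ps
    where
    goᴱ : ∀ {Γ : Env Param n} {Δ} → Pointwise (λ b c → (proj₁ b , proj₁ c) ∈ ρ × proj₂ b ≡ proj₂ c) Γ Δ →
          Pointwise (λ b c → (proj₁ b , proj₁ c) ∈ ρ′ × proj₂ b ≡ proj₂ c) Γ (relabelᴱ σ Δ)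
    goᴱ []             = []
    goᴱ ((p , e) ∷ ps) = (h p , e) ∷ goᴱ ps

    go : ∀ {𝒢 : HEnv Param n} {ℋ} → Pointwise (Pointwise (λ b c → (proj₁ b , proj₁ c) ∈ ρ × proj₂ b ≡ proj₂ c)) 𝒢 ℋ →
         Pointwise (Pointwise (λ b c → (proj₁ b , proj₁ c) ∈ ρ′ × proj₂ b ≡ proj₂ c)) 𝒢 (relabel σ ℋ)
    go []       = []
    go (p ∷ ps) = goᴱ p ∷ go ps

  ≔-rename : ∀ {σ : Name → Name} {𝒢 : HEnv Param n} {ρ ℋ} → 𝒢 ⟦ ρ ⟧≔ ℋ → 𝒢 ⟦ map (map₂ σ) ρ ⟧≔ relabel σ ℋ
  ≔-rename {σ = σ} {ρ = ρ} = ≔-map (↭.↭-reflexive (sym (List.map-∘ ρ))) (∈-map⁺ (map₂ σ))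

  Is⁇-relabel : ∀ {σ : Name → Name} {Γ : Env Name n} → All Is⁇ Γ → All Is⁇ (relabelᴱ σ Γ)
  Is⁇-relabel []         = []
  Is⁇-relabel (is⁇ ∷ ws) = is⁇ ∷ Is⁇-relabel ws

  mutual
    -- Injectivity on the free names keeps the names of the judgement distinct, so the renamed node
    -- is valid. It survives passage under a binder because renaming chooses bound names outside the
    -- image of the other free names. Bodies of abstractions are closed for names and are kept.
    rename : ∀ {σ : Name → Name} {Θ : PEnv n} {P 𝒢 𝒢′} (D : Θ ⊢ P ▹ 𝒢) → fn P ⊨ σ injective → relabel σ 𝒢 ≋ 𝒢′ →
             ∃ λ (F : Θ ⊢ P ⟪ σ ⟫ ▹ 𝒢′) → D ⟨ σ ⟩⇝ F
    rename {σ = σ} D@(node r e f v) inj g =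
      let _ , r′ , h , s = renameʳ r inj
      in node r′ e (transᵖ h (transᵖ (relabel-≋ σ f) g))
           (record { distinct = Valid.distinct v ; wfΘ = Valid.wfΘ v
                   ; wf𝒢 = Wf-≋ g (Wf-relabel _ (λ p q → inj (dom⊆fn D p) (dom⊆fn D q)) (Valid.wf𝒢 v)) })
       , node s

    renameʳ : ∀ {σ : Name → Name} {Θ : PEnv n} {P 𝒢} (r : Θ ⊩ P ▹ 𝒢) → fn P ⊨ σ injective →
              ∃[ 𝒢′ ] ∃ λ (r′ : Θ ⊩ P ⟪ σ ⟫ ▹ 𝒢′) → 𝒢′ ≋ relabel σ 𝒢 × r ⟨ σ ⟩⇝ʳ r′
    renameʳ ax inj = _ , ax , ℋ.↭-refl , ax
    renameʳ mix₀ inj = _ , mix₀ , ℋ.↭-refl , mix₀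
    renameʳ (call i) inj = _ , call (≔-rename i) , ℋ.↭-refl , call
    renameʳ {σ = σ} (mix {P = P} {𝒢 = 𝒢} {ℋ} D E) inj =
      let D′ , s = rename D (λ p q → inj (∈-++⁺ˡ p) (∈-++⁺ˡ q)) ℋ.↭-refl
          E′ , t = rename E (λ p q → inj (∈-++⁺ʳ (fn P) p) (∈-++⁺ʳ (fn P) q)) ℋ.↭-refl
      in _ , mix D′ E′ , ℋ.↭-reflexive (sym (relabel-++ σ 𝒢 ℋ)) , mix s t
    renameʳ {σ = σ} (cut {P = P} {Γ} {Δ} {𝒢} D) inj =
      let D′ , s = rename D (↦↦-fresh-injective (fn P) inj) (ℋ.↭-reflexive (relabel-bind₂ Γ Δ 𝒢 (unique D)))
      in _ , cut D′ , ℋ.↭-reflexive (cong (_∷ relabel σ 𝒢) (sym (relabelᴱ-++ σ Γ Δ))) , cut s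
    renameʳ (chop E i D) inj =
      let D′ , s = rename D inj ℋ.↭-refl in _ , chop E i D′ , ℋ.↭-refl , chop s
    renameʳ {σ = σ} (ten {x = x} {B = B} {P = P} {Γ} {Δ} D) inj =
      let D′ , s = rename D (↦-fresh-injective (fn P) (λ p q → inj (there p) (there q)))
                     (ℋ.↭-reflexive (relabel-bind Γ (((x ∶ B) ∷ Δ) ∷ []) (unique D)))
      in _ , ten D′ , ℋ.↭-reflexive (cong (λ Ξ → (_ ∷ Ξ) ∷ []) (sym (relabelᴱ-++ σ Γ Δ))) , ten s
    renameʳ (one D) inj =
      let D′ , s = rename D (λ p q → inj (there p) (there q)) ℋ.↭-refl in _ , one D′ , ℋ.↭-refl , one s
    renameʳ (par {x = x} {B = B} {P = P} {Γ} D) inj =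
      let D′ , s = rename D (↦-fresh-injective (fn P) (λ p q → inj (there p) (there q)))
                     (ℋ.↭-reflexive (relabel-bind ((x ∶ B) ∷ Γ) [] (unique D)))
      in _ , par D′ , ℋ.↭-refl , par s
    renameʳ (bot D) inj =
      let D′ , s = rename D (λ p q → inj (there p) (there q)) ℋ.↭-refl in _ , bot D′ , ℋ.↭-refl , bot s
    renameʳ (plus₁ D) inj =
      let D′ , s = rename D (λ p q → inj (there p) (there q)) ℋ.↭-refl in _ , plus₁ D′ , ℋ.↭-refl , plus₁ s
    renameʳ (plus₂ D) inj =
      let D′ , s = rename D (λ p q → inj (there p) (there q)) ℋ.↭-refl in _ , plus₂ D′ , ℋ.↭-refl , plus₂ s
    renameʳ (with′ {P = P} D E) inj =
      let D′ , s = rename D (λ p q → inj (there (∈-++⁺ˡ p)) (there (∈-++⁺ˡ q))) ℋ.↭-refl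
          E′ , t = rename E (λ p q → inj (there (∈-++⁺ʳ (fn P) p)) (there (∈-++⁺ʳ (fn P) q))) ℋ.↭-refl
      in _ , with′ D′ E′ , ℋ.↭-refl , with′ s t
    renameʳ (bang {P = P} {Γ} w D) inj =
      let D′ , s = rename D (↦-fresh-injective (fn P) (λ p q → inj (there p) (there q)))
                     (ℋ.↭-reflexive (relabel-bind Γ [] (unique D)))
      in _ , bang (Is⁇-relabel w) D′ , ℋ.↭-refl , bang s
    renameʳ (que {P = P} {Γ} D) inj =
      let D′ , s = rename D (↦-fresh-injective (fn P) (λ p q → inj (there p) (there q)))
                     (ℋ.↭-reflexive (relabel-bind Γ [] (unique D)))
      in _ , que D′ , ℋ.↭-refl , que s
    renameʳ (weak D) inj =
      let D′ , s = rename D (λ p q → inj (there p) (there q)) ℋ.↭-refl in _ , weak D′ , ℋ.↭-refl , weak s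
    renameʳ (contr {P = P} {Γ} D) inj =
      let D′ , s = rename D (↦↦-fresh-injective (fn P) (λ p q → inj (there p) (there q)))
                     (ℋ.↭-reflexive (relabel-bind₂′ Γ (unique D)))
      in _ , contr D′ , ℋ.↭-refl , contr s
    renameʳ (ex {B = B} w D) inj =
      let D′ , s = rename D (λ p q → inj (there p) (there q)) ℋ.↭-refl in _ , ex {B = B} w D′ , ℋ.↭-refl , ex s
    renameʳ {σ = σ} (all {Θ = Θ} {Γ = Γ} D) inj =
      let D′ , s = rename D (λ p q → inj (there p) (there q))
                     (ℋ.↭-reflexive (cong (λ Ξ → (_ ∷ Ξ) ∷ []) (relabelᴱ-ren σ suc Γ)))
      in _ , all {Θ = Θ} D′ , ℋ.↭-refl , all s
    renameʳ (prov E i D) inj =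
      let D′ , s = rename D (λ p q → inj (there p) (there q)) ℋ.↭-refl in _ , prov E i D′ , ℋ.↭-refl , prov s
    renameʳ (asm D) inj =
      let D′ , s = rename D (λ p q → inj (there p) (there q)) ℋ.↭-refl in _ , asm D′ , ℋ.↭-refl , asm s

  -- Instantiation of type variables in derivations.

  subᴾ : (Fin n → Ty m) → PEnv n → PEnv m
  subᴾ ξ = map (map₂ (subᴴ ξ))

  subᴾ-≋ : ∀ (ξ : Fin n → Ty m) {Θ Θ′} → Θ ≋ᴾ Θ′ → subᴾ ξ Θ ≋ᴾ subᴾ ξ Θ′
  subᴾ-≋ ξ = Perm.map⁺ (pentryS _) (pentryS _) λ { (refl , p) → refl , sub-congᴴ (λ X → ≈-refl (ξ X)) p }

  keys-subᴾ : (ξ : Fin n → Ty m) (Θ : PEnv n) → map proj₁ (subᴾ ξ Θ) ≡ map proj₁ Θ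
  keys-subᴾ ξ []      = refl
  keys-subᴾ ξ (_ ∷ Θ) = cong (_ ∷_) (keys-subᴾ ξ Θ)

  subᴾ-lift-ren : (ξ : Fin n → Ty m) (Θ : PEnv n) → subᴾ (liftˢ ξ) (renᴾ suc Θ) ≡ renᴾ suc (subᴾ ξ Θ)
  subᴾ-lift-ren ξ []            = refl
  subᴾ-lift-ren ξ ((p ∶ 𝒢) ∷ Θ) = cong₂ _∷_ (cong (p ∶_) (sub-lift-ren-sucᴴ ξ 𝒢)) (subᴾ-lift-ren ξ Θ)

  subᴾ-single-ren : (A : Ty n) (Θ : PEnv n) → subᴾ (single A) (renᴾ suc Θ) ≡ Θ
  subᴾ-single-ren A []            = refl
  subᴾ-single-ren A ((p ∶ 𝒢) ∷ Θ) = cong₂ _∷_ (cong (p ∶_) (single-renᴴ A 𝒢)) (subᴾ-single-ren A Θ)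

  subᴱ-++ : (ξ : Fin n → Ty m) (Γ Δ : Env K n) → subᴱ ξ (Γ ++ Δ) ≡ subᴱ ξ Γ ++ subᴱ ξ Δ
  subᴱ-++ ξ []      Δ = refl
  subᴱ-++ ξ (_ ∷ Γ) Δ = cong (_ ∷_) (subᴱ-++ ξ Γ Δ)

  subᴴ-++ : (ξ : Fin n → Ty m) (𝒢 ℋ : HEnv K n) → subᴴ ξ (𝒢 ++ ℋ) ≡ subᴴ ξ 𝒢 ++ subᴴ ξ ℋ
  subᴴ-++ ξ []      ℋ = refl
  subᴴ-++ ξ (_ ∷ 𝒢) ℋ = cong (_ ∷_) (subᴴ-++ ξ 𝒢 ℋ)

  ≔-sub : ∀ {𝒢 : HEnv Param n} {ρ ℋ} (ξ : Fin n → Ty m) → 𝒢 ⟦ ρ ⟧≔ ℋ → subᴴ ξ 𝒢 ⟦ ρ ⟧≔ subᴴ ξ ℋ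
  ≔-sub {n = n} {𝒢 = 𝒢} {ρ} ξ (ks , ps) = subst (_ ↭_) (sym (dom-sub ξ 𝒢)) ks , go ps
    where
    goᴱ : ∀ {Γ : Env Param n} {Δ} → Pointwise (λ b c → (proj₁ b , proj₁ c) ∈ ρ × proj₂ b ≡ proj₂ c) Γ Δ →
          Pointwise (λ b c → (proj₁ b , proj₁ c) ∈ ρ × proj₂ b ≡ proj₂ c) (subᴱ ξ Γ) (subᴱ ξ Δ)
    goᴱ []             = []
    goᴱ ((p , e) ∷ ps) = (p , cong (sub ξ) e) ∷ goᴱ ps

    go : ∀ {𝒢 : HEnv Param n} {ℋ} → Pointwise (Pointwise (λ b c → (proj₁ b , proj₁ c) ∈ ρ × proj₂ b ≡ proj₂ c)) 𝒢 ℋ →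
         Pointwise (Pointwise (λ b c → (proj₁ b , proj₁ c) ∈ ρ × proj₂ b ≡ proj₂ c)) (subᴴ ξ 𝒢) (subᴴ ξ ℋ)
    go []       = []
    go (p ∷ ps) = goᴱ p ∷ go ps

  Is⁇-sub : ∀ {ξ : Fin n → Ty m} {Γ : Env Name n} → All Is⁇ Γ → All Is⁇ (subᴱ ξ Γ)
  Is⁇-sub []         = []
  Is⁇-sub (is⁇ ∷ ws) = is⁇ ∷ Is⁇-sub ws

  Valid-sub : ∀ {ξ : Fin n → Ty m} {Θ 𝒢} → (∀ X → Wfᵗ (ξ X)) → Valid Θ 𝒢 → Valid (subᴾ ξ Θ) (subᴴ ξ 𝒢)
  Valid-sub {ξ = ξ} {Θ} {𝒢} h v = record
    { distinct = subst Unique (sym (keys-subᴾ ξ Θ)) (Valid.distinct v)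
    ; wfΘ      = All.map⁺ (All.map (Wfᵗ-subᴴ h _) (Valid.wfΘ v))
    ; wf𝒢      = Wfᵗ-subᴴ h 𝒢 (Valid.wf𝒢 v) }

  Valid-≋ : ∀ {Θ Θ′ : PEnv n} {𝒢 𝒢′} → Θ ≋ᴾ Θ′ → 𝒢 ≋ 𝒢′ → Valid Θ 𝒢 → Valid Θ′ 𝒢′
  Valid-≋ p q v = record
    { distinct = Unique-↭ (keys-↭ p) (Valid.distinct v) ; wfΘ = wfᴾ-≋ p (Valid.wfΘ v) ; wf𝒢 = Wf-≋ q (Valid.wf𝒢 v) }

  mutual
    -- The judgement of the result is free up to reordering: substituted conclusions match the shape
    -- demanded by a rule only through the laws on duality, instances and weakening, and the caller
    -- absorbs these equations here.
    instantiate : ∀ {ξ : Fin n → Ty m} {Θ Θ′ P 𝒢 𝒢′} → (∀ X → Wfᵗ (ξ X)) → (D : Θ ⊢ P ▹ 𝒢) →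
                  subᴾ ξ Θ ≋ᴾ Θ′ → subᴴ ξ 𝒢 ≋ 𝒢′ → ∃ λ (F : Θ′ ⊢ subProc ξ P ▹ 𝒢′) → D ⟨ ξ ⟩⇝ᵗ F
    instantiate {ξ = ξ} h (node r e f v) p q =
      let _ , _ , r′ , a , b , s = instantiateʳ h r
      in node r′ (transᵖ a (transᵖ (subᴾ-≋ ξ e) p)) (transᵖ b (transᵖ (sub-congᴴ (λ X → ≈-refl (ξ X)) f) q))
           (Valid-≋ p q (Valid-sub h v))
       , node s

    instantiateʳ : ∀ {ξ : Fin n → Ty m} {Θ P 𝒢} → (∀ X → Wfᵗ (ξ X)) → (r : Θ ⊩ P ▹ 𝒢) →
                   ∃[ Θ′ ] ∃[ 𝒢′ ] ∃ λ (r′ : Θ′ ⊩ subProc ξ P ▹ 𝒢′) → Θ′ ≋ᴾ subᴾ ξ Θ × 𝒢′ ≋ subᴴ ξ 𝒢 × r ⟨ ξ ⟩⇝ᵗʳ r′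
    instantiateʳ {ξ = ξ} h (ax {x} {y} {A}) =
      _ , _ , ax , 𝒫.↭-refl , ℋ.↭-reflexive (cong (λ B → ((x ∶ B) ∷ (y ∶ sub ξ A) ∷ []) ∷ []) (sym (sub-ᗮ ξ A))) , ax
    instantiateʳ h mix₀ = _ , _ , mix₀ , 𝒫.↭-refl , ℋ.↭-refl , mix₀
    instantiateʳ {ξ = ξ} h (call i) = _ , _ , call (≔-sub ξ i) , 𝒫.↭-refl , ℋ.↭-refl , call
    instantiateʳ {ξ = ξ} h (mix {Θ} {Π} {𝒢 = 𝒢} {ℋ} D E) =
      let D′ , s = instantiate h D 𝒫.↭-refl ℋ.↭-refl
          E′ , t = instantiate h E 𝒫.↭-refl ℋ.↭-refl
      in _ , _ , mix D′ E′ , 𝒫.↭-reflexive (sym (List.map-++ (map₂ (subᴴ ξ)) Θ Π)) , ℋ.↭-reflexive (sym (subᴴ-++ ξ 𝒢 ℋ)) , mix s t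
    instantiateʳ {ξ = ξ} h (cut {x = x} {y} {A} {Γ = Γ} {Δ} {𝒢} D) =
      let D′ , s = instantiate h D 𝒫.↭-refl
                     (ℋ.↭-reflexive (cong (λ B → ((x ∶ sub ξ A) ∷ subᴱ ξ Γ) ∷ ((y ∶ B) ∷ subᴱ ξ Δ) ∷ subᴴ ξ 𝒢) (sub-ᗮ ξ A)))
      in _ , _ , cut D′ , 𝒫.↭-refl , ℋ.↭-reflexive (cong (_∷ subᴴ ξ 𝒢) (sym (subᴱ-++ ξ Γ Δ))) , cut s
    instantiateʳ {ξ = ξ} h (chop {Θ} {Π} E i D) =
      let E′ , s = instantiate h E 𝒫.↭-refl ℋ.↭-refl
          D′ , t = instantiate h D 𝒫.↭-refl ℋ.↭-refl
      in _ , _ , chop E′ (≔-sub ξ i) D′ , 𝒫.↭-reflexive (sym (List.map-++ (map₂ (subᴴ ξ)) Θ Π)) , ℋ.↭-refl , chop s t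
    instantiateʳ {ξ = ξ} h (ten {Γ = Γ} {Δ} D) =
      let D′ , s = instantiate h D 𝒫.↭-refl ℋ.↭-refl
      in _ , _ , ten D′ , 𝒫.↭-refl , ℋ.↭-reflexive (cong (λ Ξ → (_ ∷ Ξ) ∷ []) (sym (subᴱ-++ ξ Γ Δ))) , ten s
    instantiateʳ h (one D) =
      let D′ , s = instantiate h D 𝒫.↭-refl ℋ.↭-refl in _ , _ , one D′ , 𝒫.↭-refl , ℋ.↭-refl , one s
    instantiateʳ h (par D) =
      let D′ , s = instantiate h D 𝒫.↭-refl ℋ.↭-refl in _ , _ , par D′ , 𝒫.↭-refl , ℋ.↭-refl , par s
    instantiateʳ h (bot D) =
      let D′ , s = instantiate h D 𝒫.↭-refl ℋ.↭-refl in _ , _ , bot D′ , 𝒫.↭-refl , ℋ.↭-refl , bot s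
    instantiateʳ h (plus₁ D) =
      let D′ , s = instantiate h D 𝒫.↭-refl ℋ.↭-refl in _ , _ , plus₁ D′ , 𝒫.↭-refl , ℋ.↭-refl , plus₁ s
    instantiateʳ h (plus₂ D) =
      let D′ , s = instantiate h D 𝒫.↭-refl ℋ.↭-refl in _ , _ , plus₂ D′ , 𝒫.↭-refl , ℋ.↭-refl , plus₂ s
    instantiateʳ h (with′ D E) =
      let D′ , s = instantiate h D 𝒫.↭-refl ℋ.↭-refl
          E′ , t = instantiate h E 𝒫.↭-refl ℋ.↭-refl
      in _ , _ , with′ D′ E′ , 𝒫.↭-refl , ℋ.↭-refl , with′ s t
    instantiateʳ h (bang w D) =
      let D′ , s = instantiate h D 𝒫.↭-refl ℋ.↭-refl in _ , _ , bang (Is⁇-sub w) D′ , 𝒫.↭-refl , ℋ.↭-refl , bang s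
    instantiateʳ h (que D) =
      let D′ , s = instantiate h D 𝒫.↭-refl ℋ.↭-refl in _ , _ , que D′ , 𝒫.↭-refl , ℋ.↭-refl , que s
    instantiateʳ h (weak D) =
      let D′ , s = instantiate h D 𝒫.↭-refl ℋ.↭-refl in _ , _ , weak D′ , 𝒫.↭-refl , ℋ.↭-refl , weak s
    instantiateʳ h (contr D) =
      let D′ , s = instantiate h D 𝒫.↭-refl ℋ.↭-refl in _ , _ , contr D′ , 𝒫.↭-refl , ℋ.↭-refl , contr s
    instantiateʳ {ξ = ξ} h (ex {x = x} {A} {B} {Γ = Γ} w D) =
      let D′ , s = instantiate h D 𝒫.↭-refl (ℋ.↭-reflexive (cong (λ C → ((x ∶ C) ∷ subᴱ ξ Γ) ∷ []) (sub-[]ᵗ ξ B A)))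
      in _ , _ , ex {B = sub (liftˢ ξ) B} (Wfᵗ-sub h A w) D′ , 𝒫.↭-refl , ℋ.↭-refl , ex s
    instantiateʳ {ξ = ξ} h (all {Θ} {x} {B} {Γ = Γ} D) =
      let D′ , s = instantiate (Wfᵗ-lift h) D (𝒫.↭-reflexive (subᴾ-lift-ren ξ Θ))
                     (ℋ.↭-reflexive (cong (λ Ξ → ((x ∶ sub (liftˢ ξ) B) ∷ Ξ) ∷ []) (sub-lift-ren-sucᴱ ξ Γ)))
      in _ , _ , all {Θ = subᴾ ξ Θ} {Γ = subᴱ ξ Γ} D′ , 𝒫.↭-refl , ℋ.↭-refl , all s
    instantiateʳ {ξ = ξ} h (prov E i D) =
      let E′ , s = instantiate h E 𝒫.↭-refl ℋ.↭-refl
          D′ , t = instantiate h D 𝒫.↭-refl ℋ.↭-refl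
      in _ , _ , prov E′ (≔-sub ξ i) D′ , 𝒫.↭-refl , ℋ.↭-refl , prov s t
    instantiateʳ h (asm D) =
      let D′ , s = instantiate h D 𝒫.↭-refl ℋ.↭-refl in _ , _ , asm D′ , 𝒫.↭-refl , ℋ.↭-refl , asm s

  -- α-equivalence

  module _ {A : Set} where

    ~-injective : ∀ {β : List (A × A)} {x y z} → β ⊢ x ~ z → β ⊢ y ~ z → x ≡ y
    ~-injective free          free          = refl
    ~-injective here          here          = refl
    ~-injective here          (there _ ≢ _) = contradiction refl ≢
    ~-injective (there _ ≢ _) here          = contradiction refl ≢
    ~-injective (there _ _ p) (there _ _ q) = ~-injective p q

    ~-strip : ∀ {β : List (A × A)} {a b x y} → ((a , b) ∷ β) ⊢ x ~ y → x ≢ a → β ⊢ x ~ y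
    ~-strip here          x≢a = contradiction refl x≢a
    ~-strip (there _ _ p) _   = p

  -- The renaming denoted by a list of paired binders. It turns α-equivalence into an instance of
  -- relabelling, the innermost pair taking precedence.
  apply : List (Name × Name) → Name → Name
  apply []            x = x
  apply ((a , b) ∷ β)   = apply β [ a ↦ b ]

  ~⇒apply : ∀ {β x y} → β ⊢ x ~ y → apply β x ≡ y
  ~⇒apply free            = refl
  ~⇒apply {(a , b) ∷ β} here            = ↦-≡ (apply β) a b
  ~⇒apply {_ ∷ β} (there ≢ _ p) = trans (↦-≢ (apply β) ≢) (~⇒apply p)

  _[_↦_]ᵖ : (PVar → PVar) → PVar → PVar → PVar → PVar
  (σ [ y ↦ z ]ᵖ) x with x ≟ᵖ y
  ... | yes _ = z
  ... | no  _ = σ x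

  ↦-≡ᵖ : ∀ (σ : PVar → PVar) y z → (σ [ y ↦ z ]ᵖ) y ≡ z
  ↦-≡ᵖ σ y z with y ≟ᵖ y
  ... | yes _  = refl
  ... | no y≢y = contradiction refl y≢y

  ↦-≢ᵖ : ∀ (σ : PVar → PVar) {x y z} → x ≢ y → (σ [ y ↦ z ]ᵖ) x ≡ σ x
  ↦-≢ᵖ σ {x} {y} x≢y with x ≟ᵖ y
  ... | yes x≡y = contradiction x≡y x≢y
  ... | no _    = refl

  applyᵖ : List (PVar × PVar) → PVar → PVar
  applyᵖ []            x = x
  applyᵖ ((a , b) ∷ π)   = applyᵖ π [ a ↦ b ]ᵖ

  ~⇒applyᵖ : ∀ {π p q} → π ⊢ p ~ q → applyᵖ π p ≡ q
  ~⇒applyᵖ free          = refl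
  ~⇒applyᵖ {(a , b) ∷ π} here          = ↦-≡ᵖ (applyᵖ π) a b
  ~⇒applyᵖ {_ ∷ π} (there ≢ _ p) = trans (↦-≢ᵖ (applyᵖ π) ≢) (~⇒applyᵖ p)

  ≐-image : ∀ {γ ρ ρ′} → γ ⊢ ρ ≐ ρ′ → map proj₁ γ ≡ image ρ
  ≐-image []         = refl
  ≐-image (cons _ s) = cong (_ ∷_) (≐-image s)

  ≐-keys : ∀ {γ ρ ρ′} → γ ⊢ ρ ≐ ρ′ → keys ρ′ ↭ keys ρ
  ≐-keys []         = ↭-refl
  ≐-keys (cons p s) = ↭-trans (↭.map⁺ proj₁ p) (prep _ (≐-keys s))

  ≐-∈ : ∀ {γ ρ ρ′ f x} → γ ⊢ ρ ≐ ρ′ → (f , x) ∈ ρ → ∃[ y ] (f , y) ∈ ρ′ × (x , y) ∈ γ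
  ≐-∈ (cons p s) (here refl) = _ , ↭.∈-resp-↭ (↭-sym p) (here refl) , here refl
  ≐-∈ (cons p s) (there q)   = let y , r , t = ≐-∈ s q in y , ↭.∈-resp-↭ (↭-sym p) (there r) , there t

  apply-∈ : ∀ {γ x y} → Unique (map proj₁ γ) → (x , y) ∈ γ → apply γ x ≡ y
  apply-∈ {(a , b) ∷ γ} u (here refl) = ↦-≡ (apply γ) a b
  apply-∈ {_ ∷ γ} u@(_ ∷ u′) (there p) = trans (↦-≢ (apply γ) (∈⇒≢head u (∈-map⁺ proj₁ p))) (apply-∈ u′ p)

  fn-~ : ∀ {β π} {P Q : Proc n} {x} → β ∣ π ⊢ P ~ᴾ Q → x ∈ fn P → ∃[ y ] β ⊢ x ~ y
  fn-~ (send x~ s) (here refl) = _ , x~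
  fn-~ (send {P = P} x~ s) (there p) = let q , ≢ = ∈-∖⁻ (fn P) p ; _ , r = fn-~ s q in _ , ~-strip r ≢
  fn-~ (recv x~ s) (here refl) = _ , x~
  fn-~ (recv {P = P} x~ s) (there p) = let q , ≢ = ∈-∖⁻ (fn P) p ; _ , r = fn-~ s q in _ , ~-strip r ≢
  fn-~ (serve x~ s) (here refl) = _ , x~
  fn-~ (serve {P = P} x~ s) (there p) = let q , ≢ = ∈-∖⁻ (fn P) p ; _ , r = fn-~ s q in _ , ~-strip r ≢
  fn-~ (use x~ s) (here refl) = _ , x~
  fn-~ (use {P = P} x~ s) (there p) = let q , ≢ = ∈-∖⁻ (fn P) p ; _ , r = fn-~ s q in _ , ~-strip r ≢
  fn-~ (close x~ s) (here refl) = _ , x~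
  fn-~ (close x~ s) (there p) = fn-~ s p
  fn-~ (wait x~ s) (here refl) = _ , x~
  fn-~ (wait x~ s) (there p) = fn-~ s p
  fn-~ (inl x~ s) (here refl) = _ , x~
  fn-~ (inl x~ s) (there p) = fn-~ s p
  fn-~ (inr x~ s) (here refl) = _ , x~
  fn-~ (inr x~ s) (there p) = fn-~ s p
  fn-~ (disp x~ s) (here refl) = _ , x~
  fn-~ (disp x~ s) (there p) = fn-~ s p
  fn-~ (recvT x~ s) (here refl) = _ , x~
  fn-~ (recvT x~ s) (there p) = fn-~ s p
  fn-~ (sendT x~ _ s) (here refl) = _ , x~
  fn-~ (sendT x~ _ s) (there p) = fn-~ s p
  fn-~ (case x~ s t) (here refl) = _ , x~
  fn-~ (case {P = P} x~ s t) (there p) = [ fn-~ s , fn-~ t ]′ (∈-++⁻ (fn P) p)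
  fn-~ (dup x~ s) (here refl) = _ , x~
  fn-~ (dup {y = y} {P = P} x~ s) (there p) =
    let q , ≢z = ∈-∖⁻ (fn P ∖ y) p ; r , ≢y = ∈-∖⁻ (fn P) q ; _ , t = fn-~ s r in _ , ~-strip (~-strip t ≢z) ≢y
  fn-~ (ν {x = x} {P = P} s) p =
    let q , ≢y = ∈-∖⁻ (fn P ∖ x) p ; r , ≢x = ∈-∖⁻ (fn P) q ; _ , t = fn-~ s r in _ , ~-strip (~-strip t ≢y) ≢x
  fn-~ (ν-comm {x = x} {P = P} s) p =
    let q , ≢y = ∈-∖⁻ (fn P ∖ x) p ; r , ≢x = ∈-∖⁻ (fn P) q ; _ , t = fn-~ s r in _ , ~-strip (~-strip t ≢y) ≢x
  fn-~ (_∥_ {P = P} s t) p = [ fn-~ s , fn-~ t ]′ (∈-++⁻ (fn P) p)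
  fn-~ (link x~ y~) (here refl) = _ , x~
  fn-~ (link x~ y~) (there (here refl)) = _ , y~
  fn-~ (provide x~ _ s t) (here refl) = _ , x~
  fn-~ (provide x~ _ s t) (there p) = fn-~ t p
  fn-~ (assume x~ s) (here refl) = _ , x~
  fn-~ (assume x~ s) (there p) = fn-~ s p
  fn-~ (call _ _ ρ≐ γ~) p with ∈-map⁻ proj₁ (subst (_ ∈_) (sym (≐-image ρ≐)) p)
  ... | _ , q , refl = _ , All.lookup γ~ q
  fn-~ (chop s _ _) p = fn-~ s p

  fpv-~ : ∀ {β π} {P Q : Proc n} {x} → β ∣ π ⊢ P ~ᴾ Q → x ∈ fpv P → ∃[ y ] π ⊢ x ~ y
  fpv-~ (send _ s) p = fpv-~ s p
  fpv-~ (recv _ s) p = fpv-~ s p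
  fpv-~ (serve _ s) p = fpv-~ s p
  fpv-~ (use _ s) p = fpv-~ s p
  fpv-~ (close _ s) p = fpv-~ s p
  fpv-~ (wait _ s) p = fpv-~ s p
  fpv-~ (inl _ s) p = fpv-~ s p
  fpv-~ (inr _ s) p = fpv-~ s p
  fpv-~ (disp _ s) p = fpv-~ s p
  fpv-~ (recvT _ s) p = fpv-~ s p
  fpv-~ (dup _ s) p = fpv-~ s p
  fpv-~ (ν s) p = fpv-~ s p
  fpv-~ (ν-comm s) p = fpv-~ s p
  fpv-~ (sendT _ _ s) p = fpv-~ s p
  fpv-~ (case {P = P} _ s t) p = [ fpv-~ s , fpv-~ t ]′ (∈-++⁻ (fpv P) p)
  fpv-~ (_∥_ {P = P} s t) p = [ fpv-~ s , fpv-~ t ]′ (∈-++⁻ (fpv P) p)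
  fpv-~ (provide {P = P} _ _ s t) p = [ fpv-~ s , fpv-~ t ]′ (∈-++⁻ (fpv P) p)
  fpv-~ (assume {P = P} _ s) p = let q , ≢ = ∈-∖ᵖ⁻ (fpv P) p ; _ , r = fpv-~ s q in _ , ~-strip r ≢
  fpv-~ (call p~ _ _ _) (here refl) = _ , p~
  fpv-~ (chop {p = p} {Q = Q} s _ t) q =
    [ (λ r → let r′ , ≢ = ∈-∖ᵖ⁻ (fpv Q) r ; _ , u = fpv-~ s r′ in _ , ~-strip u ≢) , fpv-~ t ]′ (∈-++⁻ (fpv Q ∖ᵖ p) q)

  apply-~ : ∀ {β π} {P Q : Proc n} {x} → β ∣ π ⊢ P ~ᴾ Q → x ∈ fn P → β ⊢ x ~ apply β x
  apply-~ {β = β} s p = let _ , r = fn-~ s p in subst (β ⊢ _ ~_) (sym (~⇒apply r)) r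

  applyᵖ-~ : ∀ {β π} {P Q : Proc n} {p} → β ∣ π ⊢ P ~ᴾ Q → p ∈ fpv P → π ⊢ p ~ applyᵖ π p
  applyᵖ-~ {π = π} s p = let _ , r = fpv-~ s p in subst (π ⊢ _ ~_) (sym (~⇒applyᵖ r)) r

  -- Both names are paired with a common partner, and the shadowing conditions of `_⊢_~_` make such
  -- partners unique in each direction.
  apply-injective : ∀ {β π} {P Q : Proc n} → β ∣ π ⊢ P ~ᴾ Q → fn P ⊨ apply β injective
  apply-injective {β = β} s p q e = ~-injective (apply-~ s p) (subst (β ⊢ _ ~_) (sym e) (apply-~ s q))

  applyᵖ-injective : ∀ {β π} {P Q : Proc n} → β ∣ π ⊢ P ~ᴾ Q → fpv P ⊨ applyᵖ π injective
  applyᵖ-injective {π = π} s p q e = ~-injective (applyᵖ-~ s p) (subst (π ⊢ _ ~_) (sym e) (applyᵖ-~ s q))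

  ≔-≐ : ∀ {𝒢 : HEnv Param n} {γ ρ ρ′ ℋ} → γ ⊢ ρ ≐ ρ′ → Unique (image ρ) → 𝒢 ⟦ ρ ⟧≔ ℋ → 𝒢 ⟦ ρ′ ⟧≔ relabel (apply γ) ℋ
  ≔-≐ {ρ′ = ρ′} s u = ≔-map (≐-keys s) λ p → let y , q , r = ≐-∈ s p in
    subst (λ z → (_ , z) ∈ ρ′) (sym (apply-∈ (subst Unique (sym (≐-image s)) u) r)) q

  relabelᴾ : (PVar → PVar) → PEnv n → PEnv n
  relabelᴾ g = map (map₁ g)

  relabelᴾ-≋ : (g : PVar → PVar) {Θ Π : PEnv n} → Θ ≋ᴾ Π → relabelᴾ g Θ ≋ᴾ relabelᴾ g Π
  relabelᴾ-≋ g = Perm.map⁺ (pentryS _) (pentryS _) λ { (refl , p) → refl , p }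

  relabelᴾ-ren : (g : PVar → PVar) (r : Fin n → Fin m) (Θ : PEnv n) → relabelᴾ g (renᴾ r Θ) ≡ renᴾ r (relabelᴾ g Θ)
  relabelᴾ-ren g r []      = refl
  relabelᴾ-ren g r (_ ∷ Θ) = cong (_ ∷_) (relabelᴾ-ren g r Θ)

  relabelᴾ-∉ : ∀ {g p q} (Θ : PEnv n) → p ∉ map proj₁ Θ → relabelᴾ (g [ p ↦ q ]ᵖ) Θ ≡ relabelᴾ g Θ
  relabelᴾ-∉ []      p∉ = refl
  relabelᴾ-∉ {g = g} (_ ∷ Θ) p∉ = cong₂ _∷_ (cong (_, _) (↦-≢ᵖ g λ { refl → p∉ (here refl) })) (relabelᴾ-∉ Θ (p∉ ∘ there))

  relabelᴾ-bind : ∀ {g p q ℋ} (Θ : PEnv n) → Unique (map proj₁ ((p ∶ ℋ) ∷ Θ)) →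
                  relabelᴾ (g [ p ↦ q ]ᵖ) ((p ∶ ℋ) ∷ Θ) ≡ (q ∶ ℋ) ∷ relabelᴾ g Θ
  relabelᴾ-bind {g = g} {p} {q} Θ u = cong₂ _∷_ (cong (_, _) (↦-≡ᵖ g p q)) (relabelᴾ-∉ Θ (∉-head u))

  keys-relabelᴾ : (g : PVar → PVar) (Θ : PEnv n) → map proj₁ (relabelᴾ g Θ) ≡ map g (map proj₁ Θ)
  keys-relabelᴾ g []      = refl
  keys-relabelᴾ g (_ ∷ Θ) = cong (_ ∷_) (keys-relabelᴾ g Θ)

  wfᴾ-relabel : ∀ {g} {Θ : PEnv n} → All (Wf ∘ proj₂) Θ → All (Wf ∘ proj₂) (relabelᴾ g Θ)
  wfᴾ-relabel []       = []
  wfᴾ-relabel (w ∷ ws) = w ∷ wfᴾ-relabel ws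

  Valid-~ : ∀ {β π} {P Q : Proc n} {Θ 𝒢} → β ∣ π ⊢ P ~ᴾ Q → Θ ⊢ P ▹ 𝒢 → Valid (relabelᴾ (applyᵖ π) Θ) (relabel (apply β) 𝒢)
  Valid-~ {π = π} {Θ = Θ} {𝒢} s D = record
    { distinct = subst Unique (sym (keys-relabelᴾ (applyᵖ π) Θ))
                   (Unique-map (λ p q → applyᵖ-injective s (⊆fpv D p) (⊆fpv D q)) (uniqueᴾ D))
    ; wfΘ      = wfᴾ-relabel (Valid.wfΘ (valid D))
    ; wf𝒢      = Wf-relabel 𝒢 (λ p q → apply-injective s (dom⊆fn D p) (dom⊆fn D q)) (Valid.wf𝒢 (valid D)) }

  Unique-image : ∀ {𝒢 : HEnv Param n} {ρ ℋ} → Unique (dom 𝒢) → Unique (dom ℋ) → 𝒢 ⟦ ρ ⟧≔ ℋ → Unique (image ρ)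
  Unique-image u v i = Unique-↭ (↭-sym (≔-dom i u)) v

  single-cong : {A A′ : Ty n} → A ≈ A′ → ∀ X → single A X ≈ single A′ X
  single-cong p zero    = p
  single-cong p (suc X) = var X

  Rule~ : List (Name × Name) → List (PVar × PVar) → Proc n → PEnv n → HEnv Name n → Set
  Rule~ β π Q Θ 𝒢 = ∃[ Θ′ ] ∃[ 𝒢′ ] Θ′ ⊩ Q ▹ 𝒢′ × Θ′ ≋ᴾ relabelᴾ (applyᵖ π) Θ × 𝒢′ ≋ relabel (apply β) 𝒢

  mutual
    -- α-equivalence generalized to open scopes, so that induction passes through binders: the
    -- judgement is carried along by the renamings that `β` and `π` denote. At the top level both
    -- are the identity.
    ~-typing : ∀ {β π} {P Q : Proc n} {Θ Θ′ 𝒢 𝒢′} → β ∣ π ⊢ P ~ᴾ Q → Θ ⊢ P ▹ 𝒢 →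
               relabelᴾ (applyᵖ π) Θ ≋ᴾ Θ′ → relabel (apply β) 𝒢 ≋ 𝒢′ → Θ′ ⊢ Q ▹ 𝒢′
    ~-typing {β = β} {π} s D@(node r e f v) p q =
      let _ , _ , r′ , a , b = ~-typingʳ s r (wfᴾ-≋ (𝒫.↭-sym e) (Valid.wfΘ v)) (Wf-≋ (ℋ.↭-sym f) (Valid.wf𝒢 v))
      in node r′ (transᵖ a (transᵖ (relabelᴾ-≋ (applyᵖ π) e) p)) (transᵖ b (transᵖ (relabel-≋ (apply β) f) q))
           (Valid-≋ p q (Valid-~ s D))

    ~-typingʳ : ∀ {β π} {P Q : Proc n} {Θ 𝒢} → β ∣ π ⊢ P ~ᴾ Q → Θ ⊩ P ▹ 𝒢 → All (Wf ∘ proj₂) Θ → Wf 𝒢 → Rule~ β π Q Θ 𝒢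
    ~-typingʳ {β = β} (link x~ y~) ax wΘ w𝒢 with refl ← ~⇒apply x~ | refl ← ~⇒apply y~ = _ , _ , ax , 𝒫.↭-refl , ℋ.↭-refl
    ~-typingʳ 𝟎 mix₀ wΘ w𝒢 = _ , _ , mix₀ , 𝒫.↭-refl , ℋ.↭-refl
    ~-typingʳ {β = β} (call {𝒢 = 𝒢} {ρ′ = ρ′} p~ 𝒢≋ ρ≐ γ~) (call {ℋ = ℋ} i) wΘ w𝒢 with refl ← ~⇒applyᵖ p~ =
      let j = ≔-map (≐-keys ρ≐) (λ q → let y , r , t = ≐-∈ ρ≐ q in
                subst (λ z → (_ , z) ∈ ρ′) (sym (~⇒apply {β} (All.lookup γ~ t))) r) i
          _ , k , ℋ≋ = ≔-≋ (proj₁ (All.head wΘ)) 𝒢≋ j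
      in _ , _ , call k , prepᵖ (refl , ℋ.↭-sym 𝒢≋) 𝒫.↭-refl , ℋ.↭-sym ℋ≋
    ~-typingʳ {β = β} {π} (s ∥ t) (mix {Θ} {Π} {𝒢 = 𝒢} {ℋ} D E) wΘ w𝒢 =
      _ , _ , mix (~-typing s D 𝒫.↭-refl ℋ.↭-refl) (~-typing t E 𝒫.↭-refl ℋ.↭-refl) ,
      𝒫.↭-reflexive (sym (List.map-++ _ Θ Π)) , ℋ.↭-reflexive (sym (relabel-++ (apply β) 𝒢 ℋ))
    ~-typingʳ {β = β} (ν s) (cut {Γ = Γ} {Δ} {𝒢} D) wΘ w𝒢 =
      _ , _ , cut (~-typing s D 𝒫.↭-refl (ℋ.↭-reflexive (relabel-bind₂ Γ Δ 𝒢 (unique D)))) , 𝒫.↭-refl ,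
      ℋ.↭-reflexive (cong (_∷ relabel (apply β) 𝒢) (sym (relabelᴱ-++ (apply β) Γ Δ)))
    ~-typingʳ {β = β} (ν-comm {x′ = x′} {y′ = y′} s) (cut {A = A} {Γ = Γ} {Δ} {𝒢} D) wΘ w𝒢 =
      -- With its two names exchanged the cut is at `A ᗮ`, and `x′` has the type `A` that its
      -- partner needs only after cancelling a double dual.
      _ , _ , cut {A = A ᗮ} (~-typing s D 𝒫.↭-refl (transᵖ (ℋ.↭-reflexive (relabel-bind₂ Γ Δ 𝒢 (unique D)))
                (swapᵖ (ℰ.↭-reflexive (cong (λ B → (x′ ∶ B) ∷ relabelᴱ (apply β) Γ) (sym (ᗮ-involutive A)))) ℰ.↭-refl ℋ.↭-refl))) ,
      𝒫.↭-refl ,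
      transᵖ (prepᵖ (ℰ.++-comm (relabelᴱ (apply β) Δ) (relabelᴱ (apply β) Γ)) ℋ.↭-refl)
        (ℋ.↭-reflexive (cong (_∷ relabel (apply β) 𝒢) (sym (relabelᴱ-++ (apply β) Γ Δ))))
    ~-typingʳ {β = β} {π} (chop s ρ≐ t) (chop {Θ} {Π} E i D) wΘ w𝒢 =
      _ , _ , chop (~-typing t E 𝒫.↭-refl ℋ.↭-refl)
                (≔-≐ ρ≐ (Unique-image (proj₁ (All.head (Valid.wfΘ (valid D)))) (unique E) i) i)
                (~-typing s D (𝒫.↭-reflexive (relabelᴾ-bind Θ (uniqueᴾ D))) ℋ.↭-refl) ,
      𝒫.↭-reflexive (sym (List.map-++ _ Θ Π)) , ℋ.↭-refl
    ~-typingʳ {β = β} (send x~ s) (ten {x = x} {B = B} {Γ = Γ} {Δ} D) wΘ w𝒢 with refl ← ~⇒apply x~ =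
      _ , _ , ten (~-typing s D 𝒫.↭-refl (ℋ.↭-reflexive (relabel-bind Γ (((x ∶ B) ∷ Δ) ∷ []) (unique D)))) , 𝒫.↭-refl ,
      ℋ.↭-reflexive (cong (λ Ξ → (_ ∷ Ξ) ∷ []) (sym (relabelᴱ-++ (apply β) Γ Δ)))
    ~-typingʳ (close x~ s) (one D) wΘ w𝒢 with refl ← ~⇒apply x~ = _ , _ , one (~-typing s D 𝒫.↭-refl ℋ.↭-refl) , 𝒫.↭-refl , ℋ.↭-refl
    ~-typingʳ (recv x~ s) (par {x = x} {B = B} {Γ = Γ} D) wΘ w𝒢 with refl ← ~⇒apply x~ =
      _ , _ , par (~-typing s D 𝒫.↭-refl (ℋ.↭-reflexive (relabel-bind ((x ∶ B) ∷ Γ) [] (unique D)))) , 𝒫.↭-refl , ℋ.↭-refl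
    ~-typingʳ (wait x~ s) (bot D) wΘ w𝒢 with refl ← ~⇒apply x~ = _ , _ , bot (~-typing s D 𝒫.↭-refl ℋ.↭-refl) , 𝒫.↭-refl , ℋ.↭-refl
    ~-typingʳ (inl x~ s) (plus₁ D) wΘ w𝒢 with refl ← ~⇒apply x~ = _ , _ , plus₁ (~-typing s D 𝒫.↭-refl ℋ.↭-refl) , 𝒫.↭-refl , ℋ.↭-refl
    ~-typingʳ (inr x~ s) (plus₂ D) wΘ w𝒢 with refl ← ~⇒apply x~ = _ , _ , plus₂ (~-typing s D 𝒫.↭-refl ℋ.↭-refl) , 𝒫.↭-refl , ℋ.↭-refl
    ~-typingʳ (case x~ s t) (with′ D E) wΘ w𝒢 with refl ← ~⇒apply x~ =
      _ , _ , with′ (~-typing s D 𝒫.↭-refl ℋ.↭-refl) (~-typing t E 𝒫.↭-refl ℋ.↭-refl) , 𝒫.↭-refl , ℋ.↭-refl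
    ~-typingʳ (serve x~ s) (bang {Γ = Γ} w D) wΘ w𝒢 with refl ← ~⇒apply x~ =
      _ , _ , bang (Is⁇-relabel w) (~-typing s D 𝒫.↭-refl (ℋ.↭-reflexive (relabel-bind Γ [] (unique D)))) , 𝒫.↭-refl , ℋ.↭-refl
    ~-typingʳ (use x~ s) (que {Γ = Γ} D) wΘ w𝒢 with refl ← ~⇒apply x~ =
      _ , _ , que (~-typing s D 𝒫.↭-refl (ℋ.↭-reflexive (relabel-bind Γ [] (unique D)))) , 𝒫.↭-refl , ℋ.↭-refl
    ~-typingʳ (disp x~ s) (weak D) wΘ w𝒢 with refl ← ~⇒apply x~ = _ , _ , weak (~-typing s D 𝒫.↭-refl ℋ.↭-refl) , 𝒫.↭-refl , ℋ.↭-refl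
    ~-typingʳ (dup x~ s) (contr {Γ = Γ} D) wΘ w𝒢 with refl ← ~⇒apply x~ =
      _ , _ , contr (~-typing s D 𝒫.↭-refl (ℋ.↭-reflexive (relabel-bind₂′ Γ (unique D)))) , 𝒫.↭-refl , ℋ.↭-refl
    ~-typingʳ (sendT x~ A≈ s) (ex {B = B} w D) wΘ w𝒢 with refl ← ~⇒apply x~ =
      _ , _ , ex {B = B} (Wfᵗ-≈ A≈ w)
                (~-typing s D 𝒫.↭-refl (prepᵖ (prepᵖ (refl , sub-cong (single-cong A≈) (≈-refl B)) ℰ.↭-refl) ℋ.↭-refl)) ,
      𝒫.↭-refl , ℋ.↭-refl
    ~-typingʳ {β = β} {π} (recvT x~ s) (all {Θ} {Γ = Γ} D) wΘ w𝒢 with refl ← ~⇒apply x~ =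
      _ , _ , all {Θ = relabelᴾ (applyᵖ π) Θ} {Γ = relabelᴱ (apply β) Γ}
                (~-typing s D (𝒫.↭-reflexive (relabelᴾ-ren (applyᵖ π) suc Θ))
                  (ℋ.↭-reflexive (cong (λ Ξ → (_ ∷ Ξ) ∷ []) (relabelᴱ-ren (apply β) suc Γ)))) ,
      𝒫.↭-refl , ℋ.↭-refl
    -- The provided hyperenvironment occurs in no process environment. That its parameters are
    -- distinct is read off the well-formed type `prov 𝒢` in the conclusion.
    ~-typingʳ (provide x~ ρ≐ s t) (prov E i D) wΘ ((_ ∷ _) , (((u , _) , _) , _)) with refl ← ~⇒apply x~ =
      _ , _ , prov (~-typing s E 𝒫.↭-refl ℋ.↭-refl) (≔-≐ ρ≐ (Unique-image u (unique E) i) i) (~-typing t D 𝒫.↭-refl ℋ.↭-refl) ,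
      𝒫.↭-refl , ℋ.↭-refl
    ~-typingʳ (assume x~ s) (asm {Θ} D) wΘ w𝒢 with refl ← ~⇒apply x~ =
      _ , _ , asm (~-typing s D (𝒫.↭-reflexive (relabelᴾ-bind Θ (uniqueᴾ D))) ℋ.↭-refl) , 𝒫.↭-refl , ℋ.↭-refl

  relabel-id : (𝒢 : HEnv K n) → relabel id 𝒢 ≡ 𝒢
  relabel-id []      = refl
  relabel-id (Γ ∷ 𝒢) = cong₂ _∷_ (List.map-id Γ) (relabel-id 𝒢)

  =α-typing : ∀ {P Q : Proc n} {Θ 𝒢} → P =α Q → Θ ⊢ P ▹ 𝒢 → Θ ⊢ Q ▹ 𝒢
  =α-typing {Θ = Θ} {𝒢} s D = ~-typing s D (𝒫.↭-reflexive (List.map-id Θ)) (ℋ.↭-reflexive (relabel-id 𝒢))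

  -- Disposal and duplication of promotions

  alignᴾ : ∀ {p} {ℋ ℋ′ : HEnv Param n} {Θ Θ′} → p ∉ map proj₁ Θ → (p ∶ ℋ) ∷ Θ ≋ᴾ (p ∶ ℋ′) ∷ Θ′ → ℋ ≋ ℋ′ × Θ ≋ᴾ Θ′
  alignᴾ = Keyed.align (henvS Param _)

  mutual
    -- Variables enter a derivation at calls, which name their hyperenvironment, and every other
    -- rule only combines or discharges them.
    penv-unique : ∀ {Θ Θ′ : PEnv n} {P 𝒢 𝒢′} → Θ ⊢ P ▹ 𝒢 → Θ′ ⊢ P ▹ 𝒢′ → Θ ≋ᴾ Θ′
    penv-unique (node r e _ _) (node r′ e′ _ _) = transᵖ (𝒫.↭-sym e) (transᵖ (penv-uniqueʳ r r′) e′)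

    penv-uniqueʳ : ∀ {Θ Θ′ : PEnv n} {P 𝒢 𝒢′} → Θ ⊩ P ▹ 𝒢 → Θ′ ⊩ P ▹ 𝒢′ → Θ ≋ᴾ Θ′
    penv-uniqueʳ ax ax = 𝒫.↭-refl
    penv-uniqueʳ mix₀ mix₀ = 𝒫.↭-refl
    penv-uniqueʳ (call i) (call j) = 𝒫.↭-refl
    penv-uniqueʳ (mix D E) (mix D′ E′) = 𝒫.++⁺ (penv-unique D D′) (penv-unique E E′)
    penv-uniqueʳ (cut D) (cut D′) = penv-unique D D′
    penv-uniqueʳ (chop E i D) (chop E′ i′ D′) =
      𝒫.++⁺ (proj₂ (alignᴾ (∉-head (uniqueᴾ D)) (penv-unique D D′))) (penv-unique E E′)
    penv-uniqueʳ (ten D) (ten D′) = penv-unique D D′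
    penv-uniqueʳ (one D) (one D′) = penv-unique D D′
    penv-uniqueʳ (par D) (par D′) = penv-unique D D′
    penv-uniqueʳ (bot D) (bot D′) = penv-unique D D′
    penv-uniqueʳ (plus₁ D) (plus₁ D′) = penv-unique D D′
    penv-uniqueʳ (plus₂ D) (plus₂ D′) = penv-unique D D′
    penv-uniqueʳ (with′ D E) (with′ D′ E′) = penv-unique D D′
    penv-uniqueʳ (bang w D) (bang w′ D′) = 𝒫.↭-refl
    penv-uniqueʳ (que D) (que D′) = penv-unique D D′
    penv-uniqueʳ (weak D) (weak D′) = penv-unique D D′
    penv-uniqueʳ (contr D) (contr D′) = penv-unique D D′
    penv-uniqueʳ (ex w D) (ex w′ D′) = penv-unique D D′
    penv-uniqueʳ (all {Θ} D) (all {Θ′} D′) =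
      -- Instantiation undoes the weakening of both process environments; `𝟙` is an arbitrary
      -- choice.
      subst₂ _≋ᴾ_ (subᴾ-single-ren 𝟙 Θ) (subᴾ-single-ren 𝟙 Θ′) (subᴾ-≋ (single 𝟙) (penv-unique D D′))
    penv-uniqueʳ (prov E i D) (prov E′ i′ D′) = penv-unique E E′
    penv-uniqueʳ (asm D) (asm D′) = proj₂ (alignᴾ (∉-head (uniqueᴾ D)) (penv-unique D D′))

  -- The free names of `P` other than `x` are exactly the names of `Γ`. Both lists are free of
  -- duplicates, so equality as sets is equality as bags.
  Enumerates⇒↭ : ∀ {P : Proc n} {x A Γ zs} → zs Enumerates P ∖ x → [] ⊢ P ▹ ((x ∶ A) ∷ Γ) ∷ [] → zs ↭ map proj₁ Γ
  Enumerates⇒↭ {P = P} {x} {A} {Γ} {zs} (u , h) D = ∼bag⇒↭ (unique∧set⇒bag u uΓ (mk⇔ to from))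
    where
    uΓ : Unique (map proj₁ Γ)
    uΓ = proj₁ (Unique-keys-++⁻ Γ (AllPairs.tail (unique D)))

    to : ∀ {z} → z ∈ zs → z ∈ map proj₁ Γ
    to p with Equivalence.to (h _) p
    ... | q , z≢x with ∈-dom-[]⁻ ((x ∶ A) ∷ Γ) (fn⊆dom D q)
    ... | here z≡x = contradiction z≡x z≢x
    ... | there r  = r

    from : ∀ {z} → z ∈ map proj₁ Γ → z ∈ zs
    from p = Equivalence.from (h _) (dom⊆fn D (there (∈-dom-[]⁺ Γ p)) , ∈⇒≢head (unique D) (∈-dom-[]⁺ Γ p))

  ⁇-split : ∀ {z zs} {Γ : Env Name n} → All Is⁇ Γ → z ∷ zs ↭ map proj₁ Γ →
            ∃[ A ] ∃[ Γ′ ] Γ ≋ᴱ (z ∶ ⁇ A) ∷ Γ′ × All Is⁇ Γ′ × zs ↭ map proj₁ Γ′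
  ⁇-split {z = z} w p with ∈-map⁻ proj₁ (↭.∈-resp-↭ p (here refl))
  ... | (_ , B) , q , refl with ∈-∃++ q
  ... | Γ₁ , Γ₂ , refl with All.++⁻ Γ₁ w
  ... | w₁ , is⁇ {A = A} ∷ w₂ =
    A , Γ₁ ++ Γ₂ , ℰ.↭-shift Γ₁ Γ₂ , All.++⁺ w₁ w₂ , ↭.drop-∷ (↭-trans p (keys-↭ (ℰ.↭-shift Γ₁ Γ₂)))

  Wf-[] : {Γ : Env K n} → Unique (map proj₁ Γ) → Wfᴱ Γ → Wf (Γ ∷ [])
  Wf-[] {Γ = Γ} u w = subst Unique (cong (map proj₁) (sym (List.++-identityʳ Γ))) u , w , tt

  Valid-[] : {𝒢 : HEnv Name n} → Wf 𝒢 → Valid [] 𝒢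
  Valid-[] w = record { distinct = [] ; wfΘ = [] ; wf𝒢 = w }

  Wf-tail : ∀ {x A} {Γ : Env K n} {𝒢} → Wf (((x ∶ A) ∷ Γ) ∷ 𝒢) → Wf (Γ ∷ 𝒢)
  Wf-tail ((_ ∷ u) , ((_ , v) , w)) = u , (v , w)

  Wfᴱ-++ : (Γ : Env K n) {Δ : Env K n} → Wfᴱ Γ → Wfᴱ Δ → Wfᴱ (Γ ++ Δ)
  Wfᴱ-++ []      v       w = w
  Wfᴱ-++ (_ ∷ Γ) (u , v) w = u , Wfᴱ-++ Γ v w

  disps-typing : ∀ {x zs} {Γ : Env Name n} → All Is⁇ Γ → zs ↭ map proj₁ Γ → Wf (((x ∶ 𝟙) ∷ Γ) ∷ []) →
                 [] ⊢ disps zs (close x 𝟎) ▹ ((x ∶ 𝟙) ∷ Γ) ∷ []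
  disps-typing {zs = []} {[]} ws p w =
    node (one (node mix₀ 𝒫.↭-refl ℋ.↭-refl (Valid-[] ([] , tt)))) 𝒫.↭-refl ℋ.↭-refl (Valid-[] w)
  disps-typing {zs = []} {_ ∷ _} ws p w = contradiction (↭-sym p) ↭.¬x∷xs↭[]
  disps-typing {x = x} {zs = z ∷ zs} ws p w =
    let A , Γ′ , q , ws′ , p′ = ⁇-split ws p
        reordered = transᵖ (ℰ.↭-prep (x ∶ 𝟙) q) (ℰ.↭-swap _ _ ℰ.↭-refl)
        w′ = Wf-tail {x = z} {⁇ A} {(x ∶ 𝟙) ∷ Γ′} (Wf-≋ (prepᵖ reordered ℋ.↭-refl) w)
    in node (weak {A = A} (disps-typing ws′ p′ w′)) 𝒫.↭-refl (prepᵖ (ℰ.↭-sym reordered) ℋ.↭-refl) (Valid-[] w)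

  module _ {σ₁ σ₂ : Name → Name} where

    -- Ξ collects the names that the contractions outside of zs have yet to rejoin.
    contracts : ∀ {Q : Proc n} {𝒢 𝒢′} (r : [] ⊩ Q ▹ 𝒢) (zs : List Name) (Γ Ξ : Env Name n) → All Is⁇ Γ → zs ↭ map proj₁ Γ →
                𝒢 ≋ (Ξ ++ relabelᴱ σ₂ Γ ++ relabelᴱ σ₁ Γ) ∷ [] → (Ξ ++ Γ) ∷ [] ≋ 𝒢′ → Wfᴱ Γ → Wfᴱ Ξ →
                Unique (map proj₁ Ξ ++ map σ₁ zs ++ map σ₂ zs) → Unique zs → Disjoint (map proj₁ Ξ) zs →
                AllPairs (λ z w → σ₁ z ≢ w × σ₂ z ≢ w) zs →
                ∃[ Θ ] ∃[ ℋ ] ∃[ e ] ∃[ f ] ∃[ v ] ∃ λ (F : [] ⊢ dups σ₁ σ₂ zs Q ▹ 𝒢′) →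
                  Contracts σ₁ σ₂ (node {Θ′ = Θ} {𝒢′ = ℋ} r e f v) zs F
    contracts r [] [] Ξ ws p q t wΓ wΞ u uz d ncap =
      _ , _ , 𝒫.↭-refl , transᵖ q t , Valid-[] (Wf-≋ t (Wf-[] u′ wΞ′)) , _ , []
      where
      u′ = subst (λ Ξ′ → Unique Ξ′) (trans (List.++-identityʳ _) (cong (map proj₁) (sym (List.++-identityʳ Ξ)))) u
      wΞ′ = subst Wfᴱ (sym (List.++-identityʳ Ξ)) wΞ
    contracts r [] (_ ∷ _) Ξ ws p = contradiction (↭-sym p) ↭.¬x∷xs↭[]
    contracts r (z ∷ zs) Γ Ξ ws p q t wΓ wΞ u (z≢ ∷ uz) d (z-ncap ∷ ncap) with ⁇-split ws p
    ... | A , Γ′ , s , ws′ , p′ =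
      -- The prefix of `z` is outermost, so below it the two copies of `z` are still separate.
      let Ξ′ = (σ₂ z ∶ ⁇ A) ∷ (σ₁ z ∶ ⁇ A) ∷ Ξ
          _ , _ , e , f , v , F , c = contracts r zs Γ′ Ξ′ ws′ p′
            (transᵖ q (prepᵖ (transᵖ (ℰ.++⁺ˡ Ξ (ℰ.++⁺ (relabelᴱ-≋ σ₂ s) (relabelᴱ-≋ σ₁ s)))
              (let open ℰS in
               solve 5 (λ x a b c d → x ⊹ (a ⊹ b) ⊹ (c ⊹ d) ⊜ a ⊹ c ⊹ x ⊹ b ⊹ d) ℰ.↭-refl
                       Ξ ((σ₂ z ∶ ⁇ A) ∷ []) (relabelᴱ σ₂ Γ′) ((σ₁ z ∶ ⁇ A) ∷ []) (relabelᴱ σ₁ Γ′))) ℋ.↭-refl))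
            ℋ.↭-refl (proj₂ (Wfᴱ-≋ s wΓ)) (proj₁ (Wfᴱ-≋ s wΓ) , proj₁ (Wfᴱ-≋ s wΓ) , wΞ) (rearranged u) uz
            -- `no-capture` is what keeps the two copies of `z` off the names that are rejoined
            -- further inside.
            (λ { (here refl , k) → proj₂ (All.lookup z-ncap k) refl
               ; (there (here refl) , k) → proj₁ (All.lookup z-ncap k) refl
               ; (there (there k) , l) → d (k , there l) }) ncap
          restored = transᵖ (ℰ.↭-sym (ℰ.↭-shift Ξ Γ′)) (ℰ.++⁺ˡ Ξ (ℰ.↭-sym s))
          w′ = Wf-[] {Γ = Ξ ++ Γ} (subst Unique (sym (List.map-++ proj₁ Ξ Γ)) (Unique-↭ (↭.++⁺ˡ (map proj₁ Ξ) p)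
                       (Unique.++⁺ (proj₁ (Unique-++⁻ (map proj₁ Ξ) u)) (z≢ ∷ uz) d))) (Wfᴱ-++ Ξ wΞ wΓ)
      in _ , _ , e , f , v , node (contr F) 𝒫.↭-refl (transᵖ (prepᵖ restored ℋ.↭-refl) t) (Valid-[] (Wf-≋ t w′)) , z ∷ c
      where
      rearranged : Unique (map proj₁ Ξ ++ map σ₁ (z ∷ zs) ++ map σ₂ (z ∷ zs)) →
                   Unique (σ₂ z ∷ σ₁ z ∷ map proj₁ Ξ ++ map σ₁ zs ++ map σ₂ zs)
      rearranged = Perm.Unique-resp-↭ (≡.setoid Name)
        (let open Rearrange (≡.setoid Name) in
         solve 5 (λ x a b c d → x ⊹ (a ⊹ b) ⊹ (c ⊹ d) ⊜ c ⊹ a ⊹ x ⊹ b ⊹ d) (PermS.↭-refl (≡.setoid Name))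
                 (map proj₁ Ξ) (σ₁ z ∷ []) (map σ₁ zs) (σ₂ z ∷ []) (map σ₂ zs))

  Splits-step : ∀ {x x′ x₁ x₂ A P Γ σ₁ σ₂ zs} {w : All Is⁇ Γ} {Θ : PEnv n} {𝒢 e f v} (D : [] ⊢ P ▹ ((x′ ∶ A) ∷ Γ) ∷ []) →
                Splits P x′ x₁ x₂ σ₁ σ₂ zs →
                ∃ λ (F : [] ⊢ dups σ₁ σ₂ zs (send x₁ x₂ (serve x₁ (σ₁ x′) (P ⟪ σ₁ ⟫) ∥ serve x₂ (σ₂ x′) (P ⟪ σ₂ ⟫))) ▹
                              ((x₁ ∶ ‼ A ⊗ ‼ A) ∷ Γ) ∷ []) →
                  node {Θ′ = Θ} {𝒢′ = 𝒢} (bang {x = x} w D) e f v —⟨ act (codup x x₁ x₂) ⟩→ F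
  Splits-step {x′ = x′} {x₁} {x₂} {A} {P} {Γ} {σ₁} {σ₂} {zs} {w} D S =
    let D₁ , s₁ = rename D (Splits.injective₁ S) ℋ.↭-refl
        D₂ , s₂ = rename D (Splits.injective₂ S) ℋ.↭-refl
        E₁ = node (bang {x = x₁} (Is⁇-relabel w) D₁) 𝒫.↭-refl ℋ.↭-refl (Valid-[] (Wf-[] {Γ = (x₁ ∶ ‼ A) ∷ relabelᴱ σ₁ Γ} u₁ (wA , Wfᴱ-relabel σ₁ Γ wΓ)))
        E₂ = node (bang {x = x₂} (Is⁇-relabel w) D₂) 𝒫.↭-refl ℋ.↭-refl (Valid-[] (Wf-[] {Γ = (x₂ ∶ ‼ A) ∷ relabelᴱ σ₂ Γ} u₂ (wA , Wfᴱ-relabel σ₂ Γ wΓ)))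
        -- `mix` lists the server at `x₁` first, whereas `ten` wants the environment of the output
        -- name `x₂` in front.
        E₃ = node (mix E₁ E₂) 𝒫.↭-refl (ℋ.↭-swap _ _ ℋ.↭-refl)
               (Valid-[] (u₃ , ((wA , Wfᴱ-relabel σ₂ Γ wΓ) , ((wA , Wfᴱ-relabel σ₁ Γ wΓ) , tt))))
        _ , _ , _ , _ , _ , F , c = contracts (ten E₃) zs Γ ((x₁ ∶ ‼ A ⊗ ‼ A) ∷ []) w zs↭ ℋ.↭-refl ℋ.↭-refl
               wΓ ((wA , wA) , tt) (x₁# ∷ proj₂ (Unique-++⁻′ u)) (proj₁ (Splits.enumerates S)) x₁-apart (Splits.no-capture S)
    in F , codup S s₁ s₂ c
    where
    u = Splits.distinct S
    zs↭ = Enumerates⇒↭ (Splits.enumerates S) D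
    wA = proj₁ (proj₁ (proj₂ (Valid.wf𝒢 (valid D))))
    wΓ = proj₂ (proj₁ (proj₂ (Valid.wf𝒢 (valid D))))

    renamed : (σ : Name → Name) → map σ zs ↭ map proj₁ (relabelᴱ σ Γ)
    renamed σ = subst (map σ zs ↭_) (sym (names-relabel σ Γ)) (↭.map⁺ σ zs↭)

    Unique-++⁻′ : Unique (x₁ ∷ x₂ ∷ map σ₁ zs ++ map σ₂ zs) → Unique (x₂ ∷ map σ₁ zs ++ map σ₂ zs) × Unique (map σ₁ zs ++ map σ₂ zs)
    Unique-++⁻′ (_ ∷ u@(_ ∷ u′)) = u , u′

    x₁# : All (x₁ ≢_) (map σ₁ zs ++ map σ₂ zs)
    x₁# = All.tail (AllPairs.head u)

    u₁ : Unique (x₁ ∷ map proj₁ (relabelᴱ σ₁ Γ))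
    u₁ = Unique-↭ (prep x₁ (renamed σ₁)) (proj₁ (Unique-++⁻ (x₁ ∷ map σ₁ zs) (x₁# ∷ proj₂ (Unique-++⁻′ u))))

    u₂ : Unique (x₂ ∷ map proj₁ (relabelᴱ σ₂ Γ))
    u₂ = Unique-↭ (prep x₂ (renamed σ₂)) (proj₁ (Unique-++⁻ (x₂ ∷ map σ₂ zs)
           (Unique-↭ (prep x₂ (↭.++-comm (map σ₁ zs) (map σ₂ zs))) (proj₁ (Unique-++⁻′ u)))))

    u₃ : Unique (dom (((x₂ ∶ ‼ A) ∷ relabelᴱ σ₂ Γ) ∷ ((x₁ ∶ ‼ A) ∷ relabelᴱ σ₁ Γ) ∷ []))
    u₃ = subst Unique (sym (trans (dom-∷ ((x₂ ∶ ‼ A) ∷ relabelᴱ σ₂ Γ) (((x₁ ∶ ‼ A) ∷ relabelᴱ σ₁ Γ) ∷ []))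
                                  (cong (λ ys → x₂ ∷ map proj₁ (relabelᴱ σ₂ Γ) ++ x₁ ∷ map proj₁ ys) (List.++-identityʳ (relabelᴱ σ₁ Γ)))))
           (Unique-↭ (prep x₂ (↭-trans (prep x₁ (↭-trans (↭.++⁺ (renamed σ₁) (renamed σ₂))
                                                          (↭.++-comm (map proj₁ (relabelᴱ σ₁ Γ)) (map proj₁ (relabelᴱ σ₂ Γ)))))
                                        (↭-sym (↭.shift x₁ (map proj₁ (relabelᴱ σ₂ Γ)) (map proj₁ (relabelᴱ σ₁ Γ))))))
             (Unique-↭ (↭.swap x₁ x₂ ↭-refl) u))

    x₁-apart : Disjoint (x₁ ∷ []) zs
    x₁-apart (here refl , p) = Splits.x₁∉zs S p

  -- Effects of labels

  -- ActEffect a C ps Θ Π : a consumes its subject at type C, leaving ps in its environment,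
  -- and replaces the process variables Θ by Π.
  data ActEffect {n : ℕ} : Act n (Deriv n) → Ty n → HEnv Name n → PEnv n → PEnv n → Set where
    close   : ∀ {x} → ActEffect (close x) 𝟙 [] [] []
    wait    : ∀ {x} → ActEffect (wait x) ⊥ ([] ∷ []) [] []
    send    : ∀ {x y A B} → ActEffect (send x y) (A ⊗ B) (((y ∶ A) ∷ []) ∷ ((x ∶ B) ∷ []) ∷ []) [] []
    recv    : ∀ {x y A B} → ActEffect (recv x y) (A ⅋ B) (((y ∶ A) ∷ (x ∶ B) ∷ []) ∷ []) [] []
    inl     : ∀ {x A B} → ActEffect (inl x) (A ⊕ B) (((x ∶ A) ∷ []) ∷ []) [] []
    inr     : ∀ {x A B} → ActEffect (inr x) (A ⊕ B) (((x ∶ B) ∷ []) ∷ []) [] []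
    coinl   : ∀ {x A B} → ActEffect (coinl x) (A & B) (((x ∶ A) ∷ []) ∷ []) [] []
    coinr   : ∀ {x A B} → ActEffect (coinr x) (A & B) (((x ∶ B) ∷ []) ∷ []) [] []
    sendT   : ∀ {x A B} → ActEffect (sendT x A) (∃ᵗ B) (((x ∶ B [ A ]ᵗ) ∷ []) ∷ []) [] []
    recvT   : ∀ {x A B} → ActEffect (recvT x A) (∀ᵗ B) (((x ∶ B [ A ]ᵗ) ∷ []) ∷ []) [] []
    use     : ∀ {x y A} → ActEffect (use x y) (⁇ A) (((y ∶ A) ∷ []) ∷ []) [] []
    couse   : ∀ {x y A} → ActEffect (couse x y) (‼ A) (((y ∶ A) ∷ []) ∷ []) [] []
    disp    : ∀ {x A} → ActEffect (disp x) (⁇ A) (((x ∶ ⊥) ∷ []) ∷ []) [] []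
    codisp  : ∀ {x A} → ActEffect (codisp x) (‼ A) (((x ∶ 𝟙) ∷ []) ∷ []) [] []
    dup     : ∀ {x y z A} → ActEffect (dup x y z) (⁇ A) (((y ∶ ⁇ A ⅋ ⁇ A) ∷ []) ∷ []) [] []
    codup   : ∀ {x y z A} → ActEffect (codup x y z) (‼ A) (((y ∶ ‼ A ⊗ ‼ A) ∷ []) ∷ []) [] []
    provide : ∀ {x ρ E ℋ} → ActEffect (provide x ρ E) (prov ℋ) [] (penv E) []
    assume  : ∀ {x p ℋ} → ActEffect (assume x p) (asm ℋ) ([] ∷ []) [] ((p ∶ ℋ) ∷ [])

  -- The actions in a pair are unordered but their steps form a chain. Two constructors keep the
  -- order of firing independent of the order in the label, so exchanging the actions leaves the
  -- steps alone.
  data Effect {n : ℕ} : Label n (Deriv n) → List (Env Name n × HEnv Name n) → PEnv n → PEnv n → Set where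
    τ     : Effect τ [] [] []
    link  : ∀ {x y A} → Effect (link x y) (((x ∶ A) ∷ (y ∶ A ᗮ) ∷ [] , []) ∷ []) [] []
    act   : ∀ {a A ps Θ Π} → ActEffect a A ps Θ Π → Effect (act a) (((subject a ∶ A) ∷ [] , ps) ∷ []) Θ Π
    pairˡ : ∀ {a b A B ps qs Θ Π Θ′ Π′} → ActEffect a A ps Θ Π → ActEffect b B qs Θ′ Π′ →
            Effect (a ∣ b) (((subject a ∶ A) ∷ [] , ps) ∷ ((subject b ∶ B) ∷ [] , qs) ∷ []) (Θ ++ Θ′) (Π ++ Π′)
    pairʳ : ∀ {a b A B ps qs Θ Π Θ′ Π′} → ActEffect a A ps Θ Π → ActEffect b B qs Θ′ Π′ →
            Effect (a ∣ b) (((subject b ∶ B) ∷ [] , qs) ∷ ((subject a ∶ A) ∷ [] , ps) ∷ []) (Θ ++ Θ′) (Π ++ Π′)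
    call  : ∀ {p 𝒢 ρ E} → Effect (p ^ 𝒢 ↦ ρ ∙ E) [] ((p ∶ 𝒢) ∷ []) (penv E)

  -- The two actions of a ∣ b fire one after the other.  The name that the first introduces may
  -- coincide with the subject of the second, so the names of the source (inj₁) are kept apart
  -- from the names introduced on the way (inj₂).
  tag : HEnv Name n → HEnv (Name ⊎ Name) n
  tag = relabel inj₁

  untag : HEnv (Name ⊎ Name) n → HEnv Name n
  untag = relabel [ id , id ]′

  untagᴱ : Env (Name ⊎ Name) n → Env Name n
  untagᴱ = relabelᴱ [ id , id ]′

  untagᴱ-inj₁ : (Γ : Env Name n) → untagᴱ (relabelᴱ inj₁ Γ) ≡ Γ
  untagᴱ-inj₁ []      = refl
  untagᴱ-inj₁ (_ ∷ Γ) = cong (_ ∷_) (untagᴱ-inj₁ Γ)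

  untagᴱ-inj₂ : (Γ : Env Name n) → untagᴱ (relabelᴱ inj₂ Γ) ≡ Γ
  untagᴱ-inj₂ []      = refl
  untagᴱ-inj₂ (_ ∷ Γ) = cong (_ ∷_) (untagᴱ-inj₂ Γ)

  untag-tag : (𝒢 : HEnv Name n) → untag (tag 𝒢) ≡ 𝒢
  untag-tag []      = refl
  untag-tag (Γ ∷ 𝒢) = cong₂ _∷_ (untagᴱ-inj₁ Γ) (untag-tag 𝒢)

  untag-inj₂ : (𝒢 : HEnv Name n) → untag (relabel inj₂ 𝒢) ≡ 𝒢
  untag-inj₂ []      = refl
  untag-inj₂ (Γ ∷ 𝒢) = cong₂ _∷_ (untagᴱ-inj₂ Γ) (untag-inj₂ 𝒢)

  tagʳ : Env Name n × HEnv Name n → Env (Name ⊎ Name) n × HEnv (Name ⊎ Name) n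
  tagʳ (c , ps) = relabelᴱ inj₁ c , relabel inj₂ ps

  -- `Ξ` collects the process variables that the label leaves alone. It is split off explicitly
  -- because the variable of a surrounding `chop` has to be found in it.
  record Fires {n : ℕ} (l : Label n (Deriv n)) (Θ : PEnv n) (𝒢 : HEnv Name n) (Θ′ : PEnv n) (𝒢′ : HEnv Name n) : Set where
    constructor fires
    field
      {redexes}          : List (Env Name n × HEnv Name n)
      {consumed added Ξ} : PEnv n
      {final}            : HEnv (Name ⊎ Name) n
      effect             : Effect l redexes consumed added
      steps              : Steps (map tagʳ redexes) (tag 𝒢) final
      result             : untag final ≋ 𝒢′
      before             : Θ ≋ᴾ consumed ++ Ξ
      after              : added ++ Ξ ≋ᴾ Θ′

  Fires-≋ : ∀ {l} {Θ Θ₁ Θ₂ Θ₃ : PEnv n} {𝒢 𝒢₁ 𝒢₂ 𝒢₃} → Θ ≋ᴾ Θ₁ → 𝒢 ≋ 𝒢₁ → Θ₂ ≋ᴾ Θ₃ → 𝒢₂ ≋ 𝒢₃ →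
            Fires l Θ₁ 𝒢₁ Θ₂ 𝒢₂ → Fires l Θ 𝒢 Θ₃ 𝒢₃
  Fires-≋ p q p′ q′ (fires e s r b a) =
    fires e (Steps-≋ˡ (relabel-≋ inj₁ q) s) (transᵖ r q′) (transᵖ p b) (transᵖ a p′)

  untag-++-tag : (𝒦 : HEnv (Name ⊎ Name) n) (ℋ : HEnv Name n) → untag (𝒦 ++ tag ℋ) ≡ untag 𝒦 ++ ℋ
  untag-++-tag 𝒦 ℋ = trans (relabel-++ [ id , id ]′ 𝒦 (tag ℋ)) (cong (untag 𝒦 ++_) (untag-tag ℋ))

  Fires-parˡ : ∀ {l} {Θ Θ′ Π : PEnv n} {𝒢 𝒢′ ℋ} → Fires l Θ 𝒢 Θ′ 𝒢′ → Fires l (Θ ++ Π) (𝒢 ++ ℋ) (Θ′ ++ Π) (𝒢′ ++ ℋ)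
  Fires-parˡ {Π = Π} {𝒢} {ℋ = ℋ} (fires {consumed = c} {p} {Ξ} {𝒦} e s r b a) =
    fires e (Steps-≋ˡ (ℋ.↭-reflexive (relabel-++ inj₁ 𝒢 ℋ)) (Steps-frame (tag ℋ) s))
      (transᵖ (ℋ.↭-reflexive (untag-++-tag 𝒦 ℋ)) (ℋ.++⁺ʳ ℋ r))
      (transᵖ (𝒫.++⁺ʳ Π b) (𝒫.++-assoc c Ξ Π)) (transᵖ (𝒫.↭-sym (𝒫.++-assoc p Ξ Π)) (𝒫.++⁺ʳ Π a))

  Fires-parʳ : ∀ {l} {Θ Θ′ Π : PEnv n} {𝒢 𝒢′ ℋ} → Fires l Θ 𝒢 Θ′ 𝒢′ → Fires l (Π ++ Θ) (ℋ ++ 𝒢) (Π ++ Θ′) (ℋ ++ 𝒢′)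
  Fires-parʳ {Θ = Θ} {Θ′} {Π} {𝒢} {𝒢′} {ℋ} F =
    Fires-≋ (𝒫.++-comm Π Θ) (ℋ.++-comm ℋ 𝒢) (𝒫.++-comm Θ′ Π) (ℋ.++-comm 𝒢′ ℋ) (Fires-parˡ F)

  Fires-frameᴾ : ∀ {l} {Θ Θ′ Π : PEnv n} {𝒢 𝒢′} → Fires l Θ 𝒢 Θ′ 𝒢′ → Fires l (Θ ++ Π) 𝒢 (Θ′ ++ Π) 𝒢′
  Fires-frameᴾ {𝒢 = 𝒢} {𝒢′} F =
    Fires-≋ 𝒫.↭-refl (ℋ.↭-sym (ℋ.++-identityʳ 𝒢)) 𝒫.↭-refl (ℋ.++-identityʳ 𝒢′) (Fires-parˡ {ℋ = []} F)

  Fires-syn : ∀ {a b} {Θ Θ′ Π Π′ : PEnv n} {𝒢 𝒢′ ℋ ℋ′} → Fires (act a) Θ 𝒢 Θ′ 𝒢′ → Fires (act b) Π ℋ Π′ ℋ′ →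
              Fires (a ∣ b) (Θ ++ Π) (𝒢 ++ ℋ) (Θ′ ++ Π′) (𝒢′ ++ ℋ′)
  Fires-syn {𝒢 = 𝒢} {𝒢′} {ℋ} {ℋ′} (fires {consumed = c} {p} {Ξ} {𝒦} (act e) s r b a) (fires {consumed = c′} {p′} {Ξ′} {𝒦′} (act e′) s′ r′ b′ a′) =
    fires {Ξ = Ξ ++ Ξ′} {𝒦 ++ 𝒦′} (pairˡ e e′)
      (Steps-≋ˡ (ℋ.↭-reflexive (relabel-++ inj₁ 𝒢 ℋ)) (Steps-++ (Steps-frame (tag ℋ) s) (Steps-frameˡ 𝒦 s′)))
      (transᵖ (ℋ.↭-reflexive (relabel-++ [ id , id ]′ 𝒦 𝒦′)) (ℋ.++⁺ r r′))
      (transᵖ (𝒫.++⁺ b b′) (interchange c Ξ c′ Ξ′)) (transᵖ (interchange p p′ Ξ Ξ′) (𝒫.++⁺ a a′))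
    where
    interchange : (w x y z : PEnv _) → (w ++ x) ++ (y ++ z) ≋ᴾ (w ++ y) ++ (x ++ z)
    interchange = solve 4 (λ w x y z → (w ⊹ x) ⊹ (y ⊹ z) ⊜ (w ⊹ y) ⊹ (x ⊹ z)) 𝒫.↭-refl
      where open 𝒫S

  Fires-swap : ∀ {a b} {Θ Θ′ : PEnv n} {𝒢 𝒢′} → Fires (a ∣ b) Θ 𝒢 Θ′ 𝒢′ → Fires (b ∣ a) Θ 𝒢 Θ′ 𝒢′
  Fires-swap (fires {Ξ = Ξ} (pairˡ {Θ = c} {p} {c′} {p′} e e′) s r b a) =
    fires (pairʳ e′ e) s r (transᵖ b (𝒫.++⁺ʳ Ξ (𝒫.++-comm c c′))) (transᵖ (𝒫.++⁺ʳ Ξ (𝒫.++-comm p′ p)) a)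
  Fires-swap (fires {Ξ = Ξ} (pairʳ {Θ = c} {p} {c′} {p′} e e′) s r b a) =
    fires (pairˡ e′ e) s r (transᵖ b (𝒫.++⁺ʳ Ξ (𝒫.++-comm c c′))) (transᵖ (𝒫.++⁺ʳ Ξ (𝒫.++-comm p′ p)) a)

  redex-names : ∀ {l} {rs} {Θ Π : PEnv n} → Effect l rs Θ Π → All (λ r → ∀ z → z ∈ map proj₁ (proj₁ r) → z ∈ fnᴸ l) rs
  redex-names τ = []
  redex-names link = (λ _ → id) ∷ []
  redex-names (act _) = (λ _ → id) ∷ []
  redex-names (pairˡ _ _) = (λ { _ (here e) → here e }) ∷ (λ { _ (here e) → there (here e) }) ∷ []
  redex-names (pairʳ _ _) = (λ { _ (here e) → there (here e) }) ∷ (λ { _ (here e) → here e }) ∷ []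
  redex-names call = []

  tag-∉ : ∀ {x} {c : Env Name n} → x ∉ map proj₁ c → inj₁ x ∉ map proj₁ (relabelᴱ {L = Name ⊎ Name} inj₁ c)
  tag-∉ {c = c} x∉ p with ∈-map⁻ inj₁ (subst (_ ∈_) (names-relabel inj₁ c) p)
  ... | _ , q , refl = x∉ q

  -- Every consumed name is free in the label, so a label without `x` and `y` never consumes them;
  -- the entries found in the target are the old ones and their types are still dual.
  Fires-cut : ∀ {l x y A} {Θ Θ′ : PEnv n} {Γ Δ 𝒢 𝒢₀′} → x ∉ fnᴸ l → y ∉ fnᴸ l →
              Fires l Θ (((x ∶ A) ∷ Γ) ∷ ((y ∶ A ᗮ) ∷ Δ) ∷ 𝒢) Θ′ 𝒢₀′ →
              ∃[ Γ′ ] ∃[ Δ′ ] ∃[ 𝒢′ ] 𝒢₀′ ≋ ((x ∶ A) ∷ Γ′) ∷ ((y ∶ A ᗮ) ∷ Δ′) ∷ 𝒢′ × Fires l Θ ((Γ ++ Δ) ∷ 𝒢) Θ′ ((Γ′ ++ Δ′) ∷ 𝒢′)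
  Fires-cut {Γ = Γ} {Δ} {𝒢} x∉ y∉ (fires e s r b a)
    with Steps-cut (All.map⁺ (All.map (λ h → tag-∉ (x∉ ∘ h _) , tag-∉ (y∉ ∘ h _)) (redex-names e))) ℋ.↭-refl s
  ... | Γt , Δt , 𝒢t , p , s′ =
    untagᴱ Γt , untagᴱ Δt , untag 𝒢t , transᵖ (ℋ.↭-sym r) (relabel-≋ [ id , id ]′ p) ,
    fires e (Steps-≋ˡ (ℋ.↭-reflexive (cong (_∷ tag 𝒢) (relabelᴱ-++ inj₁ Γ Δ))) s′)
      (ℋ.↭-reflexive (cong (_∷ untag 𝒢t) (relabelᴱ-++ [ id , id ]′ Γt Δt))) b a

  consumed-act : ∀ {a A ps} {Θ Π : PEnv n} {q} → ActEffect a A ps Θ Π → q ∈ map proj₁ Θ → q ∈ fpvᴬ (fpv ∘ proc) a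
  consumed-act (provide {E = E}) p = ⊆fpv (tree E) p

  consumed-fpv : ∀ {l rs} {Θ Π : PEnv n} {q} → Effect l rs Θ Π → q ∈ map proj₁ Θ → q ∈ fpvᴸ (fpv ∘ proc) l
  consumed-fpv (act e) p = consumed-act e p
  consumed-fpv (pairˡ {a} {Θ = Θ} e e′) p =
    [ ∈-++⁺ˡ ∘ consumed-act e , ∈-++⁺ʳ (fpvᴬ (fpv ∘ proc) a) ∘ consumed-act e′ ]′ (∈-names-++⁻ Θ p)
  consumed-fpv (pairʳ {a} {Θ = Θ} e e′) p =
    [ ∈-++⁺ˡ ∘ consumed-act e , ∈-++⁺ʳ (fpvᴬ (fpv ∘ proc) a) ∘ consumed-act e′ ]′ (∈-names-++⁻ Θ p)
  consumed-fpv call (here refl) = here refl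

  -- The variables that leave the source are free in the label: those of an emitted payload, or the
  -- variable of a call. As `q` is not, it lies in the untouched part.
  Fires-lift : ∀ {l q ℋ} {Θ Θ₀′ : PEnv n} {𝒢 𝒢′} → q ∉ fpvᴸ (fpv ∘ proc) l → Fires l ((q ∶ ℋ) ∷ Θ) 𝒢 Θ₀′ 𝒢′ →
               ∃[ Θ′ ] Θ₀′ ≋ᴾ (q ∶ ℋ) ∷ Θ′ × Fires l Θ 𝒢 Θ′ 𝒢′
  Fires-lift q∉ (fires {consumed = c} {p} e s r b a) = case 𝒫.∷-++-inv c b of λ where
    (inj₁ (_ , u , _))  → contradiction (consumed-fpv e (↭.∈-resp-↭ (keys-↭ (𝒫.↭-sym u)) (here refl))) q∉
    (inj₂ (Ξ′ , u , v)) → p ++ Ξ′ , transᵖ (𝒫.↭-sym a) (transᵖ (𝒫.++⁺ˡ p u) (𝒫.↭-shift p Ξ′)) , fires e s r v 𝒫.↭-refl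

  tagᴮ : Block Name n → Block (Name ⊎ Name) n
  tagᴮ (p , Γ) = relabelᴱ inj₂ p , relabelᴱ inj₁ Γ

  untagᴮ : Block (Name ⊎ Name) n → Block Name n
  untagᴮ (p , Γ) = untagᴱ p , untagᴱ Γ

  untagᴮ-tagᴮ : (bs : List (Block Name n)) → map untagᴮ (map tagᴮ bs) ≡ bs
  untagᴮ-tagᴮ []             = refl
  untagᴮ-tagᴮ ((p , Γ) ∷ bs) = cong₂ _∷_ (cong₂ _,_ (untagᴱ-inj₂ p) (untagᴱ-inj₁ Γ)) (untagᴮ-tagᴮ bs)

  untag-merge : (bs : List (Block (Name ⊎ Name) n)) → untag (merge bs) ≡ merge (map untagᴮ bs)
  untag-merge []             = refl
  untag-merge ((p , Γ) ∷ bs) = cong₂ _∷_ (relabelᴱ-++ [ id , id ]′ p Γ) (untag-merge bs)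

  untag-remainder : (bs : List (Block (Name ⊎ Name) n)) → untagᴱ (remainder bs) ≡ remainder (map untagᴮ bs)
  untag-remainder []             = refl
  untag-remainder ((p , Γ) ∷ bs) = trans (relabelᴱ-++ [ id , id ]′ Γ (remainder bs)) (cong (untagᴱ Γ ++_) (untag-remainder bs))

  tag-remainder : (bs : List (Block Name n)) → relabelᴱ inj₁ (remainder bs) ≡ remainder (map tagᴮ bs)
  tag-remainder []             = refl
  tag-remainder ((p , Γ) ∷ bs) = trans (relabelᴱ-++ inj₁ Γ (remainder bs)) (cong (relabelᴱ inj₁ Γ ++_) (tag-remainder bs))

  tag-shape : (bs : List (Block Name n)) → map proj₁ (map tagᴮ bs) ≡ relabel inj₂ (map proj₁ bs)
  tag-shape []       = refl
  tag-shape (_ ∷ bs) = cong (_ ∷_) (tag-shape bs)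

  untag-shape : (bs : List (Block (Name ⊎ Name) n)) → map proj₁ (map untagᴮ bs) ≡ untag (map proj₁ bs)
  untag-shape []       = refl
  untag-shape (_ ∷ bs) = cong (_ ∷_) (untag-shape bs)

  Fires-act : ∀ {a A c p Ξ} {Θ Θ′ : PEnv n} {𝒢 𝒢′} (bs : List (Block Name n)) → ActEffect a A (map proj₁ bs) c p →
              𝒢 ≋ ((subject a ∶ A) ∷ remainder bs) ∷ [] → merge bs ≋ 𝒢′ → Θ ≋ᴾ c ++ Ξ → p ++ Ξ ≋ᴾ Θ′ →
              Fires (act a) Θ 𝒢 Θ′ 𝒢′
  Fires-act {a = a} {A} bs e s t b f =
    fires (act e)
      (step {blocks = map tagᴮ bs} (tag-shape bs)
        (transᵖ (relabel-≋ inj₁ s) (ℋ.↭-reflexive (cong (λ Γ → ((inj₁ (subject a) ∶ A) ∷ Γ) ∷ []) (tag-remainder bs))))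
        ℋ.↭-refl ∷ [] ℋ.↭-refl)
      (transᵖ (ℋ.↭-reflexive (trans (cong untag (List.++-identityʳ _)) (trans (untag-merge (map tagᴮ bs)) (cong merge (untagᴮ-tagᴮ bs))))) t)
      b f

  -- Communication

  dom-merge : ∀ {z : K} (bs : List (Block K n)) → z ∈ dom (merge bs) → z ∈ dom (map proj₁ bs) ⊎ z ∈ map proj₁ (remainder bs)
  dom-merge ((p , Γ) ∷ bs) q with ∈-dom-++⁻ ((p ++ Γ) ∷ []) {merge bs} q
  ... | inj₂ r = [ inj₁ ∘ ∈-names-++⁺ʳ p , inj₂ ∘ ∈-names-++⁺ʳ Γ ]′ (dom-merge bs r)
  ... | inj₁ r with ∈-names-++⁻ p (∈-dom-[]⁻ (p ++ Γ) r)
  ... | inj₁ s = inj₁ (∈-names-++⁺ˡ p s)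
  ... | inj₂ s = inj₂ (∈-names-++⁺ˡ Γ s)

  -- Distinct names pin each step to the environment of its subject. For the second step this also
  -- requires that the first produce no name `y`, whence the tags.
  two-steps : ∀ {x y A B C C′ ps qs Γ Δ} {𝒢 𝒢′ : HEnv K n} →
              Unique (dom (((x ∶ A) ∷ Γ) ∷ ((y ∶ B) ∷ Δ) ∷ 𝒢)) → y ∉ dom ps →
              Steps (((x ∶ C) ∷ [] , ps) ∷ ((y ∶ C′) ∷ [] , qs) ∷ []) (((x ∶ A) ∷ Γ) ∷ ((y ∶ B) ∷ Δ) ∷ 𝒢) 𝒢′ →
              A ≈ C × B ≈ C′ × ∃[ bs ] ∃[ cs ] map proj₁ bs ≡ ps × map proj₁ cs ≡ qs ×
                Γ ≋ᴱ remainder bs × Δ ≋ᴱ remainder cs × merge bs ++ merge cs ++ 𝒢 ≋ 𝒢′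
  two-steps {K = K} {n} {x = x} {y} {A} {B} {C} {C′} {Γ = Γ} {Δ} {𝒢} u@(_ ∷ u′) y∉ps (step {bs} {rest} refl s t ∷ (step {cs} {rest′} e′ s′ t′ ∷ [] p)) =
    proj₁ first , proj₁ second , bs , cs , refl , e′ , proj₁ (proj₂ first) , proj₁ (proj₂ second) ,
    transᵖ (ℋ.shifts (merge bs) (merge cs)) (transᵖ (ℋ.++⁺ˡ (merge cs) (proj₂ (proj₂ second))) (transᵖ t′ p))
    where
    first : A ≈ C × Γ ≋ᴱ remainder bs × ((y ∶ B) ∷ Δ) ∷ 𝒢 ≋ rest
    first = focus (λ q → ∉-head u (∈-names-++⁺ˡ Γ q)) (λ q → ∉-head u (∈-names-++⁺ʳ Γ q)) s

    uʸ : Unique (y ∷ map proj₁ (Δ ++ concat 𝒢))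
    uʸ = proj₁ (proj₂ (Unique-keys-++⁻ Γ u′))

    y∉ : y ∉ dom (merge bs ++ 𝒢)
    y∉ q with ∈-dom-++⁻ (merge bs) q
    ... | inj₂ r = ∉-head uʸ (∈-names-++⁺ʳ Δ r)
    ... | inj₁ r with dom-merge bs r
    ... | inj₁ k = y∉ps k
    ... | inj₂ k = proj₂ (proj₂ (Unique-keys-++⁻ Γ u′)) (↭.∈-resp-↭ (↭-sym (keys-↭ (proj₁ (proj₂ first)))) k , here refl)

    second : B ≈ C′ × Δ ≋ᴱ remainder cs × merge bs ++ 𝒢 ≋ rest′
    second = focus (λ q → ∉-head uʸ (∈-names-++⁺ˡ Δ q)) y∉
      (transᵖ (ℋ.↭-sym (ℋ.↭-shift (merge bs) 𝒢)) (transᵖ (ℋ.++⁺ˡ (merge bs) (proj₂ (proj₂ first))) (transᵖ t s′)))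

  record Comm {n : ℕ} (a b : Act n (Deriv n)) (A B : Ty n) (Γ Δ : Env Name n) (𝒢 : HEnv Name n)
              (Θ Θ′ : PEnv n) (𝒢′ : HEnv Name n) : Set where
    constructor comm
    field
      {C C′}        : Ty n
      {ps qs}       : HEnv Name n
      {c p c′ p′ Ξ} : PEnv n
      {bs cs}       : List (Block Name n)
      effectᵃ       : ActEffect a C ps c p
      effectᵇ       : ActEffect b C′ qs c′ p′
      shapeᵃ        : map proj₁ bs ≡ ps
      shapeᵇ        : map proj₁ cs ≡ qs
      A≈C           : A ≈ C
      B≈C′          : B ≈ C′
      Γ≋            : Γ ≋ᴱ remainder bs
      Δ≋            : Δ ≋ᴱ remainder cs
      result        : merge bs ++ merge cs ++ 𝒢 ≋ 𝒢′
      before        : Θ ≋ᴾ (c ++ c′) ++ Ξ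
      after         : (p ++ p′) ++ Ξ ≋ᴾ Θ′

  untag-≋ : ∀ {𝒢 : HEnv Name n} {𝒦} → tag 𝒢 ≋ 𝒦 → 𝒢 ≋ untag 𝒦
  untag-≋ {𝒢 = 𝒢} p = subst (_≋ _) (untag-tag 𝒢) (relabel-≋ [ id , id ]′ p)

  untagᴱ-≋ : ∀ {Γ : Env Name n} {Δ} → relabelᴱ inj₁ Γ ≋ᴱ Δ → Γ ≋ᴱ untagᴱ Δ
  untagᴱ-≋ {Γ = Γ} p = subst (_≋ᴱ _) (untagᴱ-inj₁ Γ) (relabelᴱ-≋ [ id , id ]′ p)

  Fires-comm : ∀ {a b A B} {Θ Θ′ : PEnv n} {Γ Δ 𝒢 𝒢′} → Unique (dom (((subject a ∶ A) ∷ Γ) ∷ ((subject b ∶ B) ∷ Δ) ∷ 𝒢)) →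
               Fires (a ∣ b) Θ (((subject a ∶ A) ∷ Γ) ∷ ((subject b ∶ B) ∷ Δ) ∷ 𝒢) Θ′ 𝒢′ → Comm a b A B Γ Δ 𝒢 Θ Θ′ 𝒢′
  Fires-comm {n = n} {a} {b} {A} {B} {Γ = Γ} {Δ} {𝒢} u (fires e s r be af) = go e s r be af
    where
    X = (subject a ∶ A) ∷ Γ
    Y = (subject b ∶ B) ∷ Δ

    inj₁∉inj₂ : ∀ {z} (ps : HEnv Name n) → inj₁ z ∉ dom (relabel {L = Name ⊎ Name} inj₂ ps)
    inj₁∉inj₂ ps q with ∈-map⁻ inj₂ (subst (_ ∈_) (dom-relabel inj₂ ps) q)
    ... | _ , _ , ()

    tag-unique : ∀ (𝒦 : HEnv Name n) → Unique (dom 𝒦) → Unique (dom (tag 𝒦))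
    tag-unique 𝒦 v = subst Unique (sym (dom-relabel inj₁ 𝒦)) (Unique-map (λ _ _ → λ { refl → refl }) v)

    shape : ∀ (bs : List (Block (Name ⊎ Name) n)) {ps} → map proj₁ bs ≡ relabel inj₂ ps → map proj₁ (map untagᴮ bs) ≡ ps
    shape bs {ps} e = trans (untag-shape bs) (trans (cong untag e) (untag-inj₂ ps))

    merged : ∀ (bs cs : List (Block (Name ⊎ Name) n)) (𝒦 : HEnv Name n) {fin 𝒢′} → merge bs ++ merge cs ++ tag 𝒦 ≋ fin → untag fin ≋ 𝒢′ →
             merge (map untagᴮ bs) ++ merge (map untagᴮ cs) ++ 𝒦 ≋ 𝒢′
    merged bs cs 𝒦 p q = transᵖ (ℋ.↭-reflexive (sym
      (trans (relabel-++ [ id , id ]′ (merge bs) (merge cs ++ tag 𝒦))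
        (cong₂ _++_ (untag-merge bs) (trans (untag-++-tag (merge cs) 𝒦) (cong (_++ 𝒦) (untag-merge cs)))))))
      (transᵖ (relabel-≋ [ id , id ]′ p) q)

    remainder-≋ : ∀ {Γ : Env Name n} bs → relabelᴱ inj₁ Γ ≋ᴱ remainder bs → Γ ≋ᴱ remainder (map untagᴮ bs)
    remainder-≋ bs p = transᵖ (untagᴱ-≋ p) (ℰ.↭-reflexive (untag-remainder bs))

    go : ∀ {Θ Θ′ : PEnv n} {Ξ 𝒢′ rs c p fin} → Effect (a ∣ b) rs c p →
         Steps (map tagʳ rs) (tag (((subject a ∶ A) ∷ Γ) ∷ ((subject b ∶ B) ∷ Δ) ∷ 𝒢)) fin → untag fin ≋ 𝒢′ →
         Θ ≋ᴾ c ++ Ξ → p ++ Ξ ≋ᴾ Θ′ → Comm a b A B Γ Δ 𝒢 Θ Θ′ 𝒢′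
    go (pairˡ {ps = ps} e e′) s r be af =
      let A≈ , B≈ , bs , cs , sh , sh′ , Γ≋ , Δ≋ , q = two-steps (tag-unique (X ∷ Y ∷ 𝒢) u) (inj₁∉inj₂ ps) s
      in comm {bs = map untagᴮ bs} {map untagᴮ cs} e e′ (shape bs sh) (shape cs sh′) A≈ B≈ (remainder-≋ bs Γ≋) (remainder-≋ cs Δ≋) (merged bs cs 𝒢 q r) be af
    go (pairʳ {qs = qs} e e′) s r be af =
      -- `b` fires before `a`: the two environments are exchanged so that the first step again acts
      -- in the first one.
      let B≈ , A≈ , cs , bs , sh′ , sh , Δ≋ , Γ≋ , q =
            two-steps (tag-unique (Y ∷ X ∷ 𝒢) (Unique-↭ (dom-↭ (ℋ.↭-swap X Y {𝒢} ℋ.↭-refl)) u)) (inj₁∉inj₂ qs)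
                      (Steps-≋ˡ (ℋ.↭-swap _ _ ℋ.↭-refl) s)
      in comm {bs = map untagᴮ bs} {map untagᴮ cs} e e′ (shape bs sh) (shape cs sh′) A≈ B≈ (remainder-≋ bs Γ≋) (remainder-≋ cs Δ≋)
           (merged bs cs 𝒢 (transᵖ (ℋ.shifts (merge bs) (merge cs) {tag 𝒢}) q) r) be af

  -- A link produces no environment, hence consumes a whole one, consisting of its two names. Since
  -- it contains `y`, it is the environment of `y`, and `Δ` can only be the entry of `z`.
  Fires-link : ∀ {x y z A B} {Θ Θ′ : PEnv n} {Γ Δ 𝒢 𝒢′} → Unique (dom (((x ∶ A) ∷ Γ) ∷ ((y ∶ B) ∷ Δ) ∷ 𝒢)) →
               Fires (link z y) Θ (((x ∶ A) ∷ Γ) ∷ ((y ∶ B) ∷ Δ) ∷ 𝒢) Θ′ 𝒢′ →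
               ∃[ C ] B ≈ C ᗮ × Δ ≋ᴱ (z ∶ C) ∷ [] × ((x ∶ A) ∷ Γ) ∷ 𝒢 ≋ 𝒢′ × Θ ≋ᴾ Θ′
  Fires-link {x = x} {y} {z} {A} {B} {Γ = Γ} {Δ} {𝒢} {𝒢′} u@(_ ∷ u′) (fires (link {A = C}) (step {[]} {rest} refl s t ∷ [] q) r b a) =
    C , proj₁ focused , proj₁ (proj₂ focused) ,
    transᵖ (proj₂ (proj₂ focused)) (transᵖ (relabel-≋ [ id , id ]′ (transᵖ t q)) r) , transᵖ b a
    where
    uʸ : Unique (y ∷ map proj₁ (Δ ++ concat 𝒢))
    uʸ = proj₁ (proj₂ (Unique-keys-++⁻ Γ u′))

    y∉ : y ∉ dom (((x ∶ A) ∷ Γ) ∷ 𝒢)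
    y∉ (here refl) = ∉-head u (∈-names-++⁺ʳ Γ (here refl))
    y∉ (there p) = [ (λ k → proj₂ (proj₂ (Unique-keys-++⁻ Γ u′)) (k , here refl)) , (λ k → ∉-head uʸ (∈-names-++⁺ʳ Δ k)) ]′ (∈-names-++⁻ Γ p)

    source : ((x ∶ A) ∷ Γ) ∷ ((y ∶ B) ∷ Δ) ∷ 𝒢 ≋ ((z ∶ C) ∷ (y ∶ C ᗮ) ∷ []) ∷ untag rest
    source = untag-≋ s

    focused : B ≈ C ᗮ × Δ ≋ᴱ (z ∶ C) ∷ [] × ((x ∶ A) ∷ Γ) ∷ 𝒢 ≋ untag rest
    focused = focus (λ k → ∉-head uʸ (∈-names-++⁺ˡ Δ k)) y∉
      (transᵖ (ℋ.↭-swap ((y ∶ B) ∷ Δ) ((x ∶ A) ∷ Γ) ℋ.↭-refl) (transᵖ source (prepᵖ (ℰ.↭-swap (z ∶ C) (y ∶ C ᗮ) ℰ.↭-refl) ℋ.↭-refl)))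

  Fires-τ : ∀ {Θ Θ′ : PEnv n} {𝒢 𝒢′} → Θ ≋ᴾ Θ′ → 𝒢 ≋ 𝒢′ → Fires τ Θ 𝒢 Θ′ 𝒢′
  Fires-τ {𝒢 = 𝒢} p q = fires τ ([] ℋ.↭-refl) (transᵖ (ℋ.↭-reflexive (untag-tag 𝒢)) q) p 𝒫.↭-refl

  shape₀ : ∀ {bs : List (Block K n)} → map proj₁ bs ≡ [] → bs ≡ []
  shape₀ {bs = []} _ = refl

  shape₁ : ∀ {bs : List (Block K n)} {p} → map proj₁ bs ≡ p ∷ [] → ∃[ Γ ] bs ≡ (p , Γ) ∷ []
  shape₁ {bs = (p , Γ) ∷ []} refl = Γ , refl

  shape₂ : ∀ {bs : List (Block K n)} {p q} → map proj₁ bs ≡ p ∷ q ∷ [] → ∃[ Γ ] ∃[ Δ ] bs ≡ (p , Γ) ∷ (q , Δ) ∷ []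
  shape₂ {bs = (p , Γ) ∷ (q , Δ) ∷ []} refl = Γ , Δ , refl

  -- Reflexivity of α-equivalence and change of judgement.

  ~-diagonal : {A : Set} → DecidableEquality A → ∀ {β : List (A × A)} {y} → (∀ x → β ⊢ x ~ x) → ∀ x → ((y , y) ∷ β) ⊢ x ~ x
  ~-diagonal _≟_ {y = y} h x with x ≟ y
  ... | yes refl = here
  ... | no x≢y   = there x≢y x≢y (h x)

  ≐-refl : ∀ ρ → map (λ (_ , x) → x , x) ρ ⊢ ρ ≐ ρ
  ≐-refl []      = []
  ≐-refl (_ ∷ ρ) = cons ↭-refl (≐-refl ρ)

  image-~ : ∀ (ρ : Rec) x → map (λ (_ , x) → x , x) ρ ⊢ x ~ x
  image-~ []      x = free
  image-~ (_ ∷ ρ) = ~-diagonal _≟ⁿ_ (image-~ ρ)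

  ~ᴾ-refl : ∀ {β π} (P : Proc n) → (∀ x → β ⊢ x ~ x) → (∀ p → π ⊢ p ~ p) → β ∣ π ⊢ P ~ᴾ P
  ~ᴾ-refl (send x y P) h k = send (h x) (~ᴾ-refl P (~-diagonal _≟ⁿ_ h) k)
  ~ᴾ-refl (recv x y P) h k = recv (h x) (~ᴾ-refl P (~-diagonal _≟ⁿ_ h) k)
  ~ᴾ-refl (close x P) h k = close (h x) (~ᴾ-refl P h k)
  ~ᴾ-refl (wait x P) h k = wait (h x) (~ᴾ-refl P h k)
  ~ᴾ-refl (inl x P) h k = inl (h x) (~ᴾ-refl P h k)
  ~ᴾ-refl (inr x P) h k = inr (h x) (~ᴾ-refl P h k)
  ~ᴾ-refl (case x P Q) h k = case (h x) (~ᴾ-refl P h k) (~ᴾ-refl Q h k)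
  ~ᴾ-refl (sendT x A P) h k = sendT (h x) (≈-refl A) (~ᴾ-refl P h k)
  ~ᴾ-refl (recvT x P) h k = recvT (h x) (~ᴾ-refl P h k)
  ~ᴾ-refl (serve x y P) h k = serve (h x) (~ᴾ-refl P (~-diagonal _≟ⁿ_ h) k)
  ~ᴾ-refl (use x y P) h k = use (h x) (~ᴾ-refl P (~-diagonal _≟ⁿ_ h) k)
  ~ᴾ-refl (dup x y z P) h k = dup (h x) (~ᴾ-refl P (~-diagonal _≟ⁿ_ (~-diagonal _≟ⁿ_ h)) k)
  ~ᴾ-refl (disp x P) h k = disp (h x) (~ᴾ-refl P h k)
  ~ᴾ-refl (ν x y P) h k = ν (~ᴾ-refl P (~-diagonal _≟ⁿ_ (~-diagonal _≟ⁿ_ h)) k)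
  ~ᴾ-refl (P ∥ Q) h k = ~ᴾ-refl P h k ∥ ~ᴾ-refl Q h k
  ~ᴾ-refl 𝟎 h k = 𝟎
  ~ᴾ-refl (link x y) h k = link (h x) (h y)
  ~ᴾ-refl (provide x ρ P Q) h k = provide (h x) (≐-refl ρ) (~ᴾ-refl P (image-~ ρ) k) (~ᴾ-refl Q h k)
  ~ᴾ-refl (assume x p P) h k = assume (h x) (~ᴾ-refl P h (~-diagonal _≟ᵖ_ k))
  ~ᴾ-refl (call p 𝒢 ρ) h k = call (k p) ℋ.↭-refl (≐-refl ρ) (All.map⁺ (All.universal (λ (_ , x) → h x) ρ))
  ~ᴾ-refl (chop Q p ρ P) h k = chop (~ᴾ-refl Q h (~-diagonal _≟ᵖ_ k)) (≐-refl ρ) (~ᴾ-refl P (image-~ ρ) k)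

  =α-refl : {P : Proc n} → P =α P
  =α-refl {P = P} = ~ᴾ-refl P (λ _ → free) (λ _ → free)

  -- Only the reordering at the root changes, which is exactly what `reorder` allows in a target.
  cast : ∀ {Θ Θ′ : PEnv n} {P 𝒢 𝒢′} → Θ ⊢ P ▹ 𝒢 → Θ ≋ᴾ Θ′ → 𝒢 ≋ 𝒢′ → Θ′ ⊢ P ▹ 𝒢′
  cast (node r e f v) p q = node r (transᵖ e p) (transᵖ f q) (Valid-≋ p q v)

  →-source : ∀ {Θ Θ₀ Θ′ : PEnv n} {P P′ 𝒢 𝒢₀ 𝒢′ l} {D₀ : Θ₀ ⊢ P ▹ 𝒢₀} {D : Θ ⊢ P ▹ 𝒢} {E : Θ′ ⊢ P′ ▹ 𝒢′} →
             Θ ≋ᴾ Θ₀ → 𝒢 ≋ 𝒢₀ → D₀ —⟨ l ⟩→ E → D —⟨ l ⟩→ E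
  →-source = alpha =α-refl

  →-target : ∀ {Θ Θ′ Θ″ : PEnv n} {P P′ 𝒢 𝒢′ 𝒢″ l} {D : Θ ⊢ P ▹ 𝒢} {E : Θ′ ⊢ P′ ▹ 𝒢′} (p : Θ′ ≋ᴾ Θ″) (q : 𝒢′ ≋ 𝒢″) →
             D —⟨ l ⟩→ E → D —⟨ l ⟩→ cast E p q
  →-target {E = node r e f v} p q t = reorder t

  -- A record, so that the hyperenvironment remains visible to unification; it could not be inferred
  -- from its concatenation. Types are compared up to `_≈_`, which makes the notion stable under
  -- reordering.
  record Has {K : Set} {n : ℕ} (𝒢 : HEnv K n) (x : K) (A : Ty n) : Set where
    constructor has
    field entry : Any (×-Pointwise _≡_ _≈_ (x , A)) (concat 𝒢)

  concat-≋ : {𝒢 𝒢′ : HEnv K n} → 𝒢 ≋ 𝒢′ → concat 𝒢 ≋ᴱ concat 𝒢′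
  concat-≋ (reflᵖ ps) = go ps
    where
    go : {𝒢 𝒢′ : HEnv _ _} → Pointwise _≋ᴱ_ 𝒢 𝒢′ → concat 𝒢 ≋ᴱ concat 𝒢′
    go []       = ℰ.↭-refl
    go (p ∷ ps) = ℰ.++⁺ p (go ps)
  concat-≋ (prepᵖ p ps)                                = ℰ.++⁺ p (concat-≋ ps)
  concat-≋ (swapᵖ {x = Γ} {Δ} {Γ′} {Δ′} p q ps) = transᵖ (ℰ.++⁺ p (ℰ.++⁺ q (concat-≋ ps))) (ℰ.shifts Γ′ Δ′)
  concat-≋ (transᵖ ps qs)                              = transᵖ (concat-≋ ps) (concat-≋ qs)

  Has-≋ : ∀ {𝒢 𝒢′ : HEnv K n} {x A} → 𝒢 ≋ 𝒢′ → Has 𝒢 x A → Has 𝒢′ x A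
  Has-≋ p (has q) = has (ℰ.∈-resp-↭ (concat-≋ p) q)

  Has-++⁺ˡ : ∀ (𝒢 : HEnv K n) {ℋ x A} → Has 𝒢 x A → Has (𝒢 ++ ℋ) x A
  Has-++⁺ˡ 𝒢 {ℋ} (has p) = has (subst (Any _) (List.concat-++ 𝒢 ℋ) (Any.++⁺ˡ p))

  Has-++⁺ʳ : ∀ (𝒢 : HEnv K n) {ℋ x A} → Has ℋ x A → Has (𝒢 ++ ℋ) x A
  Has-++⁺ʳ 𝒢 {ℋ} (has p) = has (subst (Any _) (List.concat-++ 𝒢 ℋ) (Any.++⁺ʳ (concat 𝒢) p))

  Has-cut : ∀ {x y z : K} {A B C Γ Δ} {𝒢 : HEnv K n} → z ≢ x → z ≢ y → Has (((x ∶ A) ∷ Γ) ∷ ((y ∶ B) ∷ Δ) ∷ 𝒢) z C → Has ((Γ ++ Δ) ∷ 𝒢) z C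
  Has-cut z≢x z≢y (has (here (z≡x , _))) = contradiction z≡x z≢x
  Has-cut {Γ = Γ} {Δ} {𝒢} z≢x z≢y (has (there p)) with Any.++⁻ Γ p
  ... | inj₁ q = has (Any.++⁺ˡ (Any.++⁺ˡ q))
  ... | inj₂ (here (z≡y , _)) = contradiction z≡y z≢y
  ... | inj₂ (there q) = has (subst (Any _) (sym (List.++-assoc Γ Δ (concat 𝒢))) (Any.++⁺ʳ Γ q))

  Any-unique : ∀ {x : K} {A B} {Γ : Env K n} → Unique (map proj₁ Γ) →
               Any (×-Pointwise _≡_ _≈_ (x , A)) Γ → Any (×-Pointwise _≡_ _≈_ (x , B)) Γ → A ≈ B
  Any-unique u       (here (refl , p)) (here (refl , q)) = ≈-trans p (≈-sym q)
  Any-unique u       (here (refl , p)) (there q)         = contradiction (Any.map⁺ (Any.map proj₁ q)) (∉-head u)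
  Any-unique u       (there p)         (here (refl , q)) = contradiction (Any.map⁺ (Any.map proj₁ p)) (∉-head u)
  Any-unique (_ ∷ u) (there p)         (there q)         = Any-unique u p q

  Has-unique : ∀ {𝒢 : HEnv K n} {x A B} → Unique (dom 𝒢) → Has 𝒢 x A → Has 𝒢 x B → A ≈ B
  Has-unique u (has p) (has q) = Any-unique u p q

  -- Payloads of labels and their types.

  data Emits {n : ℕ} {S : Set} (x : Name) (ρ : Rec) (s : S) : Label n S → Set where
    act   : Emits x ρ s (act (provide x ρ s))
    left  : ∀ {b} → Emits x ρ s (provide x ρ s ∣ b)
    right : ∀ {a} → Emits x ρ s (a ∣ provide x ρ s)

  Emits-fn : ∀ {S : Set} {x ρ} {s : S} {l : Label n S} → Emits x ρ s l → x ∈ fnᴸ l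
  Emits-fn act   = here refl
  Emits-fn left  = here refl
  Emits-fn right = there (here refl)

  Emits-fpv : ∀ {x ρ} {R : Proc n} {l : Label n (Proc n)} {q} → Emits x ρ R l → q ∈ fpv R → q ∈ fpvᴸ fpv l
  Emits-fpv act             p = p
  Emits-fpv left            p = ∈-++⁺ˡ p
  Emits-fpv (right {a = a}) p = ∈-++⁺ʳ (fpvᴬ fpv a) p

  -- Quantified over every type that `x` provides. This makes the condition contravariant in the
  -- hyperenvironment, so it passes from a conclusion to each premise whose relevant entries
  -- reappear there.
  Fits∀ : HEnv Name n → Label n (Deriv n) → Set
  Fits∀ 𝒢 l = (∀ {x ρ E} → Emits x ρ E l → ∀ {ℋ} → Has 𝒢 x (prov ℋ) → ∃[ ℋρ ] ℋ ⟦ ρ ⟧≔ ℋρ × ℋρ ≋ henv E)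
            × (∀ {p ℋ ρ E} → l ≡ p ^ ℋ ↦ ρ ∙ E → ∃[ ℋρ ] ℋ ⟦ ρ ⟧≔ ℋρ × ℋρ ≋ henv E)

  Fits∀-map : ∀ {l} {𝒢 ℋ : HEnv Name n} → (∀ {x A} → x ∈ fnᴸ l → Has 𝒢 x A → Has ℋ x A) → Fits∀ ℋ l → Fits∀ 𝒢 l
  Fits∀-map h (emitted , called) = (λ e m → emitted e (h (Emits-fn e) m)) , called

  Wf-Has : ∀ {𝒢 : HEnv K n} {x A} → Wfᵗˢ 𝒢 → Has 𝒢 x A → Wfᵗ A
  Wf-Has {𝒢 = []}    w       (has ())
  Wf-Has {𝒢 = Γ ∷ 𝒢} (w , v) (has p) with Any.++⁻ Γ p
  ... | inj₂ q = Wf-Has {𝒢 = 𝒢} v (has q)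
  ... | inj₁ q = go w q
    where
    go : ∀ {Γ : Env _ _} {x A} → Wfᴱ Γ → Any (×-Pointwise _≡_ _≈_ (x , A)) Γ → Wfᵗ A
    go (w , _) (here (_ , p)) = Wfᵗ-≈ (≈-sym p) w
    go (_ , w) (there q)      = go w q

  prov-injective : ∀ {𝒢 ℋ : HEnv Param n} → prov 𝒢 ≈ prov ℋ → 𝒢 ≋ ℋ
  prov-injective (prov p) = p

  asm-injective : ∀ {𝒢 ℋ : HEnv Param n} → asm 𝒢 ≈ asm ℋ → 𝒢 ≋ ℋ
  asm-injective (asm p) = p

  -- In a well-formed hyperenvironment the type of `x` is unique up to `_≈_`, so the one witness in
  -- `Fits` can be reordered to serve any provided type.
  Fits⇒Fits∀ : ∀ {𝒢 : HEnv Name n} l → Wf 𝒢 → Fits 𝒢 l → Fits∀ 𝒢 l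
  Fits⇒Fits∀ {n = n} {𝒢} l (u , w) fits = (λ e → emitted e fits) , called l fits
    where
    emittedᴬ : ∀ x ρ E {ℋ} → FitsAct 𝒢 (provide x ρ E) → Has 𝒢 x (prov ℋ) → ∃[ ℋρ ] ℋ ⟦ ρ ⟧≔ ℋρ × ℋρ ≋ henv E
    emittedᴬ _ ρ _ (ℋ′ , _ , m , i , q) h =
      let h′ = has (Any.map (λ { refl → refl , ≈-refl (prov ℋ′) }) m)
          _ , j , r = ≔-≋ (proj₁ (Wf-Has {𝒢 = 𝒢} w h′)) (prov-injective (Has-unique {𝒢 = 𝒢} u h′ h)) i
      in _ , j , transᵖ (ℋ.↭-sym r) q

    emitted : ∀ {l x ρ E} → Emits x ρ E l → Fits 𝒢 l → ∀ {ℋ} → Has 𝒢 x (prov ℋ) → ∃[ ℋρ ] ℋ ⟦ ρ ⟧≔ ℋρ × ℋρ ≋ henv E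
    emitted {E = E} act   fits        = emittedᴬ _ _ E fits
    emitted {E = E} left  (fitsˡ , _) = emittedᴬ _ _ E fitsˡ
    emitted {E = E} right (_ , fitsʳ) = emittedᴬ _ _ E fitsʳ

    called : ∀ l → Fits 𝒢 l → ∀ {p ℋ ρ E} → l ≡ p ^ ℋ ↦ ρ ∙ E → ∃[ ℋρ ] ℋ ⟦ ρ ⟧≔ ℋρ × ℋρ ≋ henv E
    called _ fits refl = fits

  Offer : Name → Rec → Proc n → PEnv n → HEnv Name n → Set
  Offer x ρ R Θ 𝒢 = ∃[ Π ] ∃[ Ξ ] ∃[ ℋ ] ∃[ ℋρ ] (Π ⊢ R ▹ ℋρ) × ℋ ⟦ ρ ⟧≔ ℋρ × Has 𝒢 x (prov ℋ) × Θ ≋ᴾ Π ++ Ξ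

  Offer-map : ∀ {x ρ R} {Θ Θ′ Π : PEnv n} {𝒢 𝒢′} → (∀ {A} → Has 𝒢 x A → Has 𝒢′ x A) → Θ ++ Π ≋ᴾ Θ′ →
              Offer x ρ R Θ 𝒢 → Offer x ρ R Θ′ 𝒢′
  Offer-map {Π = Π} h p (Π₀ , Ξ , _ , _ , E , i , m , q) =
    _ , Ξ ++ Π , _ , _ , E , i , h m , transᵖ (𝒫.↭-sym p) (transᵖ (𝒫.++⁺ʳ Π q) (𝒫.++-assoc Π₀ Ξ Π))

  swap-Emits : ∀ {S : Set} {x ρ} {s : S} {a b : Act n S} → Emits x ρ s (b ∣ a) → Emits x ρ s (a ∣ b)
  swap-Emits left  = right
  swap-Emits right = left

  Valid-restrict : ∀ {Θ Π : PEnv n} {𝒢 𝒢′} → Valid (Θ ++ Π) 𝒢 → Wf 𝒢′ → Valid Θ 𝒢′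
  Valid-restrict {Θ = Θ} v w = record
    { distinct = proj₁ (Unique-keys-++⁻ Θ (Valid.distinct v)) ; wfΘ = All.++⁻ˡ Θ (Valid.wfΘ v) ; wf𝒢 = w }

  rotate : (Θ Ξ Π : PEnv n) → (Θ ++ Ξ) ++ Π ≋ᴾ (Θ ++ Π) ++ Ξ
  rotate = solve 3 (λ t x p → (t ⊹ x) ⊹ p ⊜ (t ⊹ p) ⊹ x) 𝒫.↭-refl
    where open 𝒫S

  -- A process communication hides its payload in `τ`, so a derivation of the payload must be found
  -- in the source before the induction hypothesis can be asked for its label. The split of `Θ` in
  -- `Offer` lets the search pass through an explicit substitution.
  offer : ∀ {x ρ R} {P P′ : Proc n} {l Θ 𝒢} → Emits x ρ R l → P —[ l ]→ P′ → Θ ⊢ P ▹ 𝒢 → Offer x ρ R Θ 𝒢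
  offer act provide (node (prov {Θ = Θ} E i D) e f v) =
    Θ , [] , _ , _ , E , i , Has-≋ f (has (here (refl , ≈-refl _))) , transᵖ (𝒫.↭-sym e) (𝒫.↭-sym (𝒫.++-identityʳ Θ))
  offer m (alpha s t) D = offer m t (=α-typing s D)
  offer m (swap t) D = offer (swap-Emits m) t D
  offer m (parˡ t _ _) (node (mix {𝒢 = 𝒢} D E) e f v) = Offer-map (λ h → Has-≋ f (Has-++⁺ˡ 𝒢 h)) e (offer m t D)
  offer m (parʳ t _ _) (node (mix {Θ} {Π} {𝒢 = 𝒢} D E) e f v) =
    Offer-map (λ h → Has-≋ f (Has-++⁺ʳ 𝒢 h)) (transᵖ (𝒫.++-comm Π Θ) e) (offer m t E)
  offer left (syn t t′ _ _) (node (mix {𝒢 = 𝒢} D E) e f v) = Offer-map (λ h → Has-≋ f (Has-++⁺ˡ 𝒢 h)) e (offer act t D)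
  offer right (syn t t′ _ _) (node (mix {Θ} {Π} {𝒢 = 𝒢} D E) e f v) =
    Offer-map (λ h → Has-≋ f (Has-++⁺ʳ 𝒢 h)) (transᵖ (𝒫.++-comm Π Θ) e) (offer act t′ E)
  offer m (res t x∉ y∉) (node (cut D) e f v) =
    Offer-map (λ h → Has-≋ f (Has-cut (λ { refl → x∉ (∈-++⁺ˡ (Emits-fn m)) }) (λ { refl → y∉ (∈-++⁺ˡ (Emits-fn m)) }) h))
      (transᵖ (𝒫.++-identityʳ _) e) (offer m t D)
  offer m (lift t q∉ _) (node (chop {Θ} {Π} E i D) e f v) =
    let Π₀ , Ξ , _ , _ , E₀ , j , h , p = offer m t D
    in case 𝒫.∷-++-inv Π₀ p of λ where
      (inj₁ (_ , r , _)) → contradiction (Emits-fpv m (⊆fpv E₀ (↭.∈-resp-↭ (keys-↭ (𝒫.↭-sym r)) (here refl)))) q∉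
      (inj₂ (Ξ′ , _ , r)) → _ , Ξ′ ++ Π , _ , _ , E₀ , j , Has-≋ f h ,
        transᵖ (𝒫.↭-sym e) (transᵖ (𝒫.++⁺ʳ Π r) (𝒫.++-assoc Π₀ Ξ′ Π))
  offer act (ext t q∈) (node (chop {Θ} {Π} E i D) e f v) =
    let Π₀ , Ξ , _ , _ , E₀ , j , h , p = offer act t D
    in case 𝒫.∷-++-inv Π₀ p of λ where
      -- `q` is free in the payload, so it is consumed with it, and the substitution can be pushed
      -- into the payload. The new node is valid because its variables are among those of the
      -- source.
      (inj₁ (Π₀′ , r , s)) →
        let split = transᵖ (𝒫.↭-sym e) (transᵖ (𝒫.++⁺ʳ Π s) (rotate Π₀′ Ξ Π))
            v′ = Valid-restrict (Valid-≋ split ℋ.↭-refl v) (Valid.wf𝒢 (valid E₀))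
        in _ , Ξ , _ , _ , node (chop E i (cast E₀ r ℋ.↭-refl)) 𝒫.↭-refl ℋ.↭-refl v′ , j , Has-≋ f h , split
      (inj₂ (Ξ′ , _ , r)) →
        contradiction (↭.∈-resp-↭ (keys-↭ (𝒫.↭-sym r)) (∈-names-++⁺ˡ Π₀ (fpv⊆ E₀ q∈))) (∉-head (uniqueᴾ D))

  Annotated : PEnv n → PVar → HEnv Param n → Set
  Annotated Θ q 𝒢 = Any (×-Pointwise _≡_ _≋_ (q , 𝒢)) Θ

  -- In `run` the annotation on the label of the premise is unconstrained. The derivation ties it to
  -- the hyperenvironment of the called variable, and so to the type of the body that replaces the
  -- call.
  annotation : ∀ {q ℋ ρ R} {P P′ : Proc n} {Θ 𝒢} → P —[ q ^ ℋ ↦ ρ ∙ R ]→ P′ → Θ ⊢ P ▹ 𝒢 → Annotated Θ q ℋ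
  annotation (call _ _) (node (call i) e f v) = 𝒫.∈-resp-↭ e (here (refl , ℋ.↭-refl))
  annotation (alpha s t) D = annotation t (=α-typing s D)
  annotation (parˡ t _ _) (node (mix D E) e f v) = 𝒫.∈-resp-↭ e (Any.++⁺ˡ (annotation t D))
  annotation (parʳ t _ _) (node (mix {Θ} D E) e f v) = 𝒫.∈-resp-↭ e (Any.++⁺ʳ Θ (annotation t E))
  annotation (res t _ _) (node (cut D) e f v) = 𝒫.∈-resp-↭ e (annotation t D)
  annotation (lift t q∉ _) (node (chop E i D) e f v) with annotation t D
  ... | here (refl , _) = contradiction (here refl) q∉
  ... | there a = 𝒫.∈-resp-↭ e (Any.++⁺ˡ a)

  -- Lifting transitions of processes to derivations

  Result : ∀ {Θ : PEnv n} {P 𝒢} → Label n (Deriv n) → Θ ⊢ P ▹ 𝒢 → Proc n → Set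
  Result {n = n} {Θ} {𝒢 = 𝒢} l D P′ =
    ∃[ Θ′ ] ∃[ 𝒢′ ] ∃ λ (D′ : Θ′ ⊢ P′ ▹ 𝒢′) → D —⟨ l ⟩→ D′ × Fires l Θ 𝒢 Θ′ 𝒢′

  Fires-one : ∀ {a A q c p} {Θ Θ₀ : PEnv n} {𝒢 𝒢′ Γ} → ActEffect a A (q ∷ []) c p → ((subject a ∶ A) ∷ Γ) ∷ [] ≋ 𝒢 → (q ++ Γ) ∷ [] ≋ 𝒢′ →
              c ++ Θ₀ ≋ᴾ Θ → Fires (act a) Θ 𝒢 (p ++ Θ₀) 𝒢′
  Fires-one {a = a} {A} {q} {Γ = Γ} e f g b =
    Fires-act ((q , Γ) ∷ []) e (transᵖ (ℋ.↭-sym f) (ℋ.↭-reflexive (cong (λ Δ → ((subject a ∶ A) ∷ Δ) ∷ []) (sym (List.++-identityʳ Γ)))))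
      g (𝒫.↭-sym b) 𝒫.↭-refl

  Fires-none : ∀ {a A c} {Θ Θ₀ : PEnv n} {𝒢} → ActEffect a A [] c [] → ((subject a ∶ A) ∷ []) ∷ [] ≋ 𝒢 →
               c ++ Θ₀ ≋ᴾ Θ → Fires (act a) Θ 𝒢 Θ₀ []
  Fires-none e f b = Fires-act [] e (ℋ.↭-sym f) ℋ.↭-refl (𝒫.↭-sym b) 𝒫.↭-refl

  Fires-axiom : ∀ {x y A} {Θ : PEnv n} {𝒢} → ((x ∶ A) ∷ (y ∶ A ᗮ) ∷ []) ∷ [] ≋ 𝒢 → [] ≋ᴾ Θ → Fires (link x y) Θ 𝒢 [] []
  Fires-axiom p q =
    fires {Ξ = []} link (step {blocks = []} {[]} refl (relabel-≋ inj₁ (ℋ.↭-sym p)) ℋ.↭-refl ∷ [] ℋ.↭-refl) ℋ.↭-refl (𝒫.↭-sym q) 𝒫.↭-refl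

  lookup-∈ : ∀ {σ f} → f ∈ keys σ → ∃[ y ] lookupᴿ σ f ≡ just y
  lookup-∈ {(g , y) ∷ σ} {f} p with f ≟ᶠ g
  lookup-∈ {(g , y) ∷ σ} {f} p           | yes _  = y , refl
  lookup-∈ {(g , y) ∷ σ} {f} (here refl) | no f≢g = contradiction refl f≢g
  lookup-∈ {(g , y) ∷ σ} {f} (there p)   | no _   = lookup-∈ p

  ∘⁻¹-∈ : ∀ {σ ρ f x} → Unique (image ρ) → f ∈ keys σ → (f , x) ∈ ρ → (σ ∘⁻¹ ρ) x ≡ σ ! f
  ∘⁻¹-∈ {σ} {(g , y) ∷ ρ} {f} {x} u k p with x ≟ⁿ y
  ∘⁻¹-∈ {σ} {(g , y) ∷ ρ} {f} u k (here refl) | yes _ =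
    -- The two sides fall back on different defaults, `y` and `freshⁿ []`, so the lookup has to be
    -- shown to succeed.
    let _ , e = lookup-∈ k in trans (cong (fromMaybe y) e) (sym (cong (fromMaybe (freshⁿ [])) e))
  ∘⁻¹-∈ u k (there p)   | yes refl = contradiction (∈-map⁺ proj₂ p) (∉-head u)
  ∘⁻¹-∈ u k (here refl) | no x≢y   = contradiction refl x≢y
  ∘⁻¹-∈ (_ ∷ u) k (there p) | no _ = ∘⁻¹-∈ u k p

  relabelᴱ-cong : ∀ {f g : K → L} (Γ : Env K n) → (∀ {x} → x ∈ map proj₁ Γ → f x ≡ g x) → relabelᴱ f Γ ≡ relabelᴱ g Γ
  relabelᴱ-cong []      h = refl
  relabelᴱ-cong (_ ∷ Γ) h = cong₂ _∷_ (cong (_, _) (h (here refl))) (relabelᴱ-cong Γ (h ∘ there))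

  relabel-cong : ∀ {f g : K → L} (𝒢 : HEnv K n) → (∀ {x} → x ∈ dom 𝒢 → f x ≡ g x) → relabel f 𝒢 ≡ relabel g 𝒢
  relabel-cong []      h = refl
  relabel-cong (Γ ∷ 𝒢) h = cong₂ _∷_ (relabelᴱ-cong Γ (h ∘ ∈-names-++⁺ˡ Γ)) (relabel-cong 𝒢 (h ∘ ∈-names-++⁺ʳ Γ))

  relabel-∘ : ∀ {M : Set} (g : L → M) (f : K → L) (𝒢 : HEnv K n) → relabel g (relabel f 𝒢) ≡ relabel (g ∘ f) 𝒢
  relabel-∘ g f []      = refl
  relabel-∘ g f (Γ ∷ 𝒢) = cong₂ _∷_ (sym (List.map-∘ Γ)) (relabel-∘ g f 𝒢)

  Unique-map⁻ : ∀ {A B : Set} {f : A → B} {xs} → Unique (map f xs) → xs ⊨ f injective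
  Unique-map⁻ u       (here refl) (here refl) e = refl
  Unique-map⁻ {f = f} u (here refl) (there q) e = contradiction (sym e) (∈⇒≢head u (∈-map⁺ f q))
  Unique-map⁻ {f = f} u (there p) (here refl) e = contradiction e (∈⇒≢head u (∈-map⁺ f p))
  Unique-map⁻ (_ ∷ u) (there p)   (there q)   e = Unique-map⁻ u p q e

  -- On the parameters of `𝒢` the renaming `σ ∘⁻¹ ρ` sends `ρ ! f` to `σ ! f`, and therefore takes
  -- `𝒢ρ` to `𝒢σ`. It is injective on the payload because validity of the source makes the names of
  -- `𝒢σ` distinct.
  call-step : ∀ {p σ ρ 𝒢σ} {𝒢 : HEnv Param n} {Θ 𝒦 e f v} (i : 𝒢 ⟦ σ ⟧≔ 𝒢σ) (E : Deriv n) → ∃[ 𝒢ρ ] 𝒢 ⟦ ρ ⟧≔ 𝒢ρ × 𝒢ρ ≋ henv E →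
              Result (p ^ 𝒢 ↦ ρ ∙ E) (node {Θ′ = Θ} {𝒢′ = 𝒦} (call {p = p} i) e f v) (proc E ⟪ σ ∘⁻¹ ρ ⟫)
  call-step {σ = σ} {ρ} {𝒢σ} {𝒢} {e = e} {f} {v} i E (𝒢ρ , j , 𝒢ρ≋) =
    let F , s = rename (tree E) injective relabelled
    in _ , _ , F , call {E = tree E} j 𝒢ρ≋ s ,
       fires {Ξ = []} call ([] ℋ.↭-refl) (transᵖ (ℋ.↭-reflexive (untag-tag _)) (ℋ.↭-sym f)) (𝒫.↭-sym e) (𝒫.++-identityʳ _)
    where
    u  = proj₁ (All.head (wfᴾ-≋ (𝒫.↭-sym e) (Valid.wfΘ v)))
    uσ = Unique-↭ (↭-sym (dom-↭ f)) (proj₁ (Valid.wf𝒢 v))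
    uρ = Unique-image u (Unique-↭ (↭-sym (dom-↭ 𝒢ρ≋)) (unique (tree E))) j

    agree : ∀ {f} → f ∈ dom 𝒢 → (σ ∘⁻¹ ρ) (ρ ! f) ≡ σ ! f
    agree p = ∘⁻¹-∈ uρ (↭.∈-resp-↭ (↭-sym (proj₁ i)) p) (∈-! (↭.∈-resp-↭ (↭-sym (proj₁ j)) p))

    𝒢ρ≡ : relabel (ρ !_) 𝒢 ≡ 𝒢ρ
    𝒢ρ≡ = ≔⇒relabel j (keys-unique j u)

    𝒢σ≡ : relabel (σ !_) 𝒢 ≡ 𝒢σ
    𝒢σ≡ = ≔⇒relabel i (keys-unique i u)

    relabelled : relabel (σ ∘⁻¹ ρ) (henv E) ≋ 𝒢σ
    relabelled = transᵖ (relabel-≋ (σ ∘⁻¹ ρ) (ℋ.↭-sym 𝒢ρ≋)) (ℋ.↭-reflexive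
      (trans (cong (relabel (σ ∘⁻¹ ρ)) (sym 𝒢ρ≡)) (trans (relabel-∘ (σ ∘⁻¹ ρ) (ρ !_) 𝒢) (trans (relabel-cong 𝒢 agree) 𝒢σ≡))))

    σ-injective : dom 𝒢 ⊨ (σ !_) injective
    σ-injective = Unique-map⁻ (subst Unique (trans (cong dom (sym 𝒢σ≡)) (dom-relabel (σ !_) 𝒢)) uσ)

    preimage : ∀ {x} → x ∈ fn (proc E) → ∃[ f ] f ∈ dom 𝒢 × x ≡ ρ ! f
    preimage p = ∈-map⁻ (ρ !_) (subst (_ ∈_) (trans (cong dom (sym 𝒢ρ≡)) (dom-relabel (ρ !_) 𝒢))
                   (↭.∈-resp-↭ (↭-sym (dom-↭ 𝒢ρ≋)) (fn⊆dom (tree E) p)))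

    injective : fn (proc E) ⊨ (σ ∘⁻¹ ρ) injective
    injective p q e with preimage p | preimage q
    ... | _ , k , refl | _ , l , refl = cong (ρ !_) (σ-injective k l (trans (sym (agree k)) (trans e (agree l))))

  -- A reordering of the right-hand list is mirrored on the left. Generic, because it is applied
  -- twice, to environments and to the hyperenvironments made of them.
  commute : {A B : Set} {Q : A → B → Set} {R : B → B → Set} {S : A → A → Set} →
            (∀ {a b b′} → Q a b → R b b′ → ∃[ a′ ] S a a′ × Q a′ b′) →
            ∀ {xs ys ys′} → Pointwise Q xs ys → Permutation R ys ys′ → ∃[ xs′ ] Permutation S xs xs′ × Pointwise Q xs′ ys′
  commute {Q = Q} {R} {S} h = go
    where
    goʷ : ∀ {xs ys ys′} → Pointwise Q xs ys → Pointwise R ys ys′ → ∃[ xs′ ] Pointwise S xs xs′ × Pointwise Q xs′ ys′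
    goʷ []       []       = [] , [] , []
    goʷ (q ∷ qs) (r ∷ rs) = let _ , s , q′ = h q r ; _ , ss , qs′ = goʷ qs rs in _ , s ∷ ss , q′ ∷ qs′

    go : ∀ {xs ys ys′} → Pointwise Q xs ys → Permutation R ys ys′ → ∃[ xs′ ] Permutation S xs xs′ × Pointwise Q xs′ ys′
    go qs            (reflᵖ rs)      = let _ , ss , qs′ = goʷ qs rs in _ , reflᵖ ss , qs′
    go (q ∷ qs)      (prepᵖ r p)     = let _ , s , q′ = h q r ; _ , ss , qs′ = go qs p in _ , prepᵖ s ss , q′ ∷ qs′
    go (q₁ ∷ q₂ ∷ qs) (swapᵖ r₁ r₂ p) =
      let _ , s₁ , q₁′ = h q₁ r₁ ; _ , s₂ , q₂′ = h q₂ r₂ ; _ , ss , qs′ = go qs p in _ , swapᵖ s₁ s₂ ss , q₂′ ∷ q₁′ ∷ qs′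
    go qs            (transᵖ p p′)   = let _ , ss , qs′ = go qs p ; _ , ss′ , qs″ = go qs′ p′ in _ , transᵖ ss ss′ , qs″

  ≔-≋ʳ : ∀ {𝒢 : HEnv Param n} {ρ ℋ ℋ′} → 𝒢 ⟦ ρ ⟧≔ ℋ → ℋ ≋ ℋ′ → ∃[ 𝒢′ ] 𝒢 ≋ 𝒢′ × 𝒢′ ⟦ ρ ⟧≔ ℋ′
  ≔-≋ʳ (ks , ps) q =
    let _ , s , ps′ = commute (commute λ { (p , refl) (refl , r) → _ , (refl , r) , (p , refl) }) ps q
    in _ , s , ↭-trans ks (dom-↭ s) , ps′

  -- The payload in the label may be another derivation of the same process as the one in the
  -- source, so the source is rebuilt around it: `penv-unique` supplies its process environment and
  -- `Fits∀` its hyperenvironment. As (Provide) admits no reordering of `𝒢ρ`, the provided type is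
  -- reordered instead.
  provide-step : ∀ {x ρ Q 𝒢ρ} {𝒢 : HEnv Param n} {Θ Θ₀ 𝒦 e f v} (s : Deriv n) (E : Θ₀ ⊢ proc s ▹ 𝒢ρ) (i : 𝒢 ⟦ ρ ⟧≔ 𝒢ρ) (D : [] ⊢ Q ▹ []) →
                 Fits∀ 𝒦 (act (provide x ρ s)) →
                 Result (act (provide x ρ s)) (node {Θ′ = Θ} {𝒢′ = 𝒦} (prov {x = x} E i D) e f v) Q
  provide-step {e = e} {f} {v} s E i D (emitted , _) =
    let _ , j , q = emitted act (Has-≋ f (has (here (refl , ≈-refl _))))
        _ , p , j′ = ≔-≋ʳ j q
        Θ≋ = transᵖ (penv-unique (tree s) E) e
        𝒢≋ = transᵖ (prepᵖ (prepᵖ (refl , prov (ℋ.↭-sym p)) ℰ.↭-refl) ℋ.↭-refl) f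
    in _ , _ , D , →-source {D₀ = node (prov (tree s) j′ D) Θ≋ 𝒢≋ v} 𝒫.↭-refl ℋ.↭-refl provide ,
       Fires-none provide f (transᵖ (𝒫.++-identityʳ _) Θ≋)

  -- Rebuilding a cut after a communication.

  Wf-head : ∀ {x A B} {Γ : Env K n} {𝒢} → Wfᵗ B → Wf (((x ∶ A) ∷ Γ) ∷ 𝒢) → Wf (((x ∶ B) ∷ Γ) ∷ 𝒢)
  Wf-head w (u , ((_ , v) , v′)) = u , ((w , v) , v′)

  Valid-cut : ∀ {x y A B} {Θ : PEnv n} {Γ Δ 𝒢} → Valid Θ (((x ∶ A) ∷ Γ) ∷ ((y ∶ B) ∷ Δ) ∷ 𝒢) → Valid Θ ((Γ ++ Δ) ∷ 𝒢)
  Valid-cut {y = y} {Γ = Γ} {Δ} {𝒢} v with Valid.wf𝒢 v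
  ... | (_ ∷ u) , ((_ , wΓ) , ((_ , wΔ) , w)) = record
    { distinct = Valid.distinct v
    ; wfΘ      = Valid.wfΘ v
    ; wf𝒢      = subst (λ Ξ → Unique (map proj₁ Ξ)) (sym (List.++-assoc Γ Δ (concat 𝒢)))
                   (AllPairs.tail (Unique-↭ (keys-↭ (ℰ.↭-shift Γ (Δ ++ concat 𝒢))) u)) , (Wfᴱ-++ Γ wΓ wΔ , w) }

  unmerge : ∀ {Γ Δ : Env K n} → Δ ≋ᴱ Γ ++ [] → Γ ≋ᴱ Δ
  unmerge {Γ = Γ} q = transᵖ (ℰ.↭-sym (ℰ.++-identityʳ Γ)) (ℰ.↭-sym q)

  -- Common to all communications in which each partner leaves a single entry in place of its
  -- subject: selection, types, and the three uses of exponentials.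
  reduct₁ : ∀ {x₁ y₁ : Name} {C C′} {bs cs : List (Block Name n)} {Γ Δ 𝒢 𝒢′} →
            map proj₁ bs ≡ ((x₁ ∶ C) ∷ []) ∷ [] → map proj₁ cs ≡ ((y₁ ∶ C′) ∷ []) ∷ [] →
            Γ ≋ᴱ remainder bs → Δ ≋ᴱ remainder cs → C ᗮ ≈ C′ → merge bs ++ merge cs ++ 𝒢 ≋ 𝒢′ →
            𝒢′ ≋ ((x₁ ∶ C) ∷ Γ) ∷ ((y₁ ∶ C ᗮ) ∷ Δ) ∷ 𝒢
  reduct₁ sa sb Γ≋ Δ≋ C≈ r with shape₁ sa | shape₁ sb
  ... | _ , refl | _ , refl =
    transᵖ (ℋ.↭-sym r) (prepᵖ (ℰ.↭-prep _ (unmerge Γ≋)) (prepᵖ (prepᵖ (refl , ≈-sym C≈) (unmerge Δ≋)) ℋ.↭-refl))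

  -- The communication rules want a cut formula with a literal outermost connective, while the
  -- effect only shows that `A` is equivalent to such a type.
  retype : ∀ {Θ : PEnv n} {P x y A B C C′ Γ Δ 𝒢} → Θ ⊢ P ▹ ((x ∶ A) ∷ Γ) ∷ ((y ∶ B) ∷ Δ) ∷ 𝒢 → A ≈ C → B ≈ C′ →
           Θ ⊢ P ▹ ((x ∶ C) ∷ Γ) ∷ ((y ∶ C′) ∷ Δ) ∷ 𝒢
  retype D p q = cast D 𝒫.↭-refl (prepᵖ (prepᵖ (refl , p) ℰ.↭-refl) (prepᵖ (prepᵖ (refl , q) ℰ.↭-refl) ℋ.↭-refl))

  retype-source : ∀ {Θ Θ′ : PEnv n} {P P′ x y A B C C′ Γ Δ 𝒢 𝒢′ l} {D : Θ ⊢ P ▹ ((x ∶ A) ∷ Γ) ∷ ((y ∶ B) ∷ Δ) ∷ 𝒢} {D′ : Θ′ ⊢ P′ ▹ 𝒢′}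
                  (p : A ≈ C) (q : B ≈ C′) → D —⟨ l ⟩→ D′ → retype D p q —⟨ l ⟩→ D′
  retype-source p q = →-source 𝒫.↭-refl (prepᵖ (prepᵖ (refl , ≈-sym p) ℰ.↭-refl) (prepᵖ (prepᵖ (refl , ≈-sym q) ℰ.↭-refl) ℋ.↭-refl))

  dual : ∀ {A B C : Ty n} → A ≈ B → A ᗮ ≈ C → B ᗮ ≈ C
  dual p q = ≈-trans (≈-sym (ᗮ-cong p)) q

  module _ {Θ Θ₀ Θ′ : PEnv n} {P P′ x y A Γ Δ 𝒢 𝒥 𝒢′} (D : Θ₀ ⊢ P ▹ ((x ∶ A) ∷ Γ) ∷ ((y ∶ A ᗮ) ∷ Δ) ∷ 𝒢)
           (e : Θ₀ ≋ᴾ Θ) (f : (Γ ++ Δ) ∷ 𝒢 ≋ 𝒥) (v : Valid Θ 𝒥) (D′ : Θ′ ⊢ P′ ▹ 𝒢′) where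

    private
      Outcome : Proc n → Set
      Outcome = Result τ (node (cut D) e f v)

      same : ∀ {Q} {E₀ E : Θ ⊢ Q ▹ 𝒥} {Q′} {F : Θ ⊢ Q′ ▹ 𝒥} → E₀ —⟨ τ ⟩→ F → E —⟨ τ ⟩→ F
      same = →-source 𝒫.↭-refl ℋ.↭-refl

      kept : Fires τ Θ 𝒥 Θ 𝒥
      kept = Fires-τ 𝒫.↭-refl ℋ.↭-refl

    close-comm : D —⟨ close x ∣ wait y ⟩→ D′ → Comm (close x) (wait y) A (A ᗮ) Γ Δ 𝒢 Θ₀ Θ′ 𝒢′ → Outcome P′
    close-comm t (comm close wait sa sb A≈ B≈ Γ≋ Δ≋ r b a) with shape₀ sa | shape₁ sb
    ... | refl | _ , refl =
      let p′ = prepᵖ (prepᵖ (refl , A≈) Γ≋) (prepᵖ (prepᵖ (refl , B≈) ℰ.↭-refl) ℋ.↭-refl)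
          q = transᵖ (ℋ.↭-sym r) (prepᵖ (unmerge Δ≋) ℋ.↭-refl)
          g = prepᵖ (ℰ.++⁺ʳ Δ (ℰ.↭-sym Γ≋)) ℋ.↭-refl
          t′ = →-target (transᵖ (𝒫.↭-sym a) (𝒫.↭-sym b)) q (→-source {D = cast D 𝒫.↭-refl p′} 𝒫.↭-refl (ℋ.↭-sym p′) t)
      in _ , _ , _ , →-source {D₀ = node (cut _) e (transᵖ g f) v} 𝒫.↭-refl ℋ.↭-refl (com-unit t′) ,
         Fires-τ (𝒫.↭-sym e) (transᵖ (ℋ.↭-sym f) (ℋ.↭-sym g))

    inl-comm : D —⟨ inl x ∣ coinl y ⟩→ D′ → Comm (inl x) (coinl y) A (A ᗮ) Γ Δ 𝒢 Θ₀ Θ′ 𝒢′ → Outcome (ν x y P′)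
    inl-comm t (comm inl coinl sa sb A≈ B≈ Γ≋ Δ≋ r b a) with dual A≈ B≈
    ... | p & q = _ , _ , node (cut (cast D′ (transᵖ (𝒫.↭-sym a) (𝒫.↭-sym b)) (reduct₁ sa sb Γ≋ Δ≋ p r))) e f v ,
      same {E₀ = node (cut (retype D A≈ (ᗮ-cong A≈))) e f v} (com-inl (→-target _ _ (retype-source A≈ (ᗮ-cong A≈) t))) , kept

    inr-comm : D —⟨ inr x ∣ coinr y ⟩→ D′ → Comm (inr x) (coinr y) A (A ᗮ) Γ Δ 𝒢 Θ₀ Θ′ 𝒢′ → Outcome (ν x y P′)
    inr-comm t (comm inr coinr sa sb A≈ B≈ Γ≋ Δ≋ r b a) with dual A≈ B≈
    ... | p & q = _ , _ , node (cut (cast D′ (transᵖ (𝒫.↭-sym a) (𝒫.↭-sym b)) (reduct₁ sa sb Γ≋ Δ≋ q r))) e f v ,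
      same {E₀ = node (cut (retype D A≈ (ᗮ-cong A≈))) e f v} (com-inr (→-target _ _ (retype-source A≈ (ᗮ-cong A≈) t))) , kept

    type-comm : ∀ {B} → D —⟨ sendT x B ∣ recvT y B ⟩→ D′ → Comm (sendT x B) (recvT y B) A (A ᗮ) Γ Δ 𝒢 Θ₀ Θ′ 𝒢′ → Outcome (ν x y P′)
    type-comm {B} t (comm (sendT {B = C}) recvT sa sb A≈ B≈ Γ≋ Δ≋ r b a) with dual A≈ B≈
    ... | ∀ᵗ p = _ , _ , node (cut (cast D′ (transᵖ (𝒫.↭-sym a) (𝒫.↭-sym b)) (reduct₁ sa sb Γ≋ Δ≋ p′ r))) e f v ,
      same {E₀ = node (cut (retype D A≈ (ᗮ-cong A≈))) e f v} (com-type (→-target _ _ (retype-source A≈ (ᗮ-cong A≈) t))) , kept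
      -- `com-type` states the type of `y` as the dual of an instance, the effect as an instance of
      -- the dual.
      where p′ = ≈-trans (subst (_≈ (C ᗮ) [ B ]ᵗ) (sub-ᗮ (single B) C) (≈-refl _)) (sub-cong (λ X → ≈-refl (single B X)) p)

    disp-comm : D —⟨ disp x ∣ codisp y ⟩→ D′ → Comm (disp x) (codisp y) A (A ᗮ) Γ Δ 𝒢 Θ₀ Θ′ 𝒢′ → Outcome (ν x y P′)
    disp-comm t (comm disp codisp sa sb A≈ B≈ Γ≋ Δ≋ r b a) =
      _ , _ , node (cut (cast D′ (transᵖ (𝒫.↭-sym a) (𝒫.↭-sym b)) (reduct₁ sa sb Γ≋ Δ≋ 𝟙 r))) e f v ,
      same {E₀ = node (cut (retype D A≈ (ᗮ-cong A≈))) e f v} (com-disp (→-target _ _ (retype-source A≈ (ᗮ-cong A≈) t))) , kept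

    use-comm : ∀ {x′ y′} → D —⟨ use x x′ ∣ couse y y′ ⟩→ D′ → Comm (use x x′) (couse y y′) A (A ᗮ) Γ Δ 𝒢 Θ₀ Θ′ 𝒢′ → Outcome (ν x′ y′ P′)
    use-comm t (comm use couse sa sb A≈ B≈ Γ≋ Δ≋ r b a) with dual A≈ B≈
    ... | ‼ p = _ , _ , node (cut (cast D′ (transᵖ (𝒫.↭-sym a) (𝒫.↭-sym b)) (reduct₁ sa sb Γ≋ Δ≋ p r))) e f v ,
      same {E₀ = node (cut (retype D A≈ (ᗮ-cong A≈))) e f v} (com-use (→-target _ _ (retype-source A≈ (ᗮ-cong A≈) t))) , kept

    dup-comm : ∀ {x₁ x₂ y₁ y₂} → D —⟨ dup x x₁ x₂ ∣ codup y y₁ y₂ ⟩→ D′ → Comm (dup x x₁ x₂) (codup y y₁ y₂) A (A ᗮ) Γ Δ 𝒢 Θ₀ Θ′ 𝒢′ →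
               Outcome (ν x₁ y₁ P′)
    dup-comm t (comm dup codup sa sb A≈ B≈ Γ≋ Δ≋ r b a) with dual A≈ B≈
    ... | ‼ p = _ , _ , node (cut (cast D′ (transᵖ (𝒫.↭-sym a) (𝒫.↭-sym b)) (reduct₁ sa sb Γ≋ Δ≋ (‼ p ⊗ ‼ p) r))) e f v ,
      same {E₀ = node (cut (retype D A≈ (ᗮ-cong A≈))) e f v} (com-dup (→-target _ _ (retype-source A≈ (ᗮ-cong A≈) t))) , kept

    -- The inner cut moves `Γ₂`, the part of `Γ` that goes with `x′`, over to the environment of
    -- `y`; the outer cut then joins it to `Γ₁`, which restores the environment of the source.
    name-comm : ∀ {x′ y′} → D —⟨ send x x′ ∣ recv y y′ ⟩→ D′ → Comm (send x x′) (recv y y′) A (A ᗮ) Γ Δ 𝒢 Θ₀ Θ′ 𝒢′ → Outcome (ν x y (ν x′ y′ P′))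
    name-comm t (comm (send {A = C} {C′}) recv sa sb A≈ B≈ Γ≋ Δ≋ r b a) with shape₂ sa | shape₁ sb | dual A≈ B≈
    ... | Γ₂ , Γ₁ , refl | Δ₁ , refl | p ⅋ q =
      let Γ≋′ = transᵖ Γ≋ (transᵖ (ℰ.++⁺ˡ Γ₂ (ℰ.++-identityʳ Γ₁)) (ℰ.++-comm Γ₂ Γ₁))
          s = prepᵖ (prepᵖ (refl , A≈) Γ≋′) (prepᵖ (prepᵖ (refl , ᗮ-cong A≈) ℰ.↭-refl) ℋ.↭-refl)
          r′ = transᵖ (ℋ.↭-sym r) (prepᵖ ℰ.↭-refl (ℋ.↭-swap _ _ ℋ.↭-refl))
          r″ = transᵖ r′ (prepᵖ ℰ.↭-refl (prepᵖ (prepᵖ (refl , ≈-sym p) (prepᵖ (refl , ≈-sym q) (unmerge Δ≋))) ℋ.↭-refl))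
          t′ = →-target (transᵖ (𝒫.↭-sym a) (𝒫.↭-sym b)) r″ (→-source {D = cast D 𝒫.↭-refl s} 𝒫.↭-refl (ℋ.↭-sym s) t)
          D″ = cast D′ (transᵖ (𝒫.↭-sym a) (𝒫.↭-sym b)) r″
          g = transᵖ (ℋ.↭-swap _ _ ℋ.↭-refl) (prepᵖ ℰ.↭-refl (prepᵖ (ℰ.↭-shift Γ₂ Δ) ℋ.↭-refl))
          E = node (cut D″) 𝒫.↭-refl g (Valid-≋ 𝒫.↭-refl g (Valid-cut (valid D″)))
          h = prepᵖ (ℰ.++⁺ʳ Δ (ℰ.↭-sym Γ≋′)) ℋ.↭-refl
      in _ , _ , node (cut E) e (transᵖ (prepᵖ (ℰ.↭-sym (ℰ.++-assoc Γ₁ Γ₂ Δ)) ℋ.↭-refl) (transᵖ h f)) v ,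
         -- The rule wants a permutation up to equality of types. It is trivial, because the source
         -- was first cast to have `Γ₁ ++ Γ₂` in place of `Γ`.
         same {E₀ = node (cut (cast D 𝒫.↭-refl s)) e (transᵖ h f) v} (com-name ↭-refl t′) , kept

    process-comm : ∀ {q ρ Π ℋρ ℋ} {Q} (E : Π ⊢ Q ▹ ℋρ) (i : ℋ ⟦ ρ ⟧≔ ℋρ) → A ≈ prov ℋ →
                   D —⟨ provide x ρ ⌊ E ⌋ ∣ assume y q ⟩→ D′ →
                   Comm (provide x ρ ⌊ E ⌋) (assume y q) A (A ᗮ) Γ Δ 𝒢 Θ₀ Θ′ 𝒢′ → Outcome (chop P′ q ρ Q)
    process-comm {Π = Π} {ℋ = ℋ} E i A≈ℋ t (comm {Ξ = Ξ} provide assume sa sb A≈ B≈ Γ≋ Δ≋ r b a) with shape₀ sa | shape₁ sb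
    ... | refl | _ , refl =
      let b′ = transᵖ b (transᵖ (𝒫.++⁺ʳ Ξ (𝒫.++-identityʳ Π)) (𝒫.++-comm Π Ξ))
          s = prepᵖ (prepᵖ (refl , A≈ℋ) Γ≋) (prepᵖ (prepᵖ (refl , ᗮ-cong A≈ℋ) ℰ.↭-refl) ℋ.↭-refl)
          -- The receiving action types `q` by its own assumption; duality of the cut identifies
          -- this with the hyperenvironment `ℋ` of the payload, as `chop` requires.
          a′ = transᵖ (𝒫.↭-sym a) (prepᵖ (refl , ℋ.↭-sym (asm-injective (dual A≈ℋ B≈))) 𝒫.↭-refl)
          r′ = transᵖ (ℋ.↭-sym r) (prepᵖ (unmerge Δ≋) ℋ.↭-refl)
          t′ = →-target a′ r′ (→-source {D = cast D b′ s} (𝒫.↭-sym b′) (ℋ.↭-sym s) t)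
          e′ = transᵖ (𝒫.↭-sym b′) e
          g = prepᵖ (ℰ.++⁺ʳ Δ (ℰ.↭-sym Γ≋)) ℋ.↭-refl
      in _ , _ , node (chop E i (cast D′ a′ r′)) e′ (transᵖ g f) v ,
         same {E₀ = node (cut (cast D b′ s)) e′ (transᵖ g f) v} (com-proc t′) , kept

    -- Renaming `x` to `z` must be injective on the names left over. It is: `z` was in the
    -- environment of `y`, which the link consumed, and by distinctness it occurs nowhere else.
    link-comm : ∀ {z} → z ≢ x → z ≢ y → D —⟨ link z y ⟩→ D′ → Fires (link z y) Θ₀ (((x ∶ A) ∷ Γ) ∷ ((y ∶ A ᗮ) ∷ Δ) ∷ 𝒢) Θ′ 𝒢′ →
                Outcome (P′ ⟪ z / x ⟫)
    link-comm {z} z≢x z≢y t F =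
      let C , B≈ , Δ≋ , 𝒢≋ , Θ≋ = Fires-link (unique D) F
          A≈C = subst₂ _≈_ (ᗮ-involutive A) (ᗮ-involutive C) (ᗮ-cong B≈)
          Δ≋′ = transᵖ Δ≋ (prepᵖ (refl , ≈-sym A≈C) ℰ.↭-refl)
          s = prepᵖ ℰ.↭-refl (prepᵖ (ℰ.↭-prep (y ∶ A ᗮ) Δ≋′) ℋ.↭-refl)
          D″ = cast D′ (𝒫.↭-sym Θ≋) (ℋ.↭-sym 𝒢≋)
          G , w = rename {σ = z / x} D″ (injective Δ≋ D″) (ℋ.↭-reflexive (renamed D″))
          t′ = →-target (𝒫.↭-sym Θ≋) (ℋ.↭-sym 𝒢≋) (→-source {D = cast D 𝒫.↭-refl s} 𝒫.↭-refl (ℋ.↭-sym s) t)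
          g = prepᵖ (ℰ.++⁺ˡ Γ (ℰ.↭-sym Δ≋′)) ℋ.↭-refl
          h = prepᵖ (ℰ.++-comm ((z ∶ A) ∷ []) Γ) ℋ.↭-refl
      in _ , _ , G , →-source {D₀ = node (cut (cast D 𝒫.↭-refl s)) e (transᵖ g f) v} 𝒫.↭-refl ℋ.↭-refl (com-link t′ z≢x z≢y w) ,
         Fires-τ (𝒫.↭-sym e) (transᵖ (ℋ.↭-sym f) (transᵖ (ℋ.↭-sym g) (ℋ.↭-sym h)))
      where
      renamed : Θ₀ ⊢ P′ ▹ ((x ∶ A) ∷ Γ) ∷ 𝒢 → relabel (z / x) (((x ∶ A) ∷ Γ) ∷ 𝒢) ≡ ((z ∶ A) ∷ Γ) ∷ 𝒢
      renamed D″ = trans (relabel-bind Γ 𝒢 (unique D″)) (cong₂ (λ Ξ → ((z ∶ A) ∷ Ξ) ∷_) (List.map-id Γ) (relabel-id 𝒢))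

      injective : ∀ {C} → Δ ≋ᴱ (z ∶ C) ∷ [] → Θ₀ ⊢ P′ ▹ ((x ∶ A) ∷ Γ) ∷ 𝒢 → fn P′ ⊨ z / x injective
      injective Δ≋ D″ = ↦-injective (fn P′) (λ _ _ e → e) λ p →
        z∉ (fn⊆dom D″ (proj₁ (∈-∖⁻ (fn P′) (subst (z ∈_) (List.map-id _) p))))
        where
        u = AllPairs.tail (unique D)

        z∈Δ : z ∈ map proj₁ Δ
        z∈Δ = ↭.∈-resp-↭ (↭-sym (keys-↭ Δ≋)) (here refl)

        z∉ : z ∉ dom (((x ∶ A) ∷ Γ) ∷ 𝒢)
        z∉ (here z≡x) = z≢x z≡x
        z∉ (there p) with ∈-names-++⁻ Γ p
        ... | inj₁ q = proj₂ (proj₂ (Unique-keys-++⁻ Γ u)) (q , there (∈-names-++⁺ˡ Δ z∈Δ))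
        ... | inj₂ q = proj₂ (proj₂ (Unique-keys-++⁻ Δ (AllPairs.tail (proj₁ (proj₂ (Unique-keys-++⁻ Γ u)))))) (z∈Δ , q)

  -- Labels under erasure, and validity of rebuilt conclusions.

  act-proc : (a : Act n (Deriv n)) → bnᴬ (mapAct proc a) ≡ bnᴬ a × subject (mapAct proc a) ≡ subject a
                                   × fpvᴬ fpv (mapAct proc a) ≡ fpvᴬ (fpv ∘ proc) a
  act-proc (close x)        = refl , refl , refl
  act-proc (wait x)         = refl , refl , refl
  act-proc (inl x)          = refl , refl , refl
  act-proc (coinl x)        = refl , refl , refl
  act-proc (inr x)          = refl , refl , refl
  act-proc (coinr x)        = refl , refl , refl
  act-proc (disp x)         = refl , refl , refl
  act-proc (codisp x)       = refl , refl , refl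
  act-proc (send x y)       = refl , refl , refl
  act-proc (recv x y)       = refl , refl , refl
  act-proc (use x y)        = refl , refl , refl
  act-proc (couse x y)      = refl , refl , refl
  act-proc (dup x y z)      = refl , refl , refl
  act-proc (codup x y z)    = refl , refl , refl
  act-proc (sendT x A)      = refl , refl , refl
  act-proc (recvT x A)      = refl , refl , refl
  act-proc (provide x ρ s)  = refl , refl , refl
  act-proc (assume x p)     = refl , refl , refl

  bnᴬ-proc : (a : Act n (Deriv n)) → bnᴬ (mapAct proc a) ≡ bnᴬ a
  bnᴬ-proc a = proj₁ (act-proc a)

  subject-proc : (a : Act n (Deriv n)) → subject (mapAct proc a) ≡ subject a
  subject-proc a = proj₁ (proj₂ (act-proc a))

  fpvᴬ-proc : (a : Act n (Deriv n)) → fpvᴬ fpv (mapAct proc a) ≡ fpvᴬ (fpv ∘ proc) a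
  fpvᴬ-proc a = proj₂ (proj₂ (act-proc a))

  bn-proc : (l : Label n (Deriv n)) → bn (procᴸ l) ≡ bn l
  bn-proc τ               = refl
  bn-proc (link x y)      = refl
  bn-proc (act a)         = bnᴬ-proc a
  bn-proc (a ∣ b)         = cong₂ _++_ (bnᴬ-proc a) (bnᴬ-proc b)
  bn-proc (p ^ 𝒢 ↦ ρ ∙ s) = refl

  fnᴸ-proc : (l : Label n (Deriv n)) → fnᴸ (procᴸ l) ≡ fnᴸ l
  fnᴸ-proc τ               = refl
  fnᴸ-proc (link x y)      = refl
  fnᴸ-proc (act a)         = cong (_∷ []) (subject-proc a)
  fnᴸ-proc (a ∣ b)         = cong₂ (λ x y → x ∷ y ∷ []) (subject-proc a) (subject-proc b)
  fnᴸ-proc (p ^ 𝒢 ↦ ρ ∙ s) = refl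

  cn-proc : (l : Label n (Deriv n)) → cn (procᴸ l) ≡ cn l
  cn-proc l = cong₂ _++_ (fnᴸ-proc l) (bn-proc l)

  fpvᴸ-proc : (l : Label n (Deriv n)) → fpvᴸ fpv (procᴸ l) ≡ fpvᴸ (fpv ∘ proc) l
  fpvᴸ-proc τ               = refl
  fpvᴸ-proc (link x y)      = refl
  fpvᴸ-proc (act a)         = fpvᴬ-proc a
  fpvᴸ-proc (a ∣ b)         = cong₂ _++_ (fpvᴬ-proc a) (fpvᴬ-proc b)
  fpvᴸ-proc (p ^ 𝒢 ↦ ρ ∙ s) = refl

  -- Every name and process variable of a judgement is free in its process, so the apartness of
  -- processes checked by a transition already makes the joint judgement distinct.
  Valid-par : ∀ {Θ Π : PEnv n} {P Q 𝒢 ℋ} → P # Q → Θ ⊢ P ▹ 𝒢 → Π ⊢ Q ▹ ℋ → Valid (Θ ++ Π) (𝒢 ++ ℋ)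
  Valid-par {Θ = Θ} {𝒢 = 𝒢} (names , pvars) D E = record
    { distinct = Unique-keys-++⁺ Θ (uniqueᴾ D) (uniqueᴾ E) λ (p , q) → pvars (⊆fpv D p , ⊆fpv E q)
    ; wfΘ      = All.++⁺ (Valid.wfΘ (valid D)) (Valid.wfΘ (valid E))
    ; wf𝒢      = Unique-dom-++⁺ 𝒢 (unique D) (unique E) (λ (p , q) → names (dom⊆fn D p , dom⊆fn E q))
               , Wfᵗˢ-++ 𝒢 (proj₂ (Valid.wf𝒢 (valid D))) (proj₂ (Valid.wf𝒢 (valid E))) }
    where
    Wfᵗˢ-++ : ∀ (𝒢 : HEnv Name _) {ℋ} → Wfᵗˢ 𝒢 → Wfᵗˢ ℋ → Wfᵗˢ (𝒢 ++ ℋ)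
    Wfᵗˢ-++ []      w       v = v
    Wfᵗˢ-++ (_ ∷ 𝒢) (u , w) v = u , Wfᵗˢ-++ 𝒢 w v

  Valid-chop : ∀ {Θ Π : PEnv n} {q ℋ P Q 𝒢 ℋρ} → Disjoint (fpv P ∖ᵖ q) (fpv Q) → (q ∶ ℋ) ∷ Θ ⊢ P ▹ 𝒢 → Π ⊢ Q ▹ ℋρ → Valid (Θ ++ Π) 𝒢
  Valid-chop {Θ = Θ} pvars D E = record
    { distinct = Unique-keys-++⁺ Θ (AllPairs.tail (uniqueᴾ D)) (uniqueᴾ E) λ (p , q) →
                   pvars (∈-∖ᵖ⁺ (⊆fpv D (there p)) (∈⇒≢head (uniqueᴾ D) p) , ⊆fpv E q)
    ; wfΘ      = All.++⁺ (All.tail (Valid.wfΘ (valid D))) (Valid.wfΘ (valid E))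
    ; wf𝒢      = Valid.wf𝒢 (valid D) }

  Valid-head : ∀ {x A B} {Θ : PEnv n} {Γ 𝒢} → Wfᵗ B → Valid Θ (((x ∶ A) ∷ Γ) ∷ 𝒢) → Valid Θ (((x ∶ B) ∷ Γ) ∷ 𝒢)
  Valid-head {A = A} {B} w v = record { distinct = Valid.distinct v ; wfΘ = Valid.wfΘ v ; wf𝒢 = Wf-head {A = A} {B} w (Valid.wf𝒢 v) }

  Valid-merge : ∀ {x y A B} {Θ : PEnv n} {Γ 𝒢} → Valid Θ (((y ∶ B) ∷ (x ∶ A) ∷ Γ) ∷ 𝒢) → Valid Θ (((x ∶ B ⅋ A) ∷ Γ) ∷ 𝒢)
  Valid-merge v with Valid.wf𝒢 v
  ... | (_ ∷ u) , ((wB , (wA , w)) , w′) = record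
    { distinct = Valid.distinct v ; wfΘ = Valid.wfΘ v ; wf𝒢 = u , (((wB , wA) , w) , w′) }

  -- The induction on process transitions.

  run-fires : ∀ {q ℋ 𝒢 ρ} {Θ Π Ξ Θ′ : PEnv n} {Q 𝒦 𝒥 𝒦′ ℋρ} {E : Π ⊢ Q ▹ ℋρ} → Θ ++ Π ≋ᴾ Ξ → 𝒦 ≋ 𝒥 → Unique (map proj₁ ((q ∶ ℋ) ∷ Θ)) →
              Fires (q ^ 𝒢 ↦ ρ ∙ ⌊ E ⌋) ((q ∶ ℋ) ∷ Θ) 𝒦 Θ′ 𝒦′ → Fires τ Ξ 𝒥 Θ′ 𝒦′
  run-fires {Θ = Θ} {Π} p q u (fires call ([] s) r b a) =
    Fires-τ (transᵖ (𝒫.↭-sym p) (transᵖ (𝒫.++-comm Θ Π) (transᵖ (𝒫.++⁺ˡ Π (proj₂ (alignᴾ (∉-head u) b))) a)))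
      (transᵖ (ℋ.↭-sym q) (transᵖ (untag-≋ s) r))

  -- The substitution leaves with the payload, so the variables of its body now count as consumed,
  -- and `q` no longer does. Comparing the entries of `q` shows that source and payload type it
  -- alike.
  ext-fires : ∀ {q ℋ ℋ′ x σ ρ} {Θ Θ₁ Π Π′ Ξ₁ Θ′ : PEnv n} {R Q 𝒦₁ 𝒦 𝒦′ 𝒥₁ ℋρ i e₁ f₁ v₁} {D₁ : (q ∶ ℋ′) ∷ Θ₁ ⊢ R ▹ 𝒦₁} {E′ : Π′ ⊢ Q ▹ ℋρ} →
              Unique (map proj₁ ((q ∶ ℋ) ∷ Θ)) → Π ≋ᴾ Π′ →
              Fires (act (provide x σ ⌊ D₁ ⌋)) ((q ∶ ℋ) ∷ Θ) 𝒦 Θ′ 𝒦′ →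
              ℋ ≋ ℋ′ × Fires (act (provide x σ ⌊ node {Θ′ = Ξ₁} {𝒢′ = 𝒥₁} (chop {ρ = ρ} E′ i D₁) e₁ f₁ v₁ ⌋)) (Θ ++ Π) 𝒦 Θ′ 𝒦′
  ext-fires {Θ = Θ} {Θ₁} {Π} {Π′} {e₁ = e₁} u p (fires {Ξ = Ξ} (act provide) s r b a) =
    let ℋ≋ , Θ≋ = alignᴾ (∉-head u) b
    in ℋ≋ , fires {Ξ = Ξ} (act provide) s r
         (transᵖ (𝒫.++⁺ Θ≋ p) (transᵖ (rotate Θ₁ Ξ Π′) (𝒫.++⁺ʳ Ξ e₁))) a

  Annotated-unique : ∀ {q 𝒢 ℋ} {Θ : PEnv n} → Unique (map proj₁ ((q ∶ ℋ) ∷ Θ)) → Annotated ((q ∶ ℋ) ∷ Θ) q 𝒢 → 𝒢 ≋ ℋ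
  Annotated-unique u (here (refl , p)) = p
  Annotated-unique u (there p)         = contradiction (Any.map⁺ (Any.map proj₁ p)) (∉-head u)

  private
    single-wf : ∀ {A : Ty n} → Wfᵗ A → ∀ X → Wfᵗ (single A X)
    single-wf w zero    = w
    single-wf w (suc X) = tt

  -- The label of the transition is a variable tied to `procᴸ l` by an equation, so that transitions
  -- can be matched although `procᴸ` computes. Recursion is on the transition: `alpha` replaces the
  -- derivation by one that is not a subtree of it.
  lifting : ∀ {P P′ : Proc n} {l₀ Θ 𝒢} l → procᴸ l ≡ l₀ → P —[ l₀ ]→ P′ → (D : Θ ⊢ P ▹ 𝒢) → Fits∀ 𝒢 l → Result l D P′
  lifting (act (send _ _)) refl send (node (ten {Γ = Γ} {Δ} D) e f v) _ =
    _ , _ , D , send ,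
    Fires-act ((_ , Γ) ∷ (_ , Δ) ∷ []) send
      (transᵖ (ℋ.↭-sym f) (ℋ.↭-reflexive (cong (λ Ξ → (_ ∷ Γ ++ Ξ) ∷ []) (sym (List.++-identityʳ Δ))))) ℋ.↭-refl (𝒫.↭-sym e) 𝒫.↭-refl
  lifting (act (recv _ _)) refl recv (node (par D) e f v) _ = _ , _ , D , recv , Fires-one recv f ℋ.↭-refl e
  lifting (act (close _)) refl close (node (one D) e f v) _ = _ , _ , D , close , Fires-none close f e
  lifting (act (wait _)) refl wait (node (bot D) e f v) _ = _ , _ , D , wait , Fires-one wait f ℋ.↭-refl e
  lifting (act (inl _)) refl inl (node (plus₁ D) e f v) _ = _ , _ , D , inl , Fires-one inl f ℋ.↭-refl e
  lifting (act (inr _)) refl inr (node (plus₂ D) e f v) _ = _ , _ , D , inr , Fires-one inr f ℋ.↭-refl e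
  lifting (act (coinl _)) refl coinl (node (with′ D E) e f v) _ = _ , _ , D , coinl , Fires-one coinl f ℋ.↭-refl e
  lifting (act (coinr _)) refl coinr (node (with′ D E) e f v) _ = _ , _ , E , coinr , Fires-one coinr f ℋ.↭-refl e
  lifting (act (sendT _ _)) refl sendT (node (ex {B = B} w D) e f v) _ = _ , _ , D , sendT {B = B} , Fires-one (sendT {B = B}) f ℋ.↭-refl e
  lifting (act (recvT _ A)) refl (recvT w) (node (all {Θ} {x} {B} {Γ = Γ} D) e f v) _ =
    let E , s = instantiate (single-wf w) D (𝒫.↭-reflexive (subᴾ-single-ren A Θ))
                  (ℋ.↭-reflexive (cong (λ Ξ → ((x ∶ B [ A ]ᵗ) ∷ Ξ) ∷ []) (single-renᴱ A Γ)))
    in _ , _ , E , recvT w s , Fires-one (recvT {B = B}) f ℋ.↭-refl e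
  lifting (act (use _ _)) refl use (node (que D) e f v) _ = _ , _ , D , use , Fires-one use f ℋ.↭-refl e
  lifting (act (couse _ _)) refl couse (node (bang w D) e f v) _ = _ , _ , D , couse , Fires-one couse f ℋ.↭-refl e
  lifting (act (disp _)) refl disp (node (weak {A = A} D) e f v) _ =
    _ , _ , node (bot D) 𝒫.↭-refl ℋ.↭-refl (Valid-head tt (Valid-≋ (𝒫.↭-sym e) (ℋ.↭-sym f) v)) , disp , Fires-one (disp {A = A}) f ℋ.↭-refl e
  lifting (act (dup _ _ _)) refl dup (node (contr D) e f v) _ =
    _ , _ , node (par D) 𝒫.↭-refl ℋ.↭-refl (Valid-merge (valid D)) , dup , Fires-one dup f ℋ.↭-refl e
  lifting (act (codisp _)) refl (codisp z) (node (bang {A = A} w D) e f v) _ =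
    _ , _ , disps-typing w (Enumerates⇒↭ z D) (Wf-head {A = ‼ A} {𝟙} tt (Wf-≋ (ℋ.↭-sym f) (Valid.wf𝒢 v))) , codisp z , Fires-one codisp f ℋ.↭-refl e
  lifting (act (codup _ _ _)) refl (codup S) (node (bang w D) e f v) _ =
    let F , t = Splits-step D S in _ , _ , F , t , Fires-one codup f ℋ.↭-refl e
  lifting (act (provide _ _ s)) refl provide (node (prov E i D) e f v) fits = provide-step s E i D fits
  lifting (act (assume _ _)) refl assume (node (asm D) e f v) _ = _ , _ , D , assume , Fires-one assume f ℋ.↭-refl e
  lifting (link x y) refl linkˡ (node (ax {A = A}) e f v) _ =
    _ , _ , node mix₀ 𝒫.↭-refl ℋ.↭-refl (Valid-[] ([] , tt)) , linkˡ ,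
    -- (Ax) puts the dual on the left name and the effect on the right one, so the effect is taken
    -- at `A ᗮ`.
    Fires-axiom {A = A ᗮ} (transᵖ (ℋ.↭-reflexive (cong (λ B → ((x ∶ A ᗮ) ∷ (y ∶ B) ∷ []) ∷ []) (ᗮ-involutive A))) f) e
  lifting (link y x) refl linkʳ (node (ax {A = A}) e f v) _ =
    _ , _ , node mix₀ 𝒫.↭-refl ℋ.↭-refl (Valid-[] ([] , tt)) , linkʳ ,
    Fires-axiom {A = A} (transᵖ (prepᵖ (ℰ.↭-swap _ _ ℰ.↭-refl) ℋ.↭-refl) f) e
  lifting (p ^ 𝒢 ↦ ρ ∙ s) refl (call _ _) (node (call i) e f v) (_ , fits) = call-step i s (fits refl)
  lifting l refl (alpha s t) D fits =
    let _ , _ , D′ , t′ , F = lifting l refl t (=α-typing s D) fits in _ , _ , D′ , alpha s 𝒫.↭-refl ℋ.↭-refl t′ , F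
  lifting (b ∣ a) refl (swap t) D (emitted , called) =
    let _ , _ , D′ , t′ , F = lifting (a ∣ b) refl t D ((λ m → emitted (swap-Emits m)) , λ ()) in _ , _ , D′ , swap t′ , Fires-swap F
  lifting l refl (parˡ t d P#Q) (node (mix {𝒢 = 𝒢} D E) e f v) fits =
    let _ , _ , D′ , t′ , F = lifting l refl t D (Fits∀-map {l = l} (λ _ m → Has-≋ f (Has-++⁺ˡ 𝒢 m)) fits)
    in _ , _ , node (mix D′ E) 𝒫.↭-refl ℋ.↭-refl (Valid-par P#Q D′ E) ,
       parˡ t′ (λ (p , q) → d (subst (_ ∈_) (sym (bn-proc l)) p , q)) ,
       Fires-≋ (𝒫.↭-sym e) (ℋ.↭-sym f) 𝒫.↭-refl ℋ.↭-refl (Fires-parˡ F)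
  lifting l refl (parʳ t d P#Q) (node (mix {𝒢 = 𝒢} D E) e f v) fits =
    let _ , _ , E′ , t′ , F = lifting l refl t E (Fits∀-map {l = l} (λ _ m → Has-≋ f (Has-++⁺ʳ 𝒢 m)) fits)
    in _ , _ , node (mix D E′) 𝒫.↭-refl ℋ.↭-refl (Valid-par P#Q D E′) ,
       parʳ t′ (λ (p , q) → d (subst (_ ∈_) (sym (bn-proc l)) p , q)) ,
       Fires-≋ (𝒫.↭-sym e) (ℋ.↭-sym f) 𝒫.↭-refl ℋ.↭-refl (Fires-parʳ F)
  lifting (a ∣ b) refl (syn t u d P#Q) (node (mix {𝒢 = 𝒢} D E) e f v) (emitted , called) =
    let _ , _ , D′ , t′ , F = lifting (act a) refl t D ((λ { act m → emitted left (Has-≋ f (Has-++⁺ˡ 𝒢 m)) }) , λ ())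
        _ , _ , E′ , u′ , G = lifting (act b) refl u E ((λ { act m → emitted right (Has-≋ f (Has-++⁺ʳ 𝒢 m)) }) , λ ())
    in _ , _ , node (mix D′ E′) 𝒫.↭-refl ℋ.↭-refl (Valid-par P#Q D′ E′) ,
       syn t′ u′ (λ (p , q) → d (subst (_ ∈_) (sym (bnᴬ-proc a)) p , subst (_ ∈_) (sym (bnᴬ-proc b)) q)) ,
       Fires-≋ (𝒫.↭-sym e) (ℋ.↭-sym f) 𝒫.↭-refl ℋ.↭-refl (Fires-syn F G)
  lifting l refl (res {x} {y} t x∉ y∉) (node (cut D) e f v) fits =
    let x∉l = x∉ ∘ subst (x ∈_) (sym (cn-proc l))
        y∉l = y∉ ∘ subst (y ∈_) (sym (cn-proc l))
        _ , _ , D′ , t′ , F = lifting l refl t D (Fits∀-map {l = l}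
          (λ z∈ m → Has-≋ f (Has-cut (λ { refl → x∉l (∈-++⁺ˡ z∈) }) (λ { refl → y∉l (∈-++⁺ˡ z∈) }) m)) fits)
        _ , _ , _ , p , G = Fires-cut (x∉l ∘ ∈-++⁺ˡ) (y∉l ∘ ∈-++⁺ˡ) F
        D″ = cast D′ 𝒫.↭-refl p
    in _ , _ , node (cut D″) 𝒫.↭-refl ℋ.↭-refl (Valid-cut (valid D″)) , res (→-target 𝒫.↭-refl p t′) x∉l y∉l ,
       Fires-≋ (𝒫.↭-sym e) (ℋ.↭-sym f) 𝒫.↭-refl ℋ.↭-refl G
  lifting τ refl (run {q} {𝒢} {ρ} t) (node (chop {Θ} {Π} E i D) e f v) _ =
    let 𝒢≋ = Annotated-unique (uniqueᴾ D) (annotation t D)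
        _ , j , r = ≔-≋ (proj₁ (All.head (Valid.wfΘ (valid D)))) (ℋ.↭-sym 𝒢≋) i
        _ , _ , D′ , t′ , F = lifting (q ^ 𝒢 ↦ ρ ∙ ⌊ E ⌋) refl t D ((λ ()) , λ { refl → _ , j , ℋ.↭-sym r })
    in _ , _ , D′ , run t′ , run-fires e f (uniqueᴾ D) F
  lifting (act (provide x σ ⌊ node (chop {Θ₁} E′ i′ D₁) e₁ f₁ v₁ ⌋)) refl (ext {q = q} t q∈) (node (chop {Θ} {Π} E i D) e f v) (emitted , _) =
    let _ , _ , D′ , t′ , F = lifting (act (provide x σ ⌊ D₁ ⌋)) refl t D
          ((λ { act m → let _ , j , r = emitted act (Has-≋ f m) in _ , j , transᵖ r (ℋ.↭-sym f₁) }) , λ ())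
        ℋ≋ , G = ext-fires {e₁ = e₁} {f₁} {v₁} (uniqueᴾ D) (penv-unique E E′) F
        p = prepᵖ (refl , ℋ≋) 𝒫.↭-refl
        e′ = transᵖ (𝒫.++⁺ˡ Θ (penv-unique E′ E)) e
    in _ , _ , D′ ,
       -- The label prescribes its own derivation `E′` of the substituted body, and the rule `ext`
       -- shares it between source and payload. The source is therefore rebuilt with `E′` for `E`
       -- and with `ℋ′` for `ℋ`.
       →-source {D₀ = node (chop E′ i′ (cast D p ℋ.↭-refl)) e′ f v} 𝒫.↭-refl ℋ.↭-refl
         (ext {D = cast D p ℋ.↭-refl} (→-source (𝒫.↭-sym p) ℋ.↭-refl t′) q∈) ,
       Fires-≋ (𝒫.↭-sym e) (ℋ.↭-sym f) 𝒫.↭-refl ℋ.↭-refl G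
  lifting l refl (lift {q} t q∉ d) (node (chop E i D) e f v) fits =
    let q∉l = q∉ ∘ subst (q ∈_) (sym (fpvᴸ-proc l))
        _ , _ , D′ , t′ , F = lifting l refl t D (Fits∀-map {l = l} (λ _ m → Has-≋ f m) fits)
        _ , p , G = Fires-lift q∉l F
        D″ = cast D′ p ℋ.↭-refl
    in _ , _ , node (chop E i D″) 𝒫.↭-refl ℋ.↭-refl (Valid-chop d D″ E) , lift (→-target p ℋ.↭-refl t′) q∉l ,
       Fires-≋ (𝒫.↭-sym e) (ℋ.↭-sym f) 𝒫.↭-refl ℋ.↭-refl (Fires-frameᴾ G)
  lifting τ refl (com-unit {x} {y} t) (node (cut D) e f v) _ =
    let _ , _ , D′ , t′ , F = lifting (close x ∣ wait y) refl t D ((λ ()) , λ ()) in close-comm D e f v D′ t′ (Fires-comm (unique D) F)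
  lifting τ refl (com-name {x} {y} {x′} {y′} t) (node (cut D) e f v) _ =
    let _ , _ , D′ , t′ , F = lifting (send x x′ ∣ recv y y′) refl t D ((λ ()) , λ ()) in name-comm D e f v D′ t′ (Fires-comm (unique D) F)
  lifting τ refl (com-inl {x} {y} t) (node (cut D) e f v) _ =
    let _ , _ , D′ , t′ , F = lifting (inl x ∣ coinl y) refl t D ((λ ()) , λ ()) in inl-comm D e f v D′ t′ (Fires-comm (unique D) F)
  lifting τ refl (com-inr {x} {y} t) (node (cut D) e f v) _ =
    let _ , _ , D′ , t′ , F = lifting (inr x ∣ coinr y) refl t D ((λ ()) , λ ()) in inr-comm D e f v D′ t′ (Fires-comm (unique D) F)
  lifting τ refl (com-type {x} {y} {A} t) (node (cut D) e f v) _ =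
    let _ , _ , D′ , t′ , F = lifting (sendT x A ∣ recvT y A) refl t D ((λ ()) , λ ()) in type-comm D e f v D′ t′ (Fires-comm (unique D) F)
  lifting τ refl (com-disp {x} {y} t) (node (cut D) e f v) _ =
    let _ , _ , D′ , t′ , F = lifting (disp x ∣ codisp y) refl t D ((λ ()) , λ ()) in disp-comm D e f v D′ t′ (Fires-comm (unique D) F)
  lifting τ refl (com-use {x} {y} {x′} {y′} t) (node (cut D) e f v) _ =
    let _ , _ , D′ , t′ , F = lifting (use x x′ ∣ couse y y′) refl t D ((λ ()) , λ ()) in use-comm D e f v D′ t′ (Fires-comm (unique D) F)
  lifting τ refl (com-dup {x} {y} {x₁} {x₂} {y₁} {y₂} t) (node (cut D) e f v) _ =
    let _ , _ , D′ , t′ , F = lifting (dup x x₁ x₂ ∣ codup y y₁ y₂) refl t D ((λ ()) , λ ()) in dup-comm D e f v D′ t′ (Fires-comm (unique D) F)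
  lifting τ refl (com-proc {x} {y} {q} {ρ} t) (node (cut {A = A} {Γ = Γ} {Δ} {𝒢} D) e f v) _ =
    let _ , _ , ℋ , _ , E , i , h , _ = offer left t D
        A≈ : ∀ {B} → Has (((x ∶ A) ∷ Γ) ∷ ((y ∶ A ᗮ) ∷ Δ) ∷ 𝒢) x B → A ≈ B
        A≈ = Has-unique (unique D) (has (here (refl , ≈-refl A)))
        fits : Fits∀ (((x ∶ A) ∷ Γ) ∷ ((y ∶ A ᗮ) ∷ Δ) ∷ 𝒢) (provide x ρ ⌊ E ⌋ ∣ assume y q)
        fits = (λ { left m → let _ , j , r = ≔-≋ (proj₁ (Wf-Has (proj₂ (Valid.wf𝒢 (valid D))) h))
                                                 (prov-injective (Has-unique (unique D) h m)) i
                             in _ , j , ℋ.↭-sym r }) , λ ()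
        _ , _ , D′ , t′ , F = lifting (provide x ρ ⌊ E ⌋ ∣ assume y q) refl t D fits
    in process-comm D e f v D′ E i (A≈ h) t′ (Fires-comm (unique D) F)
  lifting τ refl (com-link {x} {y} {z} t z≢x z≢y) (node (cut D) e f v) _ =
    let _ , _ , D′ , t′ , F = lifting (link z y) refl t D ((λ ()) , λ ()) in link-comm D e f v D′ z≢x z≢y t′ F

  -- Erasing transitions of derivations

  #-mix : ∀ {Θ Π Ξ : PEnv n} {P Q 𝒢 ℋ 𝒦} → Θ ⊢ P ▹ 𝒢 → Π ⊢ Q ▹ ℋ → Θ ++ Π ≋ᴾ Ξ → 𝒢 ++ ℋ ≋ 𝒦 → Valid Ξ 𝒦 → P # Q
  #-mix {Θ = Θ} {𝒢 = 𝒢} D E e f v =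
    (λ (p , q) → proj₂ (proj₂ (Unique-dom-++⁻ 𝒢 (Unique-↭ (↭-sym (dom-↭ f)) (proj₁ (Valid.wf𝒢 v))))) (fn⊆dom D p , fn⊆dom E q)) ,
    (λ (p , q) → proj₂ (proj₂ (Unique-keys-++⁻ Θ (Unique-↭ (↭-sym (keys-↭ e)) (Valid.distinct v)))) (fpv⊆ D p , fpv⊆ E q))

  erasure : ∀ {Θ Θ′ : PEnv n} {P P′ 𝒢 𝒢′ l} {D : Θ ⊢ P ▹ 𝒢} {D′ : Θ′ ⊢ P′ ▹ 𝒢′} → D —⟨ l ⟩→ D′ → P —[ procᴸ l ]→ P′
  erasure send          = send
  erasure recv          = recv
  erasure close         = close
  erasure wait          = wait
  erasure inl           = inl
  erasure inr           = inr
  erasure coinl         = coinl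
  erasure coinr         = coinr
  erasure sendT         = sendT
  erasure (recvT w _)   = recvT w
  erasure use           = use
  erasure couse         = couse
  erasure disp          = disp
  erasure dup           = dup
  erasure (codisp z)    = codisp z
  erasure (codup S _ _ _) = codup S
  erasure provide       = provide
  erasure assume        = assume
  erasure linkˡ         = linkˡ
  erasure linkʳ         = linkʳ
  -- The image of `ρ` is the domain of `𝒢ρ`, which is that of the payload, whose names are exactly
  -- its free names; this is the condition on abstractions.
  erasure (call {ρ = ρ} {e = e} {v = v} {i} {E} j q _) = call (↭-trans (proj₁ j) (↭-sym (proj₁ i)))
    (keys-unique j u , Unique-image u (Unique-↭ (↭-sym (dom-↭ q)) (unique E)) j ,
     λ x → mk⇔ (λ p → dom⊆fn E (↭.∈-resp-↭ (dom-↭ q) (image⊆dom u j p)))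
               (λ p → ↭.∈-resp-↭ (↭-sym (≔-dom j u)) (↭.∈-resp-↭ (↭-sym (dom-↭ q)) (fn⊆dom E p))))
    where u = proj₁ (All.head (wfᴾ-≋ (𝒫.↭-sym e) (Valid.wfΘ v)))
  erasure (alpha s _ _ t) = alpha s (erasure t)
  erasure (reorder t)     = erasure t
  erasure (swap t)        = swap (erasure t)
  erasure (parˡ {l = l} {e′ = e′} {f′} {v′} {D′ = D′} {E} t d) =
    parˡ (erasure t) (λ (p , q) → d (subst (_ ∈_) (bn-proc l) p , q)) (#-mix D′ E e′ f′ v′)
  erasure (parʳ {l = l} {e′ = e′} {f′} {v′} {D} {E′ = E′} t d) =
    parʳ (erasure t) (λ (p , q) → d (subst (_ ∈_) (bn-proc l) p , q)) (#-mix D E′ e′ f′ v′)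
  erasure (syn {a = a} {b} {e′ = e′} {f′} {v′} {D′ = D′} {E′ = E′} t u d) =
    syn (erasure t) (erasure u) (λ (p , q) → d (subst (_ ∈_) (bnᴬ-proc a) p , subst (_ ∈_) (bnᴬ-proc b) q)) (#-mix D′ E′ e′ f′ v′)
  erasure (res {x = x} {y} {l = l} t x∉ y∉) =
    res (erasure t) (x∉ ∘ subst (x ∈_) (cn-proc l)) (y∉ ∘ subst (y ∈_) (cn-proc l))
  erasure (run t)         = run (erasure t)
  erasure (ext t q∈)      = ext (erasure t) q∈
  erasure (lift {Θ′ = Θ′} {q = q} {P′ = P′} {Q = Q} {l = l} {e′ = e′} {v′ = v′} {E = E} {D′ = D′} t q∉) =
    lift (erasure t) (q∉ ∘ subst (q ∈_) (fpvᴸ-proc l)) disjoint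
    where
    disjoint : Disjoint (fpv P′ ∖ᵖ q) (fpv Q)
    disjoint (p , r) with ∈-∖ᵖ⁻ (fpv P′) p
    -- A variable of the target other than `q` lies in `Θ′`, which the valid conclusion keeps apart
    -- from the variables of the body.
    ... | s , ≢q with fpv⊆ D′ s
    ... | here refl = ≢q refl
    ... | there k   = proj₂ (proj₂ (Unique-keys-++⁻ Θ′ (Unique-↭ (↭-sym (keys-↭ e′)) (Valid.distinct v′)))) (k , fpv⊆ E r)
  erasure (com-unit t)    = com-unit (erasure t)
  erasure (com-name _ t)  = com-name (erasure t)
  erasure (com-inl t)     = com-inl (erasure t)
  erasure (com-inr t)     = com-inr (erasure t)
  erasure (com-type t)    = com-type (erasure t)
  erasure (com-disp t)    = com-disp (erasure t)
  erasure (com-use t)     = com-use (erasure t)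
  erasure (com-dup t)     = com-dup (erasure t)
  erasure (com-proc t)    = com-proc (erasure t)
  erasure (com-link t z≢x z≢y _) = com-link (erasure t) z≢x z≢y

theorem5p8 : (𝒩 𝒫 : Atoms) (Param : Set) (_≟_ : DecidableEquality Param) →
    let open HOπLL 𝒩 𝒫 Param _≟_ in
    ∀ {n} (D : Deriv n) (l : Label n (Deriv n)) →
    (∀ {D′} → D ⟶⟨ l ⟩ D′ → proc D —[ procᴸ l ]→ proc D′)
    × (Fits (henv D) l → ∀ {P′} → proc D —[ procᴸ l ]→ P′ → ∃[ D′ ] (D ⟶⟨ l ⟩ D′) × (proc D′ ≡ P′))
theorem5p8 𝒩 𝒫 Param _≟_ D l =
    erasure
  , λ fits t → let _ , _ , D′ , t′ , _ = lifting l refl t (tree D) (Fits⇒Fits∀ l (Valid.wf𝒢 (valid (tree D))) fits) in ⌊ D′ ⌋ , t′ , refl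
  where
  open HOπLL 𝒩 𝒫 Param _≟_
  open Erasure 𝒩 𝒫 Param _≟_
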